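{- Let $q$ be a prime power and $n$ a positive integer. There exists a primitive element of $\mathbb{F}_{q^n}$ that is completely normal over $\mathbb{F}_q$ in each of the following cases: (1) $n$ is odd and $n<q^{4/3}$; (2) $n$ is even, $q-1\nmid n$, and $n<q^{5/4}$.
   Context: $\mathbb{F}_{q^n}$ denotes the degree-$n$ extension of the finite field $\mathbb{F}_q$. An element is primitive if it generates the cyclic group $\mathbb{F}_{q^n}^*$. For a divisor $l$ of $n$, an element $x\in\mathbb{F}_{q^n}$ is normal over $\mathbb{F}_{q^l}$ if $\{x, x^{q^l}, \ldots, x^{q^{l(n/l-1)}}\}$ is an $\mathbb{F}_{q^l}$-basis of $\mathbb{F}_{q^n}$. An element $x\in\mathbb{F}_{q^n}$ is completely normal over $\mathbb{F}_q$ if it is normal over $\mathbb{F}_{q^l}$ for every positive divisor $l$ of $n$. -}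

module Defs where

open import Data.Nat using (ℕ; zero; suc; _^_) renaming (_*_ to _*ℕ_)
open import Data.Fin using (Fin)
open import Data.Product using (Σ; ∃; _×_)
open import Relation.Binary.PropositionalEquality using (_≡_; _≢_)
open import Relation.Nullary using (¬_)
open import Algebra.Structures using (IsCommutativeRing)
open import Function.Bundles using (_↔_)
open import Data.Nat.Primality using (Prime)

IsPrimePower : ℕ → Set
IsPrimePower q = Σ ℕ λ p → Σ ℕ λ k → Prime p × (1 Data.Nat.≤ k) × (q ≡ p ^ k)
  where import Data.Nat

record FiniteField : Set₁ where
  infixl 6 _+_
  infixl 7 _*_
  field
    Carrier : Set
    _+_ _*_ : Carrier → Carrier → Carrier
    -_ : Carrier → Carrier
    0# 1# : Carrier
    isCommutativeRing : IsCommutativeRing _≡_ _+_ _*_ -_ 0# 1#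
    0≢1 : 0# ≢ 1#
    inverse : ∀ x → x ≢ 0# → ∃ λ y → x * y ≡ 1#
    size : ℕ
    enum : Fin size ↔ Carrier

module _ (K : FiniteField) where
  open FiniteField K

  pow : Carrier → ℕ → Carrier
  pow x zero = 1#
  pow x (suc k) = x * pow x k

  sumF : (m : ℕ) → (Fin m → Carrier) → Carrier
  sumF zero f = 0#
  sumF (suc m) f = f Fin.zero + sumF m (λ i → f (Fin.suc i))
    where import Data.Fin as Fin

  Primitive : Carrier → Set
  Primitive x = x ≢ 0# × (∀ y → y ≢ 0# → ∃ λ k → pow x k ≡ y)

  -- Membership in the subfield F_{q^l} of K (|K| = q^n, l ∣ n):
  -- the fixed points of the Frobenius y ↦ y^{q^l}.
  InSubfield : ℕ → ℕ → Carrier → Set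
  InSubfield q l y = pow y (q ^ l) ≡ y

  conj : ℕ → ℕ → Carrier → (m : ℕ) → Fin m → Carrier
  conj q l x m i = pow x (q ^ (l *ℕ Data.Fin.toℕ i))

  NormalOver : (q l m : ℕ) → Carrier → Set
  NormalOver q l m x =
    (∀ (c : Fin m → Carrier) → (∀ i → InSubfield q l (c i)) →
       sumF m (λ i → c i * conj q l x m i) ≡ 0# → ∀ i → c i ≡ 0#)
    × (∀ y → Σ (Fin m → Carrier) λ c → (∀ i → InSubfield q l (c i)) ×
             (sumF m (λ i → c i * conj q l x m i) ≡ y))

  CompletelyNormal : (q n : ℕ) → Carrier → Set
  CompletelyNormal q n x = ∀ l m → l *ℕ m ≡ n → NormalOver q l m x

{-# OPTIONS --safe #-}

-- Write Q = qⁿ and M = (qⁿ - 1)/(q - 1). An element x fails to be normal over F_{q^l} exactly when it lies in the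
-- kernel of ((Tᵐ - 1)/f)(Frobˡ) for some irreducible factor f of Tᵐ - 1 over F_{q^l}, m = n/l; so x is completely
-- normal if it avoids an explicit list of "bad" additive subgroups. Complete normality is invariant under F_q^*, and
-- some F_q^*-multiple of x is primitive as soon as x is not an r-th power for any prime r dividing M.
--
-- The number of r-free elements in an additive subgroup V is estimated without characters: summing the squared
-- deviation of #{v ∈ V : b v + c ∈ D} over all affine maps (b , c) gives |Q |D ∩ V| - |D| |V|| ≤ Q √Q for every
-- multiplicative subgroup D, and inclusion-exclusion over the primes dividing M does the rest. Comparing with the sum
-- over the bad subgroups settles all large cases in which q - 1 does not divide n or equals n. If n is odd and a
-- multiple (at least 3) of q - 1, the bad hyperplanes are too many for a union bound; the set A avoiding all of them is
-- then counted exactly, being invariant under the intersection of the hyperplanes, to which the second moment applies.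
--
-- The remaining pairs (q , n) are checked by evaluating the sieve inequality, which fails only for (4 , 3), (5 , 6)
-- and (9 , 4), where an element is exhibited. The degrees n = 1 and n = 2 are elementary.
module Submission where

open import Defs
open import Algebra.Bundles using (CommutativeRing; CommutativeSemiring)
import Algebra.Solver.Ring.NaturalCoefficients.Default as NatSolver
open import Algebra.Structures using (IsCommutativeRing)
import Algebra.Properties.CommutativeMonoid.Sum as Sum
import Algebra.Properties.Ring as RingProperties
import Algebra.Properties.Semiring.Mult as Mult
import Algebra.Properties.Semiring.Exp as Exp
import Algebra.Properties.CommutativeSemiring.Binomial as Binomial
import Algebra.Solver.Ring as RingSolver
open import Algebra.Solver.Ring.AlmostCommutativeRing using (fromCommutativeRing; _-Raw-AlmostCommutative⟶_)
open import Data.Bool using (Bool; true; false; if_then_else_; _∧_; _∨_; not; T)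
open import Data.Empty using (⊥; ⊥-elim)
open import Data.Fin using (Fin; toℕ) renaming (zero to fzero; suc to fsuc)
import Data.Fin.Properties as Finₚ
import Data.Integer as ℤ
import Data.Integer.Properties as ℤₚ
open import Data.List using (List; []; _∷_; _++_; map; length; filter; upTo)
import Data.List.Properties as Listₚ
open import Data.List.Membership.Propositional using (_∈_; find)
import Data.List.Membership.Propositional.Properties as ∈ₚ
open import Data.List.Relation.Unary.All using (All; []; _∷_)
import Data.List.Relation.Unary.All as All
import Data.List.Relation.Unary.All.Properties as Allₚ
open import Data.List.Relation.Unary.Any using (Any; here; there)
import Data.List.Relation.Unary.Any as Any
open import Data.List.Relation.Unary.AllPairs using ([]; _∷_)
open import Data.List.Relation.Unary.Unique.Propositional using (Unique)
import Data.List.Relation.Unary.Unique.Propositional.Properties as Uniqueₚ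
open import Data.Maybe using (Maybe; just; nothing)
open import Data.Nat
open import Data.Nat.Combinatorics using (nCk≡n!/k![n-k]!; nCn≡1; nCk≡nC[n∸k]; k![n∸k]!∣n!) renaming (_C_ to _choose_)
open import Data.Nat.Divisibility
open import Data.Nat.DivMod using (_/_; _%_; m≡m%n+[m/n]*n; m/n*n≡m; m%n<n; m*n/n≡m; m/n*n≤m)
open import Data.Nat.ListAction using (sum; product)
open import Data.Nat.Induction using (<-rec)
open import Data.Nat.Primality using (Prime; euclidsLemma; prime⇒nonZero; prime⇒nonTrivial; prime?; prime[2]; ¬prime[0]; prime⇒irreducible)
open import Data.Nat.Primality.Factorisation using (factorise; factorisationHasAllPrimeFactors)
open import Data.Nat.Properties
open import Data.Nat.Tactic.RingSolver using (solve-∀)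
open import Data.Product using (Σ; ∃; ∃₂; _×_; _,_; proj₁; proj₂)
open import Data.Sum using (_⊎_; inj₁; inj₂)
open import Data.Unit using (tt)
open import Data.Vec using (Vec; []; _∷_)
import Data.Vec as Vec
open import Function using (_∘_)
open import Function.Bundles using (_↔_; Inverse; mk↔ₛ′)
open import Relation.Binary using (DecidableEquality; tri<; tri≈; tri>)
open import Relation.Binary.PropositionalEquality hiding ([_])
open import Relation.Nullary using (¬_; Dec; yes; no; does; contradiction)
open import Relation.Nullary.Decidable using (T?; ⌊_⌋; toWitness; fromWitness; map′; _×-dec_; ¬?)
open import Data.Bool.ListAction using (any)
open import Data.Nat.Coprimality using (Coprime; coprime⇒gcd≡1)
open import Data.Nat.GCD using (module Bézout; gcd; gcd-GCD; gcd[m,n]∣m; gcd[m,n]∣n; gcd[m,n]≡0⇒m≡0)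
import Data.Vec.Properties as Vecₚ
open import Axiom.UniquenessOfIdentityProofs.WithK using (uip)
open import Data.List.Membership.DecPropositional _≟_ using (_∈?_)
open import Data.List.Relation.Unary.Unique.DecPropositional _≟_ using (unique?)

-- Among the bad subgroups the hyperplanes belonging to roots of unity in F_q dominate: there are at
-- most gcd(n, q - 1) of them, each of density 1/q. If q - 1 does not divide n, they cover less than
-- half of K, and for q ≥ 7 all bad subgroups together leave a quarter. For n = q - 1 a share of
-- 1/(2q) remains, which is still enough. For odd multiples n ≥ 3 (q - 1) the hyperplanes may take
-- (q - 1)/q, and the bound for the other subgroups uses up nearly all of the rest or more. But then
-- q is even and n is odd, so n is invertible in K; this makes the hyperplanes independent, and a
-- share of at least 1/4 escapes them all. The sieve errs by about 2^k √Q on each subgroup, k being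
-- the number of primes dividing M. The inequality 2^k ∏ r/(r - 1) ≤ (C₄ M)^(1/4) controls this: a
-- factor of order Q^(1/4) is left to beat the number of subgroups, which is at most (n² + n)/2.

-- A solver with integer coefficients for any commutative ring

module IntegerSolver {C : Set} {_⊹_ _·_ : C → C → C} {⊖_ : C → C} {𝟘 𝟙 : C}
  (isCR : IsCommutativeRing _≡_ _⊹_ _·_ ⊖_ 𝟘 𝟙) where

  commRing : CommutativeRing _ _
  commRing = record { isCommutativeRing = isCR }

  open CommutativeRing commRing public using
    ( ring; semiring; commutativeSemiring; +-commutativeMonoid; *-commutativeMonoid )
    renaming
    ( +-assoc to ⊹-assoc
    ; +-comm to ⊹-comm
    ; +-identityˡ to ⊹-idˡ
    ; +-identityʳ to ⊹-idʳ
    ; -‿inverseˡ to ⊖-invˡ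
    ; -‿inverseʳ to ⊖-invʳ
    ; *-assoc to ·-assoc
    ; *-comm to ·-comm
    ; *-identityˡ to ·-idˡ
    ; *-identityʳ to ·-idʳ
    ; distribˡ to ·-distribˡ
    ; distribʳ to ·-distribʳ
    ; zeroˡ to ·-zeroˡ
    ; zeroʳ to ·-zeroʳ )
  open RingProperties ring public using (-‿+-comm; -‿distribˡ-*; -‿distribʳ-*)
    renaming (-‿involutive to ⊖-involutive; -0#≈0# to ⊖𝟘)
  open Mult semiring public using (×-homo-+; ×1-homo-*; ×-assoc-*) renaming (_×_ to _⋆_)

  private
    -- The constant 1 is read as `1 ⋆ 𝟙`, which is `𝟙 ⊹ 𝟘` and not `𝟙`; uses of the solver with
    -- constants are corrected by `⊹-idʳ 𝟙`.
    ⟦_⟧ℤ : ℤ.ℤ → C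
    ⟦ ℤ.+ n ⟧ℤ = n ⋆ 𝟙
    ⟦ ℤ.-[1+ n ] ⟧ℤ = ⊖ (suc n ⋆ 𝟙)

    cancel-suc : ∀ a b → (𝟙 ⊹ a) ⊹ (⊖ (𝟙 ⊹ b)) ≡ a ⊹ (⊖ b)
    cancel-suc a b = begin
      (𝟙 ⊹ a) ⊹ (⊖ (𝟙 ⊹ b))            ≡⟨ cong ((𝟙 ⊹ a) ⊹_) (sym (-‿+-comm 𝟙 b)) ⟩
      (𝟙 ⊹ a) ⊹ ((⊖ 𝟙) ⊹ (⊖ b))        ≡⟨ cong (_⊹ ((⊖ 𝟙) ⊹ (⊖ b))) (⊹-comm 𝟙 a) ⟩
      (a ⊹ 𝟙) ⊹ ((⊖ 𝟙) ⊹ (⊖ b))        ≡⟨ ⊹-assoc a 𝟙 _ ⟩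
      a ⊹ (𝟙 ⊹ ((⊖ 𝟙) ⊹ (⊖ b)))        ≡⟨ cong (a ⊹_) (sym (⊹-assoc 𝟙 (⊖ 𝟙) (⊖ b))) ⟩
      a ⊹ ((𝟙 ⊹ (⊖ 𝟙)) ⊹ (⊖ b))        ≡⟨ cong (λ z → a ⊹ (z ⊹ (⊖ b))) (⊖-invʳ 𝟙) ⟩
      a ⊹ (𝟘 ⊹ (⊖ b))                  ≡⟨ cong (a ⊹_) (⊹-idˡ _) ⟩
      a ⊹ (⊖ b) ∎ where open ≡-Reasoning

    ⊖-homo : ∀ m n → ⟦ m ℤ.⊖ n ⟧ℤ ≡ (m ⋆ 𝟙) ⊹ (⊖ (n ⋆ 𝟙))
    ⊖-homo m zero = sym (trans (cong ((m ⋆ 𝟙) ⊹_) ⊖𝟘) (⊹-idʳ _))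
    ⊖-homo zero (suc n) = sym (⊹-idˡ _)
    ⊖-homo (suc m) (suc n) = begin
      ⟦ suc m ℤ.⊖ suc n ⟧ℤ                     ≡⟨ cong ⟦_⟧ℤ (ℤₚ.[1+m]⊖[1+n]≡m⊖n m n) ⟩
      ⟦ m ℤ.⊖ n ⟧ℤ                             ≡⟨ ⊖-homo m n ⟩
      (m ⋆ 𝟙) ⊹ (⊖ (n ⋆ 𝟙))                    ≡⟨ sym (cancel-suc _ _) ⟩
      (𝟙 ⊹ (m ⋆ 𝟙)) ⊹ (⊖ (𝟙 ⊹ (n ⋆ 𝟙))) ∎ where open ≡-Reasoning

    +-homo : ∀ i j → ⟦ i ℤ.+ j ⟧ℤ ≡ ⟦ i ⟧ℤ ⊹ ⟦ j ⟧ℤ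
    +-homo (ℤ.+ m) (ℤ.+ n) = ×-homo-+ 𝟙 m n
    +-homo (ℤ.+ m) ℤ.-[1+ n ] = ⊖-homo m (suc n)
    +-homo ℤ.-[1+ m ] (ℤ.+ n) = trans (⊖-homo n (suc m)) (⊹-comm _ _)
    +-homo ℤ.-[1+ m ] ℤ.-[1+ n ] = begin
      ⊖ (suc (suc (m + n)) ⋆ 𝟙)         ≡⟨ cong (λ k → ⊖ (suc k ⋆ 𝟙)) (sym (+-suc′ m n)) ⟩
      ⊖ ((suc m + suc n) ⋆ 𝟙)           ≡⟨ cong ⊖_ (×-homo-+ 𝟙 (suc m) (suc n)) ⟩
      ⊖ ((suc m ⋆ 𝟙) ⊹ (suc n ⋆ 𝟙))         ≡⟨ sym (-‿+-comm _ _) ⟩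
      (⊖ (suc m ⋆ 𝟙)) ⊹ (⊖ (suc n ⋆ 𝟙)) ∎
      where
        open ≡-Reasoning
        +-suc′ = +-suc

    -‿homo : ∀ i → ⟦ ℤ.- i ⟧ℤ ≡ ⊖ ⟦ i ⟧ℤ
    -‿homo (ℤ.+ zero) = sym ⊖𝟘
    -‿homo (ℤ.+ suc n) = refl
    -‿homo ℤ.-[1+ n ] = sym (⊖-involutive _)

    *-homo⁺ : ∀ m j → ⟦ ℤ.+ m ℤ.* j ⟧ℤ ≡ (m ⋆ 𝟙) · ⟦ j ⟧ℤ
    *-homo⁺ zero j = trans (cong ⟦_⟧ℤ (ℤₚ.*-zeroˡ j)) (sym (·-zeroˡ _))
    *-homo⁺ (suc m) j = begin
      ⟦ ℤ.+ suc m ℤ.* j ⟧ℤ               ≡⟨ cong ⟦_⟧ℤ (ℤₚ.suc-* (ℤ.+ m) j) ⟩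
      ⟦ j ℤ.+ ℤ.+ m ℤ.* j ⟧ℤ             ≡⟨ +-homo j (ℤ.+ m ℤ.* j) ⟩
      ⟦ j ⟧ℤ ⊹ ⟦ ℤ.+ m ℤ.* j ⟧ℤ          ≡⟨ cong₂ _⊹_ (sym (·-idˡ _)) (*-homo⁺ m j) ⟩
      (𝟙 · ⟦ j ⟧ℤ) ⊹ ((m ⋆ 𝟙) · ⟦ j ⟧ℤ)  ≡⟨ sym (·-distribʳ _ _ _) ⟩
      (𝟙 ⊹ (m ⋆ 𝟙)) · ⟦ j ⟧ℤ ∎ where open ≡-Reasoning

    *-homo : ∀ i j → ⟦ i ℤ.* j ⟧ℤ ≡ ⟦ i ⟧ℤ · ⟦ j ⟧ℤ
    *-homo (ℤ.+ m) j = *-homo⁺ m j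
    *-homo ℤ.-[1+ m ] j = begin
      ⟦ ℤ.-[1+ m ] ℤ.* j ⟧ℤ         ≡⟨ cong ⟦_⟧ℤ (sym (ℤₚ.neg-distribˡ-* (ℤ.+ suc m) j)) ⟩
      ⟦ ℤ.- (ℤ.+ suc m ℤ.* j) ⟧ℤ    ≡⟨ -‿homo (ℤ.+ suc m ℤ.* j) ⟩
      ⊖ ⟦ ℤ.+ suc m ℤ.* j ⟧ℤ        ≡⟨ cong ⊖_ (*-homo⁺ (suc m) j) ⟩
      ⊖ ((suc m ⋆ 𝟙) · ⟦ j ⟧ℤ)      ≡⟨ -‿distribˡ-* _ _ ⟩
      (⊖ (suc m ⋆ 𝟙)) · ⟦ j ⟧ℤ ∎ where open ≡-Reasoning

    morphism : ℤ.+-*-rawRing -Raw-AlmostCommutative⟶ fromCommutativeRing commRing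
    morphism = record
      { ⟦_⟧ = ⟦_⟧ℤ ; +-homo = +-homo ; *-homo = *-homo ; -‿homo = -‿homo
      ; 0-homo = refl ; 1-homo = ⊹-idʳ 𝟙 }

    -- Different integers may have the same image, the characteristic being arbitrary, so only a
    -- positive answer is ever given.
    weak≟ : ∀ i j → Maybe (⟦ i ⟧ℤ ≡ ⟦ j ⟧ℤ)
    weak≟ i j with i ℤ.≟ j
    ... | yes e = just (cong ⟦_⟧ℤ e)
    ... | no _ = nothing

  module 𝕊 = RingSolver ℤ.+-*-rawRing (fromCommutativeRing commRing) morphism weak≟

-- Fields with decidable equality and exhaustive search

-- To be instantiated by the subfields F_{q^l}, which are types of fixed points and carry no
-- enumeration. `search` is exhaustion in the form in which it is inherited by a subfield: if every
-- element yields `P` or the answer `R`, then either all of them yield `P`, or `R` has been found.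
record DField : Set₁ where
  infixl 6 _⊹_
  infixl 7 _·_
  field
    Carrier : Set
    _⊹_ _·_ : Carrier → Carrier → Carrier
    ⊖_ : Carrier → Carrier
    𝟘 𝟙 : Carrier
    isCommutativeRing : IsCommutativeRing _≡_ _⊹_ _·_ ⊖_ 𝟘 𝟙
    𝟘≢𝟙 : 𝟘 ≢ 𝟙
    inverse : ∀ x → x ≢ 𝟘 → ∃ λ y → x · y ≡ 𝟙
    _≟ᶠ_ : DecidableEquality Carrier
    search : ∀ {P : Carrier → Set} {R : Set} → (∀ x → P x ⊎ R) → (∀ x → P x) ⊎ R

searchFin : ∀ n {P : Fin n → Set} {R : Set} → (∀ i → P i ⊎ R) → (∀ i → P i) ⊎ R
searchFin zero f = inj₁ λ ()
searchFin (suc n) f with f fzero | searchFin n (λ i → f (fsuc i))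
... | inj₂ r | _ = inj₂ r
... | inj₁ _ | inj₂ r = inj₂ r
... | inj₁ p | inj₁ g = inj₁ λ { fzero → p ; (fsuc i) → g i }

-- Finite sums, indicator functions and arithmetic of natural numbers

module Σℕ = Sum +-0-commutativeMonoid

sum-mono : ∀ n (f g : Fin n → ℕ) → (∀ i → f i ≤ g i) → Σℕ.sum f ≤ Σℕ.sum g
sum-mono zero f g h = z≤n
sum-mono (suc n) f g h = +-mono-≤ (h fzero) (sum-mono n _ _ (λ i → h (fsuc i)))

sum-scale : ∀ n c (f : Fin n → ℕ) → Σℕ.sum (λ i → c * f i) ≡ c * Σℕ.sum f
sum-scale zero c f = sym (*-zeroʳ c)
sum-scale (suc n) c f = trans (cong (c * f fzero +_) (sum-scale n c _)) (sym (*-distribˡ-+ c _ _))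

sum-const : ∀ n c → Σℕ.sum {n} (λ _ → c) ≡ n * c
sum-const zero c = refl
sum-const (suc n) c = cong (c +_) (sum-const n c)

sum-zero : ∀ n (f : Fin n → ℕ) → (∀ i → f i ≡ 0) → Σℕ.sum f ≡ 0
sum-zero zero f h = refl
sum-zero (suc n) f h = cong₂ _+_ (h fzero) (sum-zero n _ (λ i → h (fsuc i)))

sum-point : ∀ n (f : Fin n → ℕ) i → (∀ j → j ≢ i → f j ≡ 0) → Σℕ.sum f ≡ f i
sum-point (suc n) f fzero h =
  trans (cong (f fzero +_) (sum-zero n _ (λ j → h (fsuc j) λ ()))) (+-identityʳ _)
sum-point (suc n) f (fsuc i) h =
  cong₂ _+_ (h fzero λ ()) (sum-point n (f ∘ fsuc) i (λ j j≢i → h (fsuc j) (j≢i ∘ Finₚ.suc-injective)))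

sum-witness : ∀ n (f : Fin n → ℕ) → 0 < Σℕ.sum f → ∃ λ i → 0 < f i
sum-witness (suc n) f h with f fzero in eq
... | suc k = fzero , subst (0 <_) (sym eq) z<s
... | zero with sum-witness n (f ∘ fsuc) h
...   | i , p = fsuc i , p

sum-tabulate : ∀ n (f : Fin n → ℕ) → sum (Data.List.tabulate f) ≡ Σℕ.sum f
sum-tabulate zero f = refl
sum-tabulate (suc n) f = cong (f fzero +_) (sum-tabulate n (f ∘ fsuc))

ι : Bool → ℕ
ι true = 1
ι false = 0

T⇒≡ : ∀ {b} → T b → b ≡ true
T⇒≡ {true} _ = refl

T-∧ : ∀ {a b} → T a → T b → T (a ∧ b)
T-∧ {true} {true} _ _ = tt

T-∧₁ : ∀ {a b} → T (a ∧ b) → T a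
T-∧₁ {true} _ = tt

T-∧₂ : ∀ {a b} → T (a ∧ b) → T b
T-∧₂ {true} t = t

T-not : ∀ {b} → T (not b) → ¬ T b
T-not {false} _ ()

¬T⇒≡ : ∀ {b} → ¬ T b → b ≡ false
¬T⇒≡ {true} h = ⊥-elim (h tt)
¬T⇒≡ {false} _ = refl

ι-∧ : ∀ a b → ι (a ∧ b) ≡ ι a * ι b
ι-∧ true b = sym (+-identityʳ (ι b))
ι-∧ false b = refl

ι-idem : ∀ a → ι a * ι a ≡ ι a
ι-idem true = refl
ι-idem false = refl

ι-≤ : ∀ {a b} → (T a → T b) → ι a ≤ ι b
ι-≤ {false} h = z≤n
ι-≤ {true} {true} h = ≤-refl
ι-≤ {true} {false} h = ⊥-elim (h tt)

∣m+n-m∣≡n : ∀ m n → ∣ m + n - m ∣ ≡ n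
∣m+n-m∣≡n m n = trans (∣-∣-comm (m + n) m) (∣m-m+n∣≡n m n)

-- The expanded square of a difference with the cross term moved to the left, so that a variance can
-- be computed within the naturals.
dist-sq : ∀ m n → ∣ m - n ∣ * ∣ m - n ∣ + 2 * (m * n) ≡ m * m + n * n
dist-sq m n with ≤-total m n
... | inj₁ m≤n with m≤n⇒∃[o]m+o≡n m≤n
...   | o , refl rewrite ∣m-m+n∣≡n m o = lemma o m
  where
    lemma : ∀ o m → o * o + 2 * (m * (m + o)) ≡ m * m + (m + o) * (m + o)
    lemma = solve-∀
dist-sq m n | inj₂ n≤m with m≤n⇒∃[o]m+o≡n n≤m
...   | o , refl rewrite ∣m+n-m∣≡n n o = lemma o n
  where
    lemma : ∀ o n → o * o + 2 * ((n + o) * n) ≡ (n + o) * (n + o) + n * n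
    lemma = solve-∀

sq-cancel-≤ : ∀ m n → m * m ≤ n * n → m ≤ n
sq-cancel-≤ m n h with m ≤? n
... | yes p = p
... | no p = contradiction h (<⇒≱ (*-mono-< (≰⇒> p) (≰⇒> p)))

infixl 7 _÷_
-- Division with the default 0 for a zero divisor, which spares `N ÷ r` an instance argument; it is
-- exact where `÷-*` applies.
_÷_ : ℕ → ℕ → ℕ
m ÷ zero = 0
m ÷ suc d = m / suc d

÷-* : ∀ {m d} → 0 < m → d ∣ m → m ÷ d * d ≡ m
÷-* {m} {zero} 0<m d∣m = contradiction (0∣⇒≡0 d∣m) (λ e → <-irrefl (sym e) 0<m)
÷-* {m} {suc d} 0<m d∣m = m/n*n≡m d∣m

-- For distinct primes this is Euler's totient of `product S`.
φ : List ℕ → ℕ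
φ S = product (map pred S)

∣-dist⇒≤₁ : ∀ {m n k} → ∣ m - n ∣ ≤ k → m ≤ n + k
∣-dist⇒≤₁ {m} {n} h = ≤-trans (m≤n+∣m-n∣ m n) (+-monoʳ-≤ n h)

∣-dist⇒≤₂ : ∀ {m n k} → ∣ m - n ∣ ≤ k → n ≤ m + k
∣-dist⇒≤₂ {m} {n} h = ∣-dist⇒≤₁ {n} {m} (≤-trans (≤-reflexive (∣-∣-comm n m)) h)

private
  split-main : ∀ k r f a n → 0 < r → k * r * f * a * n ≡ k * (pred r * f) * a * n + k * f * a * n
  split-main k (suc r) f a n _ = lemma k r f a n
    where
      lemma : ∀ k r f a n → k * suc r * f * a * n ≡ k * (r * f) * a * n + k * f * a * n
      lemma = solve-∀

  -- One step of inclusion-exclusion: `X₁ = X - X₂` collects the errors of both terms. This doubling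
  -- is the source of the factor `2 ^ length S` in the sieve.
  upper-step : ∀ {X X₁ X₂ m m₁ m₂ E} → X₁ + X₂ ≡ X → m ≡ m₁ + m₂ → X ≤ m + E → m₂ ≤ X₂ + E → X₁ ≤ m₁ + 2 * E
  upper-step {X} {X₁} {X₂} {m} {m₁} {m₂} {E} refl refl h₁ h₂ = +-cancelʳ-≤ (X₂ + m₂) _ _ (begin
    X₁ + (X₂ + m₂) ≡⟨ sym (+-assoc X₁ X₂ m₂) ⟩
    X₁ + X₂ + m₂ ≤⟨ +-mono-≤ h₁ h₂ ⟩
    m₁ + m₂ + E + (X₂ + E) ≡⟨ lemma m₁ m₂ E X₂ ⟩
    m₁ + 2 * E + (X₂ + m₂) ∎)
    where
      open ≤-Reasoning
      lemma : ∀ m₁ m₂ E X₂ → m₁ + m₂ + E + (X₂ + E) ≡ m₁ + 2 * E + (X₂ + m₂)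
      lemma = solve-∀

  lower-step : ∀ {X X₁ X₂ m m₁ m₂ E} → X₁ + X₂ ≡ X → m ≡ m₁ + m₂ → m ≤ X + E → X₂ ≤ m₂ + E → m₁ ≤ X₁ + 2 * E
  lower-step e e′ h₁ h₂ = upper-step (sym e′) (sym e) h₁ h₂

-- Prime divisors

IsPrimeDivisor : ℕ → ℕ → Set
IsPrimeDivisor m r = Prime r × r ∣ m

isPrimeDivisor? : ∀ m r → Dec (IsPrimeDivisor m r)
isPrimeDivisor? m r = prime? r ×-dec (r ∣? m)

primesOf : ℕ → List ℕ
primesOf m = filter (isPrimeDivisor? m) (upTo (suc m))

∈-primesOf : ∀ {m r} → 0 < m → Prime r → r ∣ m → r ∈ primesOf m
∈-primesOf {m} 0<m pr r∣m = ∈ₚ.∈-filter⁺ (isPrimeDivisor? m) (∈ₚ.∈-upTo⁺ (s≤s (∣⇒≤ {{>-nonZero 0<m}} r∣m))) (pr , r∣m)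

primesOf-All : ∀ m → All (IsPrimeDivisor m) (primesOf m)
primesOf-All m = Allₚ.all-filter (isPrimeDivisor? m) (upTo (suc m))

primesOf-Unique : ∀ m → Unique (primesOf m)
primesOf-Unique m = Uniqueₚ.filter⁺ (isPrimeDivisor? m) (Uniqueₚ.upTo⁺ (suc m))

prime>1 : ∀ {r} → Prime r → 1 < r
prime>1 {r} pr = nonTrivial⇒n>1 r {{prime⇒nonTrivial pr}}

product-primes-∣ : ∀ {m} S → All (IsPrimeDivisor m) S → Unique S → product S ∣ m
product-primes-∣ [] _ _ = 1∣ _
product-primes-∣ {m} (r ∷ S) ((pr , r∣m) ∷ ps) (r∉S ∷ uS) with product-primes-∣ S ps uS
... | divides c refl with euclidsLemma c (product S) pr r∣m
...   | inj₁ (divides c′ refl) = divides c′ (*-assoc c′ r (product S))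
...   | inj₂ r∣S = contradiction refl (All.lookup r∉S (factorisationHasAllPrimeFactors pr r∣S (All.map proj₁ ps)))

prime-divisor : ∀ {c} → 1 < c → ∃ λ r → IsPrimeDivisor c r
prime-divisor {c} 1<c with factorise c {{>-nonZero (<⇒≤ 1<c)}}
... | record { factors = [] ; isFactorisation = e } = contradiction (sym e) (<⇒≢ 1<c)
... | record { factors = r ∷ S ; isFactorisation = e ; factorsPrime = pr ∷ _ } = r , pr , subst (r ∣_) (sym e) (m∣m*n (product S))

φ-pos : ∀ S → All Prime S → 0 < φ S
φ-pos [] _ = z<s
φ-pos (r ∷ S) (pr ∷ ps) = *-mono-< {0} {pred r} {0} (help (prime>1 pr)) (φ-pos S ps)
  where
    help : ∀ {r} → 1 < r → 0 < pred r
    help (s<s h) = h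

-- Polynomials over a searchable field: division, gcd, factorisation

module Polynomials (F : DField) where
  open DField F public
  open IntegerSolver isCommutativeRing public
  open 𝕊 using (_:+_; _:*_; :-_; _:-_; _:=_) renaming (solve to solveR)

  Poly : Set
  Poly = List Carrier

  infixl 9 _!_
  _!_ : Poly → ℕ → Carrier
  [] ! i = 𝟘
  (a ∷ p) ! zero = a
  (a ∷ p) ! suc i = p ! i

  infix 4 _≈_
  -- Lists may end in zeros, hence equality of coefficients instead of lists. The record wrapper
  -- lets both polynomials be inferred from a proof.
  record _≈_ (p q : Poly) : Set where
    constructor coeffs
    field at : ∀ i → p ! i ≡ q ! i
  open _≈_ public

  ≈-refl : ∀ {p} → p ≈ p
  ≈-refl = coeffs λ _ → refl

  ≈-sym : ∀ {p q} → p ≈ q → q ≈ p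
  ≈-sym h = coeffs λ i → sym (at h i)

  ≈-trans : ∀ {p q r} → p ≈ q → q ≈ r → p ≈ r
  ≈-trans h k = coeffs λ i → trans (at h i) (at k i)

  ∷-cong : ∀ {a b p q} → a ≡ b → p ≈ q → a ∷ p ≈ b ∷ q
  ∷-cong e h = coeffs λ { zero → e ; (suc i) → at h i }

  infixl 6 _⊕_
  infixl 7 _⊙_ _⊗_
  _⊕_ : Poly → Poly → Poly
  [] ⊕ q = q
  (a ∷ p) ⊕ [] = a ∷ p
  (a ∷ p) ⊕ (b ∷ q) = a ⊹ b ∷ p ⊕ q

  _⊙_ : Carrier → Poly → Poly
  a ⊙ p = map (a ·_) p

  _⊗_ : Poly → Poly → Poly
  [] ⊗ q = []
  (a ∷ p) ⊗ q = a ⊙ q ⊕ (𝟘 ∷ p ⊗ q)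

  one : Poly
  one = 𝟙 ∷ []

  ⊕-at : ∀ p q i → (p ⊕ q) ! i ≡ p ! i ⊹ q ! i
  ⊕-at [] q i = sym (⊹-idˡ _)
  ⊕-at (a ∷ p) [] i = sym (⊹-idʳ _)
  ⊕-at (a ∷ p) (b ∷ q) zero = refl
  ⊕-at (a ∷ p) (b ∷ q) (suc i) = ⊕-at p q i

  ⊙-at : ∀ a p i → (a ⊙ p) ! i ≡ a · p ! i
  ⊙-at a [] i = sym (·-zeroʳ a)
  ⊙-at a (b ∷ p) zero = refl
  ⊙-at a (b ∷ p) (suc i) = ⊙-at a p i

  ⊕-cong : ∀ {p p′ q q′} → p ≈ p′ → q ≈ q′ → p ⊕ q ≈ p′ ⊕ q′
  ⊕-cong {p} {p′} {q} {q′} h k = coeffs λ i → trans (⊕-at p q i) (trans (cong₂ _⊹_ (at h i) (at k i)) (sym (⊕-at p′ q′ i)))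

  ⊙-cong : ∀ {a b p q} → a ≡ b → p ≈ q → a ⊙ p ≈ b ⊙ q
  ⊙-cong {a} {b} {p} {q} e h = coeffs λ i → trans (⊙-at a p i) (trans (cong₂ _·_ e (at h i)) (sym (⊙-at b q i)))

  ⊕-assoc : ∀ p q r → (p ⊕ q) ⊕ r ≈ p ⊕ (q ⊕ r)
  ⊕-assoc p q r = coeffs λ i → trans (⊕-at (p ⊕ q) r i) (trans (cong (_⊹ r ! i) (⊕-at p q i))
    (trans (⊹-assoc _ _ _) (sym (trans (⊕-at p (q ⊕ r) i) (cong (p ! i ⊹_) (⊕-at q r i))))))

  ⊕-comm : ∀ p q → p ⊕ q ≈ q ⊕ p
  ⊕-comm p q = coeffs λ i → trans (⊕-at p q i) (trans (⊹-comm _ _) (sym (⊕-at q p i)))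

  ⊕-idʳ : ∀ p → p ⊕ [] ≈ p
  ⊕-idʳ p = ⊕-comm p []

  ⊗-congʳ : ∀ p {q q′} → q ≈ q′ → p ⊗ q ≈ p ⊗ q′
  ⊗-congʳ [] h = ≈-refl
  ⊗-congʳ (a ∷ p) h = ⊕-cong (⊙-cong refl h) (∷-cong refl (⊗-congʳ p h))

  ⊗-zeroʳ : ∀ p → p ⊗ [] ≈ []
  ⊗-zeroʳ [] = ≈-refl
  ⊗-zeroʳ (a ∷ p) = coeffs λ { zero → refl ; (suc i) → at (⊗-zeroʳ p) i }

  ⊗-∷ʳ : ∀ p b q → p ⊗ (b ∷ q) ≈ b ⊙ p ⊕ (𝟘 ∷ p ⊗ q)
  ⊗-∷ʳ [] b q = coeffs λ { zero → refl ; (suc i) → refl }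
  ⊗-∷ʳ (a ∷ p) b q = coeffs λ
    { zero → cong (_⊹ 𝟘) (·-comm a b)
    ; (suc i) → begin
        (a ⊙ q ⊕ p ⊗ (b ∷ q)) ! i ≡⟨ ⊕-at (a ⊙ q) (p ⊗ (b ∷ q)) i ⟩
        (a ⊙ q) ! i ⊹ (p ⊗ (b ∷ q)) ! i ≡⟨ cong ((a ⊙ q) ! i ⊹_) (trans (at (⊗-∷ʳ p b q) i) (⊕-at (b ⊙ p) _ i)) ⟩
        (a ⊙ q) ! i ⊹ ((b ⊙ p) ! i ⊹ (𝟘 ∷ p ⊗ q) ! i) ≡⟨ solveR 3 (λ u v w → u :+ (v :+ w) := v :+ (u :+ w)) refl _ _ _ ⟩
        (b ⊙ p) ! i ⊹ ((a ⊙ q) ! i ⊹ (𝟘 ∷ p ⊗ q) ! i) ≡⟨ cong ((b ⊙ p) ! i ⊹_) (sym (⊕-at (a ⊙ q) _ i)) ⟩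
        (b ⊙ p) ! i ⊹ (a ⊙ q ⊕ (𝟘 ∷ p ⊗ q)) ! i ≡⟨ sym (⊕-at (b ⊙ p) _ i) ⟩
        (b ⊙ p ⊕ (a ⊙ q ⊕ (𝟘 ∷ p ⊗ q))) ! i ∎ }
    where open ≡-Reasoning

  ⊗-comm : ∀ p q → p ⊗ q ≈ q ⊗ p
  ⊗-comm [] q = ≈-sym (⊗-zeroʳ q)
  ⊗-comm (a ∷ p) q = ≈-trans (⊕-cong (≈-refl {a ⊙ q}) (∷-cong refl (⊗-comm p q))) (≈-sym (⊗-∷ʳ q a p))

  ⊗-congˡ : ∀ {p p′} q → p ≈ p′ → p ⊗ q ≈ p′ ⊗ q
  ⊗-congˡ {p} {p′} q h = ≈-trans (⊗-comm p q) (≈-trans (⊗-congʳ q h) (⊗-comm q p′))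

  ⊗-distribˡ : ∀ p q r → p ⊗ (q ⊕ r) ≈ p ⊗ q ⊕ p ⊗ r
  ⊗-distribˡ [] q r = ≈-refl
  ⊗-distribˡ (a ∷ p) q r = coeffs λ i → begin
    (a ⊙ (q ⊕ r) ⊕ (𝟘 ∷ p ⊗ (q ⊕ r))) ! i ≡⟨ ⊕-at (a ⊙ (q ⊕ r)) _ i ⟩
    (a ⊙ (q ⊕ r)) ! i ⊹ (𝟘 ∷ p ⊗ (q ⊕ r)) ! i
      ≡⟨ cong₂ _⊹_ (trans (⊙-at a (q ⊕ r) i) (trans (cong (a ·_) (⊕-at q r i)) (trans (·-distribˡ a _ _) (sym (cong₂ _⊹_ (⊙-at a q i) (⊙-at a r i))))))
           (tail-eq i) ⟩
    ((a ⊙ q) ! i ⊹ (a ⊙ r) ! i) ⊹ ((𝟘 ∷ p ⊗ q) ! i ⊹ (𝟘 ∷ p ⊗ r) ! i)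
      ≡⟨ solveR 4 (λ a b c d → (a :+ b) :+ (c :+ d) := (a :+ c) :+ (b :+ d)) refl _ _ _ _ ⟩
    ((a ⊙ q) ! i ⊹ (𝟘 ∷ p ⊗ q) ! i) ⊹ ((a ⊙ r) ! i ⊹ (𝟘 ∷ p ⊗ r) ! i)
      ≡⟨ sym (trans (⊕-at ((a ∷ p) ⊗ q) _ i) (cong₂ _⊹_ (⊕-at (a ⊙ q) _ i) (⊕-at (a ⊙ r) _ i))) ⟩
    ((a ∷ p) ⊗ q ⊕ (a ∷ p) ⊗ r) ! i ∎
    where
      open ≡-Reasoning
      tail-eq : ∀ i → (𝟘 ∷ p ⊗ (q ⊕ r)) ! i ≡ (𝟘 ∷ p ⊗ q) ! i ⊹ (𝟘 ∷ p ⊗ r) ! i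
      tail-eq zero = sym (⊹-idˡ 𝟘)
      tail-eq (suc i) = trans (at (⊗-distribˡ p q r) i) (⊕-at (p ⊗ q) _ i)

  ⊗-distribʳ : ∀ p q r → (q ⊕ r) ⊗ p ≈ q ⊗ p ⊕ r ⊗ p
  ⊗-distribʳ p q r = ≈-trans (⊗-comm (q ⊕ r) p) (≈-trans (⊗-distribˡ p q r) (⊕-cong (⊗-comm p q) (⊗-comm p r)))

  shift-⊗ : ∀ s r → (𝟘 ∷ s) ⊗ r ≈ 𝟘 ∷ s ⊗ r
  shift-⊗ s r = coeffs λ i → trans (⊕-at (𝟘 ⊙ r) _ i) (trans (cong (_⊹ (𝟘 ∷ s ⊗ r) ! i) (trans (⊙-at 𝟘 r i) (·-zeroˡ _))) (⊹-idˡ _))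

  ⊙-⊗ : ∀ a q r → (a ⊙ q) ⊗ r ≈ a ⊙ (q ⊗ r)
  ⊙-⊗ a [] r = ≈-refl
  ⊙-⊗ a (b ∷ q) r = coeffs λ i → begin
    ((a · b) ⊙ r ⊕ (𝟘 ∷ (a ⊙ q) ⊗ r)) ! i ≡⟨ ⊕-at ((a · b) ⊙ r) _ i ⟩
    ((a · b) ⊙ r) ! i ⊹ (𝟘 ∷ (a ⊙ q) ⊗ r) ! i
      ≡⟨ cong₂ _⊹_ (trans (⊙-at (a · b) r i) (trans (·-assoc a b _) (cong (a ·_) (sym (⊙-at b r i))))) (tail-eq i) ⟩
    a · (b ⊙ r) ! i ⊹ a · (𝟘 ∷ q ⊗ r) ! i ≡⟨ sym (·-distribˡ a _ _) ⟩
    a · ((b ⊙ r) ! i ⊹ (𝟘 ∷ q ⊗ r) ! i) ≡⟨ cong (a ·_) (sym (⊕-at (b ⊙ r) _ i)) ⟩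
    a · ((b ∷ q) ⊗ r) ! i ≡⟨ sym (⊙-at a ((b ∷ q) ⊗ r) i) ⟩
    (a ⊙ ((b ∷ q) ⊗ r)) ! i ∎
    where
      open ≡-Reasoning
      tail-eq : ∀ i → (𝟘 ∷ (a ⊙ q) ⊗ r) ! i ≡ a · (𝟘 ∷ q ⊗ r) ! i
      tail-eq zero = sym (·-zeroʳ a)
      tail-eq (suc i) = trans (at (⊙-⊗ a q r) i) (⊙-at a (q ⊗ r) i)

  ⊗-assoc : ∀ p q r → (p ⊗ q) ⊗ r ≈ p ⊗ (q ⊗ r)
  ⊗-assoc [] q r = ≈-refl
  ⊗-assoc (a ∷ p) q r = ≈-trans (⊗-distribʳ r (a ⊙ q) (𝟘 ∷ p ⊗ q))
    (⊕-cong (⊙-⊗ a q r) (≈-trans (shift-⊗ (p ⊗ q) r) (∷-cong refl (⊗-assoc p q r))))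

  ⊗-idˡ : ∀ q → one ⊗ q ≈ q
  ⊗-idˡ q = coeffs λ i → trans (⊕-at (𝟙 ⊙ q) (𝟘 ∷ []) i) (trans (cong₂ _⊹_ (trans (⊙-at 𝟙 q i) (·-idˡ _)) (z i)) (⊹-idʳ _))
    where
      z : ∀ i → (𝟘 ∷ []) ! i ≡ 𝟘
      z zero = refl
      z (suc i) = refl

  ⊙≈⊗ : ∀ a p → a ⊙ p ≈ (a ∷ []) ⊗ p
  ⊙≈⊗ a p = ≈-sym (coeffs λ i → trans (⊕-at (a ⊙ p) (𝟘 ∷ []) i) (trans (cong ((a ⊙ p) ! i ⊹_) (z i)) (⊹-idʳ _)))
    where
      z : ∀ i → (𝟘 ∷ []) ! i ≡ 𝟘
      z zero = refl
      z (suc i) = refl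

  polySemiring : CommutativeSemiring _ _
  polySemiring = record
    { Carrier = Poly ; _≈_ = _≈_ ; _+_ = _⊕_ ; _*_ = _⊗_ ; 0# = [] ; 1# = one
    ; isCommutativeSemiring = record
      { isSemiring = record
        { isSemiringWithoutAnnihilatingZero = record
          { +-isCommutativeMonoid = record
            { isMonoid = record
              { isSemigroup = record
                { isMagma = record
                  { isEquivalence = record { refl = ≈-refl ; sym = ≈-sym ; trans = ≈-trans }
                  ; ∙-cong = ⊕-cong }
                ; assoc = ⊕-assoc }
              ; identity = (λ p → ≈-refl) , ⊕-idʳ }
            ; comm = ⊕-comm }
          ; *-cong = λ {p} {p′} {q} {q′} h k → ≈-trans (⊗-congˡ q h) (⊗-congʳ p′ k)
          ; *-assoc = ⊗-assoc
          ; *-identity = ⊗-idˡ , (λ p → ≈-trans (⊗-comm p one) (⊗-idˡ p))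
          ; distrib = ⊗-distribˡ , ⊗-distribʳ }
        ; zero = (λ p → ≈-refl) , ⊗-zeroʳ }
      ; *-comm = ⊗-comm } }

  private module PS = NatSolver polySemiring
  open PS using () renaming (solve to solveP; _:+_ to _:⊕_; _:*_ to _:⊗_; _:=_ to _:≈_; con to conP)

  infix 4 _∣ᴾ_
  _∣ᴾ_ : Poly → Poly → Set
  h ∣ᴾ f = ∃ λ s → f ≈ s ⊗ h

  -- A monic polynomial of degree d, its leading coefficient being implicit. `low` reads the same
  -- kind of vector as a polynomial of degree below d; degrees are thus carried by types and no
  -- leading coefficient needs a test.
  ⟦_⟧ : ∀ {d} → Vec Carrier d → Poly
  ⟦ [] ⟧ = one
  ⟦ a ∷ v ⟧ = a ∷ ⟦ v ⟧

  low : ∀ {d} → Vec Carrier d → Poly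
  low = Vec.toList

  invᶠ : ∀ {b} → b ≢ 𝟘 → Carrier
  invᶠ {b} h = proj₁ (inverse b h)

  invᶠ-l : ∀ {b} (h : b ≢ 𝟘) → invᶠ h · b ≡ 𝟙
  invᶠ-l {b} h = trans (·-comm _ _) (proj₂ (inverse b h))

  private
    reduce-top : ∀ {d} (h : Vec Carrier d) (w : Vec Carrier (suc d)) → ∃₂ λ b (r : Vec Carrier d) → low w ≈ b ⊙ ⟦ h ⟧ ⊕ low r
    reduce-top [] (b ∷ []) = b , [] , ∷-cong (sym (·-idʳ b)) ≈-refl
    reduce-top (c ∷ h) (a ∷ w) with reduce-top h w
    ... | b , r , e = b , (a ⊹ (⊖ (b · c)) ∷ r) , ∷-cong (solveR 2 (λ a t → a := t :+ (a :- t)) refl a (b · c)) e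

    zeros : ∀ d → Σ (Vec Carrier d) λ r → low r ≈ []
    zeros zero = [] , ≈-refl
    zeros (suc d) with zeros d
    ... | r , e = 𝟘 ∷ r , coeffs λ { zero → refl ; (suc i) → at e i }

    shift-step : ∀ {k} a b {e s : Poly} {h r′ : Vec Carrier k} {r : Vec Carrier k} → e ≈ s ⊗ ⟦ h ⟧ ⊕ low r′ → low (a ∷ r′) ≈ b ⊙ ⟦ h ⟧ ⊕ low r →
      a ∷ e ≈ (b ∷ s) ⊗ ⟦ h ⟧ ⊕ low r
    shift-step a b {e} {s} {h} {r′} {r} h₁ h₂ =
      ≈-trans (coeffs λ { zero → sym (⊹-idˡ a) ; (suc i) → at h₁ i })
      (≈-trans (⊕-cong (≈-refl {𝟘 ∷ s ⊗ ⟦ h ⟧}) h₂)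
        (solveP 3 (λ x y z → x :⊕ (y :⊕ z) :≈ (y :⊕ x) :⊕ z) ≈-refl (𝟘 ∷ s ⊗ ⟦ h ⟧) (b ⊙ ⟦ h ⟧) (low r)))

  -- Horner's scheme: once `e` has been divided with remainder r′, the polynomial a + X r′ has
  -- degree at most k, and one scalar multiple of the divisor removes its top coefficient.
  divide : ∀ {k} (h : Vec Carrier k) (e : Poly) → ∃₂ λ s (r : Vec Carrier k) → e ≈ s ⊗ ⟦ h ⟧ ⊕ low r
  divide {k} h [] with zeros k
  ... | r , z = [] , r , ≈-sym z
  divide h (a ∷ e) with divide h e
  ... | s , r′ , h₁ with reduce-top h (a ∷ r′)
  ...   | b , r , h₂ = (b ∷ s) , r , shift-step a b {s = s} {h = h} {r′} {r} h₁ h₂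

  divideM : ∀ j {k} (f : Vec Carrier (j + k)) (h : Vec Carrier k) → ∃₂ λ (s : Vec Carrier j) (r : Vec Carrier k) → ⟦ f ⟧ ≈ ⟦ s ⟧ ⊗ ⟦ h ⟧ ⊕ low r
  divideM zero f h with same-degree f h
    where
      same-degree : ∀ {k} (f h : Vec Carrier k) → Σ (Vec Carrier k) λ r → ⟦ f ⟧ ≈ ⟦ h ⟧ ⊕ low r
      same-degree [] [] = [] , ≈-refl
      same-degree (a ∷ f) (b ∷ h) with same-degree f h
      ... | r , e = (a ⊹ (⊖ b) ∷ r) , ∷-cong (solveR 2 (λ a b → a := b :+ (a :- b)) refl a b) e
  ... | r , e = [] , r , ≈-trans e (⊕-cong (≈-sym (⊗-idˡ ⟦ h ⟧)) ≈-refl)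
  divideM (suc j) (a ∷ f) h with divideM j f h
  ... | s , r′ , h₁ with reduce-top h (a ∷ r′)
  ...   | b , r , h₂ = (b ∷ s) , r , shift-step a b {s = ⟦ s ⟧} {h = h} {r′} {r} h₁ h₂

  leading : ∀ {d} (r : Vec Carrier d) → (low r ≈ []) ⊎ (∃ λ k → Σ (Vec Carrier k) λ v → ∃ λ b → k < d × b ≢ 𝟘 × low r ≈ b ⊙ ⟦ v ⟧)
  leading [] = inj₁ ≈-refl
  leading (a ∷ r) with leading r
  ... | inj₂ (k , v , b , k<d , b≢0 , e) = inj₂ (suc k , (invᶠ b≢0 · a ∷ v) , b , s<s k<d , b≢0 ,
    ∷-cong (trans (sym (·-idˡ a)) (trans (cong (_· a) (sym (proj₂ (inverse b b≢0)))) (·-assoc b _ a))) e)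
  ... | inj₁ z with a ≟ᶠ 𝟘
  ...   | yes a≡0 = inj₁ (coeffs λ { zero → a≡0 ; (suc i) → at z i })
  ...   | no a≢0 = inj₂ (0 , [] , a , z<s , a≢0 , ∷-cong (sym (·-idʳ a)) z)

  monic-top : ∀ {k} (h : Vec Carrier k) → ⟦ h ⟧ ! k ≡ 𝟙
  monic-top [] = refl
  monic-top (a ∷ h) = monic-top h

  monic-above : ∀ {k} (h : Vec Carrier k) i → k < i → ⟦ h ⟧ ! i ≡ 𝟘
  monic-above [] (suc i) _ = refl
  monic-above (a ∷ h) (suc i) (s<s k<i) = monic-above h i k<i

  low-above : ∀ {k} (r : Vec Carrier k) i → k ≤ i → low r ! i ≡ 𝟘
  low-above [] i _ = refl
  low-above (a ∷ r) (suc i) (s≤s h) = low-above r i h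

  -- As `⟦ h ⟧` is monic, the top coefficient of the product is that of `s`. The tail of `s` is
  -- killed first; then the head is the coefficient at index k.
  multiple-of-small-degree : ∀ {k} s (h : Vec Carrier k) → (∀ i → k ≤ i → (s ⊗ ⟦ h ⟧) ! i ≡ 𝟘) → s ≈ []
  multiple-of-small-degree [] h z = ≈-refl
  multiple-of-small-degree {k} (a ∷ s) h z = coeffs λ { zero → a≡0 ; (suc i) → at s≈0 i }
    where
      s≈0 : s ≈ []
      s≈0 = multiple-of-small-degree s h λ i k≤i →
        trans (sym (⊹-idˡ _)) (trans (cong (_⊹ (s ⊗ ⟦ h ⟧) ! i) (sym (trans (⊙-at a ⟦ h ⟧ (suc i)) (trans (cong (a ·_) (monic-above h (suc i) (s≤s k≤i))) (·-zeroʳ a)))))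
          (trans (sym (⊕-at (a ⊙ ⟦ h ⟧) (𝟘 ∷ s ⊗ ⟦ h ⟧) (suc i))) (z (suc i) (m≤n⇒m≤1+n k≤i))))
      tail0 : ∀ i → (𝟘 ∷ s ⊗ ⟦ h ⟧) ! i ≡ 𝟘
      tail0 zero = refl
      tail0 (suc i) = at (⊗-congˡ ⟦ h ⟧ s≈0) i
      a≡0 : a ≡ 𝟘
      a≡0 = trans (sym (trans (cong (a ·_) (monic-top h)) (·-idʳ a))) (trans (sym (⊙-at a ⟦ h ⟧ k)) (trans (sym (⊹-idʳ _))
        (trans (cong ((a ⊙ ⟦ h ⟧) ! k ⊹_) (sym (tail0 k))) (trans (sym (⊕-at (a ⊙ ⟦ h ⟧) (𝟘 ∷ s ⊗ ⟦ h ⟧) k)) (z k ≤-refl)))))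

  small-multiple-zero : ∀ {k} (h : Vec Carrier k) p → (∀ i → k ≤ i → p ! i ≡ 𝟘) → ⟦ h ⟧ ∣ᴾ p → p ≈ []
  small-multiple-zero h p z (s , e) = ≈-trans e (⊗-congˡ ⟦ h ⟧ (multiple-of-small-degree s h (λ i k≤i → trans (sym (at e i)) (z i k≤i))))

  -- Euclid's algorithm. A nonzero remainder is made monic by `leading`, so the recursion runs on
  -- the degree; the bound k ≤ d will tell a proper factor from the polynomial itself.
  gcdᴾ : ∀ d (f : Vec Carrier d) (e : Poly) → ∃ λ k → Σ (Vec Carrier k) λ h → k ≤ d × ⟦ h ⟧ ∣ᴾ ⟦ f ⟧ × ⟦ h ⟧ ∣ᴾ e ×
    (∃₂ λ α β → ⟦ h ⟧ ≈ α ⊗ ⟦ f ⟧ ⊕ β ⊗ e)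
  gcdᴾ = <-rec _ step
    where
      step : ∀ d → (∀ {k} → k < d → (f : Vec Carrier k) (e : Poly) → ∃ λ k′ → Σ (Vec Carrier k′) λ h → k′ ≤ k × ⟦ h ⟧ ∣ᴾ ⟦ f ⟧ × ⟦ h ⟧ ∣ᴾ e × (∃₂ λ α β → ⟦ h ⟧ ≈ α ⊗ ⟦ f ⟧ ⊕ β ⊗ e)) →
        (f : Vec Carrier d) (e : Poly) → ∃ λ k → Σ (Vec Carrier k) λ h → k ≤ d × ⟦ h ⟧ ∣ᴾ ⟦ f ⟧ × ⟦ h ⟧ ∣ᴾ e × (∃₂ λ α β → ⟦ h ⟧ ≈ α ⊗ ⟦ f ⟧ ⊕ β ⊗ e)
      step d rec f e with divide f e
      ... | s , r , e≈ with leading r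
      ...   | inj₁ z = d , f , ≤-refl , (one , ≈-sym (⊗-idˡ ⟦ f ⟧)) , (s , ≈-trans e≈ (≈-trans (⊕-cong ≈-refl z) (⊕-idʳ _))) ,
              one , [] , ≈-sym (≈-trans (⊕-idʳ _) (⊗-idˡ ⟦ f ⟧))
      ...   | inj₂ (k , v , b , k<d , b≢0 , r≈) with rec k<d v ⟦ f ⟧
      ...     | k′ , h , k′≤k , (u , v≈) , (t , f≈) , α , β , h≈ =
                k′ , h , ≤-trans k′≤k (<⇒≤ k<d) , (t , f≈) , (s ⊗ t ⊕ (b ∷ []) ⊗ u , h∣e) , (α ⊗ c ⊗ s⁻ ⊕ β) , α ⊗ c , bez
        where
          c s⁻ : Poly
          c = invᶠ b≢0 ∷ []
          s⁻ = (⊖ 𝟙) ⊙ s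
          r≈′ : low r ≈ (b ∷ []) ⊗ ⟦ v ⟧
          r≈′ = ≈-trans r≈ (⊙≈⊗ b ⟦ v ⟧)
          h∣e : e ≈ (s ⊗ t ⊕ (b ∷ []) ⊗ u) ⊗ ⟦ h ⟧
          h∣e = ≈-trans e≈ (≈-trans (⊕-cong (⊗-congʳ s f≈) (≈-trans r≈′ (⊗-congʳ (b ∷ []) v≈)))
            (solveP 5 (λ s t b u h → s :⊗ (t :⊗ h) :⊕ b :⊗ (u :⊗ h) :≈ (s :⊗ t :⊕ b :⊗ u) :⊗ h) ≈-refl s t (b ∷ []) u ⟦ h ⟧))
          cancel : s⁻ ⊗ ⟦ f ⟧ ⊕ s ⊗ ⟦ f ⟧ ≈ []
          cancel = coeffs λ i → trans (⊕-at (s⁻ ⊗ ⟦ f ⟧) _ i) (trans (cong (_⊹ (s ⊗ ⟦ f ⟧) ! i) (trans (at (⊙-⊗ (⊖ 𝟙) s ⟦ f ⟧) i) (⊙-at (⊖ 𝟙) (s ⊗ ⟦ f ⟧) i)))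
            (trans (cong₂ _⊹_ refl (sym (·-idˡ _))) (trans (sym (·-distribʳ _ _ _)) (trans (cong (_· (s ⊗ ⟦ f ⟧) ! i) (⊖-invˡ 𝟙)) (·-zeroˡ _)))))
          r-eq : s⁻ ⊗ ⟦ f ⟧ ⊕ e ≈ (b ∷ []) ⊗ ⟦ v ⟧
          r-eq = ≈-trans (⊕-cong (≈-refl {s⁻ ⊗ ⟦ f ⟧}) e≈) (≈-trans (≈-sym (⊕-assoc (s⁻ ⊗ ⟦ f ⟧) (s ⊗ ⟦ f ⟧) (low r))) (≈-trans (⊕-cong cancel ≈-refl) r≈′))
          cb : c ⊗ (b ∷ []) ≈ one
          cb = coeffs λ { zero → trans (⊹-idʳ _) (invᶠ-l b≢0) ; (suc i) → refl }
          v-eq : ⟦ v ⟧ ≈ c ⊗ (s⁻ ⊗ ⟦ f ⟧ ⊕ e)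
          v-eq = ≈-sym (≈-trans (⊗-congʳ c r-eq) (≈-trans (≈-sym (⊗-assoc c (b ∷ []) ⟦ v ⟧)) (≈-trans (⊗-congˡ ⟦ v ⟧ cb) (⊗-idˡ ⟦ v ⟧))))
          bez : ⟦ h ⟧ ≈ (α ⊗ c ⊗ s⁻ ⊕ β) ⊗ ⟦ f ⟧ ⊕ α ⊗ c ⊗ e
          bez = ≈-trans h≈ (≈-trans (⊕-cong (⊗-congʳ α v-eq) (≈-refl {β ⊗ ⟦ f ⟧}))
            (solveP 6 (λ α β c s f e → α :⊗ (c :⊗ (s :⊗ f :⊕ e)) :⊕ β :⊗ f :≈ (α :⊗ c :⊗ s :⊕ β) :⊗ f :⊕ α :⊗ c :⊗ e) ≈-refl α β c s⁻ ⟦ f ⟧ e))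

  Comaximal : Poly → Poly → Set
  Comaximal f e = ∃₂ λ α β → one ≈ α ⊗ f ⊕ β ⊗ e

  -- The constructive content of irreducibility: divisibility or a Bézout identity, which is the
  -- dichotomy that `annihilator` splits on.
  Irreducible : ∀ {d} → Vec Carrier d → Set
  Irreducible f = ∀ e → ⟦ f ⟧ ∣ᴾ e ⊎ Comaximal ⟦ f ⟧ e

  searchVec : ∀ d {P : Vec Carrier d → Set} {R : Set} → (∀ v → P v ⊎ R) → (∀ v → P v) ⊎ R
  searchVec zero f with f []
  ... | inj₁ p = inj₁ λ { [] → p }
  ... | inj₂ r = inj₂ r
  searchVec (suc d) {P} {R} f with search {λ a → ∀ v → P (a ∷ v)} {R} (λ a → searchVec d (λ v → f (a ∷ v)))
  ... | inj₁ g = inj₁ λ { (a ∷ v) → g a v }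
  ... | inj₂ r = inj₂ r

  Splits : ∀ {d} → Vec Carrier d → Set
  Splits {d} f = ∃₂ λ j k → suc j + suc k ≡ d × Σ (Vec Carrier (suc j)) λ s → Σ (Vec Carrier (suc k)) λ h → ⟦ f ⟧ ≈ ⟦ s ⟧ ⊗ ⟦ h ⟧

  exact-quotient : ∀ j {k} (f : Vec Carrier (j + k)) (h : Vec Carrier k) → ⟦ h ⟧ ∣ᴾ ⟦ f ⟧ → Σ (Vec Carrier j) λ s → ⟦ f ⟧ ≈ ⟦ s ⟧ ⊗ ⟦ h ⟧
  exact-quotient j {k} f h (t , f≈) with divideM j f h
  ... | s , r , f≈′ = s , ≈-trans f≈′ (≈-trans (⊕-cong ≈-refl r≈0) (⊕-idʳ _))
    where
      s⁻ : Poly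
      s⁻ = (⊖ 𝟙) ⊙ ⟦ s ⟧
      r≈ : low r ≈ (t ⊕ s⁻) ⊗ ⟦ h ⟧
      r≈ = coeffs λ i → begin
        low r ! i ≡⟨ solveR 2 (λ r x → r := (x :+ r) :- x) refl (low r ! i) ((⟦ s ⟧ ⊗ ⟦ h ⟧) ! i) ⟩
        ((⟦ s ⟧ ⊗ ⟦ h ⟧) ! i ⊹ low r ! i) ⊹ (⊖ ((⟦ s ⟧ ⊗ ⟦ h ⟧) ! i))
          ≡⟨ cong₂ _⊹_ (trans (sym (⊕-at (⟦ s ⟧ ⊗ ⟦ h ⟧) (low r) i)) (trans (sym (at f≈′ i)) (at f≈ i)))
               (trans (cong ⊖_ (sym (·-idˡ _))) (trans (-‿distribˡ-* 𝟙 _) (sym (trans (at (⊙-⊗ (⊖ 𝟙) ⟦ s ⟧ ⟦ h ⟧) i) (⊙-at (⊖ 𝟙) (⟦ s ⟧ ⊗ ⟦ h ⟧) i))))) ⟩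
        (t ⊗ ⟦ h ⟧) ! i ⊹ (s⁻ ⊗ ⟦ h ⟧) ! i ≡⟨ sym (⊕-at (t ⊗ ⟦ h ⟧) _ i) ⟩
        (t ⊗ ⟦ h ⟧ ⊕ s⁻ ⊗ ⟦ h ⟧) ! i ≡⟨ sym (at (⊗-distribʳ ⟦ h ⟧ t s⁻) i) ⟩
        ((t ⊕ s⁻) ⊗ ⟦ h ⟧) ! i ∎
        where open ≡-Reasoning
      r≈0 : low r ≈ []
      r≈0 = small-multiple-zero h (low r) (low-above r) (t ⊕ s⁻ , r≈)

  private
    split-at : ∀ {d} (f : Vec Carrier d) k (h : Vec Carrier (suc k)) j → suc j + suc k ≡ d → ⟦ h ⟧ ∣ᴾ ⟦ f ⟧ → Splits f
    split-at f k h j refl h∣f with exact-quotient (suc j) f h h∣f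
    ... | s , f≈ = j , k , refl , s , h , f≈

    comaximal-of-unit : ∀ {d k} (f r : Vec Carrier d) (v : Vec Carrier k) b → b ≢ 𝟘 → low r ≈ b ⊙ ⟦ v ⟧ →
      ∀ α β → one ≈ α ⊗ ⟦ v ⟧ ⊕ β ⊗ ⟦ f ⟧ → Comaximal ⟦ f ⟧ (low r)
    comaximal-of-unit f r v b b≢0 r≈ α β bez = β , α ⊗ c , ≈-trans bez (≈-trans (⊕-cong (⊗-congʳ α v≈) ≈-refl)
        (solveP 5 (λ α β c r f → α :⊗ (c :⊗ r) :⊕ β :⊗ f :≈ β :⊗ f :⊕ α :⊗ c :⊗ r) ≈-refl α β c (low r) ⟦ f ⟧))
      where
        c : Poly
        c = invᶠ b≢0 ∷ []
        v≈ : ⟦ v ⟧ ≈ c ⊗ low r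
        v≈ = coeffs λ i → sym (trans (sym (at (⊙≈⊗ (invᶠ b≢0) (low r)) i)) (trans (⊙-at _ (low r) i) (trans (cong (invᶠ b≢0 ·_) (trans (at r≈ i) (⊙-at b ⟦ v ⟧ i)))
          (trans (sym (·-assoc _ _ _)) (trans (cong (_· ⟦ v ⟧ ! i) (invᶠ-l b≢0)) (·-idˡ _))))))

  -- The gcd of f with a nonzero residue has degree below d. If the degree is 0, Bézout's identity
  -- shows comaximality; otherwise the gcd is a proper factor.
  residue-test : ∀ {d} (f r : Vec Carrier d) → (⟦ f ⟧ ∣ᴾ low r ⊎ Comaximal ⟦ f ⟧ (low r)) ⊎ Splits f
  residue-test {d} f r with leading r
  ... | inj₁ z = inj₁ (inj₁ ([] , z))
  ... | inj₂ (k , v , b , k<d , b≢0 , r≈) = use (gcdᴾ k v ⟦ f ⟧)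
    where
      use : (∃ λ k′ → Σ (Vec Carrier k′) λ h → k′ ≤ k × ⟦ h ⟧ ∣ᴾ ⟦ v ⟧ × ⟦ h ⟧ ∣ᴾ ⟦ f ⟧ × (∃₂ λ α β → ⟦ h ⟧ ≈ α ⊗ ⟦ v ⟧ ⊕ β ⊗ ⟦ f ⟧)) →
        (⟦ f ⟧ ∣ᴾ low r ⊎ Comaximal ⟦ f ⟧ (low r)) ⊎ Splits f
      use (zero , [] , _ , _ , _ , α , β , bez) = inj₁ (inj₂ (comaximal-of-unit f r v b b≢0 r≈ α β bez))
      use (suc k′ , h , k′<k , _ , h∣f , _) = inj₂ (split-at f k′ h (d ∸ suc (suc k′))
        (trans (sym (+-suc (d ∸ suc (suc k′)) (suc k′))) (m∸n+n≡m (≤-trans (s≤s k′<k) k<d))) h∣f)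

  -- Both alternatives depend on `e` modulo f only, and the residues form the searchable type
  -- `Vec Carrier d`. This makes irreducibility decidable.
  residues-suffice : ∀ {d} (f : Vec Carrier d) → (∀ r → ⟦ f ⟧ ∣ᴾ low r ⊎ Comaximal ⟦ f ⟧ (low r)) → Irreducible f
  residues-suffice f all e with divide f e
  ... | s , r , e≈ with all r
  ...   | inj₁ (t , r≈) = inj₁ (s ⊕ t , ≈-trans e≈ (≈-trans (⊕-cong ≈-refl r≈) (≈-sym (⊗-distribʳ ⟦ f ⟧ s t))))
  ...   | inj₂ (α , β , bez) = inj₂ ((α ⊕ β ⊗ s⁻) , β , ≈-trans bez (≈-trans (⊕-cong ≈-refl (⊗-congʳ β r-eq))
            (solveP 5 (λ α β s f e → α :⊗ f :⊕ β :⊗ (s :⊗ f :⊕ e) :≈ (α :⊕ β :⊗ s) :⊗ f :⊕ β :⊗ e) ≈-refl α β s⁻ ⟦ f ⟧ e)))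
    where
      s⁻ : Poly
      s⁻ = (⊖ 𝟙) ⊙ s
      r-eq : low r ≈ s⁻ ⊗ ⟦ f ⟧ ⊕ e
      r-eq = coeffs λ i → sym (trans (⊕-at (s⁻ ⊗ ⟦ f ⟧) e i) (trans (cong₂ _⊹_ (trans (at (⊙-⊗ (⊖ 𝟙) s ⟦ f ⟧) i) (⊙-at (⊖ 𝟙) (s ⊗ ⟦ f ⟧) i)) (trans (at e≈ i) (⊕-at (s ⊗ ⟦ f ⟧) (low r) i)))
        (trans (cong (_⊹ ((s ⊗ ⟦ f ⟧) ! i ⊹ low r ! i)) (trans (sym (-‿distribˡ-* 𝟙 _)) (cong ⊖_ (·-idˡ _))))
          (solveR 2 (λ x r → (:- x) :+ (x :+ r) := r) refl ((s ⊗ ⟦ f ⟧) ! i) (low r ! i)))))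

  irreducible-or-splits : ∀ {d} (f : Vec Carrier d) → Irreducible f ⊎ Splits f
  irreducible-or-splits {d} f = Data.Sum.map₁ (residues-suffice f)
    (searchVec d {λ r → ⟦ f ⟧ ∣ᴾ low r ⊎ Comaximal ⟦ f ⟧ (low r)} {Splits f} (residue-test f))

  record Factor : Set where
    constructor factor
    field
      {deg-1} : ℕ
      poly : Vec Carrier (suc deg-1)
      irreducible : Irreducible poly

  degree : Factor → ℕ
  degree f = suc (Factor.deg-1 f)

  ∏ᴾ : List Factor → Poly
  ∏ᴾ [] = one
  ∏ᴾ (f ∷ fs) = ⟦ Factor.poly f ⟧ ⊗ ∏ᴾ fs

  ∏ᴾ-++ : ∀ fs gs → ∏ᴾ (fs ++ gs) ≈ ∏ᴾ fs ⊗ ∏ᴾ gs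
  ∏ᴾ-++ [] gs = ≈-sym (⊗-idˡ (∏ᴾ gs))
  ∏ᴾ-++ (f ∷ fs) gs = ≈-trans (⊗-congʳ ⟦ Factor.poly f ⟧ (∏ᴾ-++ fs gs)) (≈-sym (⊗-assoc ⟦ Factor.poly f ⟧ (∏ᴾ fs) (∏ᴾ gs)))

  degrees : List Factor → ℕ
  degrees fs = sum (map degree fs)

  degrees-++ : ∀ fs gs → degrees (fs ++ gs) ≡ degrees fs + degrees gs
  degrees-++ [] gs = refl
  degrees-++ (f ∷ fs) gs = trans (cong (degree f +_) (degrees-++ fs gs)) (sym (+-assoc (degree f) _ _))

  factorisation : ∀ d (f : Vec Carrier (suc d)) → ∃ λ fs → ⟦ f ⟧ ≈ ∏ᴾ fs × degrees fs ≡ suc d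
  factorisation = <-rec _ step
    where
      step : ∀ d → (∀ {k} → k < d → (f : Vec Carrier (suc k)) → ∃ λ fs → ⟦ f ⟧ ≈ ∏ᴾ fs × degrees fs ≡ suc k) →
        (f : Vec Carrier (suc d)) → ∃ λ fs → ⟦ f ⟧ ≈ ∏ᴾ fs × degrees fs ≡ suc d
      step d rec f with irreducible-or-splits f
      ... | inj₁ irr = (factor f irr ∷ []) , ≈-sym (≈-trans (⊗-comm ⟦ f ⟧ one) (⊗-idˡ ⟦ f ⟧)) , +-identityʳ (suc d)
      ... | inj₂ (j , k , refl , s , h , f≈) with rec (m<m+n j z<s) s | rec (subst (k <_) (sym (+-suc j k)) (s≤s (m≤n+m k j))) h
      ...   | fs , s≈ , ds | gs , h≈ , dh = (fs ++ gs) ,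
        ≈-trans f≈ (≈-trans (≈-trans (⊗-congˡ ⟦ h ⟧ s≈) (⊗-congʳ (∏ᴾ fs) h≈)) (≈-sym (∏ᴾ-++ fs gs))) ,
        trans (degrees-++ fs gs) (cong₂ _+_ ds dh)

  ⊗-cancelʳ : ∀ {k} (h : Vec Carrier k) s t → s ⊗ ⟦ h ⟧ ≈ t ⊗ ⟦ h ⟧ → s ≈ t
  ⊗-cancelʳ h s t e = coeffs λ i → trans (solveR 2 (λ s t → s := (s :- t) :+ t) refl (s ! i) (t ! i))
    (trans (cong (_⊹ t ! i) (trans (cong (s ! i ⊹_) (sym (neg t i))) (trans (sym (⊕-at s ((⊖ 𝟙) ⊙ t) i)) (at diff i)))) (⊹-idˡ _))
    where
      neg : ∀ p i → ((⊖ 𝟙) ⊙ p) ! i ≡ ⊖ (p ! i)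
      neg p i = trans (⊙-at (⊖ 𝟙) p i) (trans (sym (-‿distribˡ-* 𝟙 _)) (cong ⊖_ (·-idˡ _)))
      diff : s ⊕ (⊖ 𝟙) ⊙ t ≈ []
      diff = multiple-of-small-degree _ h λ i _ → trans (at (⊗-distribʳ ⟦ h ⟧ s ((⊖ 𝟙) ⊙ t)) i)
        (trans (⊕-at (s ⊗ ⟦ h ⟧) _ i) (trans (cong₂ _⊹_ (at e i) (trans (at (⊙-⊗ (⊖ 𝟙) t ⟦ h ⟧) i) (neg (t ⊗ ⟦ h ⟧) i))) (⊖-invʳ _)))

  infixr 8 _^ᶠ_
  _^ᶠ_ : Carrier → ℕ → Carrier
  a ^ᶠ zero = 𝟙
  a ^ᶠ suc k = a · a ^ᶠ k

  -- The polynomial X^(k+1) + a.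
  binomialVec : ∀ k → Carrier → Vec Carrier (suc k)
  binomialVec k a = a ∷ Vec.replicate k 𝟘

  -- The quotient (X^(k+1) - ζ^(k+1)) / (X - ζ). When X acts as a Frobenius map, ζ = 1 gives a trace
  -- and a root of unity ζ a Lagrange resolvent.
  geometric : Carrier → ∀ k → Vec Carrier k
  geometric ζ zero = []
  geometric ζ (suc k) = ζ ^ᶠ suc k ∷ geometric ζ k

  linear : Carrier → Poly
  linear ζ = (⊖ ζ) ∷ 𝟙 ∷ []

  linear-⊗ : ∀ ζ p → linear ζ ⊗ p ≈ (⊖ ζ) ⊙ p ⊕ (𝟘 ∷ p)
  linear-⊗ ζ p = ⊕-cong (≈-refl {(⊖ ζ) ⊙ p}) (∷-cong refl (⊗-idˡ p))

  linear-geometric : ∀ ζ k → linear ζ ⊗ ⟦ geometric ζ k ⟧ ≈ ⟦ binomialVec k (⊖ (ζ ^ᶠ suc k)) ⟧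
  linear-geometric ζ k = ≈-trans (linear-⊗ ζ ⟦ geometric ζ k ⟧) (telescope k)
    where
      telescope : ∀ k → (⊖ ζ) ⊙ ⟦ geometric ζ k ⟧ ⊕ (𝟘 ∷ ⟦ geometric ζ k ⟧) ≈ ⟦ binomialVec k (⊖ (ζ ^ᶠ suc k)) ⟧
      telescope zero = coeffs λ { zero → trans (⊹-idʳ _) (trans (·-idʳ _) (cong ⊖_ (sym (·-idʳ ζ)))) ; (suc i) → refl }
      telescope (suc k) = coeffs λ
        { zero → trans (⊹-idʳ _) (sym (-‿distribˡ-* ζ _))
        ; (suc zero) → trans (⊕-at ((⊖ ζ) ⊙ G) (ζ ^ᶠ suc k ∷ G) 0) (trans (cong (_⊹ ζ ^ᶠ suc k) (trans (sym (⊹-idʳ _)) (trans (sym (⊕-at ((⊖ ζ) ⊙ G) (𝟘 ∷ G) 0)) (at (telescope k) 0)))) (⊖-invˡ _))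
        ; (suc (suc i)) → trans (⊕-at ((⊖ ζ) ⊙ G) (ζ ^ᶠ suc k ∷ G) (suc i)) (trans (sym (⊕-at ((⊖ ζ) ⊙ G) (𝟘 ∷ G) (suc i))) (at (telescope k) (suc i))) }
        where G = ⟦ geometric ζ k ⟧

-- The numerical sieve test

length-filterᵇ : ∀ {X : Set} (A : X → Bool) xs → length (Data.List.filterᵇ A xs) ≡ sum (map (ι ∘ A) xs)
length-filterᵇ A [] = refl
length-filterᵇ A (x ∷ xs) with A x
... | true = cong suc (length-filterᵇ A xs)
... | false = length-filterᵇ A xs

Unique-lookup-injective : ∀ {X : Set} {xs : List X} → Unique xs → ∀ i j → Data.List.lookup xs i ≡ Data.List.lookup xs j → i ≡ j
Unique-lookup-injective (_ ∷ _) fzero fzero _ = refl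
Unique-lookup-injective (x∉ ∷ _) fzero (fsuc j) e = contradiction e (All.lookup x∉ (∈ₚ.∈-lookup j))
Unique-lookup-injective (x∉ ∷ _) (fsuc i) fzero e = contradiction (sym e) (All.lookup x∉ (∈ₚ.∈-lookup i))
Unique-lookup-injective (_ ∷ u) (fsuc i) (fsuc j) e = cong fsuc (Unique-lookup-injective u i j e)

funToFin-cong : ∀ {m s} (f g : Fin m → Fin s) → (∀ i → f i ≡ g i) → Data.Fin.funToFin f ≡ Data.Fin.funToFin g
funToFin-cong {zero} f g h = refl
funToFin-cong {suc m} f g h = cong₂ Data.Fin.combine (h fzero) (funToFin-cong (f ∘ fsuc) (g ∘ fsuc) (h ∘ fsuc))

sum-map-≤ : ∀ {X : Set} (f : X → ℕ) b xs → All (λ x → f x ≤ b) xs → sum (map f xs) ≤ length xs * b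
sum-map-≤ f b [] [] = z≤n
sum-map-≤ f b (x ∷ xs) (h ∷ hs) = +-mono-≤ h (sum-map-≤ f b xs hs)

-- Totals over the levels l ∣ n with 2 ≤ l ≤ k. Level l has at most n / l bad subgroups, one for
-- each irreducible factor of T^(n/l) - 1, and each has at most q^(n-l) elements.
extraSize extraCount : ℕ → ℕ → ℕ → ℕ
extraSize q n zero = 0
extraSize q n (suc zero) = 0
extraSize q n (suc k@(suc _)) = (if ⌊ suc k ∣? n ⌋ then n / suc k * q ^ (n ∸ suc k) else 0) + extraSize q n k
extraCount q n zero = 0
extraCount q n (suc zero) = 0
extraCount q n (suc k@(suc _)) = (if ⌊ suc k ∣? n ⌋ then n / suc k else 0) + extraCount q n k

repunit : ℕ → ℕ → ℕ
repunit q zero = 0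
repunit q (suc n) = 1 + q * repunit q n

repunit-* : ∀ q n → 0 < q → suc (repunit q n * (q ∸ 1)) ≡ q ^ n
repunit-* q zero _ = refl
repunit-* (suc p) (suc n) h = trans (lemma p (repunit (suc p) n)) (cong (suc p *_) (repunit-* (suc p) n h))
  where
    lemma : ∀ p r → suc ((1 + suc p * r) * p) ≡ suc p * suc (r * p)
    lemma = solve-∀

smallPrimes : List ℕ
smallPrimes = 2 ∷ 3 ∷ 5 ∷ 7 ∷ 11 ∷ 13 ∷ 17 ∷ 19 ∷ 23 ∷ 29 ∷ 31 ∷ 37 ∷ 41 ∷ 43 ∷ 47 ∷ 53 ∷ 59 ∷ 61 ∷ 67 ∷ 71 ∷ 73 ∷ 79 ∷ 83 ∷ 89 ∷ 97 ∷ 101 ∷ 103 ∷ 107 ∷ 109 ∷ 113 ∷ 127 ∷ 131 ∷ 137 ∷ 139 ∷ 149 ∷ 151 ∷ []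

-- Euclid's algorithm with fuel, made for evaluation. It returns a multiple of the gcd even when the
-- fuel runs out, and an upper bound for the gcd is all that the test requires.
egcd : ℕ → ℕ → ℕ → ℕ
egcd zero a b = a + b
egcd (suc k) a zero = a
egcd (suc k) a b@(suc _) = egcd k b (a % b)

-- The integer square root, found bit by bit, plus one. Neither this nor `logAbove` is proved
-- correct: the tests themselves check `Q ≤ s * s` and `M < P * 157 ^ suc t`.
rootAbove : ℕ → ℕ → ℕ → ℕ
rootAbove Q zero r = suc r
rootAbove Q (suc i) r = if (r + 2 ^ i) * (r + 2 ^ i) ≤ᵇ Q then rootAbove Q i (r + 2 ^ i) else rootAbove Q i r

logAbove : ℕ → ℕ → ℕ → ℕ → ℕ
logAbove zero M x t = t
logAbove (suc k) M x t = if x * 157 ≤ᵇ M then logAbove k M (x * 157) (suc t) else t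

-- 2 Σ |V| ≤ sizeBound and 2 (number of V) ≤ countBound, V running over the bad subspaces and g = gcd(n, q-1).
sizeBound countBound : ℕ → ℕ → ℕ → ℕ
sizeBound q n g = q ^ (n ∸ 2) * (n + g * (2 * q ∸ 1)) + 2 * extraSize q n n
countBound q n g = n + g + 2 * extraCount q n n

-- P, f and 2^k = W are ∏ r, ∏ (r - 1) and ∏ 2 over the primes r < 157 dividing M; M has at most t prime divisors ≥ 157.
-- The first test bounds the r-free elements of a bad subgroup by its size, the second one sieves there as well, with s ≥ √Q.
trivialTest : (N P f t D : ℕ) → Bool
trivialTest N P f t D = 157 * (P * D) + 2 * (P * (t * N)) <ᵇ 157 * (2 * (f * N))

fullTest : (Q N P f W t D C s : ℕ) → Bool
fullTest Q N P f W t D C s =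
  (Q ≤ᵇ s * s) ∧ (157 * (f * D * N) + (157 * (C * s * (W * (Q * P))) + 2 * (Q * P * (t * N))) <ᵇ 157 * (2 * (f * Q * N)))

-- All data are arguments here; `test₂` and `test₁` merely supply them. The layers give every large
-- number a name, so that its value can be shared.
test₃ : (Q N M P f W t D C s : ℕ) → Bool
test₃ Q N M P f W t D C s = (M <ᵇ P * 157 ^ suc t) ∧ (trivialTest N P f t D ∨ fullTest Q N P f W t D C s)

test₂ : (q n Q M g : ℕ) → List ℕ → Bool
test₂ q n Q M g S = test₃ Q (Q ∸ 1) M (product S) (φ S) (2 ^ length S) (logAbove 60 M (product S) 0)
  (sizeBound q n g) (countBound q n g) (rootAbove Q 50 0)

test₁ : (q n Q M : ℕ) → Bool
test₁ q n Q M = test₂ q n Q M (egcd 60 n (q ∸ 1)) (filter (_∣? M) smallPrimes)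

sieveTest : ℕ → ℕ → Bool
sieveTest q n = test₁ q n (q ^ n) (repunit q n)

allBelow : ℕ → (ℕ → Bool) → Bool
allBelow zero f = true
allBelow (suc k) f = f k ∧ allBelow k f

allBelow-sound : ∀ k f → T (allBelow k f) → ∀ i → i < k → T (f i)
allBelow-sound (suc k) f t i (s≤s i≤k) with m≤n⇒m<n∨m≡n i≤k
... | inj₁ i<k = allBelow-sound k f (T-∧₂ {f k} t) i i<k
... | inj₂ refl = T-∧₁ t

-- A prime power below 2^11 that is divisible by a prime a divides a^11.
notPrimePower : ℕ → Bool
notPrimePower q = any (λ a → ⌊ a ∣? q ⌋ ∧ not ⌊ q ∣? a ^ 11 ⌋) (2 ∷ 3 ∷ 5 ∷ 7 ∷ 11 ∷ 13 ∷ 17 ∷ 19 ∷ 23 ∷ 29 ∷ 31 ∷ 37 ∷ [])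

exceptional : ℕ → ℕ → Bool
exceptional q n = ((q ≡ᵇ 4) ∧ (n ≡ᵇ 3)) ∨ (((q ≡ᵇ 5) ∧ (n ≡ᵇ 6)) ∨ ((q ≡ᵇ 9) ∧ (n ≡ᵇ 4)))

outOfRange : ℕ → ℕ → Bool
outOfRange q n = if ⌊ 2 ∣? n ⌋ then ⌊ (q ∸ 1) ∣? n ⌋ ∨ (q ^ 5 ≤ᵇ n ^ 4) else (q ^ 4 ≤ᵇ n ^ 3)

checked : ℕ → ℕ → Bool
checked n q = notPrimePower q ∨ (outOfRange q n ∨ (exceptional q n ∨ sieveTest q n))

-- For q ≥ searchBound n the estimate behind threshold takes over.
searchBound : ℕ → ℕ
searchBound 3 = 1300
searchBound 4 = 470
searchBound 5 = 220
searchBound 6 = 125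
searchBound 7 = 80
searchBound 8 = 55
searchBound 9 = 41
searchBound 10 = 32
searchBound 11 = 26
searchBound 12 = 22
searchBound 13 = 18
searchBound 14 = 16
searchBound 15 = 17
searchBound n = n + 2

-- One closed Boolean for all pairs with 3 ≤ n < 22 and q < `searchBound n`, settled by evaluation.
checks : T (allBelow 22 (λ n → (n <ᵇ 3) ∨ allBelow (searchBound n) (checked n)))
checks = tt

-- Soundness of the arithmetic behind the test

egcd-∣ : ∀ k {d} a b → d ∣ a → d ∣ b → d ∣ egcd k a b
egcd-∣ zero a b d∣a d∣b = ∣m∣n⇒∣m+n d∣a d∣b
egcd-∣ (suc k) a zero d∣a d∣b = d∣a
egcd-∣ (suc k) a (suc b) d∣a d∣b = egcd-∣ k (suc b) (a % suc b) d∣b (%-presˡ-∣ d∣a d∣b)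

egcd-pos : ∀ k a b → 0 < a → 0 < egcd k a b
egcd-pos zero a b h = ≤-trans h (m≤m+n a b)
egcd-pos (suc k) a zero h = h
egcd-pos (suc k) a (suc b) h = egcd-pos k (suc b) (a % suc b) z<s

gcd≤egcd : ∀ k a b → 0 < a → gcd a b ≤ egcd k a b
gcd≤egcd k a b h = ∣⇒≤ {{>-nonZero (egcd-pos k a b h)}} (egcd-∣ k a b (gcd[m,n]∣m a b) (gcd[m,n]∣n a b))

smallPrimes-prime : All Prime smallPrimes
smallPrimes-prime = toWitness {a? = All.all? prime? smallPrimes} tt

smallPrimes-unique : Unique smallPrimes
smallPrimes-unique = toWitness {a? = unique? smallPrimes} tt

T-∨ : ∀ {a b} → T (a ∨ b) → T a ⊎ T b
T-∨ {true} _ = inj₁ tt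
T-∨ {false} t = inj₂ t

any-sound : ∀ (f : ℕ → Bool) xs → T (any f xs) → Any (T ∘ f) xs
any-sound f (x ∷ xs) t with T-∨ {f x} t
... | inj₁ h = here h
... | inj₂ h = there (any-sound f xs h)

listed : List ℕ → ℕ → Bool
listed L r = (r <ᵇ 2) ∨ (⌊ r ∈? L ⌋ ∨ any (λ d → ⌊ d ∣? r ⌋ ∧ (d <ᵇ r)) L)

-- The check gives every r with 2 ≤ r < b a place in L or a proper divisor in L. A prime outside L
-- has neither.
unlisted-prime-≥ : ∀ L b → All Prime L → T (allBelow b (listed L)) → ∀ r → Prime r → ¬ (r ∈ L) → b ≤ r
unlisted-prime-≥ L b L-prime check r pr r∉ = ≮⇒≥ λ r<b → use (allBelow-sound b (listed L) check r r<b)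
  where
    proper : (∃ λ d → d ∈ L × T (⌊ d ∣? r ⌋ ∧ (d <ᵇ r))) → ⊥
    proper (d , d∈ , td) with prime⇒irreducible pr (toWitness {a? = d ∣? r} (T-∧₁ td))
    ... | inj₁ refl = <-irrefl refl (prime>1 (All.lookup L-prime d∈))
    ... | inj₂ refl = <-irrefl refl (<ᵇ⇒< r r (T-∧₂ {⌊ r ∣? r ⌋} td))
    use : T (listed L r) → ⊥
    use t with T-∨ {r <ᵇ 2} t
    ... | inj₁ h = <⇒≱ (<ᵇ⇒< r 2 h) (prime>1 pr)
    ... | inj₂ h with T-∨ {⌊ r ∈? L ⌋} h
    ...   | inj₁ h′ = r∉ (toWitness h′)
    ...   | inj₂ h′ = proper (find (any-sound (λ d → ⌊ d ∣? r ⌋ ∧ (d <ᵇ r)) L h′))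

smallPrimes-complete : ∀ r → Prime r → ¬ (r ∈ smallPrimes) → 157 ≤ r
smallPrimes-complete = unlisted-prime-≥ smallPrimes 157 smallPrimes-prime tt

product-++ : ∀ xs ys → product (xs ++ ys) ≡ product xs * product ys
product-++ [] ys = sym (+-identityʳ _)
product-++ (x ∷ xs) ys = trans (cong (x *_) (product-++ xs ys)) (sym (*-assoc x (product xs) (product ys)))

product-≥ : ∀ b xs → All (b ≤_) xs → b ^ length xs ≤ product xs
product-≥ b [] [] = ≤-refl
product-≥ b (x ∷ xs) (h ∷ hs) = *-mono-≤ h (product-≥ b xs hs)

-- A conversion, stated for variable `Q` and `M` so that unfolding the layers does not evaluate the
-- test.
test-unfold : ∀ q n Q M → T (test₁ q n Q M) → T (test₃ Q (Q ∸ 1) M (product (filter (_∣? M) smallPrimes)) (φ (filter (_∣? M) smallPrimes))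
  (2 ^ length (filter (_∣? M) smallPrimes)) (logAbove 60 M (product (filter (_∣? M) smallPrimes)) 0)
  (sizeBound q n (egcd 60 n (q ∸ 1))) (countBound q n (egcd 60 n (q ∸ 1))) (rootAbove Q 50 0))
test-unfold q n Q M h = h

-- Bounding the cost of sieving by all primes dividing M

tinyPrimes : List ℕ
tinyPrimes = 2 ∷ 3 ∷ 5 ∷ 7 ∷ 11 ∷ 13 ∷ 17 ∷ 19 ∷ []

tinyPrimes-prime : All Prime tinyPrimes
tinyPrimes-prime = toWitness {a? = All.all? prime? tinyPrimes} tt

tinyPrimes-unique : Unique tinyPrimes
tinyPrimes-unique = toWitness {a? = unique? tinyPrimes} tt

-- Sieving by the primes in S costs the factor 2^|S| ∏ r/(r - 1). Its fourth power, divided by ∏ r,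
-- is the product of the local quotients `weightᵃ r` / `weightᵇ r`. These are below 1 from r = 23
-- on, so the product is bounded by a constant, and the cost grows at most like the fourth root of
-- M.
weightᵃ weightᵇ : ℕ → ℕ
weightᵃ r = (2 * r) ^ 4
weightᵇ r = r * pred r ^ 4

∏ᵃ ∏ᵇ : List ℕ → ℕ
∏ᵃ S = product (map weightᵃ S)
∏ᵇ S = product (map weightᵇ S)

pow-*₄ : ∀ a b → (a * b) ^ 4 ≡ a ^ 4 * b ^ 4
pow-*₄ = expanded
  where
    expanded : ∀ a b → a * b * (a * b * (a * b * (a * b * 1))) ≡ a * (a * (a * (a * 1))) * (b * (b * (b * (b * 1))))
    expanded = solve-∀

∏ᵃ≡ : ∀ S → (2 ^ length S * product S) ^ 4 ≡ ∏ᵃ S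
∏ᵃ≡ [] = refl
∏ᵃ≡ (r ∷ S) = trans (cong (_^ 4) (lemma (2 ^ length S) r (product S))) (trans (pow-*₄ (2 * r) (2 ^ length S * product S)) (cong ((2 * r) ^ 4 *_) (∏ᵃ≡ S)))
  where
    lemma : ∀ w r p → 2 * w * (r * p) ≡ 2 * r * (w * p)
    lemma = solve-∀

∏ᵇ≡ : ∀ S → product S * φ S ^ 4 ≡ ∏ᵇ S
∏ᵇ≡ [] = refl
∏ᵇ≡ (r ∷ S) = trans (cong (r * product S *_) (pow-*₄ (pred r) (φ S))) (trans (lemma r (product S) (pred r ^ 4) (φ S ^ 4)) (cong (weightᵇ r *_) (∏ᵇ≡ S)))
  where
    lemma : ∀ r p a b → r * p * (a * b) ≡ r * a * (p * b)
    lemma = solve-∀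

-- All quotients `weightᵃ r` / `weightᵇ r` over L are at least 1, so leaving out primes can only
-- lower their product.
∏-filter : ∀ {P : ℕ → Set} (P? : ∀ r → Dec (P r)) L → All (λ r → weightᵇ r ≤ weightᵃ r) L →
  ∏ᵃ (filter P? L) * ∏ᵇ L ≤ ∏ᵃ L * ∏ᵇ (filter P? L)
∏-filter P? [] [] = ≤-refl
∏-filter P? (r ∷ L) (h ∷ hs) with does (P? r)
... | true = subst₂ _≤_ (lemma (weightᵃ r) (weightᵇ r) _ _) (lemma (weightᵃ r) (weightᵇ r) _ _) (*-monoʳ-≤ (weightᵃ r * weightᵇ r) (∏-filter P? L hs))
  where
    lemma : ∀ a b x y → a * b * (x * y) ≡ a * x * (b * y)
    lemma = solve-∀
... | false = ≤-trans (≤-reflexive (lemma (∏ᵃ (filter P? L)) (weightᵇ r) (∏ᵇ L))) (≤-trans (*-mono-≤ h (∏-filter P? L hs)) (≤-reflexive (sym (*-assoc (weightᵃ r) (∏ᵃ L) _))))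
  where
    lemma : ∀ x b y → x * (b * y) ≡ b * (x * y)
    lemma = solve-∀

cube-≤-fourth : ∀ a b k r s → 0 < a → a * r ≤ b * s → k * (b * b * b) ≤ a * a * a * a → a ≤ s → k * (r * r * r) ≤ s * (s * (s * (s * 1)))
cube-≤-fourth a b k r s 0<a ar≤bs hk a≤s = *-cancelˡ-≤ (a * a * a) {{>-nonZero (*-mono-< (*-mono-< 0<a 0<a) 0<a)}} (begin
  a * a * a * (k * (r * r * r)) ≡⟨ lemma₂ a k r ⟩
  k * (a * r * (a * r) * (a * r)) ≤⟨ *-monoʳ-≤ k (*-mono-≤ (*-mono-≤ ar≤bs ar≤bs) ar≤bs) ⟩
  k * (b * s * (b * s) * (b * s)) ≡⟨ lemma₃ k b s ⟩
  k * (b * b * b) * (s * s * s) ≤⟨ *-monoˡ-≤ (s * s * s) hk ⟩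
  a * a * a * a * (s * s * s) ≤⟨ *-monoˡ-≤ (s * s * s) (*-monoʳ-≤ (a * a * a) a≤s) ⟩
  a * a * a * s * (s * s * s) ≡⟨ lemma₅ (a * a * a) s ⟩
  a * a * a * (s * (s * (s * (s * 1)))) ∎)
  where
    open ≤-Reasoning
    lemma₂ : ∀ c k r → c * c * c * (k * (r * r * r)) ≡ k * (c * r * (c * r) * (c * r))
    lemma₂ = solve-∀
    lemma₃ : ∀ k c s → k * (c * s * (c * s) * (c * s)) ≡ k * (c * c * c) * (s * s * s)
    lemma₃ = solve-∀
    lemma₅ : ∀ c s → c * s * (s * s * s) ≡ c * (s * (s * (s * (s * 1))))
    lemma₅ = solve-∀

-- This amounts to 16 r³ ≤ (r - 1)⁴. At r = 23 it is the numerical inequality 16 · 23³ ≤ 22⁴, and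
-- r/(r - 1) ≤ 23/22 carries it upwards.
weight-large : ∀ r → 23 ≤ r → weightᵃ r ≤ weightᵇ r
weight-large (suc s) (s≤s 22≤s) = ≤-trans (≤-reflexive (lemma₁ (suc s)))
  (*-monoʳ-≤ (suc s) (cube-≤-fourth 22 23 16 (suc s) s z<s (≤-trans (≤-reflexive (*-suc 22 s)) (+-monoˡ-≤ (22 * s) 22≤s)) (≤ᵇ⇒≤ 194672 234256 tt) 22≤s))
  where
    lemma₁ : ∀ r → 2 * r * (2 * r * (2 * r * (2 * r * 1))) ≡ r * (16 * (r * r * r))
    lemma₁ = solve-∀

-- C₄ bounds the product of (2r)⁴ / (r (r-1)⁴) over the primes r < 23; for larger r the quotient is at most 1.
abstract
  C₄ : ℕ
  C₄ = 517576

  C₄≡ : C₄ ≡ 517576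
  C₄≡ = refl

  ∏-tiny : ∏ᵃ tinyPrimes ≤ C₄ * ∏ᵇ tinyPrimes
  ∏-tiny = ≤ᵇ⇒≤ (∏ᵃ tinyPrimes) (C₄ * ∏ᵇ tinyPrimes) tt

  ∏ᵇ-tiny>0 : 0 < ∏ᵇ tinyPrimes
  ∏ᵇ-tiny>0 = <ᵇ⇒< 0 (∏ᵇ tinyPrimes) tt

  tiny-weights : All (λ r → weightᵇ r ≤ weightᵃ r) tinyPrimes
  tiny-weights = toWitness {a? = All.all? (λ r → weightᵇ r ≤? weightᵃ r) tinyPrimes} tt

∏-bound : ∀ M R → All (23 ≤_) R → ∏ᵃ (filter (_∣? M) tinyPrimes ++ R) ≤ C₄ * ∏ᵇ (filter (_∣? M) tinyPrimes ++ R)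
∏-bound M R hs = begin
  ∏ᵃ (F ++ R) ≡⟨ ∏-++ weightᵃ F R ⟩
  ∏ᵃ F * ∏ᵃ R ≤⟨ *-mono-≤ tiny (large R hs) ⟩
  C₄ * ∏ᵇ F * ∏ᵇ R ≡⟨ *-assoc C₄ (∏ᵇ F) (∏ᵇ R) ⟩
  C₄ * (∏ᵇ F * ∏ᵇ R) ≡⟨ cong (C₄ *_) (sym (∏-++ weightᵇ F R)) ⟩
  C₄ * ∏ᵇ (F ++ R) ∎
  where
    open ≤-Reasoning
    F = filter (_∣? M) tinyPrimes
    ∏-++ : ∀ f xs ys → product (map f (xs ++ ys)) ≡ product (map f xs) * product (map f ys)
    ∏-++ f xs ys = trans (cong product (Listₚ.map-++ f xs ys)) (product-++ (map f xs) (map f ys))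
    large : ∀ R → All (23 ≤_) R → ∏ᵃ R ≤ ∏ᵇ R
    large [] [] = ≤-refl
    large (r ∷ R) (h ∷ hs) = *-mono-≤ (weight-large r h) (large R hs)
    swap : ∀ c a b → c * a * b ≡ c * b * a
    swap = solve-∀
    from-full : ∀ X Y Z V → 0 < V → X * V ≤ Y * Z → Y ≤ C₄ * V → X ≤ C₄ * Z
    from-full X Y Z V 0<V h₁ h₂ = *-cancelʳ-≤ X (C₄ * Z) V {{>-nonZero 0<V}}
      (≤-trans h₁ (≤-trans (*-monoˡ-≤ Z h₂) (≤-reflexive (swap C₄ V Z))))
    tiny : ∏ᵃ F ≤ C₄ * ∏ᵇ F
    tiny = from-full (∏ᵃ F) (∏ᵃ tinyPrimes) (∏ᵇ F) (∏ᵇ tinyPrimes) ∏ᵇ-tiny>0 (∏-filter (_∣? M) tinyPrimes tiny-weights) ∏-tiny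

^4-cancel-< : ∀ a b → a ^ 4 < b ^ 4 → a < b
^4-cancel-< a b h = ≰⇒> λ b≤a → <⇒≱ h (^-monoˡ-≤ 4 b≤a)

-- Q need not be a square. The upper bound makes rounding cost at most a factor 2 in s², hence 4 in
-- s⁴.
ceil-sqrt : ∀ Q → 0 < Q → ∃ λ s → Q ≤ s * s × s * s ≤ 2 * Q
ceil-sqrt (suc zero) _ = 1 , ≤-refl , s≤s z≤n
ceil-sqrt (suc Q@(suc _)) _ with ceil-sqrt Q z<s
... | s , lo , hi with suc Q ≤? s * s
...   | yes h = s , h , ≤-trans hi (*-monoʳ-≤ 2 (n≤1+n Q))
...   | no h = suc s , subst (λ z → suc z ≤ suc s * suc s) s²≡ (lemma₁ s) , subst (λ z → suc s * suc s ≤ 2 * suc z) s²≡ (lemma₂ s)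
  where
    s²≡ : s * s ≡ Q
    s²≡ = ≤-antisym (≤-pred (≰⇒> h)) lo
    lemma₁ : ∀ s → suc (s * s) ≤ suc s * suc s
    lemma₁ s = ≤-trans (m≤m+n (suc (s * s)) (2 * s)) (≤-reflexive (eq s))
      where
        eq : ∀ s → suc (s * s) + 2 * s ≡ suc s * suc s
        eq = solve-∀
    lemma₂ : ∀ s → suc s * suc s ≤ 2 * suc (s * s)
    lemma₂ zero = s≤s z≤n
    lemma₂ (suc t) = ≤-trans (m≤m+n _ (t * t)) (≤-reflexive (eq t))
      where
        eq : ∀ t → suc (suc t) * suc (suc t) + t * t ≡ 2 * suc (suc t * suc t)
        eq = solve-∀

-- Size estimates and growth of the threshold

2extraCount : ∀ q n k → 2 * extraCount q n (suc k) ≤ n * k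
2extraCount q n zero = z≤n
2extraCount q n (suc k) = begin
  2 * (c (suc (suc k) ∣? n) + extraCount q n (suc k)) ≡⟨ *-distribˡ-+ 2 (c (suc (suc k) ∣? n)) _ ⟩
  2 * c (suc (suc k) ∣? n) + 2 * extraCount q n (suc k) ≤⟨ +-mono-≤ (le (suc (suc k) ∣? n)) (2extraCount q n k) ⟩
  n + n * k ≡⟨ sym (*-suc n k) ⟩
  n * suc k ∎
  where
    open ≤-Reasoning
    c : Dec (suc (suc k) ∣ n) → ℕ
    c d = if ⌊ d ⌋ then n / suc (suc k) else 0
    le : ∀ d → 2 * c d ≤ n
    le (no _) = z≤n
    le (yes _) = ≤-trans (≤-trans (≤-reflexive (*-comm 2 (n / suc (suc k)))) (*-monoʳ-≤ (n / suc (suc k)) (s≤s (s≤s z≤n)))) (m/n*n≤m n (suc (suc k)))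

-- A telescoping sum with p = q - 1: as n / l ≤ n / 2, level l adds at most n (q - 1) q^(n-l), which
-- is n q^(n-l+1) - n q^(n-l).
2extraSize : ∀ p n k → suc k ≤ n → 2 * (p * extraSize (suc p) n (suc k)) + n * suc p ^ (n ∸ suc k) ≤ n * suc p ^ (n ∸ 1)
2extraSize p n zero _ = ≤-reflexive (cong (λ z → 2 * z + n * suc p ^ (n ∸ 1)) (*-zeroʳ p))
2extraSize p n (suc k) h = begin
  2 * (p * (c d + E)) + n * X ≡⟨ lemma₁ p (c d) E (n * X) ⟩
  p * (2 * c d) + n * X + 2 * (p * E) ≤⟨ +-monoˡ-≤ (2 * (p * E)) (+-monoˡ-≤ (n * X) (*-monoʳ-≤ p (le d))) ⟩
  p * (n * X) + n * X + 2 * (p * E) ≡⟨ lemma₂ p n X E ⟩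
  2 * (p * E) + n * (suc p * X) ≡⟨ cong (λ z → 2 * (p * E) + n * z) X≡ ⟩
  2 * (p * E) + n * suc p ^ (n ∸ suc k) ≤⟨ 2extraSize p n k (<⇒≤ h) ⟩
  n * suc p ^ (n ∸ 1) ∎
  where
    open ≤-Reasoning
    d = suc (suc k) ∣? n
    X = suc p ^ (n ∸ suc (suc k))
    E = extraSize (suc p) n (suc k)
    c : Dec (suc (suc k) ∣ n) → ℕ
    c d = if ⌊ d ⌋ then n / suc (suc k) * X else 0
    le : ∀ d → 2 * c d ≤ n * X
    le (no _) = z≤n
    le (yes _) = ≤-trans (≤-reflexive (sym (*-assoc 2 (n / suc (suc k)) X))) (*-monoˡ-≤ X (≤-trans (≤-trans (≤-reflexive (*-comm 2 (n / suc (suc k)))) (*-monoʳ-≤ (n / suc (suc k)) (s≤s (s≤s z≤n)))) (m/n*n≤m n (suc (suc k)))))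
    X≡ : suc p * X ≡ suc p ^ (n ∸ suc k)
    X≡ = cong (suc p ^_) (trans (sym (+-∸-assoc 1 h)) refl)
    lemma₁ : ∀ p c e y → 2 * (p * (c + e)) + y ≡ p * (2 * c) + y + 2 * (p * e)
    lemma₁ = solve-∀
    lemma₂ : ∀ p n x e → p * (n * x) + n * x + 2 * (p * e) ≡ 2 * (p * e) + n * (suc p * x)
    lemma₂ = solve-∀

InRange : ℕ → ℕ → Set
InRange q n = (¬ (2 ∣ n) × n ^ 3 < q ^ 4) ⊎ (2 ∣ n × ¬ ((q ∸ 1) ∣ n) × n ^ 4 < q ^ 5)

cube-double : ∀ N → 4 ≤ N → suc N * suc N * suc N ≤ 2 * (N * N * N)
cube-double N 4≤N = begin
  suc N * suc N * suc N ≡⟨ lemma₁ N ⟩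
  N * N * N + (3 * (N * N) + (3 * N + 1)) ≤⟨ +-monoʳ-≤ (N * N * N) (begin
    3 * (N * N) + (3 * N + 1) ≤⟨ +-monoʳ-≤ (3 * (N * N)) (begin
      3 * N + 1 ≤⟨ +-monoʳ-≤ (3 * N) (≤-trans (s≤s z≤n) 4≤N) ⟩
      3 * N + N ≡⟨ lemma₂ N ⟩
      4 * N ≤⟨ *-monoˡ-≤ N 4≤N ⟩
      N * N ∎) ⟩
    3 * (N * N) + N * N ≡⟨ lemma₂ (N * N) ⟩
    4 * (N * N) ≤⟨ *-monoˡ-≤ (N * N) 4≤N ⟩
    N * (N * N) ≡⟨ sym (*-assoc N N N) ⟩
    N * N * N ∎) ⟩
  N * N * N + N * N * N ≡⟨ lemma₃ (N * N * N) ⟩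
  2 * (N * N * N) ∎
  where
    open ≤-Reasoning
    lemma₁ : ∀ N → suc N * suc N * suc N ≡ N * N * N + (3 * (N * N) + (3 * N + 1))
    lemma₁ = solve-∀
    lemma₂ : ∀ N → 3 * N + N ≡ 4 * N
    lemma₂ = solve-∀
    lemma₃ : ∀ N → N + N ≡ 2 * N
    lemma₃ = solve-∀

-- If q (q + 3) were below 5 n, its cube or fourth power would contradict the hypothesis on n,
-- because (q + 3)³ ≥ 125 q from q = 7 on.
linear-in-square : ∀ q n → 7 ≤ q → n ^ 3 < q ^ 4 ⊎ n ^ 4 < q ^ 5 → 5 * n ≤ q * (q + 3)
linear-in-square q n 7≤q h = ≮⇒≥ λ lt → cases h (<⇒≤ lt)
  where
    open ≤-Reasoning
    cube : 125 * q ≤ (q + 3) * (q + 3) * (q + 3)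
    cube with m≤n⇒∃[o]m+o≡n 7≤q
    ... | k , refl = ≤-trans (m≤m+n _ _) (≤-reflexive (lemma k))
      where
        lemma : ∀ k → 125 * (7 + k) + (125 + 175 * k + 30 * (k * k) + k * k * k) ≡ (7 + k + 3) * (7 + k + 3) * (7 + k + 3)
        lemma = solve-∀
    instance
      q-nz : NonZero q
      q-nz = >-nonZero (≤-trans (s≤s z≤n) 7≤q)
    cases : n ^ 3 < q ^ 4 ⊎ n ^ 4 < q ^ 5 → q * (q + 3) ≤ 5 * n → ⊥
    cases (inj₁ h) le = <-irrefl refl (begin-strict
      125 * (q * (q * (q * (q * 1)))) ≡⟨ lemma₁ 125 q ⟩
      q * q * q * (125 * q) ≤⟨ *-monoʳ-≤ (q * q * q) cube ⟩
      q * q * q * ((q + 3) * (q + 3) * (q + 3)) ≡⟨ lemma₂ q (q + 3) ⟩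
      q * (q + 3) * (q * (q + 3)) * (q * (q + 3)) ≤⟨ *-mono-≤ (*-mono-≤ le le) le ⟩
      5 * n * (5 * n) * (5 * n) ≡⟨ lemma₃ n ⟩
      125 * (n * (n * (n * 1))) <⟨ *-monoʳ-< 125 h ⟩
      125 * (q * (q * (q * (q * 1)))) ∎)
      where
        lemma₁ : ∀ c q → c * (q * (q * (q * (q * 1)))) ≡ q * q * q * (c * q)
        lemma₁ = solve-∀
        lemma₂ : ∀ q r → q * q * q * (r * r * r) ≡ q * r * (q * r) * (q * r)
        lemma₂ = solve-∀
        lemma₃ : ∀ n → 5 * n * (5 * n) * (5 * n) ≡ 125 * (n * (n * (n * 1)))
        lemma₃ = solve-∀
    cases (inj₂ h) le = <-irrefl refl (begin-strict
      5 * (125 * (q * (q * (q * (q * (q * 1)))))) ≡⟨ lemma₁ 125 q ⟩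
      q * q * q * q * (125 * q * 5) ≤⟨ *-monoʳ-≤ (q * q * q * q) (*-mono-≤ cube (≤-trans (s≤s (s≤s (s≤s (s≤s (s≤s z≤n))))) (≤-trans 7≤q (m≤m+n q 3)))) ⟩
      q * q * q * q * ((q + 3) * (q + 3) * (q + 3) * (q + 3)) ≡⟨ lemma₂ q (q + 3) ⟩
      q * (q + 3) * (q * (q + 3)) * (q * (q + 3)) * (q * (q + 3)) ≤⟨ *-mono-≤ (*-mono-≤ (*-mono-≤ le le) le) le ⟩
      5 * n * (5 * n) * (5 * n) * (5 * n) ≡⟨ lemma₃ n ⟩
      5 * (125 * (n * (n * (n * (n * 1))))) <⟨ *-monoʳ-< 5 (*-monoʳ-< 125 h) ⟩
      5 * (125 * (q * (q * (q * (q * (q * 1)))))) ∎)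
      where
        lemma₁ : ∀ c q → 5 * (c * (q * (q * (q * (q * (q * 1)))))) ≡ q * q * q * q * (c * q * 5)
        lemma₁ = solve-∀
        lemma₂ : ∀ q r → q * q * q * q * (r * r * r * r) ≡ q * r * (q * r) * (q * r) * (q * r)
        lemma₂ = solve-∀
        lemma₃ : ∀ n → 5 * n * (5 * n) * (5 * n) * (5 * n) ≡ 5 * (125 * (n * (n * (n * (n * 1)))))
        lemma₃ = solve-∀

-- The factor 16 is 4 · 4, lost in rounding √Q and in replacing Q³ q by N³ (q - 1). The base of the
-- fourth power bounds 4 times the number of bad subgroups, 4 being the reciprocal of the share of K
-- that they leave.
threshold : ℕ → ℕ
threshold n = 16 * C₄ * (2 * (n * n + n)) ^ 4

-- From n to n + 1 the base grows by at most 3/2, and (3/2)⁴ = 81/16 < 7. So the threshold stays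
-- below 7^(n+1) once it has fallen below it.
threshold-step : ∀ n → 4 ≤ n → threshold (suc n) ≤ 7 * threshold n
threshold-step n 4≤n = begin
  16 * C₄ * (2 * a′) ^ 4 ≤⟨ *-monoʳ-≤ (16 * C₄) (begin
    (2 * a′) ^ 4 ≤⟨ ^-monoˡ-≤ 4 2a′≤3a ⟩
    (3 * a) ^ 4 ≡⟨ pow-*₄ 3 a ⟩
    81 * a ^ 4 ≤⟨ *-monoˡ-≤ (a ^ 4) (≤ᵇ⇒≤ 81 112 tt) ⟩
    112 * a ^ 4 ≡⟨ *-assoc 7 16 (a ^ 4) ⟩
    7 * (16 * a ^ 4) ≡⟨ cong (7 *_) (sym (pow-*₄ 2 a)) ⟩
    7 * (2 * a) ^ 4 ∎) ⟩
  16 * C₄ * (7 * (2 * a) ^ 4) ≡⟨ lemma₁ (16 * C₄) ((2 * a) ^ 4) ⟩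
  7 * (16 * C₄ * (2 * a) ^ 4) ∎
  where
    open ≤-Reasoning
    a = n * n + n
    a′ = suc n * suc n + suc n
    lemma₁ : ∀ c x → c * (7 * x) ≡ 7 * (c * x)
    lemma₁ = solve-∀
    lemma₂ : ∀ n → 2 * (suc n * suc n + suc n) ≡ suc n * (2 * n + 4)
    lemma₂ = solve-∀
    lemma₃ : ∀ n → suc n * (2 * n + n) ≡ 3 * (n * n + n)
    lemma₃ = solve-∀
    2a′≤3a : 2 * a′ ≤ 3 * a
    2a′≤3a = ≤-trans (≤-reflexive (lemma₂ n)) (≤-trans (*-monoʳ-≤ (suc n) (+-monoʳ-≤ (2 * n) 4≤n)) (≤-reflexive (lemma₃ n)))

exponential-growth : ∀ (f : ℕ → ℕ) b m → 0 < b → f m < b ^ suc m → (∀ n → m ≤ n → f (suc n) ≤ b * f n) → ∀ k → f (k + m) < b ^ suc (k + m)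
exponential-growth f b m 0<b base step zero = base
exponential-growth f b m 0<b base step (suc k) = ≤-<-trans (step (k + m) (m≤n+m m k)) (*-monoʳ-< b {{>-nonZero 0<b}} (exponential-growth f b m 0<b base step k))

threshold-large : ∀ n → 22 ≤ n → threshold n < 7 ^ suc n
threshold-large n 22≤n = subst (λ k → threshold k < 7 ^ suc k) (m∸n+n≡m 22≤n)
  (exponential-growth threshold 7 22 z<s base (λ n h → threshold-step n (≤-trans (≤ᵇ⇒≤ 4 22 tt) h)) (n ∸ 22))
  where
    base : threshold 22 < 7 ^ 23
    base = subst (λ c → 16 * c * (2 * (22 * 22 + 22)) ^ 4 < 7 ^ 23) (sym C₄≡) (<ᵇ⇒< (16 * 517576 * (2 * (22 * 22 + 22)) ^ 4) (7 ^ 23) tt)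

-- The inequality `n + 2 ≤ searchBound n` is included because it makes q - 1 larger than n for every
-- q beyond the bound, so that q - 1 cannot divide n.
bound-table : ∀ n → 3 ≤ n → n < 22 → (n + 2 ≤ searchBound n × 7 ≤ searchBound n) × threshold n < searchBound n ^ suc n
bound-table n 3≤n n<22 = (≤ᵇ⇒≤ (n + 2) (searchBound n) (T-∧₁ t₁) , ≤ᵇ⇒≤ 7 (searchBound n) (T-∧₁ {b = w} (T-∧₂ {n + 2 ≤ᵇ searchBound n} t₁))) ,
    subst (λ c → 16 * c * (2 * (n * n + n)) ^ 4 < searchBound n ^ suc n) (sym C₄≡) (<ᵇ⇒< _ _ (T-∧₂ {7 ≤ᵇ searchBound n} (T-∧₂ {n + 2 ≤ᵇ searchBound n} t₁)))
  where
    w : Bool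
    w = 16 * 517576 * (2 * (n * n + n)) ^ 4 <ᵇ searchBound n ^ suc n
    entry : ℕ → Bool
    entry n = (n <ᵇ 3) ∨ ((n + 2 ≤ᵇ searchBound n) ∧ ((7 ≤ᵇ searchBound n) ∧ (16 * 517576 * (2 * (n * n + n)) ^ 4 <ᵇ searchBound n ^ suc n)))
    drop : ∀ {a b} → ¬ T a → T (a ∨ b) → T b
    drop {true} h _ = ⊥-elim (h tt)
    drop {false} _ t = t
    t₁ : T ((n + 2 ≤ᵇ searchBound n) ∧ ((7 ≤ᵇ searchBound n) ∧ w))
    t₁ = drop {n <ᵇ 3} (λ t → <⇒≱ (<ᵇ⇒< n 3 t) 3≤n) (allBelow-sound 22 entry tt n n<22)

half-gcd : ∀ n p → 0 < p → ¬ (p ∣ n) → 2 * gcd n p ≤ p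
half-gcd n p 0<p p∤n with gcd[m,n]∣n n p
... | divides zero e = contradiction (sym e) (<⇒≢ 0<p)
... | divides 1 e = contradiction (subst (_∣ n) (trans (sym (*-identityˡ _)) (sym e)) (gcd[m,n]∣m n p)) p∤n
... | divides (suc (suc c)) e = ≤-trans (m≤m+n (2 * gcd n p) (c * gcd n p)) (≤-reflexive (trans (sym (*-distribʳ-+ (gcd n p) 2 c)) (sym e)))

-- Bernoulli's inequality (1 - 1/q)^k ≥ 1 - k/q for q = p + 1, cleared of denominators.
bernoulli : ∀ p k → suc p ^ k * suc p ≤ suc p * p ^ k + k * suc p ^ k
bernoulli p zero = ≤-reflexive (lemma p)
  where
    lemma : ∀ p → 1 * suc p ≡ suc p * 1 + 0
    lemma = solve-∀
bernoulli p (suc k) = begin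
  suc p * X * suc p ≡⟨ lemma₁ p X ⟩
  p * (X * suc p) + suc p * X ≤⟨ +-monoˡ-≤ (suc p * X) (*-monoʳ-≤ p (bernoulli p k)) ⟩
  p * (suc p * Y + k * X) + suc p * X ≡⟨ lemma₂ p Y k X ⟩
  suc p * (p * Y) + (k * (p * X) + suc p * X) ≤⟨ +-monoʳ-≤ (suc p * (p * Y)) (+-monoˡ-≤ (suc p * X) (*-monoʳ-≤ k (*-monoˡ-≤ X (n≤1+n p)))) ⟩
  suc p * (p * Y) + (k * (suc p * X) + suc p * X) ≡⟨ cong (suc p * (p * Y) +_) (+-comm (k * (suc p * X)) _) ⟩
  suc p * (p * Y) + suc k * (suc p * X) ∎
  where
    open ≤-Reasoning
    X = suc p ^ k
    Y = p ^ k
    lemma₁ : ∀ p x → suc p * x * suc p ≡ p * (x * suc p) + suc p * x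
    lemma₁ = solve-∀
    lemma₂ : ∀ p y k x → p * (suc p * y + k * x) + suc p * x ≡ suc p * (p * y) + (k * (p * x) + suc p * x)
    lemma₂ = solve-∀

half-power : ∀ p k → 2 * k ≤ suc p → suc p ^ k ≤ 2 * p ^ k
half-power p k h = *-cancelʳ-≤ X (2 * Y) (suc p) (+-cancelʳ-≤ (X * suc p) _ _ (begin
  X * suc p + X * suc p ≤⟨ +-mono-≤ (bernoulli p k) (bernoulli p k) ⟩
  (suc p * Y + k * X) + (suc p * Y + k * X) ≡⟨ lemma p Y k X ⟩
  2 * Y * suc p + 2 * k * X ≤⟨ +-monoʳ-≤ (2 * Y * suc p) (≤-trans (*-monoˡ-≤ X h) (≤-reflexive (*-comm (suc p) X))) ⟩
  2 * Y * suc p + X * suc p ∎))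
  where
    open ≤-Reasoning
    X = suc p ^ k
    Y = p ^ k
    lemma : ∀ p y k x → (suc p * y + k * x) + (suc p * y + k * x) ≡ 2 * y * suc p + 2 * k * x
    lemma = solve-∀

-- A substitute for (1 - 1/q)^(q-1) > 1/e: each half of the exponent is at most q/2, so by Bernoulli
-- its power keeps at least one half.
quarter-power : ∀ p k → k ≤ p → suc p ^ k ≤ 4 * p ^ k
quarter-power p k k≤p = begin
  suc p ^ k ≡⟨ cong (suc p ^_) (sym (⌊n/2⌋+⌈n/2⌉≡n k)) ⟩
  suc p ^ (a + b) ≡⟨ ^-distribˡ-+-* (suc p) a b ⟩
  suc p ^ a * suc p ^ b ≤⟨ *-mono-≤ (half-power p a (≤-trans (*-monoʳ-≤ 2 (⌊n/2⌋≤⌈n/2⌉ k)) 2b≤)) (half-power p b 2b≤) ⟩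
  2 * p ^ a * (2 * p ^ b) ≡⟨ lemma (p ^ a) (p ^ b) ⟩
  4 * (p ^ a * p ^ b) ≡⟨ cong (4 *_) (trans (sym (^-distribˡ-+-* p a b)) (cong (p ^_) (⌊n/2⌋+⌈n/2⌉≡n k))) ⟩
  4 * p ^ k ∎
  where
    open ≤-Reasoning
    a = ⌊ k /2⌋
    b = ⌈ k /2⌉
    lemma : ∀ a b → 2 * a * (2 * b) ≡ 4 * (a * b)
    lemma = solve-∀
    2b≤ : 2 * b ≤ suc p
    2b≤ = ≤-trans (≤-trans (+-monoʳ-≤ b (≤-trans (≤-reflexive (+-identityʳ b)) (⌈n/2⌉-mono (n≤1+n k)))) (≤-reflexive (⌊n/2⌋+⌈n/2⌉≡n (suc k)))) (s≤s k≤p)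

-- Parity and prime powers

odd-form : ∀ n → ¬ (2 ∣ n) → ∃ λ k → n ≡ suc (k * 2)
odd-form n h = n / 2 , trans (m≡m%n+[m/n]*n n 2) (cong (_+ n / 2 * 2) (one (n % 2) refl (m%n<n n 2)))
  where
    one : ∀ r → n % 2 ≡ r → r < 2 → r ≡ 1
    one zero e _ = contradiction (m%n≡0⇒n∣m n 2 e) h
    one (suc zero) _ _ = refl
    one (suc (suc r)) _ (s≤s (s≤s ()))

prime-∣-^ : ∀ {r} p e → Prime r → r ∣ p ^ e → r ∣ p
prime-∣-^ p zero pr d = contradiction (∣1⇒≡1 d) (<⇒≢ (prime>1 pr) ∘ sym)
prime-∣-^ p (suc e) pr d with euclidsLemma p (p ^ e) pr d
... | inj₁ h = h
... | inj₂ h = prime-∣-^ p e pr h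

prime-∣-prime : ∀ {r p} → Prime r → Prime p → r ∣ p → r ≡ p
prime-∣-prime pr pp d with prime⇒irreducible pp d
... | inj₁ refl = contradiction (prime>1 pr) (<-irrefl refl)
... | inj₂ e = e

-- Computing with coefficient vectors

-- Correctness is not proved; wherever the digits serve as an exponent, the tests compare their
-- `value` with the intended number.
binary : ℕ → ℕ → List Bool
binary zero k = []
binary (suc fuel) k = (k % 2 ≡ᵇ 1) ∷ binary fuel (k / 2)

value : List Bool → ℕ
value [] = 0
value (b ∷ bs) = ι b + 2 * value bs

-- Z/p[θ] with θ^d = Σ relᵢ θⁱ, elements being coefficient vectors.
module Coordinates (p : ℕ) {{_ : NonZero p}} {d-1 : ℕ} (rel : Vec ℕ (suc d-1)) where
  Coords : Set
  Coords = Vec ℕ (suc d-1)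

  addV : ∀ {k} → Vec ℕ k → Vec ℕ k → Vec ℕ k
  addV = Vec.zipWith (λ a b → (a + b) % p)

  scaleV : ∀ {k} → ℕ → Vec ℕ k → Vec ℕ k
  scaleV c = Vec.map (λ a → (c * a) % p)

  -- Multiplication by θ before reduction: the first argument enters as constant term, and the
  -- coefficient of θ^k that falls out is returned for `reduceV` to fold back.
  push : ∀ {k} → ℕ → Vec ℕ k → Vec ℕ k × ℕ
  push a [] = [] , a
  push a (b ∷ v) = let w , o = push b v in a ∷ w , o

  reduceV : Coords × ℕ → Coords
  reduceV (w , o) = addV w (scaleV o rel)

  constV : ℕ → Coords
  constV c = c ∷ Vec.replicate d-1 0

  mulV : ∀ {k} → Vec ℕ k → Coords → Coords
  mulV [] w = constV 0
  mulV (a ∷ v) w = addV (scaleV a w) (reduceV (push 0 (mulV v w)))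

  stepV : Bool → Coords → Coords → Coords
  stepV true v s = mulV v (mulV s s)
  stepV false v s = mulV s s

  powV : List Bool → Coords → Coords
  powV [] v = constV 1
  powV (b ∷ bs) v = stepV b v (powV bs v)

  equalV : Coords → Coords → Bool
  equalV v w = ⌊ Vecₚ.≡-dec _≟_ v w ⌋

  orbitV : ℕ → List Bool → Coords → List Coords
  orbitV zero bs v = []
  orbitV (suc k) bs v = v ∷ orbitV k bs (powV bs v)

  dotV : ℕ → List Coords → List Coords → Coords
  dotV (suc m) (v ∷ vs) (w ∷ ws) = addV (mulV v w) (dotV m vs ws)
  dotV _ _ _ = constV 0

  -- Checks that the conjugates of y form the trace-dual basis to those of x: Σⱼ σ^(i+j)(x)
  -- σ^(k+j)(y) is 1 for i = k and 0 otherwise. The orbits are listed twice over, so that m entries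
  -- remain after dropping i or k of them.
  dualTest : ℕ → List Coords → List Coords → Bool
  dualTest m xs ys = allBelow m λ k → allBelow m λ i →
    equalV (dotV m (Data.List.drop i xs) (Data.List.drop k ys)) (constV (if k ≡ᵇ i then 1 else 0))

  levelTest : ℕ → ℕ → ℕ → List Bool → Coords → Coords → Bool
  levelTest q l m bs x y = (value bs ≡ᵇ q ^ l) ∧ dualTest m (orbitV (m + m) bs x) (orbitV (m + m) bs y)

  normalTest : ℕ → ℕ → Coords → (ℕ → Coords) → Bool
  normalTest q n x y = allBelow (suc n) λ { zero → true ; l@(suc _) → not ⌊ l ∣? n ⌋ ∨ levelTest q l (n / l) (binary 20 (q ^ l)) x (y l) }

  -- The vector u is a claimed inverse of x^(N/r) - 1, with p - 1 in the place of -1. Comparing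
  -- coordinates would not do: distinct vectors might have the same value in the field, whereas an
  -- inverse certifies that the value is not 0.
  orderTest : ℕ → Coords → List (ℕ × Coords) → Bool
  orderTest N x [] = true
  orderTest N x ((r , u) ∷ rs) =
    ((value (binary 20 (N ÷ r)) ≡ᵇ N ÷ r) ∧ equalV (mulV (addV (powV (binary 20 (N ÷ r)) x) (constV (p ∸ 1))) u) (constV 1)) ∧ orderTest N x rs

-- Soundness of the search over small pairs

T-≡ᵇ : ∀ {m n} → T (m ≡ᵇ n) → m ≡ n
T-≡ᵇ {m} {n} = ≡ᵇ⇒≡ m n

notPrimePower-sound : ∀ q → q < 2 ^ 11 → T (notPrimePower q) → ¬ IsPrimePower q
notPrimePower-sound q q<2¹¹ t (p , k , p-prime , _ , q≡) = use (find (any-sound (λ a → ⌊ a ∣? q ⌋ ∧ not ⌊ q ∣? a ^ 11 ⌋) L t))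
  where
    L = 2 ∷ 3 ∷ 5 ∷ 7 ∷ 11 ∷ 13 ∷ 17 ∷ 19 ∷ 23 ∷ 29 ∷ 31 ∷ 37 ∷ []
    L-prime : All Prime L
    L-prime = toWitness {a? = All.all? prime? L} tt
    use : (∃ λ a → a ∈ L × T (⌊ a ∣? q ⌋ ∧ not ⌊ q ∣? a ^ 11 ⌋)) → ⊥
    use (a , a∈ , h) = T-not (T-∧₂ {⌊ a ∣? q ⌋} h) (fromWitness (subst (_∣ a ^ 11) (sym (trans q≡ (cong (_^ k) (sym a≡p))))
        (divides (a ^ (11 ∸ k)) (trans (cong (a ^_) (sym (m∸n+n≡m k≤11))) (^-distribˡ-+-* a (11 ∸ k) k)))))
      where
        a-prime : Prime a
        a-prime = All.lookup L-prime a∈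
        a≡p : a ≡ p
        a≡p = prime-∣-prime a-prime p-prime (prime-∣-^ p k a-prime (subst (a ∣_) q≡ (toWitness {a? = a ∣? q} (T-∧₁ h))))
        k≤11 : k ≤ 11
        k≤11 = ≮⇒≥ λ 11<k → <⇒≱ q<2¹¹ (≤-trans (≤-trans (^-monoʳ-≤ 2 (<⇒≤ 11<k)) (^-monoˡ-≤ k (prime>1 p-prime))) (≤-reflexive (sym q≡)))

outOfRange-sound : ∀ q n → T (outOfRange q n) → ¬ InRange q n
outOfRange-sound q n t range with 2 ∣? n
outOfRange-sound q n t (inj₁ (odd , _)) | yes even = odd even
outOfRange-sound q n t (inj₂ (_ , q-1∤n , lt)) | yes _ with T-∨ {⌊ (q ∸ 1) ∣? n ⌋} t
... | inj₁ h = q-1∤n (toWitness h)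
... | inj₂ h = <⇒≱ lt (≤ᵇ⇒≤ (q ^ 5) (n ^ 4) h)
outOfRange-sound q n t (inj₁ (_ , lt)) | no _ = <⇒≱ lt (≤ᵇ⇒≤ (q ^ 4) (n ^ 3) t)
outOfRange-sound q n t (inj₂ (even , _)) | no odd = odd even

power-of-two-≥32 : ∀ q → IsPrimePower q → 2 ∣ q → 23 ≤ q → 32 ≤ q
power-of-two-≥32 q (p , k , p-prime , _ , q≡) 2∣q 23≤q = subst (32 ≤_) (sym q≡2^k) (^-monoʳ-≤ 2 {5} {k} 5≤k)
  where
    q≡2^k : q ≡ 2 ^ k
    q≡2^k = trans q≡ (cong (_^ k) (sym (prime-∣-prime prime[2] p-prime (prime-∣-^ p k prime[2] (subst (2 ∣_) q≡ 2∣q)))))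
    5≤k : 5 ≤ k
    5≤k = ≰⇒> λ k≤4 → <⇒≱ (≤-trans (≤ᵇ⇒≤ 17 23 tt) 23≤q) (≤-trans (≤-reflexive q≡2^k) (^-monoʳ-≤ 2 {k} {4} k≤4))

check-sound : ∀ q n → 3 ≤ n → n < 22 → q < searchBound n → T (notPrimePower q) ⊎ T (outOfRange q n) ⊎ T (exceptional q n) ⊎ T (sieveTest q n)
check-sound q n 3≤n n<22 q<b = open-up (allBelow-sound (searchBound n) (checked n)
    (row (T-∨ {n <ᵇ 3} (allBelow-sound 22 (λ n → (n <ᵇ 3) ∨ allBelow (searchBound n) (checked n)) checks n n<22))) q q<b)
  where
    row : T (n <ᵇ 3) ⊎ T (allBelow (searchBound n) (checked n)) → T (allBelow (searchBound n) (checked n))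
    row (inj₁ h) = contradiction 3≤n (<⇒≱ (<ᵇ⇒< n 3 h))
    row (inj₂ h) = h
    peel : ∀ a b c d → T (a ∨ (b ∨ (c ∨ d))) → T a ⊎ T b ⊎ T c ⊎ T d
    peel true _ _ _ _ = inj₁ tt
    peel false true _ _ _ = inj₂ (inj₁ tt)
    peel false false true _ _ = inj₂ (inj₂ (inj₁ tt))
    peel false false false d t = inj₂ (inj₂ (inj₂ t))
    open-up : T (checked n q) → T (notPrimePower q) ⊎ T (outOfRange q n) ⊎ T (exceptional q n) ⊎ T (sieveTest q n)
    open-up = peel (notPrimePower q) (outOfRange q n) (exceptional q n) (sieveTest q n)

-- Sums and counting over a finite field

module Field (K : FiniteField) where
  open FiniteField K public using (isCommutativeRing; 0≢1; inverse; enum; size)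
    renaming (Carrier to 𝕂; _+_ to infixl 6 _⊹_; _*_ to infixl 7 _·_; -_ to infix 8 ⊖_; 0# to 𝟘; 1# to 𝟙)
  open IntegerSolver isCommutativeRing public
  open 𝕊 public using (_:+_; _:*_; :-_; _:-_; _:=_; con) renaming (solve to solveR)

  private
    to : Fin size → 𝕂
    to = Inverse.to enum
    from : 𝕂 → Fin size
    from = Inverse.from enum
    to-from : ∀ x → to (from x) ≡ x
    to-from x = Inverse.inverseˡ enum refl
    from-to : ∀ i → from (to i) ≡ i
    from-to i = Inverse.inverseʳ enum refl

  infix 4 _≟ᴷ_
  _≟ᴷ_ : DecidableEquality 𝕂
  x ≟ᴷ y = map′ (λ e → trans (sym (to-from x)) (trans (cong to e) (to-from y))) (cong from) (from x Finₚ.≟ from y)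

  searchK : ∀ {P : 𝕂 → Set} {R : Set} → (∀ x → P x ⊎ R) → (∀ x → P x) ⊎ R
  searchK {P} f with searchFin size (λ i → f (to i))
  ... | inj₂ r = inj₂ r
  ... | inj₁ g = inj₁ λ x → subst P (to-from x) (g (from x))

  any? : ∀ {P : 𝕂 → Set} → (∀ x → Dec (P x)) → Dec (∃ P)
  any? {P} P? with searchK {λ x → ¬ P x} {∃ P} (λ x → help x (P? x))
    where
      help : ∀ x → Dec (P x) → (¬ P x) ⊎ ∃ P
      help x (yes p) = inj₂ (x , p)
      help x (no np) = inj₁ np
  ... | inj₁ none = no λ (x , p) → none x p
  ... | inj₂ w = yes w

  infixl 6 _⊝_
  _⊝_ : 𝕂 → 𝕂 → 𝕂
  x ⊝ y = x ⊹ ⊖ y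

  permutation : (φ ψ : 𝕂 → 𝕂) → (∀ x → φ (ψ x) ≡ x) → (∀ x → ψ (φ x) ≡ x) → Fin size ↔ Fin size
  permutation φ ψ φψ ψφ = mk↔ₛ′ (from ∘ φ ∘ to) (from ∘ ψ ∘ to)
    (λ i → trans (cong (from ∘ φ) (to-from _)) (trans (cong from (φψ _)) (from-to i)))
    (λ i → trans (cong (from ∘ ψ) (to-from _)) (trans (cong from (ψφ _)) (from-to i)))

  abstract
    -- Kept abstract: the arguments below rest on the laws listed here, and terms under `∑` do not
    -- unfold into sums over `Fin size`.
    ∑ : (𝕂 → ℕ) → ℕ
    ∑ f = Σℕ.sum (λ i → f (to i))

    ∑-elements : ∀ f → ∑ f ≡ sum (map f (Data.List.tabulate to))
    ∑-elements f = trans (sym (sum-tabulate size (f ∘ to))) (cong sum (sym (Listₚ.map-tabulate to f)))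

    ∑-cong : ∀ {f g} → (∀ x → f x ≡ g x) → ∑ f ≡ ∑ g
    ∑-cong h = Σℕ.sum-cong-≗ (λ i → h (to i))

    ∑-mono : ∀ {f g} → (∀ x → f x ≤ g x) → ∑ f ≤ ∑ g
    ∑-mono h = sum-mono _ _ _ (λ i → h (to i))

    ∑-+ : ∀ f g → ∑ (λ x → f x + g x) ≡ ∑ f + ∑ g
    ∑-+ f g = Σℕ.∑-distrib-+ (f ∘ to) (g ∘ to)

    ∑-*ˡ : ∀ c f → ∑ (λ x → c * f x) ≡ c * ∑ f
    ∑-*ˡ c f = sum-scale size c (f ∘ to)

    ∑-*ʳ : ∀ c f → ∑ (λ x → f x * c) ≡ ∑ f * c
    ∑-*ʳ c f = trans (∑-cong (λ x → *-comm (f x) c)) (trans (∑-*ˡ c f) (*-comm c (∑ f)))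

    ∑-const : ∀ c → ∑ (λ _ → c) ≡ size * c
    ∑-const c = sum-const size c

    ∑-swap : ∀ (f : 𝕂 → 𝕂 → ℕ) → ∑ (λ x → ∑ (λ y → f x y)) ≡ ∑ (λ y → ∑ (λ x → f x y))
    ∑-swap f = Σℕ.∑-comm (λ i j → f (to i) (to j))

    ∑-bij : ∀ f (φ ψ : 𝕂 → 𝕂) → (∀ x → φ (ψ x) ≡ x) → (∀ x → ψ (φ x) ≡ x) → ∑ f ≡ ∑ (f ∘ φ)
    ∑-bij f φ ψ φψ ψφ = trans (Σℕ.sum-permute (f ∘ to) (permutation φ ψ φψ ψφ)) (Σℕ.sum-cong-≗ {size} {λ i → f (to (from (φ (to i))))} {λ i → f (φ (to i))} (λ i → cong f (to-from (φ (to i)))))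

    ∑-point : ∀ f a → (∀ x → x ≢ a → f x ≡ 0) → ∑ f ≡ f a
    ∑-point f a h = trans (sum-point size (f ∘ to) (from a) (λ j j≢ → h (to j) (λ e → j≢ (trans (sym (from-to j)) (cong from e))))) (cong f (to-from a))

    ∑-witness : ∀ f → 0 < ∑ f → ∃ λ x → 0 < f x
    ∑-witness f h with sum-witness size (f ∘ to) h
    ... | i , p = to i , p

  δ : 𝕂 → 𝕂 → ℕ
  δ a x = ι ⌊ a ≟ᴷ x ⌋

  δ-refl : ∀ a → δ a a ≡ 1
  δ-refl a with a ≟ᴷ a
  ... | yes _ = refl
  ... | no ¬e = contradiction refl ¬e

  δ-≢ : ∀ {a x} → a ≢ x → δ a x ≡ 0
  δ-≢ {a} {x} a≢x with a ≟ᴷ x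
  ... | yes e = contradiction e a≢x
  ... | no _ = refl

  ∑-δ : ∀ a (f : 𝕂 → ℕ) → ∑ (λ x → δ a x * f x) ≡ f a
  ∑-δ a f = trans (∑-point _ a (λ x x≢a → cong (_* f x) (δ-≢ (x≢a ∘ sym)))) (trans (cong (_* f a) (δ-refl a)) (*-identityˡ _))

  ∑-δ₁ : ∀ a → ∑ (δ a) ≡ 1
  ∑-δ₁ a = trans (∑-cong (λ x → sym (*-identityʳ _))) (∑-δ a (λ _ → 1))

  ∑-translate : ∀ f c → ∑ f ≡ ∑ (λ x → f (x ⊹ c))
  ∑-translate f c = ∑-bij f (_⊹ c) (_⊝ c)
    (λ x → solveR 2 (λ x c → x :- c :+ c := x) refl x c)
    (λ x → solveR 2 (λ x c → x :+ c :- c := x) refl x c)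

  #_ : (𝕂 → Bool) → ℕ
  # A = ∑ (ι ∘ A)

  inv : ∀ {x} → x ≢ 𝟘 → 𝕂
  inv {x} x≢0 = proj₁ (inverse x x≢0)

  inv-r : ∀ {x} (h : x ≢ 𝟘) → x · inv h ≡ 𝟙
  inv-r {x} h = proj₂ (inverse x h)

  inv-cancel : ∀ {b} (h : b ≢ 𝟘) x → inv h · (b · x) ≡ x
  inv-cancel {b} h x = begin
    inv h · (b · x) ≡⟨ solveR 3 (λ i b x → i :* (b :* x) := (b :* i) :* x) refl (inv h) b x ⟩
    (b · inv h) · x ≡⟨ cong (_· x) (inv-r h) ⟩
    𝟙 · x ≡⟨ ·-idˡ x ⟩
    x ∎ where open ≡-Reasoning

  cancel-inv : ∀ {b} (h : b ≢ 𝟘) x → b · (inv h · x) ≡ x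
  cancel-inv {b} h x = trans (solveR 3 (λ i b x → b :* (i :* x) := i :* (b :* x)) refl (inv h) b x) (inv-cancel h x)

  no-zero-div : ∀ {x y} → x · y ≡ 𝟘 → x ≡ 𝟘 ⊎ y ≡ 𝟘
  no-zero-div {x} {y} e with x ≟ᴷ 𝟘
  ... | yes p = inj₁ p
  ... | no x≢0 = inj₂ (trans (sym (inv-cancel x≢0 y)) (trans (cong (inv x≢0 ·_) e) (·-zeroʳ _)))

  ·-cancelˡ : ∀ {b x y} → b ≢ 𝟘 → b · x ≡ b · y → x ≡ y
  ·-cancelˡ h e = trans (sym (inv-cancel h _)) (trans (cong (inv h ·_) e) (inv-cancel h _))

  ·≢𝟘 : ∀ {x y} → x ≢ 𝟘 → y ≢ 𝟘 → x · y ≢ 𝟘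
  ·≢𝟘 hx hy e with no-zero-div e
  ... | inj₁ p = hx p
  ... | inj₂ p = hy p

  ⊝-≡ : ∀ {x y} → x ⊝ y ≡ 𝟘 → x ≡ y
  ⊝-≡ {x} {y} e = trans (solveR 2 (λ x y → x := x :- y :+ y) refl x y) (trans (cong (_⊹ y) e) (⊹-idˡ y))

  ∑-dilate : ∀ f b → b ≢ 𝟘 → ∑ f ≡ ∑ (λ x → f (b · x))
  ∑-dilate f b h = ∑-bij f (b ·_) (inv h ·_) (cancel-inv h) (inv-cancel h)

  infixr 9 _^ᴷ_
  _^ᴷ_ : 𝕂 → ℕ → 𝕂
  x ^ᴷ k = pow K x k

  pow-+ : ∀ x a b → x ^ᴷ (a + b) ≡ x ^ᴷ a · x ^ᴷ b
  pow-+ x zero b = sym (·-idˡ _)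
  pow-+ x (suc a) b = trans (cong (x ·_) (pow-+ x a b)) (sym (·-assoc _ _ _))

  pow-· : ∀ x y a → (x · y) ^ᴷ a ≡ x ^ᴷ a · y ^ᴷ a
  pow-· x y zero = sym (·-idˡ _)
  pow-· x y (suc a) = trans (cong ((x · y) ·_) (pow-· x y a))
    (solveR 4 (λ x y u v → (x :* y) :* (u :* v) := (x :* u) :* (y :* v)) refl x y _ _)

  pow-𝟙 : ∀ a → 𝟙 ^ᴷ a ≡ 𝟙
  pow-𝟙 zero = refl
  pow-𝟙 (suc a) = trans (·-idˡ _) (pow-𝟙 a)

  pow-* : ∀ x a b → x ^ᴷ (a * b) ≡ (x ^ᴷ a) ^ᴷ b
  pow-* x zero b = sym (pow-𝟙 b)
  pow-* x (suc a) b = trans (pow-+ x b (a * b)) (trans (cong (x ^ᴷ b ·_) (pow-* x a b)) (sym (pow-· x _ b)))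

  pow-1 : ∀ x → x ^ᴷ 1 ≡ x
  pow-1 = ·-idʳ

  pow-𝟘 : ∀ a → 0 < a → 𝟘 ^ᴷ a ≡ 𝟘
  pow-𝟘 (suc a) _ = ·-zeroˡ _

  pow-≢𝟘 : ∀ {x} a → x ≢ 𝟘 → x ^ᴷ a ≢ 𝟘
  pow-≢𝟘 zero h e = 0≢1 (sym e)
  pow-≢𝟘 (suc a) h = ·≢𝟘 h (pow-≢𝟘 a h)

  1<size : 1 < size
  1<size = two (from 𝟘) (from 𝟙) (λ e → 0≢1 (trans (sym (to-from 𝟘)) (trans (cong to e) (to-from 𝟙))))
    where
      two : ∀ {n} (i j : Fin n) → i ≢ j → 1 < n
      two {suc zero} fzero fzero h = contradiction refl h
      two {suc (suc n)} _ _ _ = s<s z<s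

  private
    module ∏ᴹ = Sum *-commutativeMonoid
    module ∑ᴹ = Sum +-commutativeMonoid

    ∏-≢𝟘 : ∀ n (f : Fin n → 𝕂) → (∀ i → f i ≢ 𝟘) → ∏ᴹ.sum f ≢ 𝟘
    ∏-≢𝟘 zero f h e = 0≢1 (sym e)
    ∏-≢𝟘 (suc n) f h = ·≢𝟘 (h fzero) (∏-≢𝟘 n _ (h ∘ fsuc))

    ∏-const : ∀ n a (f : Fin n → 𝕂) → (∀ i → f i ≡ a) → ∏ᴹ.sum f ≡ a ^ᴷ n
    ∏-const zero a f h = refl
    ∏-const (suc n) a f h = cong₂ _·_ (h fzero) (∏-const n a _ (h ∘ fsuc))

    ∏-but-one : ∀ n a (f : Fin n → 𝕂) i → f i ≡ 𝟙 → (∀ j → j ≢ i → f j ≡ a) → ∏ᴹ.sum f ≡ a ^ᴷ (n ∸ 1)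
    ∏-but-one (suc n) a f fzero e h = trans (cong₂ _·_ e (∏-const n a _ (λ j → h (fsuc j) λ ()))) (·-idˡ _)
    ∏-but-one (suc (suc n)) a f (fsuc i) e h = cong₂ _·_ (h fzero λ ())
      (∏-but-one (suc n) a _ i e (λ j j≢i → h (fsuc j) (j≢i ∘ Finₚ.suc-injective)))

    ∑-single : ∀ n (f : Fin n → 𝕂) i → (∀ j → j ≢ i → f j ≡ 𝟘) → ∑ᴹ.sum f ≡ f i
    ∑-single (suc n) f fzero h = trans (cong (f fzero ⊹_)
      (trans (∑ᴹ.sum-cong-≗ {n} {λ j → f (fsuc j)} {λ _ → 𝟘} (λ j → h (fsuc j) λ ())) (∑ᴹ.sum-replicate-zero n))) (⊹-idʳ _)
    ∑-single (suc n) f (fsuc i) h = trans (cong₂ _⊹_ (h fzero λ ())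
      (∑-single n (f ∘ fsuc) i (λ j j≢i → h (fsuc j) (j≢i ∘ Finₚ.suc-injective)))) (⊹-idˡ _)

    -- Sends 0 to 1, so that a product over the whole enumeration is the product of the nonzero
    -- elements. `scale a` is the factor gained when the argument is multiplied by a.
    unit : 𝕂 → 𝕂
    unit x = if ⌊ x ≟ᴷ 𝟘 ⌋ then 𝟙 else x

    unit≢𝟘 : ∀ x → unit x ≢ 𝟘
    unit≢𝟘 x with x ≟ᴷ 𝟘
    ... | yes _ = 0≢1 ∘ sym
    ... | no h = h

    scale : 𝕂 → 𝕂 → 𝕂
    scale a x = if ⌊ x ≟ᴷ 𝟘 ⌋ then 𝟙 else a

    unit-· : ∀ a → a ≢ 𝟘 → ∀ x → unit (a · x) ≡ scale a x · unit x
    unit-· a h x with x ≟ᴷ 𝟘 | a · x ≟ᴷ 𝟘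
    ... | yes p | yes q = sym (·-idˡ _)
    ... | yes p | no q = contradiction (trans (cong (a ·_) p) (·-zeroʳ a)) q
    ... | no p | yes q = contradiction q (·≢𝟘 h p)
    ... | no p | no q = refl

    scale-𝟘 : ∀ a → scale a 𝟘 ≡ 𝟙
    scale-𝟘 a with 𝟘 ≟ᴷ 𝟘
    ... | yes _ = refl
    ... | no h = contradiction refl h

    scale-≢ : ∀ a x → x ≢ 𝟘 → scale a x ≡ a
    scale-≢ a x h with x ≟ᴷ 𝟘
    ... | yes p = contradiction p h
    ... | no _ = refl

  -- Multiplication by a permutes the nonzero elements, so their product equals itself times
  -- a^(size-1).
  fermat : ∀ {a} → a ≢ 𝟘 → a ^ᴷ (size ∸ 1) ≡ 𝟙
  fermat {a} h = sym (·-cancelˡ (∏-≢𝟘 size (unit ∘ to) (unit≢𝟘 ∘ to)) eq)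
    where
      open ≡-Reasoning
      Π = ∏ᴹ.sum (unit ∘ to)
      π = permutation (a ·_) (inv h ·_) (cancel-inv h) (inv-cancel h)
      eq : Π · 𝟙 ≡ Π · a ^ᴷ (size ∸ 1)
      eq = begin
        Π · 𝟙 ≡⟨ ·-idʳ Π ⟩
        Π ≡⟨ ∏ᴹ.sum-permute (unit ∘ to) π ⟩
        ∏ᴹ.sum (λ i → unit (to (from (a · to i))))
          ≡⟨ ∏ᴹ.sum-cong-≗ {size} {λ i → unit (to (from (a · to i)))} {λ i → scale a (to i) · unit (to i)}
               (λ i → trans (cong unit (to-from (a · to i))) (unit-· a h (to i))) ⟩
        ∏ᴹ.sum (λ i → scale a (to i) · unit (to i)) ≡⟨ ∏ᴹ.∑-distrib-+ (scale a ∘ to) (unit ∘ to) ⟩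
        ∏ᴹ.sum (scale a ∘ to) · Π
          ≡⟨ cong (_· Π) (∏-but-one size a (scale a ∘ to) (from 𝟘) (trans (cong (scale a) (to-from 𝟘)) (scale-𝟘 a))
               (λ j j≢ → scale-≢ a (to j) (λ e → j≢ (trans (sym (from-to j)) (cong from e))))) ⟩
        a ^ᴷ (size ∸ 1) · Π ≡⟨ ·-comm _ _ ⟩
        Π · a ^ᴷ (size ∸ 1) ∎

  -- Translation by 1 permutes the field, so the sum of all elements equals itself plus `size ⋆ 𝟙`.
  size⋆𝟙 : size ⋆ 𝟙 ≡ 𝟘
  size⋆𝟙 = begin
    size ⋆ 𝟙 ≡⟨ solveR 2 (λ s c → c := (s :+ c) :- s) refl S (size ⋆ 𝟙) ⟩
    (S ⊹ size ⋆ 𝟙) ⊝ S ≡⟨ cong (_⊝ S) (sym eq) ⟩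
    S ⊝ S ≡⟨ ⊖-invʳ S ⟩
    𝟘 ∎
    where
      open ≡-Reasoning
      S = ∑ᴹ.sum to
      π = permutation (_⊹ 𝟙) (_⊝ 𝟙)
        (λ x → solveR 2 (λ x c → x :- c :+ c := x) refl x 𝟙)
        (λ x → solveR 2 (λ x c → x :+ c :- c := x) refl x 𝟙)
      eq : S ≡ S ⊹ size ⋆ 𝟙
      eq = begin
        S ≡⟨ ∑ᴹ.sum-permute to π ⟩
        ∑ᴹ.sum (λ i → to (from (to i ⊹ 𝟙)))
          ≡⟨ ∑ᴹ.sum-cong-≗ {size} {λ i → to (from (to i ⊹ 𝟙))} {λ i → to i ⊹ 𝟙} (λ i → to-from (to i ⊹ 𝟙)) ⟩
        ∑ᴹ.sum (λ i → to i ⊹ 𝟙) ≡⟨ ∑ᴹ.∑-distrib-+ to (λ _ → 𝟙) ⟩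
        S ⊹ ∑ᴹ.sum {size} (λ _ → 𝟙) ≡⟨ cong (S ⊹_) (∑ᴹ.sum-replicate size) ⟩
        S ⊹ size ⋆ 𝟙 ∎

  pow-⋆ : ∀ p e → (p ^ e) ⋆ 𝟙 ≡ (p ⋆ 𝟙) ^ᴷ e
  pow-⋆ p zero = ⊹-idʳ 𝟙
  pow-⋆ p (suc e) = trans (×1-homo-* p (p ^ e)) (cong (p ⋆ 𝟙 ·_) (pow-⋆ p e))

  char : ∀ p e → size ≡ p ^ e → p ⋆ 𝟙 ≡ 𝟘
  char p e size≡ with p ⋆ 𝟙 ≟ᴷ 𝟘
  ... | yes h = h
  ... | no h = contradiction (trans (sym (pow-⋆ p e)) (trans (cong (_⋆ 𝟙) (sym size≡)) size⋆𝟙)) (pow-≢𝟘 e h)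

  module Frobenius (p : ℕ) (p-prime : Prime p) (p⋆𝟙 : p ⋆ 𝟙 ≡ 𝟘) where
    private
      module E = Exp semiring

      pow≡^ : ∀ x k → x E.^ k ≡ x ^ᴷ k
      pow≡^ x zero = refl
      pow≡^ x (suc k) = cong (x ·_) (pow≡^ x k)

      ⋆-multiple : ∀ m x → p ∣ m → m ⋆ x ≡ 𝟘
      ⋆-multiple m x (divides c refl) = begin
        (c * p) ⋆ x ≡⟨ cong ((c * p) ⋆_) (sym (·-idˡ x)) ⟩
        (c * p) ⋆ (𝟙 · x) ≡⟨ sym (×-assoc-* (c * p) 𝟙 x) ⟩
        ((c * p) ⋆ 𝟙) · x ≡⟨ cong (_· x) (×1-homo-* c p) ⟩
        (c ⋆ 𝟙 · (p ⋆ 𝟙)) · x ≡⟨ cong (λ z → (c ⋆ 𝟙 · z) · x) p⋆𝟙 ⟩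
        (c ⋆ 𝟙 · 𝟘) · x ≡⟨ cong (_· x) (·-zeroʳ _) ⟩
        𝟘 · x ≡⟨ ·-zeroˡ x ⟩
        𝟘 ∎ where open ≡-Reasoning

      p∤k! : ∀ k → k < p → ¬ (p ∣ k !)
      p∤k! zero k<p d = <-irrefl refl (≤-trans (nonTrivial⇒n>1 p {{prime⇒nonTrivial p-prime}}) (∣⇒≤ d))
      p∤k! (suc k) k<p d with euclidsLemma (suc k) (k !) p-prime d
      ... | inj₁ e = <-irrefl refl (<-≤-trans k<p (∣⇒≤ e))
      ... | inj₂ e = p∤k! k (<-trans (n<1+n k) k<p) e

      p∣pCk : ∀ k → 0 < k → k < p → p ∣ p choose k
      p∣pCk k 0<k k<p with euclidsLemma (p choose k) (k ! * (p ∸ k) !) p-prime (subst (p ∣_) (sym eq) (p∣p! p (<-trans 0<k k<p)))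
        where
          instance _ = m*n≢0 (k !) ((p ∸ k) !) {{k !≢0}} {{(p ∸ k) !≢0}}
          eq : (p choose k) * (k ! * (p ∸ k) !) ≡ p !
          eq = trans (cong (_* (k ! * (p ∸ k) !)) (nCk≡n!/k![n-k]! (<⇒≤ k<p))) (m/n*n≡m (k![n∸k]!∣n! (<⇒≤ k<p)))
          p∣p! : ∀ p → 0 < p → p ∣ p !
          p∣p! (suc p) _ = m∣m*n (p !)
      ... | inj₁ d = d
      ... | inj₂ d with euclidsLemma (k !) ((p ∸ k) !) p-prime d
      ...   | inj₁ d′ = contradiction d′ (p∤k! k k<p)
      ...   | inj₂ d′ = contradiction d′ (p∤k! (p ∸ k) (∸-monoʳ-< 0<k (<⇒≤ k<p)))

      last′ : ∀ n → Fin (suc n)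
      last′ n = Data.Fin.fromℕ n

      open Binomial commutativeSemiring using (theorem; binomialExpansion)

    frob-p : ∀ x y → (x ⊹ y) ^ᴷ p ≡ x ^ᴷ p ⊹ y ^ᴷ p
    frob-p x y = trans (sym (pow≡^ _ p)) (trans (theorem p x y) (expand p refl))
      where
        open ≡-Reasoning
        expand : ∀ p′ → p′ ≡ p → binomialExpansion x y p′ ≡ x ^ᴷ p′ ⊹ y ^ᴷ p′
        expand zero e = contradiction (subst Prime (sym e) p-prime) Data.Nat.Primality.¬prime[0]
        expand (suc p′) refl = begin
          t fzero ⊹ ∑ᴹ.sum (t ∘ fsuc)
            ≡⟨ cong (t fzero ⊹_) (∑-single (suc p′) (t ∘ fsuc) (last′ p′) middle) ⟩
          t fzero ⊹ t (fsuc (last′ p′)) ≡⟨ cong₂ _⊹_ first last″ ⟩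
          y ^ᴷ suc p′ ⊹ x ^ᴷ suc p′ ≡⟨ ⊹-comm _ _ ⟩
          x ^ᴷ suc p′ ⊹ y ^ᴷ suc p′ ∎
          where
            t : Fin (suc (suc p′)) → 𝕂
            t k = (suc p′ choose toℕ k) ⋆ (x E.^ toℕ k · y E.^ (suc p′ ∸ toℕ k))
            first : t fzero ≡ y ^ᴷ suc p′
            first = trans (cong (_⋆ (𝟙 · y E.^ suc p′)) (trans (nCk≡nC[n∸k] {0} {suc p′} z≤n) (nCn≡1 (suc p′))))
              (trans (⊹-idʳ _) (trans (·-idˡ _) (pow≡^ y (suc p′))))
            at-top : ∀ i → i ≡ p′ → (suc p′ choose suc i) ⋆ (x E.^ suc i · y E.^ (p′ ∸ i)) ≡ x ^ᴷ suc p′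
            at-top i refl = trans (cong₂ (λ c d → c ⋆ (x E.^ suc p′ · y E.^ d)) (nCn≡1 (suc p′)) (n∸n≡0 p′))
              (trans (⊹-idʳ _) (trans (·-idʳ _) (pow≡^ x (suc p′))))
            last″ : t (fsuc (last′ p′)) ≡ x ^ᴷ suc p′
            last″ = at-top (toℕ (last′ p′)) (Finₚ.toℕ-fromℕ p′)
            middle : ∀ j → j ≢ last′ p′ → t (fsuc j) ≡ 𝟘
            middle j j≢ = ⋆-multiple _ _ (p∣pCk (suc (toℕ j)) z<s (s<s (≤∧≢⇒< (≤-pred (Finₚ.toℕ<n j))
              (λ e → j≢ (Finₚ.toℕ-injective (trans e (sym (Finₚ.toℕ-fromℕ p′))))))))

    frob : ∀ e x y → (x ⊹ y) ^ᴷ (p ^ e) ≡ x ^ᴷ (p ^ e) ⊹ y ^ᴷ (p ^ e)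
    frob zero x y = trans (pow-1 _) (sym (cong₂ _⊹_ (pow-1 x) (pow-1 y)))
    frob (suc e) x y = begin
      (x ⊹ y) ^ᴷ (p * p ^ e) ≡⟨ pow-* _ p (p ^ e) ⟩
      ((x ⊹ y) ^ᴷ p) ^ᴷ (p ^ e) ≡⟨ cong (_^ᴷ (p ^ e)) (frob-p x y) ⟩
      (x ^ᴷ p ⊹ y ^ᴷ p) ^ᴷ (p ^ e) ≡⟨ frob e _ _ ⟩
      (x ^ᴷ p) ^ᴷ (p ^ e) ⊹ (y ^ᴷ p) ^ᴷ (p ^ e) ≡⟨ sym (cong₂ _⊹_ (pow-* x p (p ^ e)) (pow-* y p (p ^ e))) ⟩
      x ^ᴷ (p * p ^ e) ⊹ y ^ᴷ (p * p ^ e) ∎ where open ≡-Reasoning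

  -- Cardinalities, fibres and roots of polynomials

  #-⊆ : ∀ {A B : 𝕂 → Bool} → (∀ x → T (A x) → T (B x)) → # A ≤ # B
  #-⊆ h = ∑-mono (λ x → ι-≤ (h x))

  #-≗ : ∀ {A B : 𝕂 → Bool} → (∀ x → A x ≡ B x) → # A ≡ # B
  #-≗ h = ∑-cong (λ x → cong ι (h x))

  #-empty : ∀ {A : 𝕂 → Bool} → (∀ x → ¬ T (A x)) → # A ≡ 0
  #-empty h = trans (∑-cong (λ x → cong ι (¬T⇒≡ (h x)))) (trans (∑-const 0) (*-zeroʳ size))

  #-all : # (λ _ → true) ≡ size
  #-all = trans (∑-const 1) (*-identityʳ size)

  #-witness : ∀ {A : 𝕂 → Bool} → 0 < # A → ∃ λ x → T (A x)
  #-witness {A} h with ∑-witness (ι ∘ A) h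
  ... | x , p = x , help (A x) p
    where
      help : ∀ b → 0 < ι b → T b
      help true _ = tt

  #-pos : ∀ {A : 𝕂 → Bool} x → T (A x) → 0 < # A
  #-pos {A} x h = ≤-trans (≤-reflexive (sym (∑-δ₁ x))) (∑-mono le)
    where
      le : ∀ y → δ x y ≤ ι (A y)
      le y = ι-≤ λ t → subst (T ∘ A) (toWitness {a? = x ≟ᴷ y} (subst T refl t)) h

  #-split : ∀ (A B : 𝕂 → Bool) → # (λ x → A x ∧ B x) + # (λ x → A x ∧ not (B x)) ≡ # A
  #-split A B = trans (sym (∑-+ _ _)) (∑-cong (λ x → help (A x) (B x)))
    where
      help : ∀ a b → ι (a ∧ b) + ι (a ∧ not b) ≡ ι a
      help true true = refl
      help true false = refl
      help false _ = refl

  #-fibres : ∀ (B E : 𝕂 → Bool) (φ : 𝕂 → 𝕂) k → (∀ x → T (B x) → T (E (φ x))) →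
    (∀ y → # (λ x → B x ∧ ⌊ φ x ≟ᴷ y ⌋) ≤ k) → # B ≤ # E * k
  #-fibres B E φ k B→C fib = begin
    # B ≡⟨ ∑-cong (λ x → sym (∑-δ (φ x) (λ _ → ι (B x)))) ⟩
    ∑ (λ x → ∑ (λ y → δ (φ x) y * ι (B x))) ≡⟨ ∑-swap _ ⟩
    ∑ (λ y → ∑ (λ x → δ (φ x) y * ι (B x))) ≤⟨ ∑-mono le ⟩
    ∑ (λ y → ι (E y) * k) ≡⟨ ∑-*ʳ k _ ⟩
    # E * k ∎
    where
      open ≤-Reasoning
      le : ∀ y → ∑ (λ x → δ (φ x) y * ι (B x)) ≤ ι (E y) * k
      le y with E y in eq
      ... | true = ≤-trans (≤-trans (≤-reflexive (∑-cong (λ x → trans (*-comm (δ (φ x) y) _) (sym (ι-∧ (B x) _))))) (fib y)) (≤-reflexive (sym (+-identityʳ k)))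
      ... | false = ≤-reflexive (trans (∑-cong zeroes) (trans (∑-const 0) (*-zeroʳ size)))
        where
          zeroes : ∀ x → δ (φ x) y * ι (B x) ≡ 0
          zeroes x with φ x ≟ᴷ y
          ... | no _ = refl
          ... | yes e with B x in eqB
          ...   | false = refl
          ...   | true = ⊥-elim (subst T (trans (cong E e) eq) (B→C x (subst T (sym eqB) tt)))

  evalM : ∀ {d} → Vec 𝕂 d → 𝕂 → 𝕂
  evalM [] x = 𝟙
  evalM (c ∷ v) x = c ⊹ x · evalM v x

  evalL : ∀ {d} → Vec 𝕂 d → 𝕂 → 𝕂
  evalL [] x = 𝟘
  evalL (c ∷ v) x = c ⊹ x · evalL v x

  divide-linear : ∀ {d} (v : Vec 𝕂 (suc d)) a → Σ (Vec 𝕂 d) λ w → ∀ x → evalM v x ≡ evalM v a ⊹ (x ⊝ a) · evalM w x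
  divide-linear (c ∷ []) a = [] , λ x → solveR 4 (λ c x a o → c :+ x :* o := (c :+ a :* o) :+ (x :- a) :* o) refl c x a 𝟙
  divide-linear (c ∷ v@(_ ∷ _)) a with divide-linear v a
  ... | w , eq = (evalM v a ∷ w) , λ x → trans (cong (λ z → c ⊹ x · z) (eq x))
    (solveR 5 (λ c x a r w → c :+ x :* (r :+ (x :- a) :* w) := (c :+ a :* r) :+ (x :- a) :* (r :+ x :* w)) refl c x a (evalM v a) (evalM w x))

  roots-≤ : ∀ {d} (v : Vec 𝕂 d) → # (λ x → ⌊ evalM v x ≟ᴷ 𝟘 ⌋) ≤ d
  roots-≤ [] = ≤-reflexive (#-empty (λ x t → 0≢1 (sym (toWitness t))))
  roots-≤ {suc d} v@(_ ∷ _) with any? (λ x → evalM v x ≟ᴷ 𝟘)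
  ... | no none = subst (_≤ suc d) (sym (#-empty {λ x → ⌊ evalM v x ≟ᴷ 𝟘 ⌋} (λ x t → none (x , toWitness t)))) z≤n
  ... | yes (a , root) with divide-linear v a
  ...   | w , eq = ≤-trans (∑-mono le) (≤-trans (≤-reflexive (trans (∑-+ _ _) (cong (_+ # (λ x → ⌊ evalM w x ≟ᴷ 𝟘 ⌋)) (∑-δ₁ a)))) (s≤s (roots-≤ w)))
    where
      le : ∀ x → ι ⌊ evalM v x ≟ᴷ 𝟘 ⌋ ≤ δ a x + ι ⌊ evalM w x ≟ᴷ 𝟘 ⌋
      le x with evalM v x ≟ᴷ 𝟘 | a ≟ᴷ x | evalM w x ≟ᴷ 𝟘
      ... | no _ | _ | _ = z≤n
      ... | yes _ | yes _ | _ = s≤s z≤n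
      ... | yes _ | no _ | yes _ = s≤s z≤n
      ... | yes e | no a≢x | no w≢0 = contradiction
        (trans (solveR 2 (λ r y → y := r :+ y :- r) refl (evalM v a) ((x ⊝ a) · evalM w x))
          (trans (cong (_⊝ evalM v a) (trans (sym (eq x)) e)) (trans (cong (𝟘 ⊝_) root) (⊖-invʳ 𝟘))))
        (·≢𝟘 (λ e′ → a≢x (sym (⊝-≡ e′))) w≢0)

  -- Functions given by a monic polynomial of degree d, or by one of degree below d. They are
  -- assembled without any polynomial arithmetic, the aim being only to bound the number of zeros by
  -- d.
  Monic Low : ℕ → (𝕂 → 𝕂) → Set
  Monic d f = Σ (Vec 𝕂 d) λ v → ∀ x → evalM v x ≡ f x
  Low d f = Σ (Vec 𝕂 d) λ v → ∀ x → evalL v x ≡ f x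

  low-𝟘 : ∀ d → Low d (λ _ → 𝟘)
  low-𝟘 zero = [] , λ _ → refl
  low-𝟘 (suc d) with low-𝟘 d
  ... | v , e = 𝟘 ∷ v , λ x → trans (⊹-idˡ _) (trans (cong (x ·_) (e x)) (·-zeroʳ x))

  low-monomial : ∀ d k c → k < d → Low d (λ x → c · x ^ᴷ k)
  low-monomial (suc d) zero c _ with low-𝟘 d
  ... | v , e = c ∷ v , λ x → trans (cong (λ z → c ⊹ x · z) (e x)) (trans (cong (c ⊹_) (·-zeroʳ x)) (trans (⊹-idʳ c) (sym (·-idʳ c))))
  low-monomial (suc d) (suc k) c (s≤s h) with low-monomial d k c h
  ... | v , e = 𝟘 ∷ v , λ x → trans (⊹-idˡ _) (trans (cong (x ·_) (e x)) (solveR 3 (λ x c y → x :* (c :* y) := c :* (x :* y)) refl x c (x ^ᴷ k)))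

  monic-+ : ∀ {d f g} → Low d f → Monic d g → Monic d (λ x → f x ⊹ g x)
  monic-+ (v , e) (w , e′) = Vec.zipWith _⊹_ v w , λ x → trans (help v w x) (cong₂ _⊹_ (e x) (e′ x))
    where
      help : ∀ {d} (v w : Vec 𝕂 d) x → evalM (Vec.zipWith _⊹_ v w) x ≡ evalL v x ⊹ evalM w x
      help [] [] x = sym (⊹-idˡ 𝟙)
      help (a ∷ v) (b ∷ w) x = trans (cong (λ z → (a ⊹ b) ⊹ x · z) (help v w x))
        (solveR 5 (λ a b x y z → (a :+ b) :+ x :* (y :+ z) := (a :+ x :* y) :+ (b :+ x :* z)) refl a b x _ _)

  monic-pow : ∀ d → Monic d (_^ᴷ d)
  monic-pow zero = [] , λ _ → refl
  monic-pow (suc d) with monic-pow d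
  ... | v , e = 𝟘 ∷ v , λ x → trans (⊹-idˡ _) (cong (x ·_) (e x))

  monic-roots : ∀ {d f} → Monic d f → # (λ x → ⌊ f x ≟ᴷ 𝟘 ⌋) ≤ d
  monic-roots (v , e) = ≤-trans (#-⊆ (λ x t → fromWitness (trans (e x) (toWitness t)))) (roots-≤ v)

  pow-roots : ∀ d y → 0 < d → # (λ x → ⌊ x ^ᴷ d ≟ᴷ y ⌋) ≤ d
  pow-roots d y 0<d = ≤-trans
    (#-⊆ λ x t → fromWitness {a? = (⊖ y · x ^ᴷ 0) ⊹ x ^ᴷ d ≟ᴷ 𝟘}
      (trans (cong₂ _⊹_ (·-idʳ _) (toWitness {a? = x ^ᴷ d ≟ᴷ y} t)) (⊖-invˡ y)))
    (monic-roots (monic-+ (low-monomial d 0 (⊖ y) 0<d) (monic-pow d)))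

  N : ℕ
  N = size ∸ 1

  sN≡size : suc N ≡ size
  sN≡size = m+[n∸m]≡n (<⇒≤ 1<size)

  0<N : 0 < N
  0<N = m<n⇒0<n∸m 1<size

  nonzero : 𝕂 → Bool
  nonzero x = not ⌊ x ≟ᴷ 𝟘 ⌋

  nonzero⇒ : ∀ {x} → T (nonzero x) → x ≢ 𝟘
  nonzero⇒ {x} t with x ≟ᴷ 𝟘
  ... | no h = h

  #-nonzero : # nonzero ≡ N
  #-nonzero = suc-injective (trans (cong (_+ # nonzero) (sym one)) (trans (trans (#-split (λ _ → true) (λ x → ⌊ x ≟ᴷ 𝟘 ⌋)) #-all) (sym sN≡size)))
    where
      one : # (λ x → ⌊ x ≟ᴷ 𝟘 ⌋) ≡ 1
      one = trans (∑-cong (λ x → help x)) (∑-δ₁ 𝟘)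
        where
          help : ∀ x → ι ⌊ x ≟ᴷ 𝟘 ⌋ ≡ δ 𝟘 x
          help x with x ≟ᴷ 𝟘 | 𝟘 ≟ᴷ x
          ... | yes _ | yes _ = refl
          ... | no _ | no _ = refl
          ... | yes p | no q = contradiction (sym p) q
          ... | no p | yes q = contradiction (sym q) p

  unity : ℕ → 𝕂 → Bool
  unity e x = ⌊ x ^ᴷ e ≟ᴷ 𝟙 ⌋

  unity⇒≢𝟘 : ∀ e x → 0 < e → T (unity e x) → x ≢ 𝟘
  unity⇒≢𝟘 e x 0<e t x≡0 = 0≢1 (trans (sym (pow-𝟘 e 0<e)) (trans (cong (_^ᴷ e) (sym x≡0)) (toWitness {a? = x ^ᴷ e ≟ᴷ 𝟙} t)))

  -- At most e because T^e - 1 has degree e. At least e because x ↦ x^d sends the N nonzero elements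
  -- there with fibres of at most d elements, and N = e d.
  #-unity : ∀ e d → e * d ≡ N → # (unity e) ≡ e
  #-unity e d ed≡N = ≤-antisym (pow-roots e 𝟙 0<e) (*-cancelʳ-≤ e _ d {{>-nonZero 0<d}} le)
    where
      0<ed : 0 < e * d
      0<ed = subst (0 <_) (sym ed≡N) 0<N
      0<e : 0 < e
      0<e = n≢0⇒n>0 λ e≡0 → n≮0 (subst (λ z → 0 < z * d) e≡0 0<ed)
      0<d : 0 < d
      0<d = n≢0⇒n>0 λ d≡0 → n≮0 (subst (0 <_) (*-zeroʳ e) (subst (λ z → 0 < e * z) d≡0 0<ed))
      le : e * d ≤ # (unity e) * d
      le = ≤-trans (≤-reflexive (trans ed≡N (sym #-nonzero)))
        (#-fibres nonzero (unity e) (_^ᴷ d) d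
          (λ x t → fromWitness (trans (sym (pow-* x d e)) (trans (cong (x ^ᴷ_) (trans (*-comm d e) ed≡N)) (fermat (nonzero⇒ t)))))
          (λ y → ≤-trans (#-⊆ λ x t → T-∧₂ {nonzero x} t) (pow-roots d y 0<d)))

  -- Equidistribution of multiplicative subgroups by a second moment

  -- hits b c = #{a ∈ A : b a + c ∈ D} takes the same value |A ∩ D| at all pairs b ∈ D, c ∈ b U, whereas the sum of its
  -- squared deviations over all (b , c) is known exactly.
  module SecondMoment
    (D A U : 𝕂 → Bool)
    (𝟙∈D : T (D 𝟙)) (D≢𝟘 : ∀ {b} → T (D b) → b ≢ 𝟘) (D-· : ∀ {b} x → T (D b) → D (b · x) ≡ D x)
    (A-⊹ : ∀ {u} x → T (U u) → A (x ⊹ u) ≡ A x) where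

    private
      Q = size
      𝐃 𝐀 : 𝕂 → ℕ
      𝐃 = ι ∘ D
      𝐀 = ι ∘ A

      ∑-translateˡ : ∀ f c → ∑ (λ x → f (c ⊹ x)) ≡ ∑ f
      ∑-translateˡ f c = trans (∑-cong (λ x → cong f (⊹-comm c x))) (sym (∑-translate f c))

      hits : 𝕂 → 𝕂 → ℕ
      hits b c = ∑ (λ x → 𝐀 x * 𝐃 (b · x ⊹ c))

      hits-mean : ∀ b → ∑ (λ c → hits b c) ≡ # D * # A
      hits-mean b = begin
        ∑ (λ c → ∑ (λ x → 𝐀 x * 𝐃 (b · x ⊹ c))) ≡⟨ ∑-swap _ ⟩
        ∑ (λ x → ∑ (λ c → 𝐀 x * 𝐃 (b · x ⊹ c))) ≡⟨ ∑-cong (λ x → trans (∑-*ˡ (𝐀 x) _) (cong (𝐀 x *_) (∑-translateˡ 𝐃 (b · x)))) ⟩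
        ∑ (λ x → 𝐀 x * # D) ≡⟨ ∑-*ʳ (# D) 𝐀 ⟩
        # A * # D ≡⟨ *-comm (# A) (# D) ⟩
        # D * # A ∎ where open ≡-Reasoning

      G : 𝕂 → 𝕂 → ℕ
      G x y = ∑ (λ b → ∑ (λ c → 𝐃 (b · x ⊹ c) * 𝐃 (b · y ⊹ c)))

      G-diag : ∀ x → G x x ≡ Q * # D
      G-diag x = trans (∑-cong (λ b → trans (∑-cong (λ c → ι-idem (D (b · x ⊹ c)))) (∑-translateˡ 𝐃 (b · x)))) (∑-const (# D))

      -- The affine maps are pairwise independent: with t = y - x ≠ 0, the pair of b x + c and t b
      -- runs through all of K × K when (b , c) does.
      G-off : ∀ x y → x ≢ y → G x y ≡ # D * # D
      G-off x y x≢y = begin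
        G x y ≡⟨ ∑-cong (λ b → trans (∑-cong (λ c → cong₂ (λ u v → 𝐃 u * 𝐃 v) refl (shift b c))) (∑-translateˡ (λ c → 𝐃 c * 𝐃 (c ⊹ t · b)) (b · x))) ⟩
        ∑ (λ b → ∑ (λ c → 𝐃 c * 𝐃 (c ⊹ t · b))) ≡⟨ sym (∑-dilate (λ u → ∑ (λ c → 𝐃 c * 𝐃 (c ⊹ u))) t t≢0) ⟩
        ∑ (λ u → ∑ (λ c → 𝐃 c * 𝐃 (c ⊹ u))) ≡⟨ ∑-swap _ ⟩
        ∑ (λ c → ∑ (λ u → 𝐃 c * 𝐃 (c ⊹ u))) ≡⟨ ∑-cong (λ c → trans (∑-*ˡ (𝐃 c) _) (cong (𝐃 c *_) (∑-translateˡ 𝐃 c))) ⟩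
        ∑ (λ c → 𝐃 c * # D) ≡⟨ ∑-*ʳ (# D) 𝐃 ⟩
        # D * # D ∎
        where
          open ≡-Reasoning
          t = y ⊝ x
          t≢0 : t ≢ 𝟘
          t≢0 e = x≢y (sym (⊝-≡ e))
          shift : ∀ b c → b · y ⊹ c ≡ b · x ⊹ c ⊹ t · b
          shift b c = solveR 4 (λ b x y c → b :* y :+ c := b :* x :+ c :+ (y :- x) :* b) refl b x y c

      G-eq : ∀ x y → G x y + δ x y * (# D * # D) ≡ # D * # D + δ x y * (Q * # D)
      G-eq x y with x ≟ᴷ y
      ... | yes refl = trans (cong₂ _+_ (G-diag x) (+-identityʳ (# D * # D))) (trans (+-comm (Q * # D) (# D * # D)) (cong (# D * # D +_) (sym (+-identityʳ (Q * # D)))))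
      ... | no h = cong (_+ 0) (G-off x y h)

      ∑∑ : (𝕂 → 𝕂 → ℕ) → ℕ
      ∑∑ f = ∑ (λ x → ∑ (λ y → f x y))

      ∑∑-cong : ∀ {f g : 𝕂 → 𝕂 → ℕ} → (∀ x y → f x y ≡ g x y) → ∑∑ f ≡ ∑∑ g
      ∑∑-cong h = ∑-cong (λ x → ∑-cong (h x))

      ∑∑-+ : ∀ f g → ∑∑ (λ x y → f x y + g x y) ≡ ∑∑ f + ∑∑ g
      ∑∑-+ f g = trans (∑-cong (λ x → ∑-+ (f x) (g x))) (∑-+ _ _)

      ∑∑-* : ∀ c f → ∑∑ (λ x y → c * f x y) ≡ c * ∑∑ f
      ∑∑-* c f = trans (∑-cong (λ x → ∑-*ˡ c (f x))) (∑-*ˡ c _)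

      AA : 𝕂 → 𝕂 → ℕ
      AA x y = 𝐀 x * 𝐀 y

      ∑∑AA : ∀ c → ∑∑ (λ x y → AA x y * c) ≡ # A * # A * c
      ∑∑AA c = trans (∑-cong (λ x → trans (∑-*ʳ c _) (cong (_* c) (∑-*ˡ (𝐀 x) 𝐀)))) (trans (∑-*ʳ c _) (cong (_* c) (∑-*ʳ (# A) 𝐀)))

      ∑∑AAδ : ∀ c → ∑∑ (λ x y → AA x y * (δ x y * c)) ≡ # A * c
      ∑∑AAδ c = trans (∑-cong λ x → begin
          ∑ (λ y → AA x y * (δ x y * c)) ≡⟨ ∑-cong (λ y → rearr (𝐀 x) (𝐀 y) (δ x y) c) ⟩
          ∑ (λ y → δ x y * (𝐀 x * 𝐀 y * c)) ≡⟨ ∑-δ x (λ y → 𝐀 x * 𝐀 y * c) ⟩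
          𝐀 x * 𝐀 x * c ≡⟨ cong (_* c) (ι-idem (A x)) ⟩
          𝐀 x * c ∎) (∑-*ʳ c 𝐀)
        where
          open ≡-Reasoning
          rearr : ∀ a b d c → a * b * (d * c) ≡ d * (a * b * c)
          rearr = solve-∀

      square : ∀ b c → hits b c * hits b c ≡ ∑∑ (λ x y → AA x y * (𝐃 (b · x ⊹ c) * 𝐃 (b · y ⊹ c)))
      square b c = begin
        hits b c * hits b c ≡⟨ sym (∑-*ʳ (hits b c) _) ⟩
        ∑ (λ x → 𝐀 x * 𝐃 (b · x ⊹ c) * hits b c) ≡⟨ ∑-cong (λ x → sym (∑-*ˡ (𝐀 x * 𝐃 (b · x ⊹ c)) _)) ⟩
        ∑∑ (λ x y → 𝐀 x * 𝐃 (b · x ⊹ c) * (𝐀 y * 𝐃 (b · y ⊹ c))) ≡⟨ ∑∑-cong (λ x y → rearr (𝐀 x) _ (𝐀 y) _) ⟩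
        ∑∑ (λ x y → AA x y * (𝐃 (b · x ⊹ c) * 𝐃 (b · y ⊹ c))) ∎
        where
          open ≡-Reasoning
          rearr : ∀ a u b v → a * u * (b * v) ≡ a * b * (u * v)
          rearr = solve-∀

      swap₄ : ∀ (f : 𝕂 → 𝕂 → 𝕂 → 𝕂 → ℕ) → ∑∑ (λ b c → ∑∑ (λ x y → f b c x y)) ≡ ∑∑ (λ x y → ∑∑ (λ b c → f b c x y))
      swap₄ f = begin
        ∑ (λ b → ∑ (λ c → ∑ (λ x → ∑ (λ y → f b c x y)))) ≡⟨ ∑-cong (λ b → ∑-swap _) ⟩
        ∑ (λ b → ∑ (λ x → ∑ (λ c → ∑ (λ y → f b c x y)))) ≡⟨ ∑-swap _ ⟩
        ∑ (λ x → ∑ (λ b → ∑ (λ c → ∑ (λ y → f b c x y)))) ≡⟨ ∑-cong (λ x → ∑-cong (λ b → ∑-swap _)) ⟩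
        ∑ (λ x → ∑ (λ b → ∑ (λ y → ∑ (λ c → f b c x y)))) ≡⟨ ∑-cong (λ x → ∑-swap _) ⟩
        ∑ (λ x → ∑ (λ y → ∑ (λ b → ∑ (λ c → f b c x y)))) ∎ where open ≡-Reasoning

      M₂ : ℕ
      M₂ = ∑∑ (λ b c → hits b c * hits b c)

      -- The square of `hits` is expanded over pairs (x , y). A diagonal pair counts Q #D in place
      -- of (#D)², and that correction stands on the left to avoid a subtraction.
      M₂-eq : M₂ + # A * (# D * # D) ≡ # A * # A * (# D * # D) + # A * (Q * # D)
      M₂-eq = begin
        M₂ + # A * (# D * # D)
          ≡⟨ cong₂ _+_ (trans (∑∑-cong square) (trans (swap₄ _) (∑∑-cong (λ x y → ∑∑-* (AA x y) _)))) (sym (∑∑AAδ (# D * # D))) ⟩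
        ∑∑ (λ x y → AA x y * G x y) + ∑∑ (λ x y → AA x y * (δ x y * (# D * # D))) ≡⟨ sym (∑∑-+ _ _) ⟩
        ∑∑ (λ x y → AA x y * G x y + AA x y * (δ x y * (# D * # D)))
          ≡⟨ ∑∑-cong (λ x y → trans (sym (*-distribˡ-+ (AA x y) _ _)) (trans (cong (AA x y *_) (G-eq x y)) (*-distribˡ-+ (AA x y) _ _))) ⟩
        ∑∑ (λ x y → AA x y * (# D * # D) + AA x y * (δ x y * (Q * # D))) ≡⟨ ∑∑-+ _ _ ⟩
        ∑∑ (λ x y → AA x y * (# D * # D)) + ∑∑ (λ x y → AA x y * (δ x y * (Q * # D)))
          ≡⟨ cong₂ _+_ (∑∑AA (# D * # D)) (∑∑AAδ (Q * # D)) ⟩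
        # A * # A * (# D * # D) + # A * (Q * # D) ∎ where open ≡-Reasoning

      Y : ℕ
      Y = # D * # A

      dev : 𝕂 → 𝕂 → ℕ
      dev b c = ∣ Q * hits b c - Y ∣ * ∣ Q * hits b c - Y ∣

      variance-eq : ∑∑ dev + 2 * (Q * Y) * (Q * Y) ≡ Q * Q * M₂ + Q * (Q * (Y * Y))
      variance-eq = begin
        ∑∑ dev + 2 * (Q * Y) * (Q * Y) ≡⟨ cong (∑∑ dev +_) (sym cross) ⟩
        ∑∑ dev + ∑∑ (λ b c → 2 * (Q * hits b c * Y)) ≡⟨ sym (∑∑-+ _ _) ⟩
        ∑∑ (λ b c → dev b c + 2 * (Q * hits b c * Y)) ≡⟨ ∑∑-cong (λ b c → dist-sq (Q * hits b c) Y) ⟩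
        ∑∑ (λ b c → Q * hits b c * (Q * hits b c) + Y * Y) ≡⟨ ∑∑-+ _ _ ⟩
        ∑∑ (λ b c → Q * hits b c * (Q * hits b c)) + ∑∑ (λ b c → Y * Y)
          ≡⟨ cong₂ _+_ (trans (∑∑-cong (λ b c → rearr Q (hits b c))) (∑∑-* (Q * Q) _)) (trans (∑-cong (λ _ → ∑-const (Y * Y))) (∑-const _)) ⟩
        Q * Q * M₂ + Q * (Q * (Y * Y)) ∎
        where
          open ≡-Reasoning
          rearr : ∀ a h → a * h * (a * h) ≡ a * a * (h * h)
          rearr = solve-∀
          rearr₂ : ∀ a h y → 2 * (a * h * y) ≡ 2 * (a * y) * h
          rearr₂ = solve-∀
          cross : ∑∑ (λ b c → 2 * (Q * hits b c * Y)) ≡ 2 * (Q * Y) * (Q * Y)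
          cross = trans (∑∑-cong (λ b c → rearr₂ Q (hits b c) Y)) (trans (∑∑-* (2 * (Q * Y)) hits)
            (cong (2 * (Q * Y) *_) (trans (∑-cong hits-mean) (∑-const Y))))

      -- The exact value is Q³ #A #D - Q² #A (#D)²; the subtracted term `X` is given away.
      variance-≤ : ∑∑ dev ≤ Q * Q * Q * # A * # D
      variance-≤ = +-cancelʳ-≤ (X + (Z + Z)) _ _ (≤-trans (≤-reflexive eq) (+-monoʳ-≤ (Q * Q * Q * # A * # D) (m≤n+m (Z + Z) X)))
        where
          X = Q * Q * (# A * (# D * # D))
          Z = Q * Q * (Y * Y)
          alg₁ : ∀ v q y x → v + (x + (q * q * (y * y) + q * q * (y * y))) ≡ (v + 2 * (q * y) * (q * y)) + x
          alg₁ = solve-∀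
          alg₂ : ∀ q m a d y → q * q * m + q * (q * (y * y)) + q * q * (a * (d * d)) ≡ q * q * (m + a * (d * d)) + q * q * (y * y)
          alg₂ = solve-∀
          alg₃ : ∀ q a d → q * q * (a * a * (d * d) + a * (q * d)) + q * q * (d * a * (d * a)) ≡ q * q * q * a * d + (q * q * (d * a * (d * a)) + q * q * (d * a * (d * a)))
          alg₃ = solve-∀
          eq : ∑∑ dev + (X + (Z + Z)) ≡ Q * Q * Q * # A * # D + (Z + Z)
          eq = trans (alg₁ (∑∑ dev) Q Y X) (trans (cong (_+ X) variance-eq) (trans (alg₂ Q M₂ (# A) (# D) Y)
            (trans (cong (λ z → Q * Q * z + Z) M₂-eq) (alg₃ Q (# A) (# D)))))

      orbit : ∀ b u → T (D b) → T (U u) → hits b (b · u) ≡ # (λ x → A x ∧ D x)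
      orbit b u b∈D u∈U = begin
        ∑ (λ x → 𝐀 x * 𝐃 (b · x ⊹ b · u))
          ≡⟨ ∑-cong (λ x → cong₂ _*_ (cong ι (sym (A-⊹ x u∈U))) (cong ι (trans (cong D (sym (·-distribˡ b x u))) (D-· (x ⊹ u) b∈D)))) ⟩
        ∑ (λ x → 𝐀 (x ⊹ u) * 𝐃 (x ⊹ u)) ≡⟨ sym (∑-translate (λ x → 𝐀 x * 𝐃 x) u) ⟩
        ∑ (λ x → 𝐀 x * 𝐃 x) ≡⟨ ∑-cong (λ x → sym (ι-∧ (A x) (D x))) ⟩
        # (λ x → A x ∧ D x) ∎ where open ≡-Reasoning

      m = # (λ x → A x ∧ D x)
      e₀ = ∣ Q * m - Y ∣ * ∣ Q * m - Y ∣

      slice : ∀ b → ι (D b) * (# U * e₀) ≤ ∑ (dev b)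
      slice b with D b in eq
      ... | false = z≤n
      ... | true = begin
          # U * e₀ + 0 ≡⟨ +-identityʳ _ ⟩
          # U * e₀ ≡⟨ sym (∑-*ʳ e₀ (ι ∘ U)) ⟩
          ∑ (λ u → ι (U u) * e₀) ≤⟨ ∑-mono le ⟩
          ∑ (λ u → dev b (b · u)) ≡⟨ sym (∑-dilate (dev b) b (D≢𝟘 b∈D)) ⟩
          ∑ (dev b) ∎
        where
          open ≤-Reasoning
          b∈D : T (D b)
          b∈D = subst T (sym eq) tt
          le : ∀ u → ι (U u) * e₀ ≤ dev b (b · u)
          le u with U u in eqU
          ... | false = z≤n
          ... | true = ≤-reflexive (trans (+-identityʳ e₀) (cong (λ z → ∣ Q * z - Y ∣ * ∣ Q * z - Y ∣) (sym (orbit b u b∈D (subst T (sym eqU) tt)))))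

    -- The deviation at (1 , 0) recurs at #D #U pairs, and the factor #D cancels against the one in
    -- the variance. The bound therefore does not depend on the size of D.
    deviation² : # U * (∣ Q * m - Y ∣ * ∣ Q * m - Y ∣) ≤ Q * Q * Q * # A
    deviation² = *-cancelʳ-≤ _ _ (# D) {{>-nonZero (#-pos 𝟙 𝟙∈D)}} (begin
      # U * e₀ * # D ≡⟨ *-comm (# U * e₀) (# D) ⟩
      # D * (# U * e₀) ≡⟨ sym (∑-*ʳ _ 𝐃) ⟩
      ∑ (λ b → 𝐃 b * (# U * e₀)) ≤⟨ ∑-mono slice ⟩
      ∑∑ dev ≤⟨ variance-≤ ⟩
      Q * Q * Q * # A * # D ∎)
      where open ≤-Reasoning

    -- For a subgroup A = U the hypothesis says s ≥ √Q. The general form serves a set A that is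
    -- merely a union of cosets of U and pays for it with a larger s.
    deviation : ∀ s → size * # A ≤ s * s * # U → 0 < # U →
      ∣ size * # (λ x → A x ∧ D x) - # D * # A ∣ ≤ size * s
    deviation s h 0<U = sq-cancel-≤ _ _ (*-cancelˡ-≤ (# U) {{>-nonZero 0<U}} (begin
      # U * e₀ ≤⟨ deviation² ⟩
      Q * Q * Q * # A ≡⟨ alg₁ Q (# A) ⟩
      Q * Q * (Q * # A) ≤⟨ *-monoʳ-≤ (Q * Q) h ⟩
      Q * Q * (s * s * # U) ≡⟨ alg₂ Q s (# U) ⟩
      # U * (Q * s * (Q * s)) ∎))
      where
        open ≤-Reasoning
        alg₁ : ∀ q a → q * q * q * a ≡ q * q * (q * a)
        alg₁ = solve-∀
        alg₂ : ∀ q s u → q * q * (s * s * u) ≡ u * (q * s * (q * s))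
        alg₂ = solve-∀

  -- The sieve by prime powers

  record Equidistributed (A : 𝕂 → Bool) (s : ℕ) : Set where
    field
      equidistributed : ∀ e d → e * d ≡ N → ∣ size * # (λ x → A x ∧ unity e x) - # (unity e) * # A ∣ ≤ size * s

  unity-𝟙 : ∀ e → T (unity e 𝟙)
  unity-𝟙 e = fromWitness (pow-𝟙 e)

  unity-·-invariant : ∀ e {b} x → T (unity e b) → unity e (b · x) ≡ unity e x
  unity-·-invariant e {b} x t = cong (λ z → ⌊ z ≟ᴷ 𝟙 ⌋) (trans (pow-· b x e) (trans (cong (_· x ^ᴷ e) (toWitness {a? = b ^ᴷ e ≟ᴷ 𝟙} t)) (·-idˡ _)))

  invariant-equidistributed : ∀ A U s → (∀ {u} x → T (U u) → A (x ⊹ u) ≡ A x) → T (U 𝟘) →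
    size * # A ≤ s * s * # U → Equidistributed A s
  invariant-equidistributed A U s A-⊹ U𝟘 h = record { equidistributed = λ e d ed≡N →
    let 0<e = n≢0⇒n>0 λ e≡0 → n≮0 (subst (0 <_) (sym ed≡N) 0<N |> λ z → subst (λ w → 0 < w * d) e≡0 z) in
    SecondMoment.deviation (unity e) A U (unity-𝟙 e) (λ {b} → unity⇒≢𝟘 e b 0<e) (unity-·-invariant e) A-⊹ s h (#-pos 𝟘 U𝟘) }
    where
      infixl 1 _|>_
      _|>_ : ∀ {X Y : Set} → X → (X → Y) → Y
      x |> f = f x

  whole-equidistributed : Equidistributed (λ _ → true) 0
  whole-equidistributed = record { equidistributed = λ e d ed≡N →
    ≤-reflexive (trans (m≡n⇒∣m-n∣≡0 (trans (*-comm size _) (cong (# (unity e) *_) (sym #-all)))) (sym (*-zeroʳ size))) }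

  -- For d ∣ N these are the nonzero d-th powers, written as roots of unity so that `deviation`
  -- applies to them; `power 1` contains just the nonzero elements.
  power : ℕ → 𝕂 → Bool
  power d = unity (N ÷ d)

  free : List ℕ → 𝕂 → Bool
  free [] x = true
  free (r ∷ S) x = not (power r x) ∧ free S x

  free⇒ : ∀ {S x r} → r ∈ S → T (free S x) → ¬ T (power r x)
  free⇒ {r ∷ S} {x} (here refl) t p with power r x
  ... | true = t
  free⇒ {r ∷ S} {x} (there r∈S) t = free⇒ {S} r∈S (T-∧₂ {not (power r x)} t)

  ⇒free : ∀ {S x} → (∀ {r} → r ∈ S → ¬ T (power r x)) → T (free S x)
  ⇒free {[]} h = tt
  ⇒free {r ∷ S} {x} h with power r x in eq
  ... | true = h (here refl) (subst T (sym eq) tt)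
  ... | false = ⇒free {S} (h ∘ there)

  pow-multiple : ∀ {y c} k → y ^ᴷ c ≡ 𝟙 → y ^ᴷ (k * c) ≡ 𝟙
  pow-multiple {y} {c} k e = trans (cong (y ^ᴷ_) (*-comm k c)) (trans (pow-* y c k) (trans (cong (_^ᴷ k) e) (pow-𝟙 k)))

  pow-gcd : ∀ y a b → y ^ᴷ a ≡ 𝟙 → y ^ᴷ b ≡ 𝟙 → y ^ᴷ gcd a b ≡ 𝟙
  pow-gcd y a b ea eb with Bézout.identity (gcd-GCD a b)
  ... | Bézout.+- u v e = trans (sym (·-idʳ _)) (trans (cong (y ^ᴷ gcd a b ·_) (sym (pow-multiple v eb)))
    (trans (sym (pow-+ y (gcd a b) (v * b))) (trans (cong (y ^ᴷ_) e) (pow-multiple u ea))))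
  ... | Bézout.-+ u v e = trans (sym (·-idʳ _)) (trans (cong (y ^ᴷ gcd a b ·_) (sym (pow-multiple u ea)))
    (trans (sym (pow-+ y (gcd a b) (u * a))) (trans (cong (y ^ᴷ_) e) (pow-multiple v eb))))

  pow-coprime : ∀ {a b} y → Coprime a b → y ^ᴷ a ≡ 𝟙 → y ^ᴷ b ≡ 𝟙 → y ≡ 𝟙
  pow-coprime {a} {b} y cop ea eb = trans (sym (pow-1 y)) (trans (cong (y ^ᴷ_) (sym (coprime⇒gcd≡1 cop))) (pow-gcd y a b ea eb))

  -- Put y = x^(N/(d r)). Being a d-th and an r-th power means y^r = 1 and y^d = 1, and coprime
  -- exponents then force y = 1.
  power-* : ∀ d r x → d * r ∣ N → Coprime d r → power (d * r) x ≡ power d x ∧ power r x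
  power-* d r x dr∣N cop = agree
    where
      e = N ÷ (d * r)
      edr : e * (d * r) ≡ N
      edr = ÷-* 0<N dr∣N
      0<d*r : 0 < d * r
      0<d*r = n≢0⇒n>0 λ z → <-irrefl (trans (sym (*-zeroʳ e)) (trans (cong (e *_) (sym z)) edr)) 0<N
      N÷d : N ÷ d ≡ e * r
      N÷d = *-cancelʳ-≡ _ _ d {{>-nonZero (n≢0⇒n>0 λ { refl → n≮0 0<d*r })}} (trans (÷-* {d = d} 0<N (∣-trans (m∣m*n r) dr∣N)) (trans (sym edr) (lemma e d r)))
        where
          lemma : ∀ e d r → e * (d * r) ≡ e * r * d
          lemma = solve-∀
      N÷r : N ÷ r ≡ e * d
      N÷r = *-cancelʳ-≡ _ _ r {{>-nonZero (n≢0⇒n>0 λ { refl → n≮0 (subst (0 <_) (*-zeroʳ d) 0<d*r) })}} (trans (÷-* {d = r} 0<N (∣-trans (n∣m*n d) dr∣N)) (trans (sym edr) (sym (*-assoc e d r))))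
      y = x ^ᴷ e
      agree : unity e x ≡ unity (N ÷ d) x ∧ unity (N ÷ r) x
      agree rewrite N÷d | N÷r | pow-* x e r | pow-* x e d with y ≟ᴷ 𝟙 | y ^ᴷ r ≟ᴷ 𝟙 | y ^ᴷ d ≟ᴷ 𝟙
      ... | yes p | yes _ | yes _ = refl
      ... | yes p | no h | _ = contradiction (trans (cong (_^ᴷ r) p) (pow-𝟙 r)) h
      ... | yes p | yes _ | no h = contradiction (trans (cong (_^ᴷ d) p) (pow-𝟙 d)) h
      ... | no h | yes er | yes ed = contradiction (pow-coprime y cop ed er) h
      ... | no _ | yes _ | no _ = refl
      ... | no _ | no _ | _ = refl

  #-power : ∀ d → d ∣ N → # (power d) * d ≡ N
  #-power d d∣N = trans (cong (_* d) (#-unity (N ÷ d) d (÷-* 0<N d∣N))) (÷-* 0<N d∣N)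

  -- The quantity on which inclusion-exclusion recurses: S holds the primes still to be excluded, d
  -- the product of those imposed so far.
  sifted : (𝕂 → Bool) → ℕ → List ℕ → ℕ
  sifted A d S = # (λ x → A x ∧ (power d x ∧ free S x))

  sifted-∷ : ∀ A d r S → d * r ∣ N → Coprime d r → sifted A d (r ∷ S) + sifted A (d * r) S ≡ sifted A d S
  sifted-∷ A d r S dr∣N cop = trans (sym (∑-+ _ _)) (∑-cong λ x →
    trans (cong (λ z → ι (A x ∧ (power d x ∧ (not (power r x) ∧ free S x))) + ι (A x ∧ (z ∧ free S x))) (power-* d r x dr∣N cop))
      (table (A x) (power d x) (power r x) (free S x)))
    where
      table : ∀ a p r f → ι (a ∧ (p ∧ (not r ∧ f))) + ι (a ∧ ((p ∧ r) ∧ f)) ≡ ι (a ∧ (p ∧ f))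
      table false _ _ _ = refl
      table true false _ _ = refl
      table true true true _ = refl
      table true true false f = +-identityʳ (ι f)

  prime-coprime : ∀ {d r} → Prime r → ¬ (r ∣ d) → Coprime d r
  prime-coprime {d} {r} pr r∤d {k} (k∣d , k∣r) with prime⇒irreducible pr k∣r
  ... | inj₁ k≡1 = k≡1
  ... | inj₂ refl = contradiction k∣d r∤d

  -- Excluding r means subtracting the r-th powers, that is, the same count with d r in place of d.
  -- The main terms combine through r = (r - 1) + 1 into φ(S), and the errors double. The cofactor k
  -- keeps the denominator P = k d ∏ S fixed throughout the recursion.
  sifted-bounds : ∀ {A s} → Equidistributed A s → ∀ S d k P → All Prime S → Unique S → All (λ r → ¬ (r ∣ d)) S →
    d * product S ∣ N → k * (d * product S) ≡ P →
    (size * P * sifted A d S ≤ k * φ S * # A * N + 2 ^ length S * (s * size * P)) ×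
    (k * φ S * # A * N ≤ size * P * sifted A d S + 2 ^ length S * (s * size * P))
  sifted-bounds {A} {s} eqd [] d k P _ _ _ d∣N kd≡P =
      subst₂ _≤_ lhs (trans (*-distribˡ-+ P (#D * # A) (size * s)) (cong₂ _+_ rhs err)) (*-monoʳ-≤ P (∣-dist⇒≤₁ {size * m} dev))
    , subst₂ _≤_ rhs (trans (*-distribˡ-+ P (size * m) (size * s)) (cong₂ _+_ lhs err)) (*-monoʳ-≤ P (∣-dist⇒≤₂ {size * m} dev))
    where
      d∣N′ : d ∣ N
      d∣N′ = ∣-trans (m∣m*n 1) d∣N
      m = # (λ x → A x ∧ power d x)
      #D = # (power d)
      dev = Equidistributed.equidistributed eqd (N ÷ d) d (÷-* 0<N d∣N′)
      P≡ : P ≡ k * d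
      P≡ = trans (sym kd≡P) (cong (k *_) (*-identityʳ d))
      m≡ : m ≡ sifted A d []
      m≡ = #-≗ (λ x → cong (A x ∧_) (help (power d x)))
        where
          help : ∀ b → b ≡ b ∧ true
          help true = refl
          help false = refl
      lhs : P * (size * m) ≡ size * P * sifted A d []
      lhs = trans (cong (λ z → P * (size * z)) m≡) (lemma P size (sifted A d []))
        where
          lemma : ∀ P z m → P * (z * m) ≡ z * P * m
          lemma = solve-∀
      rhs : P * (#D * # A) ≡ k * 1 * # A * N
      rhs = trans (cong (_* (#D * # A)) P≡) (trans (lemma k d #D (# A)) (cong (k * 1 * # A *_) (#-power d d∣N′)))
        where
          lemma : ∀ k d D a → k * d * (D * a) ≡ k * 1 * a * (D * d)
          lemma = solve-∀
      err : P * (size * s) ≡ 1 * (s * size * P)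
      err = lemma P size s
        where
          lemma : ∀ P z s → P * (z * s) ≡ 1 * (s * z * P)
          lemma = solve-∀
  sifted-bounds {A} {s} eqd (r ∷ S) d k P (pr ∷ prs) (r∉S ∷ uS) (r∤d ∷ S∤d) dS∣N kdS≡P =
      subst (λ z → size * P * sifted A d (r ∷ S) ≤ k * φ (r ∷ S) * # A * N + z) (pow-eq _)
        (upper-step split main (proj₁ ih₁) (proj₂ ih₂))
    , subst (λ z → k * φ (r ∷ S) * # A * N ≤ size * P * sifted A d (r ∷ S) + z) (pow-eq _)
        (lower-step split main (proj₂ ih₁) (proj₁ ih₂))
    where
      instance _ = prime⇒nonZero pr
      reassoc : ∀ d r p → d * (r * p) ≡ d * r * p
      reassoc = solve-∀
      reassoc₂ : ∀ k r d p → k * (d * (r * p)) ≡ k * r * (d * p)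
      reassoc₂ = solve-∀
      pow-eq : ∀ E → 2 * (2 ^ length S * E) ≡ 2 ^ suc (length S) * E
      pow-eq E = sym (*-assoc 2 (2 ^ length S) E)
      drS∣N : d * r * product S ∣ N
      drS∣N = subst (_∣ N) (reassoc d r (product S)) dS∣N
      coprimes : All (λ r′ → ¬ (r′ ∣ d * r)) S
      coprimes = help prs S∤d r∉S
        where
          help : ∀ {S} → All Prime S → All (λ r → ¬ (r ∣ d)) S → All (r ≢_) S → All (λ r′ → ¬ (r′ ∣ d * r)) S
          help [] [] [] = []
          help {r′ ∷ _} (p ∷ ps) (h ∷ hs) (ne ∷ nes) = no-div ∷ help ps hs nes
            where
              no-div : ¬ (r′ ∣ d * r)
              no-div x with euclidsLemma d r p x
              ... | inj₁ y = h y
              ... | inj₂ y with prime⇒irreducible pr y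
              ...   | inj₁ refl = contradiction p (λ ())
              ...   | inj₂ e = ne (sym e)
      ih₁ = sifted-bounds {A} {s} eqd S d (k * r) P prs uS S∤d (∣-trans (*-monoʳ-∣ d (n∣m*n r)) dS∣N)
        (trans (sym (reassoc₂ k r d (product S))) kdS≡P)
      ih₂ = sifted-bounds {A} {s} eqd S (d * r) k P prs uS coprimes drS∣N
        (trans (cong (k *_) (sym (reassoc d r (product S)))) kdS≡P)
      dr∣N : d * r ∣ N
      dr∣N = ∣-trans (m∣m*n (product S)) drS∣N
      split : size * P * sifted A d (r ∷ S) + size * P * sifted A (d * r) S ≡ size * P * sifted A d S
      split = trans (sym (*-distribˡ-+ (size * P) _ _)) (cong (size * P *_) (sifted-∷ A d r S dr∣N (prime-coprime pr r∤d)))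
      main : k * r * φ S * # A * N ≡ k * φ (r ∷ S) * # A * N + k * φ S * # A * N
      main = split-main k r (φ S) (# A) N (>-nonZero⁻¹ r)

  -- Primitive elements

  1∉primes : ∀ {S} → All Prime S → All (λ r → ¬ (r ∣ 1)) S
  1∉primes = All.map λ pr r∣1 → <-irrefl (sym (∣1⇒≡1 r∣1)) (prime>1 pr)

  power⇒≢𝟘 : ∀ d {x} → d ∣ N → T (power d x) → x ≢ 𝟘
  power⇒≢𝟘 d {x} d∣N = unity⇒≢𝟘 (N ÷ d) x (n≢0⇒n>0 λ z → <-irrefl (trans (cong (_* d) (sym z)) (÷-* 0<N d∣N)) 0<N)

  power⇒ : ∀ {r x} → T (power r x) → x ^ᴷ (N ÷ r) ≡ 𝟙
  power⇒ = toWitness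

  -- If x^k = 1, then x^g = 1 for g = gcd(k, N). As g < N, some prime r divides N/g, and x^(N/r) = 1
  -- would make x an r-th power.
  no-small-order : ∀ {x} → x ≢ 𝟘 → (∀ {r} → IsPrimeDivisor N r → ¬ T (power r x)) → ∀ k → 0 < k → k < N → x ^ᴷ k ≢ 𝟙
  no-small-order {x} x≢0 hfree k 0<k k<N e with gcd[m,n]∣n k N
  ... | divides c N≡cg with prime-divisor {c} (1<c c N≡cg)
    where
      g = gcd k N
      1<c : ∀ c → N ≡ c * g → 1 < c
      1<c 0 h = contradiction (sym h) (<⇒≢ 0<N)
      1<c 1 h = contradiction (subst (_≤ k) (trans (sym (+-identityʳ g)) (sym h)) (∣⇒≤ {{>-nonZero 0<k}} (gcd[m,n]∣m k N))) (<⇒≱ k<N)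
      1<c (suc (suc _)) _ = s<s z<s
  ...   | r , pr , divides c′ refl = hfree {r} (pr , r∣N) (fromWitness (trans (cong (x ^ᴷ_) N÷r) (pow-multiple c′ (pow-gcd x k N e (fermat x≢0)))))
    where
      lemma : ∀ c r g → c * r * g ≡ c * g * r
      lemma = solve-∀
      r∣N : r ∣ N
      r∣N = divides (c′ * gcd k N) (trans N≡cg (lemma c′ r (gcd k N)))
      N÷r : N ÷ r ≡ c′ * gcd k N
      N÷r = *-cancelʳ-≡ _ _ r {{prime⇒nonZero pr}} (trans (÷-* {d = r} 0<N r∣N) (trans N≡cg (lemma c′ r (gcd k N))))

  generated : ∀ {x} → x ≢ 𝟘 → (∀ {r} → IsPrimeDivisor N r → ¬ T (power r x)) → Primitive K x
  generated {x} x≢0 hfree = x≢0 , reach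
    where
      inj< : ∀ i j → i < j → j < N → x ^ᴷ i ≢ x ^ᴷ j
      inj< i j i<j j<N e = no-small-order x≢0 hfree (j ∸ i) (m<n⇒0<n∸m i<j) (≤-<-trans (m∸n≤m j i) j<N)
        (sym (·-cancelˡ (pow-≢𝟘 i x≢0) (trans (·-idʳ _) (trans e (trans (cong (x ^ᴷ_) (sym (m+[n∸m]≡n (<⇒≤ i<j)))) (pow-+ x i (j ∸ i)))))))
      reach : ∀ y → y ≢ 𝟘 → ∃ λ k → x ^ᴷ k ≡ y
      reach y y≢0 with Finₚ.any? {N} (λ k → x ^ᴷ toℕ k ≟ᴷ y)
      ... | yes (k , e) = toℕ k , e
      -- Pigeonhole: 0, y and the N distinct powers of x would be N + 2 elements in a field of N +
      -- 1.
      ... | no none = contradiction (Finₚ.injective⇒≤ {f = Inverse.from enum ∘ f} inj) (<⇒≱ (≤-reflexive (cong suc (sym sN≡size))))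
        where
          f : Fin (suc (suc N)) → 𝕂
          f fzero = 𝟘
          f (fsuc fzero) = y
          f (fsuc (fsuc k)) = x ^ᴷ toℕ k
          f-inj : ∀ i j → f i ≡ f j → i ≡ j
          f-inj fzero fzero _ = refl
          f-inj fzero (fsuc fzero) e = contradiction (sym e) y≢0
          f-inj fzero (fsuc (fsuc j)) e = contradiction (sym e) (pow-≢𝟘 (toℕ j) x≢0)
          f-inj (fsuc fzero) fzero e = contradiction e y≢0
          f-inj (fsuc fzero) (fsuc fzero) _ = refl
          f-inj (fsuc fzero) (fsuc (fsuc j)) e = contradiction (j , sym e) none
          f-inj (fsuc (fsuc i)) fzero e = contradiction e (pow-≢𝟘 (toℕ i) x≢0)
          f-inj (fsuc (fsuc i)) (fsuc fzero) e = contradiction (i , e) none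
          f-inj (fsuc (fsuc i)) (fsuc (fsuc j)) e with <-cmp (toℕ i) (toℕ j)
          ... | tri< i<j _ _ = contradiction e (inj< _ _ i<j (Finₚ.toℕ<n j))
          ... | tri≈ _ i≡j _ = cong (fsuc ∘ fsuc) (Finₚ.toℕ-injective i≡j)
          ... | tri> _ _ j<i = contradiction (sym e) (inj< _ _ j<i (Finₚ.toℕ<n i))
          inj : ∀ {i j} → Inverse.from enum (f i) ≡ Inverse.from enum (f j) → i ≡ j
          inj {i} {j} e = f-inj i j (trans (sym (Inverse.inverseˡ enum refl)) (trans (cong (Inverse.to enum) e) (Inverse.inverseˡ enum refl)))

  -- The whole field is equidistributed with error 0, so the main term alone proves that a primitive
  -- element exists.
  sifted-whole-pos : ∀ S → All (IsPrimeDivisor N) S → Unique S → 0 < sifted (λ _ → true) 1 S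
  sifted-whole-pos S ps uS = n≢0⇒n>0 λ z → <-irrefl refl (<-≤-trans pos (≤-trans (proj₂ bounds) (≤-reflexive (vanish z))))
    where
      ps′ = All.map proj₁ ps
      bounds = sifted-bounds {λ _ → true} {0} whole-equidistributed S 1 1 (1 * (1 * product S)) ps′ uS (1∉primes ps′)
        (subst (_∣ N) (sym (*-identityˡ _)) (product-primes-∣ S ps uS)) refl
      pos : 0 < 1 * φ S * # (λ _ → true) * N
      pos = *-mono-< (*-mono-< (subst (0 <_) (sym (*-identityˡ _)) (φ-pos S ps′)) (subst (0 <_) (sym #-all) (<-trans z<s 1<size))) 0<N
      vanish : sifted (λ _ → true) 1 S ≡ 0 → size * (1 * (1 * product S)) * sifted (λ _ → true) 1 S + 2 ^ length S * (0 * size * (1 * (1 * product S))) ≡ 0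
      vanish z = cong₂ _+_ (trans (cong (size * (1 * (1 * product S)) *_) z) (*-zeroʳ (size * (1 * (1 * product S))))) (*-zeroʳ (2 ^ length S))

  generator : ∃ λ γ → Primitive K γ × (∀ {r} → IsPrimeDivisor N r → ¬ T (power r γ))
  generator with #-witness (sifted-whole-pos (primesOf N) (primesOf-All N) (primesOf-Unique N))
  ... | γ , t = γ , generated (power⇒≢𝟘 1 (1∣ N) (T-∧₁ t)) γ-free , γ-free
    where
      γ-free : ∀ {r} → IsPrimeDivisor N r → ¬ T (power r γ)
      γ-free (pr , r∣N) = free⇒ (∈-primesOf 0<N pr r∣N) (T-∧₂ {power 1 γ} t)

  power⇒∣ : ∀ {γ} → γ ≢ 𝟘 → (∀ {r} → IsPrimeDivisor N r → ¬ T (power r γ)) → ∀ {r} e → IsPrimeDivisor N r → T (power r (γ ^ᴷ e)) → r ∣ e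
  power⇒∣ {γ} γ≢0 γ-free {r} e (pr , r∣N) t with r ∣? e
  ... | yes d = d
  ... | no r∤e = contradiction (fromWitness (pow-coprime y (prime-coprime pr r∤e) ye yr)) (γ-free (pr , r∣N))
    where
      y = γ ^ᴷ (N ÷ r)
      ye : y ^ᴷ e ≡ 𝟙
      ye = trans (sym (pow-* γ (N ÷ r) e)) (trans (cong (γ ^ᴷ_) (*-comm (N ÷ r) e)) (trans (pow-* γ e (N ÷ r)) (power⇒ {r} t)))
      yr : y ^ᴷ r ≡ 𝟙
      yr = trans (sym (pow-* γ (N ÷ r) r)) (trans (cong (γ ^ᴷ_) (÷-* {d = r} 0<N r∣N)) (fermat γ≢0))

  ∣⇒power : ∀ {γ} → γ ≢ 𝟘 → ∀ {r} e → IsPrimeDivisor N r → r ∣ e → T (power r (γ ^ᴷ e))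
  ∣⇒power {γ} γ≢0 {r} e (pr , r∣N) (divides c refl) = fromWitness (trans (sym (pow-* γ (c * r) (N ÷ r)))
    (trans (cong (γ ^ᴷ_) (trans (*-assoc c r (N ÷ r)) (cong (c *_) (trans (*-comm r (N ÷ r)) (÷-* {d = r} 0<N r∣N))))) (pow-multiple c (fermat γ≢0))))

  -- Write x = γ^i and multiply by γ^(M j), which has order dividing w. Let j be the product of the
  -- primes dividing N but neither M nor i. Then no prime r of N divides M j + i: for r ∣ M this is
  -- the hypothesis on x, and otherwise r divides exactly one of j and i.
  adjust : ∀ {x} M w → M * w ≡ N → x ≢ 𝟘 → (∀ {r} → IsPrimeDivisor M r → ¬ T (power r x)) →
    ∃ λ c → c ^ᴷ w ≡ 𝟙 × Primitive K (c · x)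
  adjust {x} M w Mw≡N x≢0 x-free with generator
  ... | γ , (γ≢0 , γ-gen) , γ-free with γ-gen x x≢0
  ...   | i , refl = γ ^ᴷ (M * j) , cw , generated (·≢𝟘 (pow-≢𝟘 (M * j) γ≢0) x≢0) free′
    where
      extra? : ∀ r → Dec ((¬ (r ∣ M)) × (¬ (r ∣ i)))
      extra? r = ¬? (r ∣? M) ×-dec ¬? (r ∣? i)
      extras = filter extra? (primesOf N)
      j = product extras
      cw : (γ ^ᴷ (M * j)) ^ᴷ w ≡ 𝟙
      cw = trans (sym (pow-* γ (M * j) w)) (trans (cong (γ ^ᴷ_) (trans (lemma M j w) (cong (j *_) Mw≡N))) (pow-multiple j (fermat γ≢0)))
        where
          lemma : ∀ m j w → m * j * w ≡ j * (m * w)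
          lemma = solve-∀
      extras-prime : All Prime extras
      extras-prime = Allₚ.filter⁺ extra? (All.map proj₁ (primesOf-All N))
      free′ : ∀ {r} → IsPrimeDivisor N r → ¬ T (power r (γ ^ᴷ (M * j) · γ ^ᴷ i))
      free′ {r} (pr , r∣N) t = cases (r ∣? M) (r ∣? i)
        where
          r∣sum : r ∣ M * j + i
          r∣sum = power⇒∣ γ≢0 γ-free (M * j + i) (pr , r∣N) (subst (T ∘ power r) (sym (pow-+ γ (M * j) i)) t)
          cases : Dec (r ∣ M) → Dec (r ∣ i) → ⊥
          cases (yes r∣M) _ = x-free (pr , r∣M) (∣⇒power γ≢0 i (pr , r∣N) (∣m+n∣m⇒∣n r∣sum (∣-trans r∣M (m∣m*n j))))
          cases (no r∤M) (no r∤i) = r∤i (∣m+n∣m⇒∣n r∣sum (∣-trans (∈⇒∣product (∈ₚ.∈-filter⁺ extra? (∈-primesOf 0<N pr r∣N) (r∤M , r∤i))) (n∣m*n M)))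
            where
              ∈⇒∣product : ∀ {r S} → r ∈ S → r ∣ product S
              ∈⇒∣product {r} {_ ∷ S} (here refl) = m∣m*n (product S)
              ∈⇒∣product {r} {s ∷ S} (there h) = ∣-trans (∈⇒∣product h) (n∣m*n s)
          cases (no r∤M) (yes r∣i) with euclidsLemma M j pr (∣m+n∣m⇒∣n (subst (r ∣_) (+-comm (M * j) i) r∣sum) r∣i)
          ... | inj₁ r∣M = r∤M r∣M
          ... | inj₂ r∣j = proj₂ (proj₂ (∈ₚ.∈-filter⁻ extra? {xs = primesOf N} (factorisationHasAllPrimeFactors pr r∣j extras-prime))) r∣i

  -- Additive subgroups and kernels

  -- Invariance under translation by members yields closure under addition and, at x = -u, under
  -- negation. It is also the form in which `SecondMoment` takes its hypothesis on A, with U = A.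
  record IsSubgroup (V : 𝕂 → Bool) : Set where
    field
      has-𝟘 : T (V 𝟘)
      invariant : ∀ {u} x → T (V u) → V (x ⊹ u) ≡ V x
  open IsSubgroup public

  Additive : (𝕂 → 𝕂) → Set
  Additive f = ∀ x y → f (x ⊹ y) ≡ f x ⊹ f y

  additive-𝟘 : ∀ {f} → Additive f → f 𝟘 ≡ 𝟘
  additive-𝟘 {f} add = trans (solveR 1 (λ a → a := a :+ a :- a) refl (f 𝟘))
    (trans (cong (_⊝ f 𝟘) (trans (sym (add 𝟘 𝟘)) (cong f (⊹-idˡ 𝟘)))) (⊖-invʳ _))

  additive-⊖ : ∀ {f} → Additive f → ∀ x → f (⊖ x) ≡ ⊖ f x
  additive-⊖ {f} add x = trans (solveR 2 (λ a b → a := a :+ b :- b) refl (f (⊖ x)) (f x))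
    (trans (cong (_⊝ f x) (trans (sym (add (⊖ x) x)) (trans (cong f (⊖-invˡ x)) (additive-𝟘 add)))) (⊹-idˡ _))

  ker : (𝕂 → 𝕂) → 𝕂 → Bool
  ker f x = ⌊ f x ≟ᴷ 𝟘 ⌋

  ker-isSubgroup : ∀ {f} → Additive f → IsSubgroup (ker f)
  ker-isSubgroup {f} add = record
    { has-𝟘 = fromWitness (additive-𝟘 add)
    ; invariant = λ {u} x t → cong (λ z → ⌊ z ≟ᴷ 𝟘 ⌋) (trans (add x u) (trans (cong (f x ⊹_) (toWitness {a? = f u ≟ᴷ 𝟘} t)) (⊹-idʳ _))) }

  subgroup-fibre : ∀ {f} → Additive f → ∀ (B : 𝕂 → Bool) → IsSubgroup B → ∀ y →
    # (λ x → B x ∧ ⌊ f x ≟ᴷ y ⌋) ≤ # (λ x → B x ∧ ker f x)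
  subgroup-fibre {f} add B sB y with any? (λ x → T? (B x ∧ ⌊ f x ≟ᴷ y ⌋))
  ... | no none = ≤-trans (≤-reflexive (#-empty (λ x t → none (x , t)))) z≤n
  ... | yes (x₀ , t₀) = ≤-trans (≤-reflexive (∑-translate _ x₀)) (#-⊆ λ x t →
      T-∧ (subst T (invariant sB x (T-∧₁ t₀)) (T-∧₁ t))
        (fromWitness (trans (solveR 2 (λ a b → a := a :+ b :- b) refl (f x) (f x₀))
          (trans (cong (_⊝ f x₀) (trans (sym (add x x₀)) (trans (toWitness {a? = f (x ⊹ x₀) ≟ᴷ y} (T-∧₂ {B (x ⊹ x₀)} t)) (sym (toWitness {a? = f x₀ ≟ᴷ y} (T-∧₂ {B x₀} t₀)))))) (⊖-invʳ _)))))

  ker-∘ : ∀ {f g} → Additive g → # ker (λ x → f (g x)) ≤ # ker f * # ker g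
  ker-∘ {f} {g} add = #-fibres (ker (λ x → f (g x))) (ker f) g (# ker g) (λ x t → t) λ y →
    ≤-trans (#-⊆ λ x t → T-∧₂ {ker (λ x → f (g x)) x} t)
      (≤-trans (subgroup-fibre add (λ _ → true) (record { has-𝟘 = tt ; invariant = λ _ _ → refl }) y) ≤-refl)

  ∧-isSubgroup : ∀ {V W} → IsSubgroup V → IsSubgroup W → IsSubgroup (λ x → V x ∧ W x)
  ∧-isSubgroup {V} {W} v w = record
    { has-𝟘 = T-∧ (has-𝟘 v) (has-𝟘 w)
    ; invariant = λ {u} x t → cong₂ _∧_ (invariant v x (T-∧₁ t)) (invariant w x (T-∧₂ {V u} t)) }

  elements : List 𝕂
  elements = Data.List.tabulate (Inverse.to enum)

  ∈-elements : ∀ x → x ∈ elements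
  ∈-elements x = subst (_∈ elements) (Inverse.inverseˡ enum refl) (∈ₚ.∈-tabulate⁺ (Inverse.from enum x))

  listOf : (𝕂 → Bool) → List 𝕂
  listOf A = Data.List.filterᵇ A elements

  ∈-listOf : ∀ {A : 𝕂 → Bool} {x} → T (A x) → x ∈ listOf A
  ∈-listOf {A} {x} t = ∈ₚ.∈-filter⁺ (λ x → T? (A x)) (∈-elements x) t

  ∈-listOf⁻ : ∀ {A : 𝕂 → Bool} {x} → x ∈ listOf A → T (A x)
  ∈-listOf⁻ {A} {x} h = proj₂ (∈ₚ.∈-filter⁻ (λ x → T? (A x)) {xs = elements} h)

  listOf-Unique : ∀ A → Unique (listOf A)
  listOf-Unique A = Uniqueₚ.filter⁺ (λ x → T? (A x))
    (Uniqueₚ.tabulate⁺ {f = Inverse.to enum} (λ {i} {j} e → trans (sym (Inverse.inverseʳ enum refl)) (trans (cong (Inverse.from enum) e) (Inverse.inverseʳ enum refl))))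

  -- Polynomials acting through an additive map

  module ActionOf (F : DField) where
    private module P = Polynomials F

    -- Constants act by multiplication and X acts as τ. With a Frobenius map for τ this turns
    -- relations between conjugates into polynomials; with multiplication by ζ it is evaluation at
    -- ζ.
    module Action
      (j : P.Carrier → 𝕂) (j-+ : ∀ a b → j (a P.⊹ b) ≡ j a ⊹ j b) (j-· : ∀ a b → j (a P.· b) ≡ j a · j b)
      (j-𝟘 : j P.𝟘 ≡ 𝟘) (j-𝟙 : j P.𝟙 ≡ 𝟙)
      (τ : 𝕂 → 𝕂) (τ-+ : Additive τ) (τ-j : ∀ a x → τ (j a · x) ≡ j a · τ x) where

      act : P.Poly → 𝕂 → 𝕂
      act [] x = 𝟘
      act (a ∷ p) x = j a · x ⊹ τ (act p x)

      act-⊕ : ∀ p q x → act (p P.⊕ q) x ≡ act p x ⊹ act q x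
      act-⊕ [] q x = sym (⊹-idˡ _)
      act-⊕ (a ∷ p) [] x = sym (⊹-idʳ _)
      act-⊕ (a ∷ p) (b ∷ q) x = trans (cong₂ (λ u v → u · x ⊹ v) (j-+ a b) (trans (cong τ (act-⊕ p q x)) (τ-+ _ _)))
        (solveR 5 (λ a b x u v → (a :+ b) :* x :+ (u :+ v) := (a :* x :+ u) :+ (b :* x :+ v)) refl (j a) (j b) x _ _)

      act-⊙ : ∀ a p x → act (a P.⊙ p) x ≡ j a · act p x
      act-⊙ a [] x = sym (·-zeroʳ _)
      act-⊙ a (b ∷ p) x = trans (cong₂ (λ u v → u · x ⊹ v) (j-· a b) (trans (cong τ (act-⊙ a p x)) (τ-j a _)))
        (solveR 4 (λ a b x u → (a :* b) :* x :+ a :* u := a :* (b :* x :+ u)) refl (j a) (j b) x _)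

      act-additive : ∀ p → Additive (act p)
      act-additive [] x y = sym (⊹-idˡ 𝟘)
      act-additive (a ∷ p) x y = trans (cong (λ v → j a · (x ⊹ y) ⊹ v) (trans (cong τ (act-additive p x y)) (τ-+ _ _)))
        (solveR 5 (λ a x y u v → a :* (x :+ y) :+ (u :+ v) := (a :* x :+ u) :+ (a :* y :+ v)) refl (j a) x y _ _)

      act-τ : ∀ p x → act p (τ x) ≡ τ (act p x)
      act-τ [] x = sym (additive-𝟘 τ-+)
      act-τ (a ∷ p) x = trans (cong₂ _⊹_ (sym (τ-j a x)) (cong τ (act-τ p x))) (sym (τ-+ _ _))

      act-⊗ : ∀ p q x → act (p P.⊗ q) x ≡ act p (act q x)
      act-⊗ [] q x = refl
      act-⊗ (a ∷ p) q x = trans (act-⊕ (a P.⊙ q) (P.𝟘 ∷ p P.⊗ q) x) (cong₂ _⊹_ (act-⊙ a q x)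
        (trans (cong₂ _⊹_ (trans (cong (_· x) j-𝟘) (·-zeroˡ x)) (cong τ (act-⊗ p q x))) (⊹-idˡ _)))

      act-≈[] : ∀ p x → p P.≈ [] → act p x ≡ 𝟘
      act-≈[] [] x h = refl
      act-≈[] (a ∷ p) x h = trans (cong₂ (λ u v → u · x ⊹ v) (trans (cong j (P.at h 0)) j-𝟘)
        (trans (cong τ (act-≈[] p x (P.coeffs λ i → P.at h (suc i)))) (additive-𝟘 τ-+))) (trans (⊹-idʳ _) (·-zeroˡ x))

      act-≈ : ∀ p q x → p P.≈ q → act p x ≡ act q x
      act-≈ [] q x h = sym (act-≈[] q x (P.≈-sym h))
      act-≈ (a ∷ p) [] x h = act-≈[] (a ∷ p) x h
      act-≈ (a ∷ p) (b ∷ q) x h = cong₂ (λ u v → j u · x ⊹ τ v) (P.at h 0) (act-≈ p q x (P.coeffs λ i → P.at h (suc i)))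

      act-comm : ∀ p q x → act p (act q x) ≡ act q (act p x)
      act-comm p q x = trans (sym (act-⊗ p q x)) (trans (act-≈ (p P.⊗ q) (q P.⊗ p) x (P.⊗-comm p q)) (act-⊗ q p x))

      act-one : ∀ x → act P.one x ≡ x
      act-one x = trans (cong₂ (λ u v → u · x ⊹ v) j-𝟙 (additive-𝟘 τ-+)) (trans (⊹-idʳ _) (·-idˡ x))

      cofactors : List P.Factor → List (P.Factor × P.Poly)
      cofactors [] = []
      cofactors (f ∷ fs) = (f , P.∏ᴾ fs) ∷ map (λ (g , c) → g , P.⟦ P.Factor.poly f ⟧ P.⊗ c) (cofactors fs)

      -- Recursion on the factors, with x replaced by its image under f. What remains is c = e ∏ fs.
      -- If f divides e, the whole product divides c. Otherwise 1 = α f + β e, and since both f and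
      -- e kill y = ∏ fs · x, this y is 0: the cofactor of f kills x. Repeated factors cause no
      -- trouble, as no coprimality of different factors enters.
      annihilator : ∀ fs x c → act (P.∏ᴾ fs) x ≡ 𝟘 → act c x ≡ 𝟘 →
        P.∏ᴾ fs P.∣ᴾ c ⊎ Any (λ (_ , c) → act c x ≡ 𝟘) (cofactors fs)
      annihilator [] x c _ _ = inj₁ (c , P.≈-sym (P.≈-trans (P.⊗-comm c P.one) (P.⊗-idˡ c)))
      annihilator (f ∷ fs) x c ux≡0 cx≡0 with annihilator fs (act 𝐟 x) c
          (trans (act-comm (P.∏ᴾ fs) 𝐟 x) (trans (sym (act-⊗ 𝐟 (P.∏ᴾ fs) x)) ux≡0))
          (trans (act-comm c 𝐟 x) (trans (cong (act 𝐟) cx≡0) (additive-𝟘 (act-additive 𝐟))))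
        where 𝐟 = P.⟦ P.Factor.poly f ⟧
      ... | inj₂ any = inj₂ (there (lift (cofactors fs) any))
        where
          𝐟 = P.⟦ P.Factor.poly f ⟧
          lift : ∀ cs → Any (λ (_ , c) → act c (act 𝐟 x) ≡ 𝟘) cs → Any (λ (_ , c) → act c x ≡ 𝟘) (map (λ (g , c) → g , 𝐟 P.⊗ c) cs)
          lift ((g , c) ∷ cs) (here e) = here (trans (act-⊗ 𝐟 c x) (trans (act-comm 𝐟 c x) e))
          lift (_ ∷ cs) (there a) = there (lift cs a)
      ... | inj₁ (e , c≈) with P.Factor.irreducible f e
      ...   | inj₁ (e′ , e≈) = inj₁ (e′ , P.≈-trans c≈ (P.≈-trans (P.⊗-congˡ (P.∏ᴾ fs) e≈) (P.⊗-assoc e′ P.⟦ P.Factor.poly f ⟧ (P.∏ᴾ fs))))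
      ...   | inj₂ (α , β , one≈) = inj₂ (here killed)
        where
          open ≡-Reasoning
          𝐟 = P.⟦ P.Factor.poly f ⟧
          y = act (P.∏ᴾ fs) x
          killed : y ≡ 𝟘
          killed = begin
            y ≡⟨ sym (act-one y) ⟩
            act P.one y ≡⟨ act-≈ P.one (α P.⊗ 𝐟 P.⊕ β P.⊗ e) y one≈ ⟩
            act (α P.⊗ 𝐟 P.⊕ β P.⊗ e) y ≡⟨ act-⊕ (α P.⊗ 𝐟) (β P.⊗ e) y ⟩
            act (α P.⊗ 𝐟) y ⊹ act (β P.⊗ e) y ≡⟨ cong₂ _⊹_ (act-⊗ α 𝐟 y) (act-⊗ β e y) ⟩
            act α (act 𝐟 y) ⊹ act β (act e y)
              ≡⟨ cong₂ (λ u v → act α u ⊹ act β v) (trans (sym (act-⊗ 𝐟 (P.∏ᴾ fs) x)) ux≡0)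
                   (trans (sym (act-⊗ e (P.∏ᴾ fs) x)) (trans (sym (act-≈ c (e P.⊗ P.∏ᴾ fs) x c≈)) cx≡0)) ⟩
            act α 𝟘 ⊹ act β 𝟘 ≡⟨ cong₂ _⊹_ (additive-𝟘 (act-additive α)) (additive-𝟘 (act-additive β)) ⟩
            𝟘 ⊹ 𝟘 ≡⟨ ⊹-idˡ 𝟘 ⟩
            𝟘 ∎

      module KernelSizes (q : ℕ) (ker-poly : ∀ {d} (v : Vec P.Carrier d) → # ker (act P.⟦ v ⟧) ≤ q ^ d) where

        ker-⊗ : ∀ p r → # ker (act (p P.⊗ r)) ≤ # ker (act p) * # ker (act r)
        ker-⊗ p r = ≤-trans (#-⊆ λ x t → fromWitness (trans (sym (act-⊗ p r x)) (toWitness {a? = act (p P.⊗ r) x ≟ᴷ 𝟘} t))) (ker-∘ (act-additive r))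

        ker-∏ : ∀ fs → # ker (act (P.∏ᴾ fs)) ≤ q ^ P.degrees fs
        ker-∏ [] = ker-poly []
        ker-∏ (f ∷ fs) = ≤-trans (ker-⊗ P.⟦ P.Factor.poly f ⟧ (P.∏ᴾ fs)) (≤-trans (*-mono-≤ (ker-poly (P.Factor.poly f)) (ker-∏ fs))
          (≤-reflexive (sym (^-distribˡ-+-* q (P.degree f) (P.degrees fs)))))

        ker-cofactors : ∀ fs → All (λ (g , c) → # ker (act c) * q ^ P.degree g ≤ q ^ P.degrees fs) (cofactors fs)
        ker-cofactors [] = []
        ker-cofactors (f ∷ fs) = ≤-trans (*-monoˡ-≤ _ (ker-∏ fs)) (≤-reflexive (trans (*-comm (q ^ P.degrees fs) _) (sym (^-distribˡ-+-* q (P.degree f) (P.degrees fs)))))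
          ∷ lift (cofactors fs) (ker-cofactors fs)
          where
            𝐟 = P.⟦ P.Factor.poly f ⟧
            lift : ∀ cs → All (λ (g , c) → # ker (act c) * q ^ P.degree g ≤ q ^ P.degrees fs) cs →
              All (λ (g , c) → # ker (act c) * q ^ P.degree g ≤ q ^ P.degrees (f ∷ fs)) (map (λ (g , c) → g , 𝐟 P.⊗ c) cs)
            lift [] [] = []
            lift ((g , c) ∷ cs) (h ∷ hs) = le ∷ lift cs hs
              where
                open ≤-Reasoning
                le : # ker (act (𝐟 P.⊗ c)) * q ^ P.degree g ≤ q ^ P.degrees (f ∷ fs)
                le = begin
                  # ker (act (𝐟 P.⊗ c)) * q ^ P.degree g ≤⟨ *-monoˡ-≤ _ (≤-trans (ker-⊗ 𝐟 c) (*-monoˡ-≤ _ (ker-poly (P.Factor.poly f)))) ⟩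
                  q ^ P.degree f * # ker (act c) * q ^ P.degree g ≡⟨ *-assoc (q ^ P.degree f) _ _ ⟩
                  q ^ P.degree f * (# ker (act c) * q ^ P.degree g) ≤⟨ *-monoʳ-≤ (q ^ P.degree f) h ⟩
                  q ^ P.degree f * q ^ P.degrees fs ≡⟨ sym (^-distribˡ-+-* q (P.degree f) (P.degrees fs)) ⟩
                  q ^ P.degrees (f ∷ fs) ∎

      cofactors-∏ : ∀ fs → All (λ (g , c) → P.⟦ P.Factor.poly g ⟧ P.⊗ c P.≈ P.∏ᴾ fs) (cofactors fs)
      cofactors-∏ [] = []
      cofactors-∏ (f ∷ fs) = P.≈-refl ∷ lift (cofactors fs) (cofactors-∏ fs)
        where
          𝐟 = P.⟦ P.Factor.poly f ⟧
          lift : ∀ cs → All (λ (g , c) → P.⟦ P.Factor.poly g ⟧ P.⊗ c P.≈ P.∏ᴾ fs) cs →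
            All (λ (g , c) → P.⟦ P.Factor.poly g ⟧ P.⊗ c P.≈ 𝐟 P.⊗ P.∏ᴾ fs) (map (λ (g , c) → g , 𝐟 P.⊗ c) cs)
          lift [] [] = []
          lift ((g , c) ∷ cs) (h ∷ hs) = P.≈-trans (P.≈-sym (P.⊗-assoc 𝐠 𝐟 c)) (P.≈-trans (P.⊗-congˡ c (P.⊗-comm 𝐠 𝐟))
              (P.≈-trans (P.⊗-assoc 𝐟 𝐠 c) (P.⊗-congʳ 𝐟 h))) ∷ lift cs hs
            where 𝐠 = P.⟦ P.Factor.poly g ⟧

      cofactors-factors : ∀ fs → map proj₁ (cofactors fs) ≡ fs
      cofactors-factors [] = refl
      cofactors-factors (f ∷ fs) = cong (f ∷_) (trans (sym (Listₚ.map-∘ (cofactors fs))) (cofactors-factors fs))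

  -- Soundness of the coordinate computations

  module Evaluation (p : ℕ) {{_ : NonZero p}} {d-1 : ℕ} (rel : Vec ℕ (suc d-1)) where
    open Coordinates p rel public

    -- Nothing is claimed about injectivity, and `rel` need not come from an irreducible polynomial:
    -- only equalities of vectors are used, and these survive evaluation.
    ev : ∀ {k} → 𝕂 → Vec ℕ k → 𝕂
    ev θ [] = 𝟘
    ev θ (a ∷ v) = a ⋆ 𝟙 ⊹ θ · ev θ v

    module At (p⋆𝟙 : p ⋆ 𝟙 ≡ 𝟘) (θ : 𝕂) (θ-rel : θ ^ᴷ suc d-1 ≡ ev θ rel) where

      private
        ⟪_⟫ : ∀ {k} → Vec ℕ k → 𝕂
        ⟪_⟫ = ev θ

        mod-⋆ : ∀ a → (a % p) ⋆ 𝟙 ≡ a ⋆ 𝟙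
        mod-⋆ a = sym (trans (cong (_⋆ 𝟙) (m≡m%n+[m/n]*n a p)) (trans (×-homo-+ 𝟙 (a % p) (a / p * p))
          (trans (cong ((a % p) ⋆ 𝟙 ⊹_) (trans (×1-homo-* (a / p) p) (trans (cong ((a / p) ⋆ 𝟙 ·_) p⋆𝟙) (·-zeroʳ _)))) (⊹-idʳ _))))

        ev-add : ∀ {k} (v w : Vec ℕ k) → ⟪ addV v w ⟫ ≡ ⟪ v ⟫ ⊹ ⟪ w ⟫
        ev-add [] [] = sym (⊹-idˡ 𝟘)
        ev-add (a ∷ v) (b ∷ w) = trans (cong₂ (λ s t → s ⊹ θ · t) (trans (mod-⋆ (a + b)) (×-homo-+ 𝟙 a b)) (ev-add v w))
          (solveR 5 (λ a b t x y → (a :+ b) :+ t :* (x :+ y) := (a :+ t :* x) :+ (b :+ t :* y)) refl (a ⋆ 𝟙) (b ⋆ 𝟙) θ _ _)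

        ev-scale : ∀ {k} c (v : Vec ℕ k) → ⟪ scaleV c v ⟫ ≡ c ⋆ 𝟙 · ⟪ v ⟫
        ev-scale c [] = sym (·-zeroʳ _)
        ev-scale c (a ∷ v) = trans (cong₂ (λ s t → s ⊹ θ · t) (trans (mod-⋆ (c * a)) (×1-homo-* c a)) (ev-scale c v))
          (solveR 4 (λ c a t x → c :* a :+ t :* (c :* x) := c :* (a :+ t :* x)) refl (c ⋆ 𝟙) (a ⋆ 𝟙) θ _)

        ev-push : ∀ {k} a (v : Vec ℕ k) → a ⋆ 𝟙 ⊹ θ · ⟪ v ⟫ ≡ ⟪ proj₁ (push a v) ⟫ ⊹ proj₂ (push a v) ⋆ 𝟙 · θ ^ᴷ k
        ev-push a [] = trans (cong (a ⋆ 𝟙 ⊹_) (·-zeroʳ θ)) (trans (⊹-comm _ _) (cong (𝟘 ⊹_) (sym (·-idʳ _))))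
        ev-push {suc k} a (b ∷ v) = trans (cong (λ z → a ⋆ 𝟙 ⊹ θ · z) (ev-push b v))
          (solveR 5 (λ a t w o y → a :+ t :* (w :+ o :* y) := (a :+ t :* w) :+ o :* (t :* y)) refl (a ⋆ 𝟙) θ ⟪ proj₁ (push b v) ⟫ (proj₂ (push b v) ⋆ 𝟙) (θ ^ᴷ k))

        ev-const : ∀ c → ⟪ constV c ⟫ ≡ c ⋆ 𝟙
        ev-const c = trans (cong (λ z → c ⋆ 𝟙 ⊹ θ · z) (zeros d-1)) (trans (cong (c ⋆ 𝟙 ⊹_) (·-zeroʳ θ)) (⊹-idʳ _))
          where
            zeros : ∀ k → ⟪ Vec.replicate k 0 ⟫ ≡ 𝟘
            zeros zero = refl
            zeros (suc k) = trans (⊹-idˡ _) (trans (cong (θ ·_) (zeros k)) (·-zeroʳ θ))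

        ev-mul : ∀ {k} (v : Vec ℕ k) w → ⟪ mulV v w ⟫ ≡ ⟪ v ⟫ · ⟪ w ⟫
        ev-mul [] w = trans (ev-const 0) (sym (·-zeroˡ _))
        ev-mul (a ∷ v) w = begin
          ⟪ addV (scaleV a w) (reduceV (push 0 u)) ⟫ ≡⟨ ev-add (scaleV a w) _ ⟩
          ⟪ scaleV a w ⟫ ⊹ ⟪ addV (proj₁ (push 0 u)) (scaleV (proj₂ (push 0 u)) rel) ⟫ ≡⟨ cong₂ _⊹_ (ev-scale a w) (ev-add (proj₁ (push 0 u)) _) ⟩
          a ⋆ 𝟙 · ⟪ w ⟫ ⊹ (⟪ proj₁ (push 0 u) ⟫ ⊹ ⟪ scaleV (proj₂ (push 0 u)) rel ⟫)
            ≡⟨ cong (λ z → a ⋆ 𝟙 · ⟪ w ⟫ ⊹ (⟪ proj₁ (push 0 u) ⟫ ⊹ z)) (trans (ev-scale (proj₂ (push 0 u)) rel) (cong (proj₂ (push 0 u) ⋆ 𝟙 ·_) (sym θ-rel))) ⟩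
          a ⋆ 𝟙 · ⟪ w ⟫ ⊹ (⟪ proj₁ (push 0 u) ⟫ ⊹ proj₂ (push 0 u) ⋆ 𝟙 · θ ^ᴷ suc d-1) ≡⟨ cong (a ⋆ 𝟙 · ⟪ w ⟫ ⊹_) (trans (sym (ev-push 0 u)) (⊹-idˡ _)) ⟩
          a ⋆ 𝟙 · ⟪ w ⟫ ⊹ θ · ⟪ u ⟫ ≡⟨ cong (λ z → a ⋆ 𝟙 · ⟪ w ⟫ ⊹ θ · z) (ev-mul v w) ⟩
          a ⋆ 𝟙 · ⟪ w ⟫ ⊹ θ · (⟪ v ⟫ · ⟪ w ⟫) ≡⟨ solveR 4 (λ a t v w → a :* w :+ t :* (v :* w) := (a :+ t :* v) :* w) refl (a ⋆ 𝟙) θ ⟪ v ⟫ ⟪ w ⟫ ⟩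
          (a ⋆ 𝟙 ⊹ θ · ⟪ v ⟫) · ⟪ w ⟫ ∎
          where
            open ≡-Reasoning
            u = mulV v w

        ev-one : ⟪ constV 1 ⟫ ≡ 𝟙
        ev-one = trans (ev-const 1) (⊹-idʳ 𝟙)

      ev-pow : ∀ bs v → ⟪ powV bs v ⟫ ≡ ⟪ v ⟫ ^ᴷ value bs
      ev-pow [] v = ev-one
      ev-pow (b ∷ bs) v = step b (powV bs v) (ev-pow bs v)
        where
          y = ⟪ v ⟫
          k = value bs
          double : ∀ s → ⟪ s ⟫ ≡ y ^ᴷ k → ⟪ mulV s s ⟫ ≡ y ^ᴷ (2 * k)
          double s e = trans (ev-mul s s) (trans (cong₂ _·_ e e) (trans (sym (pow-+ y k k)) (cong (λ z → y ^ᴷ (k + z)) (sym (+-identityʳ k)))))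
          step : ∀ b s → ⟪ s ⟫ ≡ y ^ᴷ k → ⟪ stepV b v s ⟫ ≡ y ^ᴷ (ι b + 2 * k)
          step true s e = trans (ev-mul v (mulV s s)) (cong (y ·_) (double s e))
          step false s e = double s e

      order-sound : ∀ N′ x rs → T (orderTest N′ x rs) → ∀ {r} → r ∈ map proj₁ rs → ⟪ x ⟫ ^ᴷ (N′ ÷ r) ≢ 𝟙
      order-sound N′ x ((r , u) ∷ rs) t (there r∈) = order-sound N′ x rs (T-∧₂ {(value (binary 20 (N′ ÷ r)) ≡ᵇ N′ ÷ r) ∧ equalV (mulV (addV (powV (binary 20 (N′ ÷ r)) x) (constV (p ∸ 1))) u) (constV 1)} t) r∈
      order-sound N′ x ((r , u) ∷ rs) t (here refl) e = 0≢1 (begin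
        𝟘 ≡⟨ sym (·-zeroˡ _) ⟩
        𝟘 · ⟪ u ⟫ ≡⟨ cong (_· ⟪ u ⟫) (sym p⋆𝟙) ⟩
        (p ⋆ 𝟙) · ⟪ u ⟫ ≡⟨ cong (λ z → (z ⋆ 𝟙) · ⟪ u ⟫) (sym (m+[n∸m]≡n (>-nonZero⁻¹ p))) ⟩
        (𝟙 ⊹ (p ∸ 1) ⋆ 𝟙) · ⟪ u ⟫ ≡⟨ cong (λ z → (z ⊹ (p ∸ 1) ⋆ 𝟙) · ⟪ u ⟫) (sym (trans (ev-pow bs x) (trans (cong (⟪ x ⟫ ^ᴷ_) (T-≡ᵇ {value bs} {N′ ÷ r} (T-∧₁ t₁))) e))) ⟩
        (⟪ powV bs x ⟫ ⊹ (p ∸ 1) ⋆ 𝟙) · ⟪ u ⟫ ≡⟨ cong (_· ⟪ u ⟫) (sym (trans (ev-add (powV bs x) _) (cong (⟪ powV bs x ⟫ ⊹_) (ev-const (p ∸ 1))))) ⟩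
        ⟪ addV (powV bs x) (constV (p ∸ 1)) ⟫ · ⟪ u ⟫ ≡⟨ sym (ev-mul (addV (powV bs x) (constV (p ∸ 1))) u) ⟩
        ⟪ mulV (addV (powV bs x) (constV (p ∸ 1))) u ⟫ ≡⟨ cong ⟪_⟫ (toWitness {a? = Vecₚ.≡-dec _≟_ _ _} (T-∧₂ {value bs ≡ᵇ N′ ÷ r} t₁)) ⟩
        ⟪ constV 1 ⟫ ≡⟨ ev-one ⟩
        𝟙 ∎)
        where
          open ≡-Reasoning
          bs = binary 20 (N′ ÷ r)
          t₁ : T ((value bs ≡ᵇ N′ ÷ r) ∧ equalV (mulV (addV (powV bs x) (constV (p ∸ 1))) u) (constV 1))
          t₁ = T-∧₁ t

      unit-sound : ∀ (x u : Coords) → T (equalV (mulV x u) (constV 1)) → ⟪ x ⟫ ≢ 𝟘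
      unit-sound x u t e = 0≢1 (trans (sym (trans (cong (_· ⟪ u ⟫) e) (·-zeroˡ _))) (trans (sym (ev-mul x u)) (trans (cong ⟪_⟫ (toWitness {a? = Vecₚ.≡-dec _≟_ _ _} t)) ev-one)))

      data Represents (f : ℕ → 𝕂) : ℕ → ℕ → List Coords → Set where
        [] : ∀ {e} → Represents f e 0 []
        _∷_ : ∀ {e k v vs} → ⟪ v ⟫ ≡ f e → Represents f (suc e) k vs → Represents f e (suc k) (v ∷ vs)

      private
        drop-represents : ∀ {f vs} i e k → Represents f e (i + k) vs → Represents f (i + e) k (Data.List.drop i vs)
        drop-represents zero e k r = r
        drop-represents {f} {_ ∷ vs} (suc i) e k (_ ∷ r) = subst (λ z → Represents f z k (Data.List.drop i vs)) (+-suc i e) (drop-represents i (suc e) k r)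

        dot-sound : ∀ {f g vs ws} m a b j k → Represents f a (m + j) vs → Represents g b (m + k) ws →
          ⟪ dotV m vs ws ⟫ ≡ sumF K m (λ i → f (a + toℕ i) · g (b + toℕ i))
        dot-sound zero a b j k _ _ = ev-const 0
        dot-sound {f} {g} (suc m) a b j k (_∷_ {v = v} e r) (_∷_ {v = w} e′ r′) = trans (ev-add (mulV v w) _)
          (cong₂ _⊹_ (trans (ev-mul v w) (cong₂ _·_ (trans e (cong f (sym (+-identityʳ a)))) (trans e′ (cong g (sym (+-identityʳ b))))))
            (trans (dot-sound m (suc a) (suc b) j k r r′) (sumF-cong m λ i → cong₂ (λ u v → f u · g v) (sym (+-suc a (toℕ i))) (sym (+-suc b (toℕ i))))))
          where
            sumF-cong : ∀ k {f g : Fin k → 𝕂} → (∀ i → f i ≡ g i) → sumF K k f ≡ sumF K k g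
            sumF-cong zero h = refl
            sumF-cong (suc k) h = cong₂ _⊹_ (h fzero) (sumF-cong k (h ∘ fsuc))

      orbit-represents : ∀ f bs → (∀ e → f (suc e) ≡ f e ^ᴷ value bs) → ∀ k e v → ⟪ v ⟫ ≡ f e → Represents f e k (orbitV k bs v)
      orbit-represents f bs step zero e v h = []
      orbit-represents f bs step (suc k) e v h = h ∷ orbit-represents f bs step k (suc e) (powV bs v) (trans (ev-pow bs v) (trans (cong (_^ᴷ value bs) h) (sym (step e))))

      dual-sound : ∀ f g m xs ys → Represents f 0 (m + m) xs → Represents g 0 (m + m) ys → T (dualTest m xs ys) →
        ∀ (k i : Fin m) → sumF K m (λ j → f (toℕ i + toℕ j) · g (toℕ k + toℕ j)) ≡ (if toℕ k ≡ᵇ toℕ i then 1 else 0) ⋆ 𝟙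
      dual-sound f g m xs ys rx ry t k i = trans (sym (dot-sound m (toℕ i) (toℕ k) (m ∸ toℕ i) (m ∸ toℕ k) (part f xs rx i) (part g ys ry k)))
        (trans (cong ⟪_⟫ (toWitness {a? = Vecₚ.≡-dec _≟_ _ _} entry)) (ev-const (if toℕ k ≡ᵇ toℕ i then 1 else 0)))
        where
          entry : T (equalV (dotV m (Data.List.drop (toℕ i) xs) (Data.List.drop (toℕ k) ys)) (constV (if toℕ k ≡ᵇ toℕ i then 1 else 0)))
          entry = allBelow-sound m _ (allBelow-sound m _ t (toℕ k) (Finₚ.toℕ<n k)) (toℕ i) (Finₚ.toℕ<n i)
          part : ∀ f xs → Represents f 0 (m + m) xs → ∀ (i : Fin m) → Represents f (toℕ i) (m + (m ∸ toℕ i)) (Data.List.drop (toℕ i) xs)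
          part f xs r i = subst (λ z → Represents f z (m + (m ∸ toℕ i)) (Data.List.drop (toℕ i) xs)) (+-identityʳ (toℕ i))
            (drop-represents (toℕ i) 0 (m + (m ∸ toℕ i)) (subst (λ z → Represents f 0 z xs) eq r))
            where
              i≤m : toℕ i ≤ m
              i≤m = <⇒≤ (Finₚ.toℕ<n i)
              eq : m + m ≡ toℕ i + (m + (m ∸ toℕ i))
              eq = trans (cong (m +_) (sym (m+[n∸m]≡n i≤m))) (lemma m (toℕ i) (m ∸ toℕ i))
                where
                  lemma : ∀ a b c → a + (b + c) ≡ b + (a + c)
                  lemma = solve-∀

-- The field of qⁿ elements and its subfields

module Extension (K : FiniteField) (q n : ℕ) (q-pp : IsPrimePower q) (0<n : 0 < n) (size≡ : FiniteField.size K ≡ q ^ n) where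
  open Field K

  private
    char-p char-e : ℕ
    char-p = proj₁ q-pp
    char-e = proj₁ (proj₂ q-pp)
    p-prime : Prime char-p
    p-prime = proj₁ (proj₂ (proj₂ q-pp))
    q≡p^e : q ≡ char-p ^ char-e
    q≡p^e = proj₂ (proj₂ (proj₂ (proj₂ q-pp)))

  1<q : 1 < q
  1<q = subst (1 <_) (sym q≡p^e) (≤-trans (prime>1 p-prime) (≤-trans (≤-reflexive (sym (^-identityʳ char-p))) (^-monoʳ-≤ char-p {{prime⇒nonZero p-prime}} (proj₁ (proj₂ (proj₂ (proj₂ q-pp)))))))

  private instance
    q-nonZero : NonZero q
    q-nonZero = >-nonZero (<⇒≤ 1<q)

  p⋆𝟙 : char-p ⋆ 𝟙 ≡ 𝟘
  p⋆𝟙 = char char-p (char-e * n) (trans size≡ (trans (cong (_^ n) q≡p^e) (^-*-assoc char-p char-e n)))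

  frobenius : ℕ → 𝕂 → 𝕂
  frobenius l x = x ^ᴷ (q ^ l)

  frobenius-+ : ∀ l → Additive (frobenius l)
  frobenius-+ l x y = subst (λ z → (x ⊹ y) ^ᴷ z ≡ x ^ᴷ z ⊹ y ^ᴷ z) (sym (trans (cong (_^ l) q≡p^e) (^-*-assoc char-p char-e l)))
    (Frobenius.frob char-p p-prime p⋆𝟙 (char-e * l) x y)

  pow-size : ∀ x → x ^ᴷ size ≡ x
  pow-size x = trans (cong (x ^ᴷ_) (sym sN≡size)) (help (x ≟ᴷ 𝟘))
    where
      help : Dec (x ≡ 𝟘) → x · x ^ᴷ N ≡ x
      help (yes refl) = ·-zeroˡ _
      help (no h) = trans (cong (x ·_) (fermat h)) (·-idʳ x)

  0<factorsˡ : ∀ l m → l * m ≡ n → 0 < l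
  0<factorsˡ zero m lm≡n = subst (0 <_) (sym lm≡n) 0<n
  0<factorsˡ (suc l) m _ = z<s

  module Level (l m-1 : ℕ) (lm≡n : l * suc m-1 ≡ n) where
    m qˡ : ℕ
    m = suc m-1
    qˡ = q ^ l

    τ : 𝕂 → 𝕂
    τ = frobenius l

    0<l : 0 < l
    0<l = 0<factorsˡ l m lm≡n

    1<qˡ : 1 < qˡ
    1<qˡ = ≤-trans 1<q (≤-trans (≤-reflexive (sym (^-identityʳ q))) (^-monoʳ-≤ q 0<l))

    qˡ^m : qˡ ^ m ≡ q ^ n
    qˡ^m = trans (^-*-assoc q l m) (cong (q ^_) lm≡n)

    𝔽 : Set
    𝔽 = Σ 𝕂 (InSubfield K q l)

    𝔽-≡ : {a b : 𝔽} → proj₁ a ≡ proj₁ b → a ≡ b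
    𝔽-≡ {a , h} {.a , h′} refl = cong (a ,_) (uip h h′)

    τ-𝟙 : τ 𝟙 ≡ 𝟙
    τ-𝟙 = pow-𝟙 qˡ

    τ-· : ∀ x y → τ (x · y) ≡ τ x · τ y
    τ-· x y = pow-· x y qˡ

    subfield : DField
    subfield = record
      { Carrier = 𝔽
      ; _⊹_ = λ (a , h) (b , k) → a ⊹ b , trans (frobenius-+ l a b) (cong₂ _⊹_ h k)
      ; _·_ = λ (a , h) (b , k) → a · b , trans (τ-· a b) (cong₂ _·_ h k)
      ; ⊖_ = λ (a , h) → ⊖ a , trans (additive-⊖ (frobenius-+ l) a) (cong ⊖_ h)
      ; 𝟘 = 𝟘 , additive-𝟘 (frobenius-+ l)
      ; 𝟙 = 𝟙 , τ-𝟙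
      ; isCommutativeRing = record
        { isRing = record
          { +-isAbelianGroup = record
            { isGroup = record
              { isMonoid = record
                { isSemigroup = record
                  { isMagma = record { isEquivalence = isEquivalence ; ∙-cong = cong₂ _ }
                  ; assoc = λ _ _ _ → 𝔽-≡ (⊹-assoc _ _ _) }
                ; identity = (λ _ → 𝔽-≡ (⊹-idˡ _)) , (λ _ → 𝔽-≡ (⊹-idʳ _)) }
              ; inverse = (λ _ → 𝔽-≡ (⊖-invˡ _)) , (λ _ → 𝔽-≡ (⊖-invʳ _))
              ; ⁻¹-cong = λ { refl → refl } }
            ; comm = λ _ _ → 𝔽-≡ (⊹-comm _ _) }
          ; *-cong = cong₂ _
          ; *-assoc = λ _ _ _ → 𝔽-≡ (·-assoc _ _ _)
          ; *-identity = (λ _ → 𝔽-≡ (·-idˡ _)) , (λ _ → 𝔽-≡ (·-idʳ _))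
          ; distrib = (λ _ _ _ → 𝔽-≡ (·-distribˡ _ _ _)) , (λ _ _ _ → 𝔽-≡ (·-distribʳ _ _ _)) }
        ; *-comm = λ _ _ → 𝔽-≡ (·-comm _ _) }
      ; 𝟘≢𝟙 = λ e → 0≢1 (cong proj₁ e)
      ; inverse = λ (a , h) a≢0 → let a≢0′ = λ e → a≢0 (𝔽-≡ e) in
          (inv a≢0′ , ·-cancelˡ a≢0′ (trans (cong (_· τ (inv a≢0′)) (sym h)) (trans (sym (τ-· a _)) (trans (cong τ (inv-r a≢0′)) (trans τ-𝟙 (sym (inv-r a≢0′))))))) , 𝔽-≡ (inv-r a≢0′)
      ; _≟ᶠ_ = λ a b → map′ 𝔽-≡ (cong proj₁) (proj₁ a ≟ᴷ proj₁ b)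
      ; search = λ {P} {R} f → Data.Sum.map₁ (λ g (a , h) → g a h) (searchK {λ a → ∀ h → P (a , h)} {R} (λ a → test {P} {R} f a (τ a ≟ᴷ a)))
      }
      where
        test : ∀ {P : 𝔽 → Set} {R : Set} → (∀ a → P a ⊎ R) → ∀ a → Dec (τ a ≡ a) → (∀ h → P (a , h)) ⊎ R
        test f a (no ¬h) = inj₁ λ h → contradiction h ¬h
        test {P} f a (yes h) = Data.Sum.map₁ (λ pf h′ → subst (λ z → P (a , z)) (uip h h′) pf) (f (a , h))

    module P = Polynomials subfield

    open ActionOf.Action subfield proj₁ (λ _ _ → refl) (λ _ _ → refl) refl refl τ (frobenius-+ l)
      (λ (a , h) x → trans (τ-· a x) (cong (_· τ x) h)) public

    iterate-τ : ℕ → 𝕂 → 𝕂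
    iterate-τ i x = x ^ᴷ (qˡ ^ i)

    τ-iterate : ∀ i x → τ (iterate-τ i x) ≡ iterate-τ (suc i) x
    τ-iterate i x = trans (sym (pow-* x (qˡ ^ i) qˡ)) (cong (x ^ᴷ_) (*-comm (qˡ ^ i) qˡ))

    iterate-τ-m : ∀ x → iterate-τ m x ≡ x
    iterate-τ-m x = trans (cong (x ^ᴷ_) (trans qˡ^m (sym size≡))) (pow-size x)

    private
      -- The linearised polynomial Σ aⱼ x^(qˡ^(i+j)). At i = 0 it computes `act`, and for a monic
      -- polynomial of degree d it is monic of degree qˡ^d, which bounds the kernel.
      expanded : ℕ → P.Poly → 𝕂 → 𝕂
      expanded i [] x = 𝟘
      expanded i (a ∷ v) x = proj₁ a · x ^ᴷ (qˡ ^ i) ⊹ expanded (suc i) v x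

      expanded≡act : ∀ i v x → expanded i v x ≡ act v (iterate-τ i x)
      expanded≡act i [] x = refl
      expanded≡act i (a ∷ v) x = cong (proj₁ a · iterate-τ i x ⊹_)
        (trans (expanded≡act (suc i) v x) (trans (cong (act v) (sym (τ-iterate i x))) (act-τ v (iterate-τ i x))))

      expanded-monic : ∀ i {d} (v : Vec 𝔽 d) → Monic (qˡ ^ (i + d)) (expanded i P.⟦ v ⟧)
      expanded-monic i [] = subst (λ z → Monic (qˡ ^ z) (expanded i P.one)) (sym (+-identityʳ i))
        (let v , h = monic-pow (qˡ ^ i) in v , λ x → trans (h x) (sym (trans (⊹-idʳ _) (·-idˡ _))))
      expanded-monic i {suc d} (a ∷ v) = monic-+ (low-monomial (qˡ ^ (i + suc d)) (qˡ ^ i) (proj₁ a) (^-monoʳ-< qˡ 1<qˡ (m<m+n i z<s)))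
        (subst (λ z → Monic (qˡ ^ z) (expanded (suc i) P.⟦ v ⟧)) (sym (+-suc i d)) (expanded-monic (suc i) v))

    ker-poly : ∀ {d} (v : Vec 𝔽 d) → # ker (act P.⟦ v ⟧) ≤ qˡ ^ d
    ker-poly v = ≤-trans (#-⊆ λ x t → fromWitness (trans (expanded≡act 0 P.⟦ v ⟧ x)
      (trans (cong (act P.⟦ v ⟧) (pow-1 x)) (toWitness {a? = act P.⟦ v ⟧ x ≟ᴷ 𝟘} t)))) (monic-roots (expanded-monic 0 v))

    open KernelSizes qˡ ker-poly public

    act-binomial : ∀ k a x → act P.⟦ P.binomialVec k a ⟧ x ≡ proj₁ a · x ⊹ iterate-τ (suc k) x
    act-binomial k a x = cong (proj₁ a · x ⊹_) (trans (cong τ (tail k)) (τ-iterate k x))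
      where
        tail : ∀ k → act P.⟦ Vec.replicate k P.𝟘 ⟧ x ≡ iterate-τ k x
        tail zero = trans (act-one x) (sym (pow-1 x))
        tail (suc k) = trans (cong₂ _⊹_ (·-zeroˡ x) (trans (cong τ (tail k)) (τ-iterate k x))) (⊹-idˡ _)

    -- The polynomial T^m - 1. It kills all of K, because the m-th iterate of τ is x ↦ x^size.
    circle : Vec 𝔽 m
    circle = P.binomialVec m-1 (P.⊖ P.𝟙)

    circle-kills : ∀ x → act P.⟦ circle ⟧ x ≡ 𝟘
    circle-kills x = trans (act-binomial m-1 (P.⊖ P.𝟙) x) (trans (cong₂ _⊹_ (trans (sym (-‿distribˡ-* 𝟙 x)) (cong ⊖_ (·-idˡ x))) (iterate-τ-m x)) (⊖-invˡ x))

    abstract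
      -- Kept abstract, since the factorisation is obtained by exhaustive search and must never be
      -- evaluated.
      factors : List P.Factor
      factors = proj₁ (P.factorisation m-1 circle)

      circle≈ : P.⟦ circle ⟧ P.≈ P.∏ᴾ factors
      circle≈ = proj₁ (proj₂ (P.factorisation m-1 circle))

      degrees-factors : P.degrees factors ≡ m
      degrees-factors = proj₂ (proj₂ (P.factorisation m-1 circle))

    Avoids : 𝕂 → Set
    Avoids x = All (λ (_ , c) → act c x ≢ 𝟘) (cofactors factors)

    Independent : 𝕂 → Set
    Independent x = ∀ (c : Fin m → 𝕂) → (∀ i → InSubfield K q l (c i)) → sumF K m (λ i → c i · conj K q l x m i) ≡ 𝟘 → ∀ i → c i ≡ 𝟘

    private
      sum-as-act : ∀ k (c : Fin k → 𝕂) (h : ∀ i → InSubfield K q l (c i)) x →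
        sumF K k (λ i → c i · conj K q l x k i) ≡ act (P.low (Vec.tabulate (λ i → c i , h i))) x
      sum-as-act zero c h x = refl
      sum-as-act (suc k) c h x = cong₂ _⊹_ (cong (c fzero ·_) (trans (cong (λ z → x ^ᴷ (q ^ z)) (*-zeroʳ l)) (pow-1 x)))
        (trans (sumF-cong k (λ i → cong (c (fsuc i) ·_) (shift i))) (trans (sum-as-act k (c ∘ fsuc) (h ∘ fsuc) (τ x)) (act-τ (P.low (Vec.tabulate (λ i → c (fsuc i) , h (fsuc i)))) x)))
        where
          sumF-cong : ∀ k {f g : Fin k → 𝕂} → (∀ i → f i ≡ g i) → sumF K k f ≡ sumF K k g
          sumF-cong zero h = refl
          sumF-cong (suc k) h = cong₂ _⊹_ (h fzero) (sumF-cong k (h ∘ fsuc))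
          shift : ∀ (i : Fin k) → x ^ᴷ (q ^ (l * suc (toℕ i))) ≡ (τ x) ^ᴷ (q ^ (l * toℕ i))
          shift i = trans (cong (x ^ᴷ_) (trans (cong (q ^_) (*-suc l (toℕ i))) (^-distribˡ-+-* q l (l * toℕ i)))) (pow-* x qˡ (q ^ (l * toℕ i)))

      low-tabulate : ∀ {k} (f : Fin k → 𝔽) i → P.low (Vec.tabulate f) P.! toℕ i ≡ f i
      low-tabulate f fzero = refl
      low-tabulate f (fsuc i) = low-tabulate (f ∘ fsuc) i

    -- A linear relation between the m conjugates is a polynomial of degree below m that kills x. If
    -- no cofactor kills x, `annihilator` makes T^m - 1 divide it, so it is 0.
    avoids⇒independent : ∀ x → Avoids x → Independent x
    avoids⇒independent x avoids c h sum≡0 i = conclude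
        (annihilator factors x (P.low 𝐯) (trans (sym (act-≈ P.⟦ circle ⟧ (P.∏ᴾ factors) x circle≈)) (circle-kills x)) (trans (sym (sum-as-act m c h x)) sum≡0))
      where
        𝐯 : Vec 𝔽 m
        𝐯 = Vec.tabulate (λ i → c i , h i)
        conclude : P.∏ᴾ factors P.∣ᴾ P.low 𝐯 ⊎ Any (λ (_ , c) → act c x ≡ 𝟘) (cofactors factors) → c i ≡ 𝟘
        conclude (inj₂ any) = contradiction any (Allₚ.All¬⇒¬Any avoids)
        conclude (inj₁ (s , c≈)) = trans (cong proj₁ (sym (low-tabulate (λ i → c i , h i) i))) (cong proj₁ (P.at zero-poly (toℕ i)))
          where
            zero-poly : P.low 𝐯 P.≈ []
            zero-poly = P.small-multiple-zero circle (P.low 𝐯) (P.low-above 𝐯) (s , P.≈-trans c≈ (P.⊗-congʳ s (P.≈-sym circle≈)))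

    inSub : 𝕂 → Bool
    inSub y = ⌊ τ y ≟ᴷ y ⌋

    -- The identity `linear-geometric`, read as one of operators: (τ - ζ) G = τ^(k+1) - ζ^(k+1).
    eigen-geometric : ∀ (ζ : 𝔽) k x → τ (act P.⟦ P.geometric ζ k ⟧ x) ≡ proj₁ ζ · act P.⟦ P.geometric ζ k ⟧ x ⊹ (iterate-τ (suc k) x ⊝ proj₁ (ζ P.^ᶠ suc k) · x)
    eigen-geometric ζ k x = begin
      τ G ≡⟨ solveR 2 (λ t z → t := z :+ ((:- z) :+ t)) refl (τ G) (proj₁ ζ · G) ⟩
      proj₁ ζ · G ⊹ (⊖ (proj₁ ζ · G) ⊹ τ G) ≡⟨ cong (proj₁ ζ · G ⊹_) (trans (cong₂ _⊹_ (-‿distribˡ-* (proj₁ ζ) G) (cong τ (sym (act-one G)))) main) ⟩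
      proj₁ ζ · G ⊹ (iterate-τ (suc k) x ⊝ proj₁ (ζ P.^ᶠ suc k) · x) ∎
      where
        open ≡-Reasoning
        G = act P.⟦ P.geometric ζ k ⟧ x
        main : act (P.linear ζ) G ≡ iterate-τ (suc k) x ⊝ proj₁ (ζ P.^ᶠ suc k) · x
        main = trans (sym (act-⊗ (P.linear ζ) P.⟦ P.geometric ζ k ⟧ x)) (trans (act-≈ (P.linear ζ P.⊗ P.⟦ P.geometric ζ k ⟧) P.⟦ P.binomialVec k (P.⊖ (ζ P.^ᶠ suc k)) ⟧ x (P.linear-geometric ζ k))
          (trans (act-binomial k (P.⊖ (ζ P.^ᶠ suc k)) x) (solveR 3 (λ z x t → (:- z) :* x :+ t := t :- z :* x) refl (proj₁ (ζ P.^ᶠ suc k)) x (iterate-τ (suc k) x))))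

    𝟙^ᶠ : ∀ k → proj₁ (P.𝟙 P.^ᶠ k) ≡ 𝟙
    𝟙^ᶠ zero = refl
    𝟙^ᶠ (suc k) = trans (·-idˡ _) (𝟙^ᶠ k)

    -- The trace maps K into the subfield and has a kernel of size at most qˡ^(m-1).
    qˡ≤#inSub : qˡ ≤ # inSub
    qˡ≤#inSub = *-cancelʳ-≤ qˡ _ (qˡ ^ m-1) {{m^n≢0 qˡ m-1 {{>-nonZero (<⇒≤ 1<qˡ)}}}} (begin
      qˡ ^ m ≡⟨ trans qˡ^m (sym (trans #-all size≡)) ⟩
      # (λ _ → true) ≤⟨ #-fibres (λ _ → true) inSub trace (qˡ ^ m-1) (λ x _ → fromWitness (in-sub x))
        (λ y → ≤-trans (subgroup-fibre (act-additive P.⟦ P.geometric P.𝟙 m-1 ⟧) (λ _ → true) (record { has-𝟘 = tt ; invariant = λ _ _ → refl }) y) (ker-poly (P.geometric P.𝟙 m-1))) ⟩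
      # inSub * qˡ ^ m-1 ∎)
      where
        open ≤-Reasoning
        trace = act P.⟦ P.geometric P.𝟙 m-1 ⟧
        in-sub : ∀ x → τ (trace x) ≡ trace x
        in-sub x = trans (eigen-geometric P.𝟙 m-1 x) (trans (cong₂ _⊹_ (·-idˡ _) (trans (cong₂ _⊝_ (iterate-τ-m x) (trans (cong (_· x) (𝟙^ᶠ m)) (·-idˡ x))) (⊖-invʳ x))) (⊹-idʳ _))

    private
      scalars : List 𝕂
      scalars = listOf inSub

      s : ℕ
      s = length scalars

      s≡ : s ≡ # inSub
      s≡ = trans (length-filterᵇ inSub elements) (sym (∑-elements (ι ∘ inSub)))

      scalar : Fin s → 𝕂
      scalar = Data.List.lookup scalars

      scalar-in : ∀ i → InSubfield K q l (scalar i)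
      scalar-in i = toWitness (∈-listOf⁻ (∈ₚ.∈-lookup i))

      scalar-injective : ∀ {i j} → scalar i ≡ scalar j → i ≡ j
      scalar-injective = Unique-lookup-injective (listOf-Unique inSub) _ _

      combo : 𝕂 → (Fin m → Fin s) → 𝕂
      combo x f = sumF K m (λ i → scalar (f i) · conj K q l x m i)

      combo-injective : ∀ x → Independent x → ∀ f g → combo x f ≡ combo x g → ∀ i → f i ≡ g i
      combo-injective x ind f g e i = scalar-injective (⊝-≡ (ind (λ i → scalar (f i) ⊝ scalar (g i))
        (λ i → trans (frobenius-+ l _ _) (cong₂ _⊹_ (scalar-in (f i)) (trans (additive-⊖ (frobenius-+ l) _) (cong ⊖_ (scalar-in (g i))))))
        (trans (sub m (scalar ∘ f) (scalar ∘ g) (conj K q l x m)) (trans (cong (_⊝ combo x g) e) (⊖-invʳ _))) i))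
        where
          sub : ∀ k (a b y : Fin k → 𝕂) → sumF K k (λ i → (a i ⊝ b i) · y i) ≡ sumF K k (λ i → a i · y i) ⊝ sumF K k (λ i → b i · y i)
          sub zero a b y = sym (⊖-invʳ 𝟘)
          sub (suc k) a b y = trans (cong ((a fzero ⊝ b fzero) · y fzero ⊹_) (sub k (a ∘ fsuc) (b ∘ fsuc) (y ∘ fsuc)))
            (solveR 5 (λ a b y u v → (a :- b) :* y :+ (u :- v) := (a :* y :+ u) :- (b :* y :+ v)) refl (a fzero) (b fzero) (y fzero) _ _)

    -- Spanning is proved by counting. Independence makes the s^m combinations distinct, where s ≥
    -- qˡ is the number of scalars; an element missed by all of them would be one too many.
    independent⇒normal : ∀ x → Independent x → NormalOver K q l m x
    independent⇒normal x ind = ind , span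
      where
        span : ∀ y → Σ (Fin m → 𝕂) λ c → (∀ i → InSubfield K q l (c i)) × (sumF K m (λ i → c i · conj K q l x m i) ≡ y)
        span y with Finₚ.any? {s ^ m} (λ k → combo x (Data.Fin.finToFun {s} {m} k) ≟ᴷ y)
        ... | yes (k , e) = (λ i → scalar (Data.Fin.finToFun {s} {m} k i)) , (λ i → scalar-in _) , e
        ... | no none = contradiction (Finₚ.injective⇒≤ {f = Inverse.from enum ∘ g} inj)
            (<⇒≱ (s≤s (≤-trans (≤-reflexive (trans size≡ (sym qˡ^m))) (^-monoˡ-≤ m (≤-trans qˡ≤#inSub (≤-reflexive (sym s≡)))))))
          where
            g : Fin (suc (s ^ m)) → 𝕂
            g fzero = y
            g (fsuc k) = combo x (Data.Fin.finToFun {s} {m} k)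
            g-inj : ∀ i j → g i ≡ g j → i ≡ j
            g-inj fzero fzero _ = refl
            g-inj fzero (fsuc j) e = contradiction (j , sym e) none
            g-inj (fsuc i) fzero e = contradiction (i , e) none
            g-inj (fsuc i) (fsuc j) e = cong fsuc (trans (sym (Finₚ.funToFin-finToFin {m} {s} i))
              (trans (funToFin-cong (Data.Fin.finToFun i) (Data.Fin.finToFun j) (combo-injective x ind (Data.Fin.finToFun i) (Data.Fin.finToFun j) e))
                (Finₚ.funToFin-finToFin {m} {s} j)))
            inj : ∀ {i j} → Inverse.from enum (g i) ≡ Inverse.from enum (g j) → i ≡ j
            inj {i} {j} e = g-inj i j (trans (sym (Inverse.inverseˡ enum refl)) (trans (cong (Inverse.to enum) e) (Inverse.inverseˡ enum refl)))

    normal : ∀ x → Avoids x → NormalOver K q l m x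
    normal x = independent⇒normal x ∘ avoids⇒independent x

  sizes : List (𝕂 → Bool) → ℕ
  sizes 𝒱 = sum (map #_ 𝒱)

  Outside : List (𝕂 → Bool) → 𝕂 → Set
  Outside 𝒱 x = All (λ V → ¬ T (V x)) 𝒱

  -- Linear and nonlinear factors of T^m - 1

  module Linear (l m-1 : ℕ) (lm≡n : l * suc m-1 ≡ n) where
    open Level l m-1 lm≡n

    -- The action again, with T acting as multiplication by ζ; applied to 1 it evaluates a
    -- polynomial at ζ.
    module At (ζ : 𝔽) = ActionOf.Action subfield proj₁ (λ _ _ → refl) (λ _ _ → refl) refl refl
      (proj₁ ζ ·_) (λ x y → ·-distribˡ (proj₁ ζ) x y)
      (λ a x → solveR 3 (λ z a x → z :* (a :* x) := a :* (z :* x)) refl (proj₁ ζ) (proj₁ a) x)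

    eval : 𝔽 → P.Poly → 𝕂
    eval ζ p = At.act ζ p 𝟙

    private
      At-scale : ∀ ζ p x → At.act ζ p x ≡ eval ζ p · x
      At-scale ζ [] x = sym (·-zeroˡ x)
      At-scale ζ (a ∷ p) x = trans (cong (λ z → proj₁ a · x ⊹ proj₁ ζ · z) (At-scale ζ p x))
        (solveR 5 (λ a x z e o → a :* x :+ z :* (e :* x) := (a :+ z :* e) :* x) refl (proj₁ a) x (proj₁ ζ) (eval ζ p) 𝟙
          |> λ h → trans h (cong (λ w → (w ⊹ proj₁ ζ · eval ζ p) · x) (sym (·-idʳ (proj₁ a)))))
        where
          infixl 1 _|>_
          _|>_ : ∀ {X Y : Set} → X → (X → Y) → Y
          x |> f = f x

      eval-⊗ : ∀ ζ p r → eval ζ (p P.⊗ r) ≡ eval ζ p · eval ζ r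
      eval-⊗ ζ p r = trans (At.act-⊗ ζ p r 𝟙) (At-scale ζ p (eval ζ r))

      eval-binomial : ∀ ζ k a → eval ζ P.⟦ P.binomialVec k a ⟧ ≡ proj₁ a ⊹ proj₁ ζ ^ᴷ suc k
      eval-binomial ζ k a = cong₂ _⊹_ (·-idʳ _) (cong (proj₁ ζ ·_) (tail k))
        where
          tail : ∀ k → eval ζ P.⟦ Vec.replicate k P.𝟘 ⟧ ≡ proj₁ ζ ^ᴷ k
          tail zero = At.act-one ζ 𝟙
          tail (suc k) = trans (cong₂ _⊹_ (·-zeroˡ 𝟙) (cong (proj₁ ζ ·_) (tail k))) (⊹-idˡ _)

      eval-linear : ∀ ζ a → eval ζ (a ∷ P.𝟙 ∷ []) ≡ proj₁ a ⊹ proj₁ ζ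
      eval-linear ζ a = cong₂ _⊹_ (·-idʳ _) (trans (cong (proj₁ ζ ·_) (At.act-one ζ 𝟙)) (·-idʳ _))

    isLinear : P.Factor → Bool
    isLinear (P.factor {zero} _ _) = true
    isLinear (P.factor {suc _} _ _) = false

    root : P.Factor → 𝕂
    root (P.factor {zero} (a ∷ []) _) = ⊖ proj₁ a
    -- A dummy value; in the count of roots it is weighted with `isLinear f`, which is false here.
    root (P.factor {suc _} _ _) = 𝟘

    private
      -- An irreducible factor of degree at least 2 cannot divide T - ζ, and a Bézout identity with
      -- T - ζ, evaluated at a root ζ, would read 1 = 0.
      factor-with-root : ∀ ζ f → eval ζ P.⟦ P.Factor.poly f ⟧ ≡ 𝟘 → T (isLinear f) × root f ≡ proj₁ ζ
      factor-with-root ζ (P.factor {zero} (a ∷ []) _) e = tt ,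
        trans (solveR 2 (λ a z → :- a := z :- (a :+ z)) refl (proj₁ a) (proj₁ ζ))
          (trans (cong (proj₁ ζ ⊝_) (trans (sym (eval-linear ζ a)) e)) (trans (cong (proj₁ ζ ⊹_) ⊖𝟘) (⊹-idʳ _)))
      factor-with-root ζ (P.factor {suc d} v irr) e = ⊥-elim (impossible (irr (P.linear ζ)))
        where
          eval-lin : eval ζ (P.linear ζ) ≡ 𝟘
          eval-lin = trans (eval-linear ζ (P.⊖ ζ)) (⊖-invˡ _)
          impossible : ¬ (P.⟦ v ⟧ P.∣ᴾ P.linear ζ ⊎ P.Comaximal P.⟦ v ⟧ (P.linear ζ))
          impossible (inj₁ dv) = 0≢1 (sym (cong proj₁ (P.at (P.small-multiple-zero v (P.linear ζ) above dv) 1)))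
            where
              above : ∀ i → suc (suc d) ≤ i → P.linear ζ P.! i ≡ P.𝟘
              above (suc (suc i)) _ = refl
              above (suc zero) (s≤s ())
          impossible (inj₂ (α , β , one≈)) = 0≢1 (begin
            𝟘 ≡⟨ sym (trans (cong₂ _⊹_ (·-zeroʳ _) (·-zeroʳ _)) (⊹-idˡ 𝟘)) ⟩
            eval ζ α · 𝟘 ⊹ eval ζ β · 𝟘 ≡⟨ cong₂ (λ u w → eval ζ α · u ⊹ eval ζ β · w) (sym e) (sym eval-lin) ⟩
            eval ζ α · eval ζ P.⟦ v ⟧ ⊹ eval ζ β · eval ζ (P.linear ζ) ≡⟨ sym (cong₂ _⊹_ (eval-⊗ ζ α P.⟦ v ⟧) (eval-⊗ ζ β (P.linear ζ))) ⟩
            eval ζ (α P.⊗ P.⟦ v ⟧) ⊹ eval ζ (β P.⊗ P.linear ζ) ≡⟨ sym (At.act-⊕ ζ (α P.⊗ P.⟦ v ⟧) (β P.⊗ P.linear ζ) 𝟙) ⟩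
            eval ζ (α P.⊗ P.⟦ v ⟧ P.⊕ β P.⊗ P.linear ζ) ≡⟨ sym (At.act-≈ ζ P.one _ 𝟙 one≈) ⟩
            eval ζ P.one ≡⟨ At.act-one ζ 𝟙 ⟩
            𝟙 ∎)
            where open ≡-Reasoning

      ∏-root : ∀ ζ fs → eval ζ (P.∏ᴾ fs) ≡ 𝟘 → Any (λ f → T (isLinear f) × root f ≡ proj₁ ζ) fs
      ∏-root ζ [] e = contradiction (trans (sym e) (At.act-one ζ 𝟙)) 0≢1
      ∏-root ζ (f ∷ fs) e = cases (no-zero-div (trans (sym (eval-⊗ ζ P.⟦ P.Factor.poly f ⟧ (P.∏ᴾ fs))) e))
        where
          cases : eval ζ P.⟦ P.Factor.poly f ⟧ ≡ 𝟘 ⊎ eval ζ (P.∏ᴾ fs) ≡ 𝟘 → Any (λ f → T (isLinear f) × root f ≡ proj₁ ζ) (f ∷ fs)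
          cases (inj₁ h) = here (factor-with-root ζ f h)
          cases (inj₂ h) = there (∏-root ζ fs h)

      eval-circle : ∀ ζ → eval ζ (P.∏ᴾ factors) ≡ proj₁ ζ ^ᴷ m ⊝ 𝟙
      eval-circle ζ = trans (sym (At.act-≈ ζ P.⟦ circle ⟧ (P.∏ᴾ factors) 𝟙 circle≈)) (trans (eval-binomial ζ m-1 (P.⊖ P.𝟙)) (⊹-comm _ _))

    rootsOfUnity : 𝕂 → Bool
    rootsOfUnity z = inSub z ∧ ⌊ z ^ᴷ m ≟ᴷ 𝟙 ⌋

    linears nonlinears : List P.Factor → ℕ
    linears fs = sum (map (ι ∘ isLinear) fs)
    nonlinears fs = sum (map (ι ∘ not ∘ isLinear) fs)

    degrees-bound : ∀ fs → linears fs + 2 * nonlinears fs ≤ P.degrees fs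
    degrees-bound [] = z≤n
    degrees-bound (P.factor {zero} _ _ ∷ fs) = s≤s (degrees-bound fs)
    degrees-bound (P.factor {suc d} _ _ ∷ fs) = begin
      linears fs + 2 * suc (nonlinears fs) ≡⟨ lemma (linears fs) (nonlinears fs) ⟩
      2 + (linears fs + 2 * nonlinears fs) ≤⟨ +-mono-≤ (s≤s (s≤s z≤n)) (degrees-bound fs) ⟩
      suc (suc d) + P.degrees fs ∎
      where
        open ≤-Reasoning
        lemma : ∀ a b → a + 2 * suc b ≡ 2 + (a + 2 * b)
        lemma = solve-∀

    #roots≤linears : # rootsOfUnity ≤ linears factors
    #roots≤linears = begin
      # rootsOfUnity ≤⟨ ∑-mono bound ⟩
      ∑ (λ z → sum (map (λ f → ι (isLinear f) * δ (root f) z) factors)) ≡⟨ interchange factors ⟩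
      linears factors ∎
      where
        open ≤-Reasoning
        interchange : ∀ fs → ∑ (λ z → sum (map (λ f → ι (isLinear f) * δ (root f) z) fs)) ≡ linears fs
        interchange [] = trans (∑-const 0) (*-zeroʳ size)
        interchange (f ∷ fs) = trans (∑-+ _ _) (cong₂ _+_ (trans (∑-*ˡ (ι (isLinear f)) _) (trans (cong (ι (isLinear f) *_) (∑-δ₁ (root f))) (*-identityʳ _))) (interchange fs))
        hit : ∀ z fs → Any (λ f → T (isLinear f) × root f ≡ z) fs → 1 ≤ sum (map (λ f → ι (isLinear f) * δ (root f) z) fs)
        hit z (f ∷ fs) (here (t , e)) = ≤-trans (≤-reflexive (sym (cong₂ _*_ (cong ι (T⇒≡ t)) (trans (cong (λ w → δ w z) e) (δ-refl z))))) (m≤m+n _ _)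
        hit z (f ∷ fs) (there a) = ≤-trans (hit z fs a) (m≤n+m _ (ι (isLinear f) * δ (root f) z))
        bound : ∀ z → ι (rootsOfUnity z) ≤ sum (map (λ f → ι (isLinear f) * δ (root f) z) factors)
        bound z with rootsOfUnity z in eq
        ... | false = z≤n
        ... | true = hit z factors (∏-root (z , z∈𝔽) factors
            (trans (eval-circle (z , z∈𝔽)) (trans (cong (_⊝ 𝟙) (toWitness {a? = z ^ᴷ m ≟ᴷ 𝟙} (T-∧₂ {inSub z} t))) (⊖-invʳ 𝟙))))
          where
            t : T (rootsOfUnity z)
            t = subst T (sym eq) tt
            z∈𝔽 : InSubfield K q l z
            z∈𝔽 = toWitness {a? = τ z ≟ᴷ z} (T-∧₁ t)

    -- The Lagrange resolvent Σ z^(k-i) τ^i x for z fixed by τ. Unlike `geometric` it accepts any z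
    -- in K, so that families of kernels can be indexed by field elements without proofs of
    -- membership.
    resolvent : 𝕂 → ℕ → 𝕂 → 𝕂
    resolvent z zero x = x
    resolvent z (suc k) x = z ^ᴷ suc k · x ⊹ τ (resolvent z k x)

    resolvent-additive : ∀ z k → Additive (resolvent z k)
    resolvent-additive z zero x y = refl
    resolvent-additive z (suc k) x y = trans (cong (z ^ᴷ suc k · (x ⊹ y) ⊹_) (trans (cong τ (resolvent-additive z k x y)) (frobenius-+ l _ _)))
      (solveR 5 (λ a x y u v → a :* (x :+ y) :+ (u :+ v) := (a :* x :+ u) :+ (a :* y :+ v)) refl (z ^ᴷ suc k) x y _ _)

    ^ᶠ≡^ᴷ : ∀ (ζ : 𝔽) k → proj₁ (ζ P.^ᶠ k) ≡ proj₁ ζ ^ᴷ k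
    ^ᶠ≡^ᴷ ζ zero = refl
    ^ᶠ≡^ᴷ ζ (suc k) = cong (proj₁ ζ ·_) (^ᶠ≡^ᴷ ζ k)

    resolvent≡act : ∀ (ζ : 𝔽) k x → resolvent (proj₁ ζ) k x ≡ act P.⟦ P.geometric ζ k ⟧ x
    resolvent≡act ζ zero x = sym (act-one x)
    resolvent≡act ζ (suc k) x = cong₂ (λ u v → u · x ⊹ τ v) (sym (^ᶠ≡^ᴷ ζ (suc k))) (resolvent≡act ζ k x)

    resolvent-ker : ∀ (ζ : 𝔽) → # ker (resolvent (proj₁ ζ) m-1) * qˡ ≤ q ^ n
    resolvent-ker ζ = ≤-trans (*-monoˡ-≤ qˡ (≤-trans (#-⊆ λ x t → fromWitness (trans (sym (resolvent≡act ζ m-1 x)) (toWitness {a? = resolvent (proj₁ ζ) m-1 x ≟ᴷ 𝟘} t))) (ker-poly (P.geometric ζ m-1))))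
      (≤-reflexive (trans (*-comm (qˡ ^ m-1) qˡ) qˡ^m))

    resolvent-eigen : ∀ (ζ : 𝔽) → proj₁ ζ ^ᴷ m ≡ 𝟙 → ∀ x → τ (resolvent (proj₁ ζ) m-1 x) ≡ proj₁ ζ · resolvent (proj₁ ζ) m-1 x
    resolvent-eigen ζ e x rewrite resolvent≡act ζ m-1 x = trans (eigen-geometric ζ m-1 x)
      (trans (cong (proj₁ ζ · act P.⟦ P.geometric ζ m-1 ⟧ x ⊹_) (trans (cong₂ _⊝_ (iterate-τ-m x) (trans (cong (_· x) (trans (^ᶠ≡^ᴷ ζ m) e)) (·-idˡ x))) (⊖-invʳ x))) (⊹-idʳ _))

    private
      -- Both c and the geometric polynomial are quotients of T^m - 1 by the same T - ζ, and monic
      -- factors cancel.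
      linear-cofactor : ∀ g c → T (isLinear g) → P.⟦ P.Factor.poly g ⟧ P.⊗ c P.≈ P.∏ᴾ factors →
        T (rootsOfUnity (root g)) × (∀ x → act c x ≡ 𝟘 → resolvent (root g) m-1 x ≡ 𝟘)
      linear-cofactor (P.factor {zero} (a ∷ []) irr) c _ gc≈ = T-∧ {inSub z} {⌊ z ^ᴷ m ≟ᴷ 𝟙 ⌋} (fromWitness {a? = τ z ≟ᴷ z} (proj₂ ζ)) (fromWitness {a? = z ^ᴷ m ≟ᴷ 𝟙} ζ^m) ,
        λ x e → trans (resolvent≡act ζ m-1 x) (trans (sym (act-≈ c P.⟦ P.geometric ζ m-1 ⟧ x c≈)) e)
        where
          ζ : 𝔽
          ζ = P.⊖ a
          z : 𝕂
          z = ⊖ proj₁ a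
          G = P.⟦ P.geometric ζ m-1 ⟧
          lin = a ∷ P.𝟙 ∷ []
          lin≡ : P.linear ζ ≡ lin
          lin≡ = cong (λ z → z ∷ P.𝟙 ∷ []) (𝔽-≡ (⊖-involutive (proj₁ a)))
          ζ^m : proj₁ ζ ^ᴷ m ≡ 𝟙
          ζ^m = ⊝-≡ (trans (sym (eval-circle ζ)) (trans (sym (At.act-≈ ζ (lin P.⊗ c) (P.∏ᴾ factors) 𝟙 gc≈))
            (trans (eval-⊗ ζ lin c) (trans (cong (_· eval ζ c) (trans (eval-linear ζ a) (⊖-invʳ (proj₁ a)))) (·-zeroˡ _)))))
          lin-G : lin P.⊗ G P.≈ P.⟦ circle ⟧
          lin-G = subst₂ (λ u v → u P.⊗ G P.≈ P.⟦ P.binomialVec m-1 v ⟧) lin≡ (cong P.⊖_ (𝔽-≡ (trans (^ᶠ≡^ᴷ ζ m) ζ^m))) (P.linear-geometric ζ m-1)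
          c≈ : c P.≈ G
          c≈ = P.⊗-cancelʳ (a ∷ []) c G (P.≈-trans (P.⊗-comm c lin) (P.≈-trans gc≈ (P.≈-trans (P.≈-sym circle≈) (P.≈-trans (P.≈-sym lin-G) (P.⊗-comm lin G)))))

    -- The linear part is indexed by distinct roots of unity rather than by factors. When the
    -- characteristic divides m, linear factors repeat, but equal factors have the same kernel; the
    -- number of sets is thus bounded by a gcd.
    linearSets nonlinearSets allSets : List (𝕂 → Bool)
    linearSets = map (λ z → ker (resolvent z m-1)) (listOf rootsOfUnity)
    nonlinearSets = map (λ (_ , c) → ker (act c)) (Data.List.filterᵇ (not ∘ isLinear ∘ proj₁) (cofactors factors))
    allSets = map (λ (_ , c) → ker (act c)) (cofactors factors)

    length-linearSets : length linearSets ≡ # rootsOfUnity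
    length-linearSets = trans (Listₚ.length-map _ (listOf rootsOfUnity)) (trans (length-filterᵇ rootsOfUnity elements) (sym (∑-elements (ι ∘ rootsOfUnity))))

    length-nonlinearSets : length nonlinearSets ≡ nonlinears factors
    length-nonlinearSets = trans (Listₚ.length-map _ (Data.List.filterᵇ (not ∘ isLinear ∘ proj₁) (cofactors factors)))
      (trans (length-filterᵇ (not ∘ isLinear ∘ proj₁) (cofactors factors)) (cong sum (trans (Listₚ.map-∘ (cofactors factors)) (cong (map (ι ∘ not ∘ isLinear)) (cofactors-factors factors)))))

    linearSets-subgroups : All IsSubgroup linearSets
    linearSets-subgroups = Allₚ.map⁺ (All.universal (λ z → ker-isSubgroup (resolvent-additive z m-1)) (listOf rootsOfUnity))

    nonlinearSets-subgroups : All IsSubgroup nonlinearSets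
    nonlinearSets-subgroups = Allₚ.map⁺ (All.universal (λ (_ , c) → ker-isSubgroup (act-additive c)) (Data.List.filterᵇ (not ∘ isLinear ∘ proj₁) (cofactors factors)))

    allSets-subgroups : All IsSubgroup allSets
    allSets-subgroups = Allₚ.map⁺ (All.universal (λ (_ , c) → ker-isSubgroup (act-additive c)) (cofactors factors))

    linearSets-size : All (λ V → # V * qˡ ≤ q ^ n) linearSets
    linearSets-size = Allₚ.map⁺ (All.tabulate λ {z} z∈ → resolvent-ker (z , toWitness {a? = τ z ≟ᴷ z} (T-∧₁ (∈-listOf⁻ z∈))))

    private
      cofactor-size : All (λ (g , c) → # ker (act c) * qˡ ^ P.degree g ≤ q ^ n) (cofactors factors)
      cofactor-size = subst (λ z → All (λ (g , c) → # ker (act c) * qˡ ^ P.degree g ≤ z) (cofactors factors)) (trans (cong (qˡ ^_) degrees-factors) qˡ^m) (ker-cofactors factors)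

      degree-≥ : ∀ g → T (not (isLinear g)) → 2 ≤ P.degree g
      degree-≥ (P.factor {suc d} _ _) _ = s≤s (s≤s z≤n)

      instance
        qˡ-nonZero : NonZero qˡ
        qˡ-nonZero = >-nonZero (<⇒≤ 1<qˡ)

    nonlinearSets-size : All (λ V → # V * (qˡ * qˡ) ≤ q ^ n) nonlinearSets
    nonlinearSets-size = Allₚ.map⁺ (All.tabulate λ {(g , c)} gc∈ → let gc∈′ , t = ∈ₚ.∈-filter⁻ (λ y → T? (not (isLinear (proj₁ y)))) {xs = cofactors factors} gc∈ in
      ≤-trans (*-monoʳ-≤ (# ker (act c)) (≤-trans (≤-reflexive (cong (qˡ *_) (sym (*-identityʳ qˡ)))) (^-monoʳ-≤ qˡ (degree-≥ g t)))) (All.lookup cofactor-size gc∈′))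

    allSets-size : All (λ V → # V * qˡ ≤ q ^ n) allSets
    allSets-size = Allₚ.map⁺ (All.map (λ {(g , c)} h → ≤-trans (*-monoʳ-≤ (# ker (act c)) (≤-trans (≤-reflexive (sym (*-identityʳ qˡ))) (^-monoʳ-≤ qˡ {1} {P.degree g} (s≤s z≤n)))) h) cofactor-size)

    length-allSets : length allSets ≤ m
    length-allSets = ≤-trans (≤-reflexive (trans (Listₚ.length-map _ (cofactors factors)) (trans (sym (Listₚ.length-map proj₁ (cofactors factors))) (cong length (cofactors-factors factors)))))
      (≤-trans (count factors) (≤-reflexive degrees-factors))
      where
        count : ∀ fs → length fs ≤ P.degrees fs
        count [] = z≤n
        count (f ∷ fs) = s≤s (≤-trans (count fs) (m≤n+m _ (P.Factor.deg-1 f)))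

    outside-allSets : ∀ x → Outside allSets x → NormalOver K q l m x
    outside-allSets x out = normal x (All.map (λ h e → h (fromWitness e)) (Allₚ.map⁻ out))

    outside-split : ∀ x → Outside linearSets x → Outside nonlinearSets x → NormalOver K q l m x
    outside-split x out₁ out₂ = normal x (All.tabulate λ {(g , c)} gc∈ e → check g c gc∈ e (isLinear g) refl)
      where
        check : ∀ g c → (g , c) ∈ cofactors factors → act c x ≡ 𝟘 → ∀ b → isLinear g ≡ b → ⊥
        check g c gc∈ e true eq = let z∈ , kill = linear-cofactor g c (subst T (sym eq) tt) (All.lookup (cofactors-∏ factors) gc∈) in
          All.lookup (Allₚ.map⁻ out₁) (∈-listOf z∈) (fromWitness (kill x e))
        check g c gc∈ e false eq = All.lookup (Allₚ.map⁻ out₂) (∈ₚ.∈-filter⁺ (λ y → T? (not (isLinear (proj₁ y)))) gc∈ (subst (T ∘ not) (sym eq) tt)) (fromWitness e)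

    #roots+2nonlinears : # rootsOfUnity + 2 * nonlinears factors ≤ m
    #roots+2nonlinears = ≤-trans (+-monoˡ-≤ _ #roots≤linears) (≤-trans (degrees-bound factors) (≤-reflexive degrees-factors))

  -- The list of bad subgroups over all levels

  n-1 : ℕ
  n-1 = pred n

  1n≡n : 1 * suc n-1 ≡ n
  1n≡n = trans (*-identityˡ (suc n-1)) (suc-pred n {{>-nonZero 0<n}})

  module Ground = Linear 1 n-1 1n≡n

  private
    cofactor : ∀ {l} c → n ≡ c * l → l * suc (pred c) ≡ n
    cofactor zero e = contradiction (sym e) (<⇒≢ 0<n)
    cofactor {l} (suc c) e = trans (*-comm l (suc c)) (sym e)

  levelSets : ∀ k → Dec (suc k ∣ n) → List (𝕂 → Bool)
  levelSets k (yes (divides c e)) = Linear.allSets (suc k) (pred c) (cofactor c e)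
  levelSets k (no _) = []

  extraSets : ℕ → List (𝕂 → Bool)
  extraSets zero = []
  extraSets (suc zero) = []
  extraSets (suc k@(suc _)) = levelSets k (suc k ∣? n) ++ extraSets k

  private
    levelSets-subgroups : ∀ k d → All IsSubgroup (levelSets k d)
    levelSets-subgroups k (yes (divides c e)) = Linear.allSets-subgroups (suc k) (pred c) (cofactor c e)
    levelSets-subgroups k (no _) = []

    suc-pred-cofactor : ∀ {l} c → n ≡ c * l → suc (pred c) ≡ c
    suc-pred-cofactor zero e = contradiction (sym e) (<⇒≢ 0<n)
    suc-pred-cofactor (suc c) e = refl

    n/ : ∀ k c → n ≡ c * suc k → n / suc k ≡ c
    n/ k c e = trans (cong (_/ suc k) e) (m*n/n≡m c (suc k))

    length-levelSets : ∀ k d → length (levelSets k d) ≤ (if ⌊ d ⌋ then n / suc k else 0)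
    length-levelSets k (yes (divides c e)) = ≤-trans (Linear.length-allSets (suc k) (pred c) (cofactor c e)) (≤-reflexive (trans (suc-pred-cofactor c e) (sym (n/ k c e))))
    length-levelSets k (no _) = z≤n

    sizes-levelSets : ∀ k d → sizes (levelSets k d) ≤ (if ⌊ d ⌋ then n / suc k * q ^ (n ∸ suc k) else 0)
    sizes-levelSets k (no _) = z≤n
    sizes-levelSets k (yes (divides c e)) = ≤-trans (sum-map-≤ #_ (q ^ (n ∸ suc k)) 𝒱 (All.map bound (Linear.allSets-size (suc k) (pred c) (cofactor c e))))
      (*-monoˡ-≤ (q ^ (n ∸ suc k)) (length-levelSets k (yes (divides c e))))
      where
        𝒱 = Linear.allSets (suc k) (pred c) (cofactor c e)
        sk≤n : suc k ≤ n
        sk≤n = ∣⇒≤ {{>-nonZero 0<n}} (divides c e)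
        bound : ∀ {V} → # V * q ^ suc k ≤ q ^ n → # V ≤ q ^ (n ∸ suc k)
        bound {V} h = *-cancelʳ-≤ (# V) _ (q ^ suc k) {{m^n≢0 q (suc k) {{>-nonZero (<⇒≤ 1<q)}}}}
          (≤-trans h (≤-reflexive (trans (cong (q ^_) (sym (m∸n+n≡m sk≤n))) (^-distribˡ-+-* q (n ∸ suc k) (suc k)))))

  sizes-++ : ∀ 𝒱 𝒲 → sizes (𝒱 ++ 𝒲) ≡ sizes 𝒱 + sizes 𝒲
  sizes-++ [] 𝒲 = refl
  sizes-++ (V ∷ 𝒱) 𝒲 = trans (cong (# V +_) (sizes-++ 𝒱 𝒲)) (sym (+-assoc (# V) _ _))

  extraSets-subgroups : ∀ k → All IsSubgroup (extraSets k)
  extraSets-subgroups zero = []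
  extraSets-subgroups (suc zero) = []
  extraSets-subgroups (suc k@(suc _)) = Allₚ.++⁺ (levelSets-subgroups k (suc k ∣? n)) (extraSets-subgroups k)

  length-extraSets : ∀ k → length (extraSets k) ≤ extraCount q n k
  length-extraSets zero = z≤n
  length-extraSets (suc zero) = z≤n
  length-extraSets (suc k@(suc _)) = ≤-trans (≤-reflexive (Listₚ.length-++ (levelSets k (suc k ∣? n))))
    (+-mono-≤ (length-levelSets k (suc k ∣? n)) (length-extraSets k))

  sizes-extraSets : ∀ k → sizes (extraSets k) ≤ extraSize q n k
  sizes-extraSets zero = z≤n
  sizes-extraSets (suc zero) = z≤n
  sizes-extraSets (suc k@(suc _)) = ≤-trans (≤-reflexive (sizes-++ (levelSets k (suc k ∣? n)) _))
    (+-mono-≤ (sizes-levelSets k (suc k ∣? n)) (sizes-extraSets k))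

  private
    outside-levelSets : ∀ k d x → Outside (levelSets k d) x → ∀ m → suc k * m ≡ n → NormalOver K q (suc k) m x
    outside-levelSets k (no ¬d) x out m e = contradiction (divides m (trans (sym e) (*-comm (suc k) m))) ¬d
    outside-levelSets k (yes (divides c e)) x out m e′ =
      subst (λ z → NormalOver K q (suc k) z x) (*-cancelˡ-≡ (suc (pred c)) m (suc k) (trans (cofactor c e) (sym e′)))
        (Linear.outside-allSets (suc k) (pred c) (cofactor c e) x out)

    outside-extraSets : ∀ k x → Outside (extraSets k) x → ∀ l m → 2 ≤ l → l ≤ k → l * m ≡ n → NormalOver K q l m x
    outside-extraSets zero x out l m 2≤l l≤k e = contradiction (≤-trans 2≤l l≤k) λ ()
    outside-extraSets (suc k) x out l m 2≤l l≤k e = step k out l≤k (λ out′ l≤k′ → outside-extraSets k x out′ l m 2≤l l≤k′ e)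
      where
        step : ∀ k → Outside (extraSets (suc k)) x → l ≤ suc k → (Outside (extraSets k) x → l ≤ k → NormalOver K q l m x) → NormalOver K q l m x
        step zero out l≤k rec = contradiction (≤-trans 2≤l l≤k) λ { (s≤s ()) }
        step (suc k) out l≤k rec = cases (m≤n⇒m<n∨m≡n l≤k)
          where
            cases : l < suc (suc k) ⊎ l ≡ suc (suc k) → NormalOver K q l m x
            cases (inj₁ (s≤s l≤k′)) = rec (Allₚ.++⁻ʳ (levelSets (suc k) (suc (suc k) ∣? n)) out) l≤k′
            cases (inj₂ refl) = outside-levelSets (suc k) (suc (suc k) ∣? n) x (Allₚ.++⁻ˡ (levelSets (suc k) (suc (suc k) ∣? n)) out) m e

  completely-normal : ∀ x → Outside Ground.linearSets x → Outside Ground.nonlinearSets x → Outside (extraSets n) x → CompletelyNormal K q n x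
  completely-normal x out₁ out₂ out₃ zero m e = contradiction e (<⇒≢ 0<n)
  completely-normal x out₁ out₂ out₃ (suc zero) m e =
    subst (λ z → NormalOver K q 1 z x) (trans (sym (*-identityˡ _)) (trans 1n≡n (trans (sym e) (*-identityˡ m)))) (Ground.outside-split x out₁ out₂)
  completely-normal x out₁ out₂ out₃ l@(suc (suc _)) m e = outside-extraSets n x out₃ l m (s≤s (s≤s z≤n))
    (∣⇒≤ {{>-nonZero 0<n}} (divides m (trans (sym e) (*-comm l m)))) e

  -- A root of unity in F_q satisfies z^n = 1 and z^(q-1) = 1, hence z^g = 1 for the gcd g, and
  -- there are at most g such z.
  #roots≤gcd : # Ground.rootsOfUnity ≤ gcd n (q ∸ 1)
  #roots≤gcd = ≤-trans (#-⊆ λ z t → fromWitness (pow-gcd z n (q ∸ 1)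
      (trans (cong (z ^ᴷ_) (sym (suc-pred n {{>-nonZero 0<n}}))) (z^n z t)) (z^q-1 z t)))
      (pow-roots (gcd n (q ∸ 1)) 𝟙 (n≢0⇒n>0 λ g≡0 → <⇒≢ 0<n (sym (gcd[m,n]≡0⇒m≡0 g≡0))))
    where
      z^n : ∀ z → T (Ground.rootsOfUnity z) → z ^ᴷ suc n-1 ≡ 𝟙
      z^n z t = toWitness {a? = z ^ᴷ suc n-1 ≟ᴷ 𝟙} (T-∧₂ {⌊ z ^ᴷ (q ^ 1) ≟ᴷ z ⌋} t)
      z^q-1 : ∀ z → T (Ground.rootsOfUnity z) → z ^ᴷ (q ∸ 1) ≡ 𝟙
      z^q-1 z t = ·-cancelˡ {z} z≢0 (trans (cong (z ^ᴷ_) (m+[n∸m]≡n (<⇒≤ 1<q))) (trans (sym (cong (z ^ᴷ_) (*-identityʳ q))) (trans (toWitness {a? = z ^ᴷ (q ^ 1) ≟ᴷ z} (T-∧₁ t)) (sym (·-idʳ z)))))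
        where
          z≢0 : z ≢ 𝟘
          z≢0 refl = 0≢1 (trans (sym (·-zeroˡ _)) (z^n z t))

  linear-count : length Ground.linearSets + 2 * length Ground.nonlinearSets ≤ n
  linear-count = ≤-trans (≤-reflexive (cong₂ (λ a b → a + 2 * b) Ground.length-linearSets Ground.length-nonlinearSets))
    (≤-trans Ground.#roots+2nonlinears (≤-reflexive (suc-pred n {{>-nonZero 0<n}})))

  -- Good elements and the sieve criteria

  M : ℕ
  M = repunit q n

  M*[q-1]≡N : M * (q ∸ 1) ≡ N
  M*[q-1]≡N = suc-injective (trans (repunit-* q n (<⇒≤ 1<q)) (trans (sym size≡) (sym sN≡size)))

  M∣N : M ∣ N
  M∣N = subst (M ∣_) M*[q-1]≡N (m∣m*n (q ∸ 1))

  0<M : 0 < M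
  0<M = n≢0⇒n>0 λ M≡0 → <⇒≢ 0<N (trans (cong (_* (q ∸ 1)) (sym M≡0)) M*[q-1]≡N)

  Good : 𝕂 → Set
  Good x = Primitive K x × CompletelyNormal K q n x

  scale-normal : ∀ {c x l m} → c ≢ 𝟘 → c ^ᴷ q ≡ c → NormalOver K q l m x → NormalOver K q l m (c · x)
  scale-normal {c} {x} {l} {m} c≢0 cq (ind , span) =
      (λ d h e → ind d h (·-cancelˡ c≢0 (trans (sym (pull m d (conj K q l x m) (conj K q l (c · x) m) conj-c)) (trans e (sym (·-zeroʳ c))))))
    , λ y → let d , h , e = span (inv c≢0 · y) in d , h ,
        trans (pull m d (conj K q l x m) (conj K q l (c · x) m) conj-c) (trans (cong (c ·_) e) (cancel-inv c≢0 y))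
    where
      c-fixed : ∀ k → c ^ᴷ (q ^ k) ≡ c
      c-fixed zero = pow-1 c
      c-fixed (suc k) = trans (pow-* c q (q ^ k)) (trans (cong (_^ᴷ (q ^ k)) cq) (c-fixed k))
      conj-c : ∀ i → conj K q l (c · x) m i ≡ c · conj K q l x m i
      conj-c i = trans (pow-· c x (q ^ (l * toℕ i))) (cong (_· conj K q l x m i) (c-fixed (l * toℕ i)))
      pull : ∀ k (d y y′ : Fin k → 𝕂) → (∀ i → y′ i ≡ c · y i) → sumF K k (λ i → d i · y′ i) ≡ c · sumF K k (λ i → d i · y i)
      pull zero d y y′ h = sym (·-zeroʳ c)
      pull (suc k) d y y′ h = trans (cong₂ _⊹_ (cong (d fzero ·_) (h fzero)) (pull k (d ∘ fsuc) (y ∘ fsuc) (y′ ∘ fsuc) (h ∘ fsuc)))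
        (solveR 4 (λ d c y s → d :* (c :* y) :+ c :* s := c :* (d :* y :+ s)) refl (d fzero) c (y fzero) _)

  adjust-good : ∀ {x} → x ≢ 𝟘 → (∀ {r} → IsPrimeDivisor M r → ¬ T (power r x)) → CompletelyNormal K q n x → ∃ Good
  adjust-good {x} x≢0 x-free cn = use (adjust M (q ∸ 1) M*[q-1]≡N x≢0 x-free)
    where
      use : (∃ λ c → c ^ᴷ (q ∸ 1) ≡ 𝟙 × Primitive K (c · x)) → ∃ Good
      use (c , c^ , prim) = c · x , prim , λ l m e → scale-normal {c} {x} {l} {m} c≢0 cq (cn l m e)
        where
          c≢0 : c ≢ 𝟘
          c≢0 c≡0 = proj₁ prim (trans (cong (_· x) c≡0) (·-zeroˡ x))
          cq : c ^ᴷ q ≡ c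
          cq = trans (cong (c ^ᴷ_) (sym (m+[n∸m]≡n (<⇒≤ 1<q)))) (trans (cong (c ·_) c^) (·-idʳ c))

  ∑-sum : ∀ {X : Set} (F : X → 𝕂 → ℕ) xs → ∑ (λ z → sum (map (λ x → F x z) xs)) ≡ sum (map (λ x → ∑ (F x)) xs)
  ∑-sum F [] = trans (∑-const 0) (*-zeroʳ size)
  ∑-sum F (x ∷ xs) = trans (∑-+ _ _) (cong (∑ (F x) +_) (∑-sum F xs))

  private
    sum-hit : ∀ {X : Set} (f : X → ℕ) xs → Any (λ x → 1 ≤ f x) xs → 1 ≤ sum (map f xs)
    sum-hit f (x ∷ xs) (here h) = ≤-trans h (m≤m+n _ _)
    sum-hit f (x ∷ xs) (there a) = ≤-trans (sum-hit f xs a) (m≤n+m _ (f x))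

    T⇒1≤ι : ∀ {b} → T b → 1 ≤ ι b
    T⇒1≤ι {true} _ = ≤-refl

    ι-∧-≤ : ∀ a b {k} → (T a → T b → 1 ≤ k) → ι (a ∧ b) ≤ k
    ι-∧-≤ true true h = h tt tt
    ι-∧-≤ true false h = z≤n
    ι-∧-≤ false _ h = z≤n

    ¬¬T : ∀ {b} → ¬ ¬ T b → T b
    ¬¬T {true} _ = tt
    ¬¬T {false} h = h λ ()

  -- The union bound: if no x were as claimed, each S-free element of A would lie in some V, where
  -- it is S-free too, or be an r-th power for some r in R.
  sifted-survivor : ∀ A 𝒱 S R → sum (map (λ V → sifted V 1 S) 𝒱) + sum (map (λ r → # power r) R) < sifted A 1 S →
    ∃ λ x → (T (A x) × T (power 1 x ∧ free S x)) × (Outside 𝒱 x × All (λ r → ¬ T (power r x)) R)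
  sifted-survivor A 𝒱 S R lt = cases (any? λ x → (T? (A x) ×-dec T? (power 1 x ∧ free S x)) ×-dec (out? x ×-dec out′? x))
    where
      open ≤-Reasoning
      out? : ∀ x → Dec (Outside 𝒱 x)
      out? x = All.all? (λ V → ¬? (T? (V x))) 𝒱
      out′? : ∀ x → Dec (All (λ r → ¬ T (power r x)) R)
      out′? x = All.all? (λ r → ¬? (T? (power r x))) R
      F : (𝕂 → Bool) → 𝕂 → ℕ
      F V x = ι (V x ∧ (power 1 x ∧ free S x))
      G : ℕ → 𝕂 → ℕ
      G r x = ι (power r x)
      total : 𝕂 → ℕ
      total x = sum (map (λ V → F V x) 𝒱) + sum (map (λ r → G r x) R)
      cases : Dec (∃ λ x → (T (A x) × T (power 1 x ∧ free S x)) × (Outside 𝒱 x × All (λ r → ¬ T (power r x)) R)) → _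
      cases (yes w) = w
      cases (no none) = contradiction lt (≤⇒≯ (begin
        sifted A 1 S ≤⟨ ∑-mono bound ⟩
        ∑ total ≡⟨ trans (∑-+ _ _) (cong₂ _+_ (∑-sum F 𝒱) (∑-sum G R)) ⟩
        sum (map (λ V → sifted V 1 S) 𝒱) + sum (map (λ r → # power r) R) ∎))
        where
          bound′ : ∀ x → T (A x) → T (power 1 x ∧ free S x) → Dec (Outside 𝒱 x) → Dec (All (λ r → ¬ T (power r x)) R) → 1 ≤ total x
          bound′ x a p (yes o) (yes o′) = contradiction (x , (a , p) , o , o′) none
          bound′ x a p (no ¬o) _ = ≤-trans (sum-hit (λ V → F V x) 𝒱 (Any.map (λ h → T⇒1≤ι (T-∧ (¬¬T h) p)) (Allₚ.¬All⇒Any¬ (λ V → ¬? (T? (V x))) 𝒱 ¬o))) (m≤m+n _ _)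
          bound′ x a p (yes _) (no ¬o) = ≤-trans (sum-hit (λ r → G r x) R (Any.map (λ h → T⇒1≤ι (¬¬T h)) (Allₚ.¬All⇒Any¬ (λ r → ¬? (T? (power r x))) R ¬o))) (m≤n+m _ (sum (map (λ V → F V x) 𝒱)))
          bound : ∀ x → ι (A x ∧ (power 1 x ∧ free S x)) ≤ total x
          bound x = ι-∧-≤ (A x) (power 1 x ∧ free S x) λ a p → bound′ x a p (out? x) (out′? x)

  -- Primes in S are sieved by inclusion-exclusion and cost a factor 2 each in the error. Primes in
  -- R are only subtracted, at a cost of N/r elements, which is cheaper for large r.
  record PrimeSplit : Set where
    field
      S R : List ℕ
      S-prime : All (IsPrimeDivisor M) S
      S-unique : Unique S
      cover : ∀ {r} → IsPrimeDivisor M r → r ∈ S ⊎ r ∈ R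

  badSets : List (𝕂 → Bool)
  badSets = Ground.nonlinearSets ++ extraSets n

  badSets-subgroups : All IsSubgroup badSets
  badSets-subgroups = Allₚ.++⁺ Ground.nonlinearSets-subgroups (extraSets-subgroups n)

  module _ (σ : PrimeSplit) where
    open PrimeSplit σ

    private
      P : ℕ
      P = product S

      S-prime′ : All Prime S
      S-prime′ = All.map proj₁ S-prime

      P∣N : 1 * P ∣ N
      P∣N = subst (_∣ N) (sym (*-identityˡ P)) (∣-trans (product-primes-∣ S S-prime S-unique) M∣N)

      bounds : ∀ {A s} → Equidistributed A s →
        (size * P * sifted A 1 S ≤ φ S * # A * N + 2 ^ length S * (s * size * P)) ×
        (φ S * # A * N ≤ size * P * sifted A 1 S + 2 ^ length S * (s * size * P))
      bounds {A} {s} e = subst (λ z → (size * P * sifted A 1 S ≤ z * # A * N + 2 ^ length S * (s * size * P)) × (z * # A * N ≤ size * P * sifted A 1 S + 2 ^ length S * (s * size * P)))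
        (*-identityˡ (φ S)) (sifted-bounds {A} {s} e S 1 1 P S-prime′ S-unique (1∉primes S-prime′) P∣N (trans (*-identityˡ _) (*-identityˡ P)))

      size>0 : 0 < size
      size>0 = <-trans z<s 1<size

      sieve-list : ∀ 𝒱 s → All IsSubgroup 𝒱 → size ≤ s * s →
        size * P * sum (map (λ V → sifted V 1 S) 𝒱) ≤ φ S * sizes 𝒱 * N + length 𝒱 * (2 ^ length S * (s * size * P))
      sieve-list [] s _ _ = ≤-trans (≤-reflexive (*-zeroʳ (size * P))) z≤n
      sieve-list (V ∷ 𝒱) s (v ∷ vs) h = begin
        size * P * (sifted V 1 S + sum (map (λ V → sifted V 1 S) 𝒱)) ≡⟨ *-distribˡ-+ (size * P) (sifted V 1 S) _ ⟩
        size * P * sifted V 1 S + size * P * sum (map (λ V → sifted V 1 S) 𝒱)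
          ≤⟨ +-mono-≤ (proj₁ (bounds {V} {s} (invariant-equidistributed V V s (λ x t → invariant v x t) (has-𝟘 v) (*-monoˡ-≤ (# V) h)))) (sieve-list 𝒱 s vs h) ⟩
        φ S * # V * N + E + (φ S * sizes 𝒱 * N + length 𝒱 * E) ≡⟨ lemma (φ S) (# V) N E (sizes 𝒱) (length 𝒱) ⟩
        φ S * (# V + sizes 𝒱) * N + suc (length 𝒱) * E ∎
        where
          open ≤-Reasoning
          E = 2 ^ length S * (s * size * P)
          lemma : ∀ f v n e z l → f * v * n + e + (f * z * n + l * e) ≡ f * (v + z) * n + suc l * e
          lemma = solve-∀

    finish : ∀ A 𝒱 → (∀ x → T (A x) → Outside 𝒱 x → CompletelyNormal K q n x) →
      sum (map (λ V → sifted V 1 S) 𝒱) + sum (map (λ r → # power r) R) < sifted A 1 S → ∃ Good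
    finish A 𝒱 normal lt with sifted-survivor A 𝒱 S R lt
    ... | x , (a , p) , o , o′ = adjust-good (power⇒≢𝟘 1 (1∣ N) (T-∧₁ p)) x-free (normal x a o)
      where
        x-free : ∀ {r} → IsPrimeDivisor M r → ¬ T (power r x)
        x-free pr t with cover pr
        ... | inj₁ r∈S = free⇒ r∈S (T-∧₂ {power 1 x} p) t
        ... | inj₂ r∈R = All.lookup o′ r∈R t

    -- A is sieved from below and every bad V from above. The error s′ for A is kept apart from s,
    -- because it vanishes when A is the whole field.
    criterion : ∀ A 𝒱 s s′ ρ → Equidistributed A s′ → All IsSubgroup 𝒱 → size ≤ s * s →
      (∀ x → T (A x) → Outside 𝒱 x → CompletelyNormal K q n x) → sum (map (λ r → # power r) R) ≤ ρ →
      φ S * sizes 𝒱 * N + (length 𝒱 * s + s′) * (2 ^ length S * (size * P)) + size * P * ρ < φ S * # A * N → ∃ Good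
    criterion A 𝒱 s s′ ρ eqd subs h normal ρ≥ lt = finish A 𝒱 normal (*-cancelˡ-< (size * P) _ _ (+-cancelʳ-< (W * (s′ * size * P)) _ _ (begin-strict
      size * P * (Σ𝒱 + Σᴿ) + W * (s′ * size * P) ≡⟨ cong (_+ W * (s′ * size * P)) (*-distribˡ-+ (size * P) Σ𝒱 Σᴿ) ⟩
      size * P * Σ𝒱 + size * P * Σᴿ + W * (s′ * size * P) ≤⟨ +-monoˡ-≤ _ (+-mono-≤ (sieve-list 𝒱 s subs h) (*-monoʳ-≤ (size * P) ρ≥)) ⟩
      φ S * sizes 𝒱 * N + length 𝒱 * (W * (s * size * P)) + size * P * ρ + W * (s′ * size * P) ≡⟨ lemma (φ S * sizes 𝒱 * N) (length 𝒱) W s size P ρ s′ ⟩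
      φ S * sizes 𝒱 * N + (length 𝒱 * s + s′) * (W * (size * P)) + size * P * ρ <⟨ lt ⟩
      φ S * # A * N ≤⟨ proj₂ (bounds {A} {s′} eqd) ⟩
      size * P * sifted A 1 S + W * (s′ * size * P) ∎)))
      where
        open ≤-Reasoning
        W = 2 ^ length S
        Σ𝒱 = sum (map (λ V → sifted V 1 S) 𝒱)
        Σᴿ = sum (map (λ r → # power r) R)
        lemma : ∀ x l w s z p ρ t → x + l * (w * (s * z * p)) + z * p * ρ + w * (t * z * p) ≡ x + (l * s + t) * (w * (z * p)) + z * p * ρ
        lemma = solve-∀

    trivial-criterion : ∀ 𝒱 ρ → (∀ x → Outside 𝒱 x → CompletelyNormal K q n x) → sum (map (λ r → # power r) R) ≤ ρ →
      P * (sizes 𝒱 + ρ) < φ S * N → ∃ Good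
    trivial-criterion 𝒱 ρ normal ρ≥ lt = finish (λ _ → true) 𝒱 (λ x _ → normal x) (*-cancelˡ-< P _ _ (*-cancelˡ-< size _ _ (begin-strict
      size * (P * (Σ𝒱 + Σᴿ)) ≤⟨ *-monoʳ-≤ size (*-monoʳ-≤ P (+-mono-≤ (le 𝒱) ρ≥)) ⟩
      size * (P * (sizes 𝒱 + ρ)) <⟨ *-monoʳ-< size {{>-nonZero size>0}} lt ⟩
      size * (φ S * N) ≡⟨ lemma size (φ S) N ⟩
      φ S * size * N ≡⟨ cong (λ z → φ S * z * N) (sym #-all) ⟩
      φ S * # (λ _ → true) * N ≤⟨ proj₂ (bounds {λ _ → true} {0} whole-equidistributed) ⟩
      size * P * sifted (λ _ → true) 1 S + W * 0 ≡⟨ trans (cong (size * P * sifted (λ _ → true) 1 S +_) (*-zeroʳ W)) (+-identityʳ _) ⟩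
      size * P * sifted (λ _ → true) 1 S ≡⟨ *-assoc size P _ ⟩
      size * (P * sifted (λ _ → true) 1 S) ∎)))
      where
        open ≤-Reasoning
        W = 2 ^ length S
        Σ𝒱 = sum (map (λ V → sifted V 1 S) 𝒱)
        Σᴿ = sum (map (λ r → # power r) R)
        lemma : ∀ z f n → z * (f * n) ≡ f * z * n
        lemma = solve-∀
        le : ∀ 𝒱 → sum (map (λ V → sifted V 1 S) 𝒱) ≤ sizes 𝒱
        le [] = z≤n
        le (V ∷ 𝒱) = +-mono-≤ (#-⊆ λ x t → T-∧₁ t) (le 𝒱)

  allBadSets : List (𝕂 → Bool)
  allBadSets = Ground.linearSets ++ badSets

  allBadSets-subgroups : All IsSubgroup allBadSets
  allBadSets-subgroups = Allₚ.++⁺ Ground.linearSets-subgroups badSets-subgroups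

  outside-badSets : ∀ x → Outside Ground.linearSets x → Outside badSets x → CompletelyNormal K q n x
  outside-badSets x o₁ o₂ = completely-normal x o₁ (Allₚ.++⁻ˡ Ground.nonlinearSets o₂) (Allₚ.++⁻ʳ Ground.nonlinearSets o₂)

  outside-allBadSets : ∀ x → Outside allBadSets x → CompletelyNormal K q n x
  outside-allBadSets x o = outside-badSets x (Allₚ.++⁻ˡ Ground.linearSets o) (Allₚ.++⁻ʳ Ground.linearSets o)

  -- Certificates by dual bases

  private
    sumF-cong : ∀ k {f g : Fin k → 𝕂} → (∀ i → f i ≡ g i) → sumF K k f ≡ sumF K k g
    sumF-cong zero h = refl
    sumF-cong (suc k) h = cong₂ _⊹_ (h fzero) (sumF-cong k (h ∘ fsuc))

    sumF-𝟘 : ∀ k → sumF K k (λ _ → 𝟘) ≡ 𝟘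
    sumF-𝟘 zero = refl
    sumF-𝟘 (suc k) = trans (⊹-idˡ _) (sumF-𝟘 k)

    sumF-· : ∀ k c (f : Fin k → 𝕂) → c · sumF K k f ≡ sumF K k (λ i → c · f i)
    sumF-· zero c f = ·-zeroʳ c
    sumF-· (suc k) c f = trans (·-distribˡ c _ _) (cong (c · f fzero ⊹_) (sumF-· k c (f ∘ fsuc)))

    sumF-+ : ∀ k (f g : Fin k → 𝕂) → sumF K k f ⊹ sumF K k g ≡ sumF K k (λ i → f i ⊹ g i)
    sumF-+ zero f g = ⊹-idˡ 𝟘
    sumF-+ (suc k) f g = trans (solveR 4 (λ a b c d → (a :+ b) :+ (c :+ d) := (a :+ c) :+ (b :+ d)) refl _ _ _ _) (cong (f fzero ⊹ g fzero ⊹_) (sumF-+ k (f ∘ fsuc) (g ∘ fsuc)))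

    sumF-swap : ∀ j k (f : Fin j → Fin k → 𝕂) → sumF K j (λ a → sumF K k (f a)) ≡ sumF K k (λ b → sumF K j (λ a → f a b))
    sumF-swap zero k f = sym (sumF-𝟘 k)
    sumF-swap (suc j) k f = trans (cong (sumF K k (f fzero) ⊹_) (sumF-swap j k (f ∘ fsuc))) (sumF-+ k (f fzero) (λ b → sumF K j (λ a → f (fsuc a) b)))

    sumF-frobenius : ∀ e k (f : Fin k → 𝕂) → frobenius e (sumF K k f) ≡ sumF K k (λ i → frobenius e (f i))
    sumF-frobenius e zero f = additive-𝟘 (frobenius-+ e)
    sumF-frobenius e (suc k) f = trans (frobenius-+ e _ _) (cong (frobenius e (f fzero) ⊹_) (sumF-frobenius e k (f ∘ fsuc)))

    select : ∀ m (c : Fin m → 𝕂) (k : Fin m) → sumF K m (λ i → c i · ((if toℕ k ≡ᵇ toℕ i then 1 else 0) ⋆ 𝟙)) ≡ c k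
    select (suc m) c fzero = trans (cong₂ _⊹_ (trans (cong (c fzero ·_) (⊹-idʳ 𝟙)) (·-idʳ _)) (trans (sumF-cong m (λ i → ·-zeroʳ _)) (sumF-𝟘 m))) (⊹-idʳ _)
    select (suc m) c (fsuc k) = trans (cong₂ _⊹_ (·-zeroʳ _) (select m (c ∘ fsuc) k)) (⊹-idˡ _)

  conjugate : ℕ → 𝕂 → ℕ → 𝕂
  conjugate l x e = x ^ᴷ (q ^ (l * e))

  -- Apply σ^j to the relation Σ cᵢ σ^i(x) = 0, multiply by σ^(k+j)(y) and sum over j. The scalars
  -- cᵢ are fixed by σ, and duality singles out c_k.
  dual-independent : ∀ l m-1 (lm≡n : l * suc m-1 ≡ n) x y →
    (∀ (k i : Fin (suc m-1)) → sumF K (suc m-1) (λ j → conjugate l x (toℕ i + toℕ j) · conjugate l y (toℕ k + toℕ j)) ≡ (if toℕ k ≡ᵇ toℕ i then 1 else 0) ⋆ 𝟙) →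
    Level.Independent l m-1 lm≡n x
  dual-independent l m-1 lm≡n x y dual c h sum≡0 k = begin
    c k ≡⟨ sym (select m c k) ⟩
    sumF K m (λ i → c i · ((if toℕ k ≡ᵇ toℕ i then 1 else 0) ⋆ 𝟙)) ≡⟨ sumF-cong m (λ i → trans (cong (c i ·_) (sym (dual k i))) (sumF-· m (c i) (λ j → X (toℕ i + toℕ j) · Y j))) ⟩
    sumF K m (λ i → sumF K m (λ j → c i · (X (toℕ i + toℕ j) · Y j))) ≡⟨ sumF-swap m m (λ i j → c i · (X (toℕ i + toℕ j) · Y j)) ⟩
    sumF K m (λ j → sumF K m (λ i → c i · (X (toℕ i + toℕ j) · Y j))) ≡⟨ sumF-cong m vanish ⟩
    sumF K m (λ _ → 𝟘) ≡⟨ sumF-𝟘 m ⟩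
    𝟘 ∎
    where
      open ≡-Reasoning
      m = suc m-1
      X : ℕ → 𝕂
      X = conjugate l x
      Y : Fin m → 𝕂
      Y j = conjugate l y (toℕ k + toℕ j)
      fixed : ∀ i j → frobenius (l * j) (c i) ≡ c i
      fixed i zero = trans (cong (λ z → c i ^ᴷ (q ^ z)) (*-zeroʳ l)) (pow-1 (c i))
      fixed i (suc j) = trans (cong (c i ^ᴷ_) (trans (cong (q ^_) (*-suc l j)) (^-distribˡ-+-* q l (l * j)))) (trans (pow-* (c i) (q ^ l) (q ^ (l * j))) (trans (cong (frobenius (l * j)) (h i)) (fixed i j)))
      shift : ∀ (i : Fin m) j → frobenius (l * j) (X (toℕ i)) ≡ X (toℕ i + j)
      shift i j = trans (sym (pow-* x (q ^ (l * toℕ i)) (q ^ (l * j)))) (cong (x ^ᴷ_) (trans (sym (^-distribˡ-+-* q (l * toℕ i) (l * j))) (cong (q ^_) (sym (*-distribˡ-+ l (toℕ i) j)))))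
      vanish : ∀ j → sumF K m (λ i → c i · (X (toℕ i + toℕ j) · Y j)) ≡ 𝟘
      vanish j = trans (sumF-cong m (λ i → trans (cong₂ (λ a b → a · (b · Y j)) (sym (fixed i (toℕ j))) (sym (shift i (toℕ j))))
          (trans (solveR 3 (λ a b y → a :* (b :* y) := y :* (a :* b)) refl _ _ (Y j)) (cong (Y j ·_) (sym (pow-· (c i) (X (toℕ i)) (q ^ (l * toℕ j))))))))
        (trans (sym (sumF-· m (Y j) (λ i → frobenius (l * toℕ j) (c i · X (toℕ i))))) (trans (cong (Y j ·_) (trans (sym (sumF-frobenius (l * toℕ j) m (λ i → c i · X (toℕ i)))) (trans (cong (frobenius (l * toℕ j)) sum≡0) (additive-𝟘 (frobenius-+ (l * toℕ j)))))) (·-zeroʳ _)))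

  module _ (p : ℕ) {{_ : NonZero p}} {d-1 : ℕ} (rel : Vec ℕ (suc d-1)) (p⋆𝟙 : p ⋆ 𝟙 ≡ 𝟘) (θ : 𝕂)
    (θ-rel : θ ^ᴷ suc d-1 ≡ Evaluation.ev p rel θ rel) where
    open Evaluation p rel
    open At p⋆𝟙 θ θ-rel

    -- At level n there is a single conjugate and the dual basis is an inverse, so `y n` doubles as
    -- the certificate that x is not 0.
    certified : ∀ x y rs → T (normalTest q n x y) → T (orderTest N x rs) → (∀ {r} → IsPrimeDivisor N r → r ∈ map proj₁ rs) → T (equalV (mulV x (y n)) (constV 1)) → ∃ Good
    certified x y rs tn to primes tu = ev θ x , generated x≢0 (λ pr t → order-sound N x rs to (primes pr) (toWitness t)) , normal′
      where
        x≢0 : ev θ x ≢ 𝟘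
        x≢0 = unit-sound x (y n) tu
        level : ∀ l m-1 → l * suc m-1 ≡ n → ∀ bs → T (levelTest q l (suc m-1) bs x (y l)) → NormalOver K q l (suc m-1) (ev θ x)
        level l m-1 e bs t = Level.independent⇒normal l m-1 e (ev θ x) (dual-independent l m-1 e (ev θ x) (ev θ (y l))
            (dual-sound (conjugate l (ev θ x)) (conjugate l (ev θ (y l))) (suc m-1) _ _ (represents x) (represents (y l)) (T-∧₂ {value bs ≡ᵇ q ^ l} t)))
          where
            represents : ∀ v → Represents (conjugate l (ev θ v)) 0 (suc m-1 + suc m-1) (orbitV (suc m-1 + suc m-1) bs v)
            represents v = orbit-represents (conjugate l (ev θ v)) bs step (suc m-1 + suc m-1) 0 v (sym (trans (cong (λ z → ev θ v ^ᴷ (q ^ z)) (*-zeroʳ l)) (pow-1 _)))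
              where
                step : ∀ e → conjugate l (ev θ v) (suc e) ≡ conjugate l (ev θ v) e ^ᴷ value bs
                step e = trans (cong (ev θ v ^ᴷ_) (trans (cong (q ^_) (trans (*-suc l e) (+-comm l (l * e)))) (^-distribˡ-+-* q (l * e) l)))
                  (trans (pow-* (ev θ v) (q ^ (l * e)) (q ^ l)) (cong (conjugate l (ev θ v) e ^ᴷ_) (sym (T-≡ᵇ {value bs} {q ^ l} (T-∧₁ t)))))
        normal′ : CompletelyNormal K q n (ev θ x)
        normal′ zero m e = contradiction e (<⇒≢ 0<n)
        normal′ (suc l) zero e = contradiction (trans (sym (*-zeroʳ (suc l))) e) (<⇒≢ 0<n)
        normal′ (suc l) (suc m) e = level (suc l) m e (binary 20 (q ^ suc l)) (subst (λ z → T (levelTest q (suc l) z (binary 20 (q ^ suc l)) x (y (suc l)))) n/l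
            (strip (suc l ∣? n) (allBelow-sound (suc n) _ tn (suc l) (s≤s (∣⇒≤ {{>-nonZero 0<n}} l∣n)))))
          where
            l∣n : suc l ∣ n
            l∣n = divides (suc m) (trans (sym e) (*-comm (suc l) (suc m)))
            n/l : n / suc l ≡ suc m
            n/l = trans (cong (_/ suc l) (trans (sym e) (*-comm (suc l) (suc m)))) (m*n/n≡m (suc m) (suc l))
            strip : ∀ (d : Dec (suc l ∣ n)) {b} → T (not ⌊ d ⌋ ∨ b) → T b
            strip (yes _) t = t
            strip (no h) _ = contradiction l∣n h

  -- Degrees one and two

  one-dimensional : ∀ l (e : l * 1 ≡ n) {x} → x ≢ 𝟘 → NormalOver K q l 1 x
  one-dimensional l e {x} x≢0 = Level.independent⇒normal l 0 e x λ { c h s fzero →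
    conclude (c fzero) (no-zero-div (trans (sym (⊹-idʳ _)) s)) }
    where
      conclude : ∀ c → c ≡ 𝟘 ⊎ conj K q l x 1 fzero ≡ 𝟘 → c ≡ 𝟘
      conclude c (inj₁ h) = h
      conclude c (inj₂ h) = contradiction h (pow-≢𝟘 (q ^ (l * 0)) x≢0)

  -- If c₀ x + c₁ x^q = 0 with c₁ ≠ 0, then x^(q-1) lies in F_q^*, so x has order at most (q-1)² < q² - 1.
  two-dimensional : n ≡ 2 → ∀ {x} → x ≢ 𝟘 → (∀ {r} → IsPrimeDivisor N r → ¬ T (power r x)) → NormalOver K q 1 2 x
  two-dimensional refl {x} x≢0 x-free = Level.independent⇒normal 1 1 refl x independent
    where
      p : ℕ
      p = q ∸ 1
      q≡ : suc p ≡ q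
      q≡ = m+[n∸m]≡n (<⇒≤ 1<q)
      0<p : 0 < p
      0<p = m<n⇒0<n∸m 1<q
      scalar-order : ∀ {a} → a ^ᴷ (q ^ 1) ≡ a → a ≢ 𝟘 → a ^ᴷ p ≡ 𝟙
      scalar-order {a} h a≢0 = ·-cancelˡ a≢0 (trans (cong (a ^ᴷ_) (trans q≡ (sym (*-identityʳ q)))) (trans h (sym (·-idʳ a))))
      p²<N : p * p < N
      p²<N = ≤-pred (subst (suc (suc (p * p)) ≤_) (sym sN≡q²) (subst (λ z → suc (suc (p * p)) ≤ z * (z * 1)) q≡ (≤-trans (s≤s (m<m+n (p * p) (*-mono-< {0} {2} z<s 0<p))) (≤-reflexive (lemma p)))))
        where
          lemma : ∀ p → suc (p * p + 2 * p) ≡ suc p * (suc p * 1)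
          lemma = solve-∀
          sN≡q² : suc N ≡ q * (q * 1)
          sN≡q² = trans sN≡size size≡
      independent : Level.Independent 1 1 refl x
      independent c h s = λ { fzero → c₀≡0 ; (fsuc fzero) → c₁≡0 }
        where
          a = c fzero
          b = c (fsuc fzero)
          y = x ^ᴷ p
          relation : x · (a ⊹ b · y) ≡ 𝟘
          relation = trans (solveR 4 (λ x a b y → x :* (a :+ b :* y) := a :* x :+ (b :* (x :* y) :+ (a :- a))) refl x a b y)
            (trans (cong₂ (λ u v → a · u ⊹ v) (sym (pow-1 x)) (cong₂ (λ u v → b · u ⊹ v) (cong (x ^ᴷ_) (trans q≡ (sym (*-identityʳ q)))) (⊖-invʳ a))) s)
          eq : a ⊹ b · y ≡ 𝟘
          eq = nonzero-factor (no-zero-div relation)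
            where
              nonzero-factor : x ≡ 𝟘 ⊎ a ⊹ b · y ≡ 𝟘 → a ⊹ b · y ≡ 𝟘
              nonzero-factor (inj₁ z) = contradiction z x≢0
              nonzero-factor (inj₂ z) = z
          c₁≡0 : b ≡ 𝟘
          c₁≡0 with b ≟ᴷ 𝟘
          ... | yes z = z
          ... | no b≢0 = contradiction y^p (subst (_≢ 𝟙) (pow-* x p p) (no-small-order x≢0 x-free (p * p) (*-mono-< 0<p 0<p) p²<N))
            where
              by≡ : b · y ≡ ⊖ a
              by≡ = trans (solveR 2 (λ a z → z := (a :+ z) :- a) refl a (b · y)) (trans (cong (_⊝ a) eq) (⊹-idˡ _))
              -a-fixed : (⊖ a) ^ᴷ (q ^ 1) ≡ ⊖ a
              -a-fixed = trans (additive-⊖ (frobenius-+ 1) a) (cong ⊖_ (h fzero))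
              -a≢0 : ⊖ a ≢ 𝟘
              -a≢0 z = ·≢𝟘 b≢0 (pow-≢𝟘 p x≢0) (trans by≡ z)
              y^p : y ^ᴷ p ≡ 𝟙
              y^p = trans (sym (·-idˡ _)) (trans (cong (_· y ^ᴷ p) (sym (scalar-order (h (fsuc fzero)) b≢0))) (trans (sym (pow-· b y p)) (trans (cong (_^ᴷ p) by≡) (scalar-order -a-fixed -a≢0))))
          c₀≡0 : a ≡ 𝟘
          c₀≡0 = trans (sym (⊹-idʳ a)) (trans (cong (a ⊹_) (sym (trans (cong (_· y) c₁≡0) (·-zeroˡ y)))) eq)

  degree-one : n ≡ 1 → ∃ Good
  degree-one n≡1 = let γ , prim , _ = generator in γ , prim , λ l m e → normal γ (proj₁ prim) l m e
    where
      normal : ∀ γ → γ ≢ 𝟘 → ∀ l m → l * m ≡ n → NormalOver K q l m γ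
      normal γ γ≢0 l m e = subst (λ z → NormalOver K q l z γ) (sym m≡1) (one-dimensional l (trans (cong (l *_) (sym m≡1)) e) γ≢0)
        where
          m≡1 : m ≡ 1
          m≡1 = m*n≡1⇒n≡1 l m (trans e n≡1)

  degree-two : n ≡ 2 → ∃ Good
  degree-two n≡2 = let γ , prim , γ-free = generator in γ , prim , λ l m e → normal γ (proj₁ prim) γ-free l m (trans e n≡2) e
    where
      normal : ∀ γ → γ ≢ 𝟘 → (∀ {r} → IsPrimeDivisor N r → ¬ T (power r γ)) → ∀ l m → l * m ≡ 2 → l * m ≡ n → NormalOver K q l m γ
      normal γ γ≢0 γ-free 1 m e e′ = subst (λ z → NormalOver K q 1 z γ) (trans (sym e) (*-identityˡ m)) (two-dimensional n≡2 γ≢0 γ-free)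
      normal γ γ≢0 γ-free l 1 e e′ = one-dimensional l e′ γ≢0
      normal γ γ≢0 γ-free zero (suc (suc m)) () e′
      normal γ γ≢0 γ-free (suc (suc l)) zero e e′ = contradiction (trans (sym (*-zeroʳ l)) e) λ ()
      normal γ γ≢0 γ-free zero zero () e′
      normal γ γ≢0 γ-free (suc (suc l)) (suc (suc m)) e e′ = contradiction e (λ e → <⇒≢ (≤-trans (≤ᵇ⇒≤ 3 4 tt) (*-mono-≤ {2} {suc (suc l)} {2} {suc (suc m)} (s≤s (s≤s z≤n)) (s≤s (s≤s z≤n)))) (sym e))

  characteristic : ∀ {r} → Prime r → r ∣ q → r ⋆ 𝟙 ≡ 𝟘
  characteristic r-prime r∣q =
    trans (cong (_⋆ 𝟙) (prime-∣-prime r-prime p-prime (prime-∣-^ char-p char-e r-prime (subst (_ ∣_) q≡p^e r∣q)))) p⋆𝟙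

  -- Eigenspaces of the Frobenius map and the complement of the hyperplanes

  module Eigenspaces (l m-1 : ℕ) (lm≡n : l * suc m-1 ≡ n) where
    open Level l m-1 lm≡n
    open Linear l m-1 lm≡n

    private
      L : 𝕂 → 𝕂 → 𝕂
      L z = resolvent z m-1

      fixed : ∀ z → T (rootsOfUnity z) → τ z ≡ z
      fixed z t = toWitness {a? = τ z ≟ᴷ z} (T-∧₁ t)

      order : ∀ z → T (rootsOfUnity z) → z ^ᴷ m ≡ 𝟙
      order z t = toWitness {a? = z ^ᴷ m ≟ᴷ 𝟙} (T-∧₂ {inSub z} t)

      resolvent-scalar : ∀ z k c x → τ c ≡ c → resolvent z k (c · x) ≡ c · resolvent z k x
      resolvent-scalar z zero c x h = refl
      resolvent-scalar z (suc k) c x h = trans (cong (z ^ᴷ suc k · (c · x) ⊹_) (trans (cong τ (resolvent-scalar z k c x h)) (trans (τ-· c _) (cong (_· τ (resolvent z k x)) h))))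
        (solveR 4 (λ a c x r → a :* (c :* x) :+ c :* r := c :* (a :* x :+ r)) refl (z ^ᴷ suc k) c x _)

      L-τ : ∀ z → T (rootsOfUnity z) → ∀ x → L z (τ x) ≡ τ (L z x)
      L-τ z t x = trans (resolvent≡act (z , fixed z t) m-1 (τ x)) (trans (act-τ P.⟦ P.geometric (z , fixed z t) m-1 ⟧ x) (cong τ (sym (resolvent≡act (z , fixed z t) m-1 x))))

      L-eigen : ∀ z → T (rootsOfUnity z) → ∀ x → τ (L z x) ≡ z · L z x
      L-eigen z t = resolvent-eigen (z , fixed z t) (order z t)

      -- `L z′` commutes with τ and with scalars, so its value at w is an eigenvector for z as well
      -- as for z′; for z ≠ z′ it must be 0.
      L-orthogonal : ∀ z z′ → T (rootsOfUnity z) → T (rootsOfUnity z′) → z ≢ z′ → ∀ w → τ w ≡ z · w → L z′ w ≡ 𝟘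
      L-orthogonal z z′ t t′ z≢z′ w e = conclude (no-zero-div product≡0)
        where
          G = L z′ w
          z′G≡zG : z′ · G ≡ z · G
          z′G≡zG = trans (sym (L-eigen z′ t′ w)) (trans (sym (L-τ z′ t′ w)) (trans (cong (L z′) e) (resolvent-scalar z′ m-1 z w (fixed z t))))
          product≡0 : (z ⊝ z′) · G ≡ 𝟘
          product≡0 = trans (solveR 3 (λ a b g → (a :- b) :* g := a :* g :- b :* g) refl z z′ G) (trans (cong (z · G ⊝_) z′G≡zG) (⊖-invʳ _))
          conclude : z ⊝ z′ ≡ 𝟘 ⊎ G ≡ 𝟘 → G ≡ 𝟘
          conclude (inj₁ h) = contradiction (⊝-≡ h) z≢z′
          conclude (inj₂ h) = h

      -- Each of the k + 1 terms z^(k-i) τ^i w equals z^k w. On its own eigenspace `L z` is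
      -- therefore multiplication by m z^(m-1), which is nonzero if m is not 0 in K.
      L-own : ∀ z k w → τ z ≡ z → τ w ≡ z · w → resolvent z k w ≡ (suc k ⋆ 𝟙) · (z ^ᴷ k · w)
      L-own z zero w hz hw = sym (trans (cong₂ _·_ (⊹-idʳ 𝟙) (·-idˡ w)) (·-idˡ w))
      L-own z (suc k) w hz hw = trans (cong (λ y → z ^ᴷ suc k · w ⊹ τ y) (L-own z k w hz hw))
        (trans (cong (z ^ᴷ suc k · w ⊹_) (trans (τ-· _ _) (cong₂ _·_ (τ-⋆ (suc k)) (trans (τ-· _ _) (cong₂ _·_ (τ-pow k) hw)))))
          (solveR 4 (λ z y w c → (z :* y) :* w :+ c :* (y :* (z :* w)) := (con (ℤ.+ 1) :+ c) :* ((z :* y) :* w)) refl z (z ^ᴷ k) w (suc k ⋆ 𝟙)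
            |> λ e → trans e (cong (λ o → (o ⊹ suc k ⋆ 𝟙) · (z ^ᴷ suc k · w)) (⊹-idʳ 𝟙))))
        where
          infixl 1 _|>_
          _|>_ : ∀ {X Y : Set} → X → (X → Y) → Y
          x |> f = f x
          τ-⋆ : ∀ k → τ (k ⋆ 𝟙) ≡ k ⋆ 𝟙
          τ-⋆ zero = additive-𝟘 (frobenius-+ l)
          τ-⋆ (suc k) = trans (frobenius-+ l 𝟙 _) (cong₂ _⊹_ τ-𝟙 (τ-⋆ k))
          τ-pow : ∀ k → τ (z ^ᴷ k) ≡ z ^ᴷ k
          τ-pow zero = τ-𝟙
          τ-pow (suc k) = trans (τ-· z _) (cong₂ _·_ hz (τ-pow k))

      -- Values of `L z` are eigenvectors, and they cannot all be 0, the kernel having at most q^n /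
      -- qˡ elements.
      eigenvector : ∀ z → T (rootsOfUnity z) → ∃ λ w → w ≢ 𝟘 × τ w ≡ z · w
      eigenvector z t = cases (any? λ x → ¬? (L z x ≟ᴷ 𝟘))
        where
          cases : Dec (∃ λ x → L z x ≢ 𝟘) → ∃ λ w → w ≢ 𝟘 × τ w ≡ z · w
          cases (yes (x , h)) = L z x , h , L-eigen z t x
          cases (no none) = contradiction (resolvent-ker (z , fixed z t)) (<⇒≱ (begin-strict
            q ^ n ≡⟨ sym (*-identityʳ (q ^ n)) ⟩
            q ^ n * 1 <⟨ *-monoʳ-< (q ^ n) {{>-nonZero (subst (0 <_) size≡ (<-trans z<s 1<size))}} 1<qˡ ⟩
            q ^ n * qˡ ≡⟨ cong (_* qˡ) (trans (sym size≡) (sym #-all)) ⟩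
            # (λ _ → true) * qˡ ≤⟨ *-monoˡ-≤ qˡ (#-⊆ λ x _ → fromWitness (stable x)) ⟩
            # ker (L z) * qˡ ∎))
            where
              open ≤-Reasoning
              stable : ∀ x → L z x ≡ 𝟘
              stable x with L z x ≟ᴷ 𝟘
              ... | yes e = e
              ... | no h = contradiction (x , h) none

    avoid common : List 𝕂 → 𝕂 → Bool
    avoid [] x = true
    avoid (z ∷ zs) x = avoid zs x ∧ not (ker (L z) x)
    common [] x = true
    common (z ∷ zs) x = common zs x ∧ ker (L z) x

    avoid⇒outside : ∀ zs x → T (avoid zs x) → Outside (map (λ z → ker (resolvent z m-1)) zs) x
    avoid⇒outside [] x t = []
    avoid⇒outside (z ∷ zs) x t = (λ k → T-not (T-∧₂ {avoid zs x} t) k) ∷ avoid⇒outside zs x (T-∧₁ t)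

    private
      ker-shift : ∀ z x u → L z u ≡ 𝟘 → ker (L z) (x ⊹ u) ≡ ker (L z) x
      ker-shift z x u h = cong (λ y → ⌊ y ≟ᴷ 𝟘 ⌋) (trans (resolvent-additive z m-1 x u) (trans (cong (L z x ⊹_) h) (⊹-idʳ _)))

      avoid-shift : ∀ zs x u → All (λ z → L z u ≡ 𝟘) zs → avoid zs (x ⊹ u) ≡ avoid zs x
      avoid-shift [] x u [] = refl
      avoid-shift (z ∷ zs) x u (h ∷ hs) = cong₂ (λ a b → a ∧ not b) (avoid-shift zs x u hs) (ker-shift z x u h)

    avoid-invariant : ∀ zs {u} x → T (common zs u) → avoid zs (x ⊹ u) ≡ avoid zs x
    avoid-invariant zs {u} x t = avoid-shift zs x u (vanish zs t)
      where
        vanish : ∀ zs → T (common zs u) → All (λ z → L z u ≡ 𝟘) zs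
        vanish [] _ = []
        vanish (z ∷ zs) t = toWitness {a? = L z u ≟ᴷ 𝟘} (T-∧₂ {common zs u} t) ∷ vanish zs (T-∧₁ t)

    common-isSubgroup : ∀ zs → IsSubgroup (common zs)
    common-isSubgroup [] = record { has-𝟘 = tt ; invariant = λ _ _ → refl }
    common-isSubgroup (z ∷ zs) = ∧-isSubgroup (common-isSubgroup zs) (ker-isSubgroup (resolvent-additive z m-1))

    -- `L z` takes values in the eigenspace of z, the zeros of y^qˡ - z y. Each further condition
    -- thus shrinks the intersection by a factor of at most qˡ.
    common-size : ∀ zs → All (T ∘ rootsOfUnity) zs → size ≤ # common zs * qˡ ^ length zs
    common-size [] [] = ≤-reflexive (trans (sym #-all) (sym (*-identityʳ _)))
    common-size (z ∷ zs) (t ∷ ts) = begin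
      size ≤⟨ common-size zs ts ⟩
      # common zs * qˡ ^ length zs ≤⟨ *-monoˡ-≤ (qˡ ^ length zs) step ⟩
      # eigenspace * # common (z ∷ zs) * qˡ ^ length zs ≤⟨ *-monoˡ-≤ (qˡ ^ length zs) (*-monoˡ-≤ (# common (z ∷ zs)) eigenspace-size) ⟩
      qˡ * # common (z ∷ zs) * qˡ ^ length zs ≡⟨ lemma qˡ (# common (z ∷ zs)) (qˡ ^ length zs) ⟩
      # common (z ∷ zs) * (qˡ * qˡ ^ length zs) ∎
      where
        open ≤-Reasoning
        lemma : ∀ a b c → a * b * c ≡ b * (a * c)
        lemma = solve-∀
        eigenspace : 𝕂 → Bool
        eigenspace y = ⌊ τ y ≟ᴷ z · y ⌋
        eigenspace-size : # eigenspace ≤ qˡ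
        eigenspace-size = ≤-trans (#-⊆ λ y h → fromWitness {a? = (⊖ z) · y ^ᴷ 1 ⊹ y ^ᴷ qˡ ≟ᴷ 𝟘}
            (trans (cong₂ _⊹_ (trans (cong ((⊖ z) ·_) (pow-1 y)) (sym (-‿distribˡ-* z y))) (toWitness {a? = τ y ≟ᴷ z · y} h)) (⊖-invˡ _)))
          (monic-roots (monic-+ (low-monomial qˡ 1 (⊖ z) 1<qˡ) (monic-pow qˡ)))
        step : # common zs ≤ # eigenspace * # common (z ∷ zs)
        step = #-fibres (common zs) eigenspace (L z) (# common (z ∷ zs)) (λ x _ → fromWitness (L-eigen z t x))
          (subgroup-fibre (resolvent-additive z m-1) (common zs) (common-isSubgroup zs))

    module _ (m⋆𝟙≢𝟘 : m ⋆ 𝟙 ≢ 𝟘) where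

      private
        -- Let w be an eigenvector for z and consider the lines y + c w with c in F_{q^l}. On such a
        -- line the other resolvents are constant, while `L z` is injective in c; hence at most one
        -- of its qˡ points lies in the kernel. Double counting over y and c gives the inequality.
        slice-bound : ∀ z zs → T (rootsOfUnity z) → All (T ∘ rootsOfUnity) zs → All (z ≢_) zs →
          qˡ * # (λ x → avoid zs x ∧ ker (L z) x) ≤ # avoid zs
        slice-bound z zs t ts z∉ = use (eigenvector z t)
          where
            use : (∃ λ w → w ≢ 𝟘 × τ w ≡ z · w) → qˡ * # (λ x → avoid zs x ∧ ker (L z) x) ≤ # avoid zs
            use (w , w≢0 , hw) = begin
              qˡ * # B ≤⟨ *-monoˡ-≤ (# B) qˡ≤#inSub ⟩
              # inSub * # B ≡⟨ sym (∑-*ʳ (# B) (ι ∘ inSub)) ⟩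
              ∑ (λ c → ι (inSub c) * # B) ≡⟨ ∑-cong (λ c → trans (cong (ι (inSub c) *_) (∑-translate (ι ∘ B) (c · w))) (sym (∑-*ˡ (ι (inSub c)) _))) ⟩
              ∑ (λ c → ∑ (λ y → ι (inSub c) * ι (B (y ⊹ c · w)))) ≡⟨ ∑-swap _ ⟩
              ∑ (λ y → ∑ (λ c → ι (inSub c) * ι (B (y ⊹ c · w)))) ≤⟨ ∑-mono le ⟩
              # avoid zs ∎
              where
                open ≤-Reasoning
                B : 𝕂 → Bool
                B x = avoid zs x ∧ ker (L z) x
                v = L z w
                v≢0 : v ≢ 𝟘
                v≢0 e = ·≢𝟘 m⋆𝟙≢𝟘 (·≢𝟘 (pow-≢𝟘 m-1 z≢0) w≢0) (trans (sym (L-own z m-1 w (fixed z t) hw)) e)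
                  where
                    z≢0 : z ≢ 𝟘
                    z≢0 z≡0 = 0≢1 (trans (sym (trans (cong (_^ᴷ m) z≡0) (·-zeroˡ _))) (order z t))
                others : All (λ z′ → L z′ w ≡ 𝟘) zs
                others = help zs ts z∉
                  where
                    help : ∀ zs → All (T ∘ rootsOfUnity) zs → All (z ≢_) zs → All (λ z′ → L z′ w ≡ 𝟘) zs
                    help [] [] [] = []
                    help (z′ ∷ zs) (t′ ∷ ts) (ne ∷ nes) = L-orthogonal z z′ t t′ ne w hw ∷ help zs ts nes
                term : ∀ y c → T (inSub c) → T (B (y ⊹ c · w)) → T (avoid zs y) × L z y ⊹ c · v ≡ 𝟘
                term y c tc tB = subst T (avoid-shift zs y (c · w) (All.map (λ {z′} h → trans (resolvent-scalar z′ m-1 c w c∈) (trans (cong (c ·_) h) (·-zeroʳ c))) others)) (T-∧₁ tB) ,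
                    trans (sym (trans (resolvent-additive z m-1 y (c · w)) (cong (L z y ⊹_) (resolvent-scalar z m-1 c w c∈)))) (toWitness {a? = L z (y ⊹ c · w) ≟ᴷ 𝟘} (T-∧₂ {avoid zs (y ⊹ c · w)} tB))
                  where
                    c∈ : τ c ≡ c
                    c∈ = toWitness {a? = τ c ≟ᴷ c} tc
                le : ∀ y → ∑ (λ c → ι (inSub c) * ι (B (y ⊹ c · w))) ≤ ι (avoid zs y)
                le y = cases (any? λ c → T? (inSub c ∧ B (y ⊹ c · w)))
                  where
                    f : 𝕂 → ℕ
                    f c = ι (inSub c) * ι (B (y ⊹ c · w))
                    f≡ : ∀ c → f c ≡ ι (inSub c ∧ B (y ⊹ c · w))
                    f≡ c = sym (ι-∧ (inSub c) (B (y ⊹ c · w)))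
                    cases : Dec (∃ λ c → T (inSub c ∧ B (y ⊹ c · w))) → ∑ f ≤ ι (avoid zs y)
                    cases (no none) = ≤-trans (≤-reflexive (trans (∑-cong λ c → trans (f≡ c) (cong ι (¬T⇒≡ (λ h → none (c , h))))) (trans (∑-const 0) (*-zeroʳ size)))) z≤n
                    cases (yes (c₀ , h₀)) = ≤-trans (∑-mono below) (≤-trans (≤-reflexive (∑-δ₁ c₀)) (≤-reflexive (sym (cong ι (T⇒≡ (proj₁ at-c₀))))))
                      where
                        at-c₀ = term y c₀ (T-∧₁ h₀) (T-∧₂ {inSub c₀} h₀)
                        below : ∀ c → f c ≤ δ c₀ c
                        below c = ≤-trans (≤-reflexive (f≡ c)) (ι-≤ λ h → fromWitness {a? = c₀ ≟ᴷ c} (·-cancelˡ v≢0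
                          (trans (·-comm v c₀) (trans (same (proj₂ at-c₀) (proj₂ (term y c (T-∧₁ h) (T-∧₂ {inSub c} h)))) (·-comm c v)))))
                          where
                            same : ∀ {r a b} → r ⊹ a ≡ 𝟘 → r ⊹ b ≡ 𝟘 → a ≡ b
                            same {r} {a} {b} ha hb = trans (solveR 2 (λ r a → a := (r :+ a) :- r) refl r a) (trans (cong (_⊝ r) (trans ha (sym hb))) (solveR 2 (λ r b → (r :+ b) :- r := b) refl r b))

      -- By `slice-bound` each new hyperplane removes at most the share 1/qˡ of what the earlier
      -- ones left, so the losses multiply instead of adding up.
      avoid-size : ∀ zs → All (T ∘ rootsOfUnity) zs → Unique zs → size * (qˡ ∸ 1) ^ length zs ≤ # avoid zs * qˡ ^ length zs
      avoid-size [] [] [] = ≤-reflexive (cong (_* 1) (sym #-all))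
      avoid-size (z ∷ zs) (t ∷ ts) (z∉ ∷ u) = begin
        size * (p * p ^ length zs) ≡⟨ lemma₁ size p (p ^ length zs) ⟩
        p * (size * p ^ length zs) ≤⟨ *-monoʳ-≤ p (avoid-size zs ts u) ⟩
        p * (# avoid zs * qˡ ^ length zs) ≡⟨ sym (*-assoc p (# avoid zs) _) ⟩
        p * # avoid zs * qˡ ^ length zs ≤⟨ *-monoˡ-≤ (qˡ ^ length zs) step ⟩
        # avoid (z ∷ zs) * qˡ * qˡ ^ length zs ≡⟨ *-assoc (# avoid (z ∷ zs)) qˡ _ ⟩
        # avoid (z ∷ zs) * (qˡ * qˡ ^ length zs) ∎
        where
          open ≤-Reasoning
          p = qˡ ∸ 1
          lemma₁ : ∀ s p x → s * (p * x) ≡ p * (s * x)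
          lemma₁ = solve-∀
          B = # (λ x → avoid zs x ∧ ker (L z) x)
          total : B + # avoid (z ∷ zs) ≡ # avoid zs
          total = #-split (avoid zs) (ker (L z))
          q≡ : suc p ≡ qˡ
          q≡ = m+[n∸m]≡n (<⇒≤ 1<qˡ)
          step : p * # avoid zs ≤ # avoid (z ∷ zs) * qˡ
          step = +-cancelˡ-≤ (# avoid zs) _ _ (begin
            # avoid zs + p * # avoid zs ≡⟨ cong (_* # avoid zs) q≡ ⟩
            qˡ * # avoid zs ≡⟨ cong (qˡ *_) (sym total) ⟩
            qˡ * (B + # avoid (z ∷ zs)) ≡⟨ *-distribˡ-+ qˡ B _ ⟩
            qˡ * B + qˡ * # avoid (z ∷ zs) ≤⟨ +-mono-≤ (slice-bound z zs t ts z∉) (≤-reflexive (*-comm qˡ _)) ⟩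
            # avoid zs + # avoid (z ∷ zs) * qˡ ∎)

  -- Estimates for the bad subgroups and the large cases

  module AtLeastTwo (2≤n : 2 ≤ n) where
    private
      e : ℕ
      e = n ∸ 2

      q^n≡ : q ^ n ≡ q ^ e * (q * q)
      q^n≡ = trans (cong (q ^_) (sym (m∸n+n≡m 2≤n))) (trans (^-distribˡ-+-* q e 2) (cong (λ z → q ^ e * (q * z)) (*-identityʳ q)))

      lin = Ground.linearSets
      non = Ground.nonlinearSets

      sizes-lin : sizes lin ≤ length lin * (q ^ e * q)
      sizes-lin = sum-map-≤ #_ (q ^ e * q) lin (All.map (λ {V} h → *-cancelʳ-≤ (# V) (q ^ e * q) q
        (≤-trans (≤-reflexive (cong (# V *_) (sym (*-identityʳ q)))) (≤-trans h (≤-reflexive (trans q^n≡ (sym (*-assoc (q ^ e) q q))))))) Ground.linearSets-size)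

      sizes-non : sizes non ≤ length non * q ^ e
      sizes-non = sum-map-≤ #_ (q ^ e) non (All.map (λ {V} h → *-cancelʳ-≤ (# V) (q ^ e) (q * q) {{m*n≢0 q q}}
        (≤-trans (≤-reflexive (cong (λ z → # V * (z * z)) (sym (*-identityʳ q)))) (≤-trans h (≤-reflexive q^n≡)))) Ground.nonlinearSets-size)

    2sizes-bad : 2 * sizes badSets ≤ n * q ^ e + 2 * extraSize q n n
    2sizes-bad = begin
      2 * sizes badSets ≡⟨ cong (2 *_) (sizes-++ non (extraSets n)) ⟩
      2 * (sizes non + sizes (extraSets n)) ≤⟨ *-monoʳ-≤ 2 (+-mono-≤ sizes-non (sizes-extraSets n)) ⟩
      2 * (length non * q ^ e + extraSize q n n) ≡⟨ lemma (length non) (q ^ e) (extraSize q n n) ⟩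
      2 * length non * q ^ e + 2 * extraSize q n n ≤⟨ +-monoˡ-≤ _ (*-monoˡ-≤ (q ^ e) (≤-trans (m≤n+m _ (length lin)) linear-count)) ⟩
      n * q ^ e + 2 * extraSize q n n ∎
      where
        open ≤-Reasoning
        lemma : ∀ h x y → 2 * (h * x + y) ≡ 2 * h * x + 2 * y
        lemma = solve-∀

    -- In units of q^(n-2), twice the total is 2 q per linear set and 2 per nonlinear set. The
    -- relation linear + 2 nonlinear ≤ n absorbs the nonlinear sets and leaves 2 q - 1 for each
    -- linear one.
    2sizes : ∀ g → length lin ≤ g → 2 * sizes allBadSets ≤ sizeBound q n g
    2sizes g h = begin
      2 * sizes allBadSets ≡⟨ cong (2 *_) (trans (sizes-++ lin badSets) (cong (sizes lin +_) (sizes-++ non (extraSets n)))) ⟩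
      2 * (sizes lin + (sizes non + sizes (extraSets n))) ≤⟨ *-monoʳ-≤ 2 (+-mono-≤ sizes-lin (+-mono-≤ sizes-non (sizes-extraSets n))) ⟩
      2 * (length lin * (q ^ e * q) + (length non * q ^ e + extraSize q n n)) ≡⟨ lemma (length lin) (length non) (q ^ e) q (extraSize q n n) ⟩
      q ^ e * (2 * length non + length lin * (2 * q)) + 2 * extraSize q n n ≤⟨ +-monoˡ-≤ _ (*-monoʳ-≤ (q ^ e) le) ⟩
      sizeBound q n g ∎
      where
        open ≤-Reasoning
        lemma : ∀ g h x q y → 2 * (g * (x * q) + (h * x + y)) ≡ x * (2 * h + g * (2 * q)) + 2 * y
        lemma = solve-∀
        lemma₂ : ∀ g h x → 2 * h + g * suc x ≡ (g + 2 * h) + g * x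
        lemma₂ = solve-∀
        2q≡ : 2 * q ≡ suc (2 * q ∸ 1)
        2q≡ = sym (m+[n∸m]≡n (≤-trans (<⇒≤ 1<q) (m≤m+n q _)))
        le : 2 * length non + length lin * (2 * q) ≤ n + g * (2 * q ∸ 1)
        le = ≤-trans (≤-reflexive (trans (cong (λ z → 2 * length non + length lin * z) 2q≡) (lemma₂ (length lin) (length non) (2 * q ∸ 1))))
          (+-mono-≤ linear-count (*-monoˡ-≤ (2 * q ∸ 1) h))

    2length : ∀ g → length lin ≤ g → 2 * length allBadSets ≤ countBound q n g
    2length g h = begin
      2 * length allBadSets ≡⟨ cong (2 *_) (trans (Listₚ.length-++ lin) (cong (length lin +_) (Listₚ.length-++ non))) ⟩
      2 * (length lin + (length non + length (extraSets n))) ≡⟨ lemma (length lin) (length non) (length (extraSets n)) ⟩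
      (length lin + 2 * length non) + length lin + 2 * length (extraSets n) ≤⟨ +-mono-≤ (+-mono-≤ linear-count h) (*-monoʳ-≤ 2 (length-extraSets n)) ⟩
      countBound q n g ∎
      where
        open ≤-Reasoning
        lemma : ∀ a b c → 2 * (a + (b + c)) ≡ (a + 2 * b) + a + 2 * c
        lemma = solve-∀

    length-lin≤ : length lin ≤ gcd n (q ∸ 1)
    length-lin≤ = ≤-trans (≤-reflexive Ground.length-linearSets) #roots≤gcd

    private
      S₀ R₀ : List ℕ
      S₀ = filter (_∣? M) smallPrimes
      R₀ = filter (λ r → ¬? (r ∈? smallPrimes)) (primesOf M)

    trialSplit : PrimeSplit
    trialSplit = record { S = S₀ ; R = R₀
      ; S-prime = All.zip (Allₚ.filter⁺ (_∣? M) smallPrimes-prime , Allₚ.all-filter (_∣? M) smallPrimes)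
      ; S-unique = Uniqueₚ.filter⁺ (_∣? M) smallPrimes-unique
      ; cover = λ {r} (pr , r∣M) → cases r pr r∣M (r ∈? smallPrimes) }
      where
        cases : ∀ r → Prime r → r ∣ M → Dec (r ∈ smallPrimes) → r ∈ S₀ ⊎ r ∈ R₀
        cases r pr r∣M (yes h) = inj₁ (∈ₚ.∈-filter⁺ (_∣? M) h r∣M)
        cases r pr r∣M (no h) = inj₂ (∈ₚ.∈-filter⁺ (λ r → ¬? (r ∈? smallPrimes)) (∈-primesOf 0<M pr r∣M) h)

    private
      R₀-All : All (λ r → IsPrimeDivisor M r × 157 ≤ r) R₀
      R₀-All = All.tabulate λ {r} r∈ → let r∈′ , r∉ = ∈ₚ.∈-filter⁻ (λ r → ¬? (r ∈? smallPrimes)) {xs = primesOf M} r∈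
                                           pr = All.lookup (primesOf-All M) r∈′ in pr , smallPrimes-complete r (proj₁ pr) r∉

      length-R : ∀ t → M < product S₀ * 157 ^ suc t → length R₀ ≤ t
      length-R t h = ≮⇒≥ λ t<R → <⇒≱ h (begin
        product S₀ * 157 ^ suc t ≤⟨ *-monoʳ-≤ (product S₀) (^-monoʳ-≤ 157 t<R) ⟩
        product S₀ * 157 ^ length R₀ ≤⟨ *-monoʳ-≤ (product S₀) (product-≥ 157 R₀ (All.map proj₂ R₀-All)) ⟩
        product S₀ * product R₀ ≡⟨ sym (product-++ S₀ R₀) ⟩
        product (S₀ ++ R₀) ≤⟨ ∣⇒≤ {{>-nonZero 0<M}} (product-primes-∣ (S₀ ++ R₀) (Allₚ.++⁺ (PrimeSplit.S-prime trialSplit) (All.map proj₁ R₀-All))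
          (Uniqueₚ.++⁺ (PrimeSplit.S-unique trialSplit) (Uniqueₚ.filter⁺ _ (primesOf-Unique M)) disjoint)) ⟩
        M ∎)
        where
          open ≤-Reasoning
          disjoint : ∀ {r} → ¬ (r ∈ S₀ × r ∈ R₀)
          disjoint (r∈S , r∈R) = proj₂ (∈ₚ.∈-filter⁻ (λ r → ¬? (r ∈? smallPrimes)) {xs = primesOf M} r∈R) (proj₁ (∈ₚ.∈-filter⁻ (_∣? M) {xs = smallPrimes} r∈S))

      tail-sum : ∀ t → M < product S₀ * 157 ^ suc t → 157 * sum (map (λ r → # power r) R₀) ≤ t * N
      tail-sum t h = ≤-trans (go R₀ R₀-All) (*-monoˡ-≤ N (length-R t h))
        where
          go : ∀ R₀ → All (λ r → IsPrimeDivisor M r × 157 ≤ r) R₀ → 157 * sum (map (λ r → # power r) R₀) ≤ length R₀ * N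
          go [] [] = ≤-trans (≤-reflexive (*-zeroʳ 157)) z≤n
          go (r ∷ R₀) (((pr , r∣M) , 157≤r) ∷ hs) = ≤-trans (≤-reflexive (*-distribˡ-+ 157 (# power r) _)) (+-mono-≤
            (≤-trans (≤-reflexive (*-comm 157 (# power r))) (≤-trans (*-monoʳ-≤ (# power r) 157≤r) (≤-reflexive (#-power r (∣-trans r∣M M∣N))))) (go R₀ hs))

      trivial-sound : ∀ t D → 2 * sizes allBadSets ≤ D → M < product S₀ * 157 ^ suc t → T (trivialTest N (product S₀) (φ S₀) t D) → ∃ Good
      trivial-sound t D hD hM h = trivial-criterion trialSplit allBadSets ρ outside-allBadSets ≤-refl
        -- 314 = 2 · 157 clears both the factor 2 in `sizeBound` and the denominator 157 of the
        -- tail.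
        (*-cancelˡ-< 314 _ _ (begin-strict
          314 * (P * (Z + ρ)) ≡⟨ lemma P Z ρ ⟩
          157 * (P * (2 * Z)) + 2 * (P * (157 * ρ)) ≤⟨ +-mono-≤ (*-monoʳ-≤ 157 (*-monoʳ-≤ P hD)) (*-monoʳ-≤ 2 (*-monoʳ-≤ P (tail-sum t hM))) ⟩
          157 * (P * D) + 2 * (P * (t * N)) <⟨ <ᵇ⇒< (157 * (P * D) + 2 * (P * (t * N))) (157 * (2 * (φ S₀ * N))) h ⟩
          157 * (2 * (φ S₀ * N)) ≡⟨ sym (*-assoc 157 2 (φ S₀ * N)) ⟩
          314 * (φ S₀ * N) ∎))
        where
          open ≤-Reasoning
          P = product S₀
          Z = sizes allBadSets
          ρ = sum (map (λ r → # power r) R₀)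
          lemma : ∀ p z r → 314 * (p * (z + r)) ≡ 157 * (p * (2 * z)) + 2 * (p * (157 * r))
          lemma = solve-∀

      full-sound : ∀ t D c s → 2 * sizes allBadSets ≤ D → 2 * length allBadSets ≤ c → M < product S₀ * 157 ^ suc t →
        T (fullTest size N (product S₀) (φ S₀) (2 ^ length S₀) t D c s) → ∃ Good
      full-sound t D c s hD hc hM h = criterion trialSplit (λ _ → true) allBadSets s 0 ρ whole-equidistributed allBadSets-subgroups
        (≤ᵇ⇒≤ size (s * s) (T-∧₁ h)) (λ x _ → outside-allBadSets x) ≤-refl
        (*-cancelˡ-< 314 _ _ (begin-strict
          314 * (f * Z * N + (l * s + 0) * (W * (size * P)) + size * P * ρ) ≡⟨ lemma f Z N l s W (size * P) ρ ⟩
          157 * (f * (2 * Z) * N) + (157 * (2 * l * s * (W * (size * P))) + 2 * (size * P * (157 * ρ)))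
            ≤⟨ +-mono-≤ (*-monoʳ-≤ 157 (*-monoˡ-≤ N (*-monoʳ-≤ f hD))) (+-mono-≤ (*-monoʳ-≤ 157 (*-monoˡ-≤ (W * (size * P)) (*-monoˡ-≤ s hc))) (*-monoʳ-≤ 2 (*-monoʳ-≤ (size * P) (tail-sum t hM)))) ⟩
          157 * (f * D * N) + (157 * (c * s * (W * (size * P))) + 2 * (size * P * (t * N)))
            <⟨ <ᵇ⇒< (157 * (f * D * N) + (157 * (c * s * (W * (size * P))) + 2 * (size * P * (t * N)))) (157 * (2 * (f * size * N))) (T-∧₂ {size ≤ᵇ s * s} h) ⟩
          157 * (2 * (f * size * N)) ≡⟨ sym (*-assoc 157 2 (f * size * N)) ⟩
          314 * (f * size * N) ≡⟨ cong (λ z → 314 * (f * z * N)) (sym #-all) ⟩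
          314 * (f * # (λ _ → true) * N) ∎))
        where
          open ≤-Reasoning
          P = product S₀
          f = φ S₀
          W = 2 ^ length S₀
          Z = sizes allBadSets
          l = length allBadSets
          ρ = sum (map (λ r → # power r) R₀)
          lemma : ∀ f z n l s w p r → 314 * (f * z * n + (l * s + 0) * (w * p) + p * r) ≡ 157 * (f * (2 * z) * n) + (157 * (2 * l * s * (w * p)) + 2 * (p * (157 * r)))
          lemma = solve-∀

    test-sound : T (sieveTest q n) → ∃ Good
    test-sound h = cases (T-∨ {trivialTest N (product S₀) (φ S₀) t D} (T-∧₂ {M <ᵇ product S₀ * 157 ^ suc t} h′))
      where
        g t D c s : ℕ
        g = egcd 60 n (q ∸ 1)
        t = logAbove 60 M (product S₀) 0
        D = sizeBound q n g
        c = countBound q n g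
        s = rootAbove size 50 0
        h′ : T (test₃ size N M (product S₀) (φ S₀) (2 ^ length S₀) t D c s)
        h′ = test-unfold q n size M (subst (λ z → T (test₁ q n z M)) (sym size≡) h)
        hM : M < product S₀ * 157 ^ suc t
        hM = <ᵇ⇒< M (product S₀ * 157 ^ suc t) (T-∧₁ h′)
        g≥ : length lin ≤ g
        g≥ = ≤-trans length-lin≤ (gcd≤egcd 60 n (q ∸ 1) 0<n)
        cases : T (trivialTest N (product S₀) (φ S₀) t D) ⊎ T (fullTest size N (product S₀) (φ S₀) (2 ^ length S₀) t D c s) → ∃ Good
        cases (inj₁ u) = trivial-sound t D (2sizes g g≥) hM u
        cases (inj₂ v) = full-sound t D c s (2sizes g g≥) (2length g g≥) hM v

    private
      F R S : List ℕ
      F = filter (_∣? M) tinyPrimes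
      R = filter (λ r → ¬? (r ∈? tinyPrimes)) (primesOf M)
      S = F ++ R

      R-All : All (λ r → IsPrimeDivisor M r × 23 ≤ r) R
      R-All = All.tabulate λ {r} r∈ → let r∈′ , r∉ = ∈ₚ.∈-filter⁻ (λ r → ¬? (r ∈? tinyPrimes)) {xs = primesOf M} r∈
                                          pr = All.lookup (primesOf-All M) r∈′ in pr , unlisted-prime-≥ tinyPrimes 23 tinyPrimes-prime tt r (proj₁ pr) r∉

    -- Nothing is set aside here: `C₄` controls the cost of sieving by all primes dividing M,
    -- whatever they are.
    split : PrimeSplit
    split = record { S = S ; R = []
      ; S-prime = Allₚ.++⁺ (All.zip (Allₚ.filter⁺ (_∣? M) tinyPrimes-prime , Allₚ.all-filter (_∣? M) tinyPrimes)) (All.map proj₁ R-All)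
      ; S-unique = Uniqueₚ.++⁺ (Uniqueₚ.filter⁺ (_∣? M) tinyPrimes-unique) (Uniqueₚ.filter⁺ _ (primesOf-Unique M)) disjoint
      ; cover = λ {r} (pr , r∣M) → inj₁ (cases r pr r∣M (r ∈? tinyPrimes)) }
      where
        disjoint : ∀ {r} → ¬ (r ∈ F × r ∈ R)
        disjoint (r∈F , r∈R) = proj₂ (∈ₚ.∈-filter⁻ (λ r → ¬? (r ∈? tinyPrimes)) {xs = primesOf M} r∈R) (proj₁ (∈ₚ.∈-filter⁻ (_∣? M) {xs = tinyPrimes} r∈F))
        cases : ∀ r → Prime r → r ∣ M → Dec (r ∈ tinyPrimes) → r ∈ S
        cases r pr r∣M (yes h) = ∈ₚ.∈-++⁺ˡ (∈ₚ.∈-filter⁺ (_∣? M) h r∣M)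
        cases r pr r∣M (no h) = ∈ₚ.∈-++⁺ʳ F (∈ₚ.∈-filter⁺ (λ r → ¬? (r ∈? tinyPrimes)) (∈-primesOf 0<M pr r∣M) h)

    private
      Y : ℕ
      Y = 2 ^ length S * product S

      Y⁴≤ : Y ^ 4 ≤ C₄ * M * φ S ^ 4
      Y⁴≤ = begin
        Y ^ 4 ≡⟨ ∏ᵃ≡ S ⟩
        ∏ᵃ S ≤⟨ ∏-bound M R (All.map proj₂ R-All) ⟩
        C₄ * ∏ᵇ S ≡⟨ cong (C₄ *_) (sym (∏ᵇ≡ S)) ⟩
        C₄ * (product S * φ S ^ 4) ≡⟨ sym (*-assoc C₄ (product S) _) ⟩
        C₄ * product S * φ S ^ 4 ≤⟨ *-monoˡ-≤ (φ S ^ 4) (*-monoʳ-≤ C₄ (∣⇒≤ {{>-nonZero 0<M}} (product-primes-∣ S (PrimeSplit.S-prime split) (PrimeSplit.S-unique split)))) ⟩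
        C₄ * M * φ S ^ 4 ∎
        where open ≤-Reasoning

    -- The parameter w says that A retains at least size/w elements outside the bad subgroups, and L
    -- s₀ bounds the sum of all errors. What remains is w L s₀ Y < φ(S) N, which is checked in the
    -- fourth power, where the bound for Y⁴ applies.
    large-criterion : ∀ A 𝒱 s s′ s₀ w L X → Equidistributed A s′ → All IsSubgroup 𝒱 → size ≤ s * s →
      (∀ x → T (A x) → Outside 𝒱 x → CompletelyNormal K q n x) →
      size + w * sizes 𝒱 ≤ w * # A → length 𝒱 * s + s′ ≤ L * s₀ → s₀ ^ 4 ≤ X →
      (w * L) ^ 4 * X * C₄ < N * N * N * (q ∸ 1) → ∃ Good
    large-criterion A 𝒱 s s′ s₀ w L X eqd subs hs normal hw hL hX lt =
      criterion split A 𝒱 s s′ 0 eqd subs hs normal ≤-refl (*-cancelˡ-< w _ _ (begin-strict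
        w * (f * Z * N + (l * s + s′) * (2 ^ length S * (size * product S)) + size * product S * 0)
          ≤⟨ *-monoʳ-≤ w (+-monoˡ-≤ (size * product S * 0) (+-monoʳ-≤ (f * Z * N) (*-monoˡ-≤ (2 ^ length S * (size * product S)) hL))) ⟩
        w * (f * Z * N + (L * s₀) * (2 ^ length S * (size * product S)) + size * product S * 0) ≡⟨ lemma₁ w f Z N L s₀ (2 ^ length S) size (product S) ⟩
        f * N * (w * Z) + w * L * s₀ * Y * size <⟨ +-monoʳ-< (f * N * (w * Z)) (*-monoˡ-< size {{>-nonZero (<-trans z<s 1<size)}} key) ⟩
        f * N * (w * Z) + f * N * size ≡⟨ lemma₂ (f * N) (w * Z) size ⟩
        f * N * (size + w * Z) ≤⟨ *-monoʳ-≤ (f * N) hw ⟩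
        f * N * (w * # A) ≡⟨ lemma₃ f N w (# A) ⟩
        w * (f * # A * N) ∎))
      where
        open ≤-Reasoning
        f = φ S
        Z = sizes 𝒱
        l = length 𝒱
        lemma₁ : ∀ w f z n l s a b c → w * (f * z * n + (l * s) * (a * (b * c)) + b * c * 0) ≡ f * n * (w * z) + w * l * s * (a * c) * b
        lemma₁ = solve-∀
        lemma₂ : ∀ a b c → a * b + a * c ≡ a * (c + b)
        lemma₂ = solve-∀
        lemma₃ : ∀ f n w a → f * n * (w * a) ≡ w * (f * a * n)
        lemma₃ = solve-∀
        lemma₄ : ∀ c a x m f → a * x * (c * m * f) ≡ a * x * c * m * f
        lemma₄ = solve-∀
        lemma₅ : ∀ n k m → n * n * n * k * m ≡ n * n * n * (m * k)
        lemma₅ = solve-∀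
        lemma₆ : ∀ n f → n * n * n * n * f ≡ f * (n * (n * (n * (n * 1))))
        lemma₆ = solve-∀
        f⁴>0 : 0 < f ^ 4
        f⁴>0 = m^n>0 f {{>-nonZero (φ-pos S (All.map proj₁ (PrimeSplit.S-prime split)))}} 4
        -- The bound for Y⁴ brings in a factor M, and M (q - 1) = N supplies the missing factor of
        -- N⁴.
        key : w * L * s₀ * Y < f * N
        key = ^4-cancel-< _ _ (begin-strict
          (w * L * s₀ * Y) ^ 4 ≡⟨ trans (pow-*₄ (w * L * s₀) Y) (cong (_* Y ^ 4) (pow-*₄ (w * L) s₀)) ⟩
          (w * L) ^ 4 * s₀ ^ 4 * Y ^ 4 ≤⟨ *-mono-≤ (*-monoʳ-≤ ((w * L) ^ 4) hX) Y⁴≤ ⟩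
          (w * L) ^ 4 * X * (C₄ * M * f ^ 4) ≡⟨ lemma₄ C₄ ((w * L) ^ 4) X M (f ^ 4) ⟩
          (w * L) ^ 4 * X * C₄ * M * f ^ 4 <⟨ *-monoˡ-< (f ^ 4) {{>-nonZero f⁴>0}} (*-monoˡ-< M {{>-nonZero 0<M}} lt) ⟩
          N * N * N * (q ∸ 1) * M * f ^ 4 ≡⟨ cong (_* f ^ 4) (trans (lemma₅ N (q ∸ 1) M) (cong (N * N * N *_) M*[q-1]≡N)) ⟩
          N * N * N * N * f ^ 4 ≡⟨ lemma₆ N (f ^ 4) ⟩
          f ^ 4 * N ^ 4 ≡⟨ sym (pow-*₄ f N) ⟩
          (f * N) ^ 4 ∎)

    union-criterion : ∀ w L → size + w * sizes allBadSets ≤ w * size → length allBadSets ≤ L →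
      (w * L) ^ 4 * (4 * (size * size)) * C₄ < N * N * N * (q ∸ 1) → ∃ Good
    union-criterion w L hw hL lt = use (ceil-sqrt size (<-trans z<s 1<size))
      where
        open ≤-Reasoning
        lemma : ∀ s → s * (s * (s * (s * 1))) ≡ s * s * (s * s)
        lemma = solve-∀
        lemma₂ : ∀ s → 2 * s * (2 * s) ≡ 4 * (s * s)
        lemma₂ = solve-∀
        use : (∃ λ s → size ≤ s * s × s * s ≤ 2 * size) → ∃ Good
        use (s , lo , hi) = large-criterion (λ _ → true) allBadSets s 0 s w L (4 * (size * size)) whole-equidistributed allBadSets-subgroups lo
          (λ x _ → outside-allBadSets x) (subst (λ z → size + w * sizes allBadSets ≤ w * z) (sym #-all) hw)
          (≤-trans (≤-reflexive (+-identityʳ _)) (*-monoˡ-≤ s hL))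
          (≤-trans (≤-reflexive (lemma s)) (≤-trans (*-mono-≤ hi hi) (≤-reflexive (lemma₂ size)))) lt

    private
      l x E : ℕ
      l = length allBadSets
      x = q ^ (n ∸ 2)
      E = extraSize q n n

    q≡suc : q ≡ suc (q ∸ 1)
    q≡suc = sym (m+[n∸m]≡n (<⇒≤ 1<q))

    size≡x : size ≡ x * (q * q)
    size≡x = trans size≡ (trans (cong (q ^_) (sym (m∸n+n≡m 2≤n))) (trans (^-distribˡ-+-* q (n ∸ 2) 2) (cong (λ z → x * (q * z)) (*-identityʳ q))))

    extra-bound : 2 * ((q ∸ 1) * E) ≤ n * (q * x)
    extra-bound = ≤-trans (m≤m+n _ _) (≤-trans (subst (λ z → 2 * ((q ∸ 1) * extraSize z n n) + n * z ^ (n ∸ n) ≤ n * z ^ (n ∸ 1)) (sym q≡suc) main)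
        (≤-reflexive (cong (n *_) (cong (q ^_) (trans (cong (_∸ 1) (sym (m+[n∸m]≡n 2≤n))) refl)))))
      where
        main : 2 * ((q ∸ 1) * extraSize (suc (q ∸ 1)) n n) + n * suc (q ∸ 1) ^ (n ∸ n) ≤ n * suc (q ∸ 1) ^ (n ∸ 1)
        main = subst (λ k → 2 * ((q ∸ 1) * extraSize (suc (q ∸ 1)) n k) + n * suc (q ∸ 1) ^ (n ∸ k) ≤ n * suc (q ∸ 1) ^ (n ∸ 1)) (suc-pred n {{>-nonZero 0<n}})
          (2extraSize (q ∸ 1) n (pred n) (≤-reflexive (suc-pred n {{>-nonZero 0<n}})))

    2l≤ : 2 * l ≤ n * n + n
    2l≤ = begin
      2 * l ≤⟨ 2length n (≤-trans length-lin≤ (∣⇒≤ {{>-nonZero 0<n}} (gcd[m,n]∣m n (q ∸ 1)))) ⟩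
      n + n + 2 * extraCount q n n ≤⟨ +-monoʳ-≤ (n + n) (subst (λ k → 2 * extraCount q n k ≤ n * pred n) (suc-pred n {{>-nonZero 0<n}}) (2extraCount q n (pred n))) ⟩
      n + n + n * pred n ≡⟨ lemma n (n * pred n) ⟩
      n + n * pred n + n ≡⟨ cong (_+ n) (trans (sym (*-suc n (pred n))) (cong (n *_) (suc-pred n {{>-nonZero 0<n}}))) ⟩
      n * n + n ∎
      where
        open ≤-Reasoning
        lemma : ∀ n y → n + n + y ≡ n + y + n
        lemma = solve-∀

    quarter-size-cubed : 4 ≤ N → size * size * size * q ≤ 4 * (N * N * N * (q ∸ 1))
    quarter-size-cubed 4≤N = begin
      size * size * size * q ≡⟨ cong (λ z → z * z * z * q) (sym sN≡size) ⟩
      suc N * suc N * suc N * q ≤⟨ *-mono-≤ (cube-double N 4≤N) q≤ ⟩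
      2 * (N * N * N) * (2 * (q ∸ 1)) ≡⟨ lemma (N * N * N) (q ∸ 1) ⟩
      4 * (N * N * N * (q ∸ 1)) ∎
      where
        open ≤-Reasoning
        lemma : ∀ a b → 2 * a * (2 * b) ≡ 4 * (a * b)
        lemma = solve-∀
        q≤ : q ≤ 2 * (q ∸ 1)
        q≤ = ≤-trans (≤-reflexive q≡suc) (+-mono-≤ {1} {q ∸ 1} (m<n⇒0<n∸m 1<q) (≤-reflexive (sym (+-identityʳ (q ∸ 1)))))

    union-criterion′ : ∀ w → 4 ≤ N → size + w * sizes allBadSets ≤ w * size → 16 * C₄ * (w * l) ^ 4 < q ^ suc n → ∃ Good
    union-criterion′ w 4≤N hw lt = union-criterion w l hw ≤-refl (*-cancelˡ-< 4 _ _ (begin-strict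
      4 * ((w * l) ^ 4 * (4 * (size * size)) * C₄) ≡⟨ lemma₁ ((w * l) ^ 4) (size * size) C₄ ⟩
      16 * C₄ * (w * l) ^ 4 * (size * size) <⟨ *-monoˡ-< (size * size) {{>-nonZero (*-mono-< 0<size 0<size)}} lt ⟩
      q * q ^ n * (size * size) ≡⟨ cong (λ z → q * z * (size * size)) (sym size≡) ⟩
      q * size * (size * size) ≡⟨ lemma₂ q size ⟩
      size * size * size * q ≤⟨ quarter-size-cubed 4≤N ⟩
      4 * (N * N * N * (q ∸ 1)) ∎))
      where
        open ≤-Reasoning
        0<size : 0 < size
        0<size = <-trans z<s 1<size
        lemma₁ : ∀ y s c → 4 * (y * (4 * s) * c) ≡ 16 * c * y * s
        lemma₁ = solve-∀
        lemma₂ : ∀ q s → q * s * (s * s) ≡ s * s * s * q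
        lemma₂ = solve-∀

    4≤N : 7 ≤ q → 4 ≤ N
    4≤N 7≤q = ≤-pred (≤-trans (s≤s (s≤s (s≤s (s≤s (s≤s z≤n))))) (≤-trans 7≤q (≤-trans (≤-trans (≤-reflexive (sym (^-identityʳ q))) (^-monoʳ-≤ q {{>-nonZero (<⇒≤ 1<q)}} 0<n)) (≤-reflexive (trans (sym size≡) (sym sN≡size))))))

    -- As q - 1 does not divide n, the gcd is at most (q - 1)/2 and the linear sets cover less than
    -- half of K. With 5 n ≤ q (q + 3) all bad sets together cover at most three quarters, hence w =
    -- 4.
    non-splitting-case : 7 ≤ q → ¬ ((q ∸ 1) ∣ n) → 5 * n ≤ q * (q + 3) → threshold n < q ^ suc n → ∃ Good
    non-splitting-case 7≤q q-1∤n 5n≤ lt = union-criterion′ 4 (4≤N 7≤q) hw (≤-<-trans (*-monoʳ-≤ (16 * C₄) (^-monoˡ-≤ 4 4l≤)) lt)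
      where
        open ≤-Reasoning
        4l≤ : 4 * l ≤ 2 * (n * n + n)
        4l≤ = ≤-trans (≤-reflexive (*-assoc 2 2 l)) (*-monoʳ-≤ 2 2l≤)
        p g Z : ℕ
        p = q ∸ 1
        g = gcd n p
        Z = sizes allBadSets
        6≤p : 6 ≤ p
        6≤p = ∸-monoˡ-≤ 1 7≤q
        instance
          p-nz : NonZero p
          p-nz = >-nonZero (≤-trans (s≤s z≤n) 6≤p)
        2q-1 : 2 * q ∸ 1 ≡ 2 * p + 1
        2q-1 = trans (cong (λ z → 2 * z ∸ 1) q≡suc) (trans (cong (_∸ 1) (lemma p)) refl)
          where
            lemma : ∀ p → 2 * suc p ≡ suc (2 * p + 1)
            lemma = solve-∀
        12E≤ : 12 * E ≤ 7 * (n * x)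
        12E≤ = *-cancelˡ-≤ p (begin
          p * (12 * E) ≡⟨ lemma₁ p E ⟩
          6 * (2 * (p * E)) ≤⟨ *-monoʳ-≤ 6 extra-bound ⟩
          6 * (n * (q * x)) ≡⟨ trans (cong (λ z → 6 * (n * (z * x))) q≡suc) (lemma₂ n p x) ⟩
          (6 + 6 * p) * (n * x) ≤⟨ *-monoˡ-≤ (n * x) (+-monoˡ-≤ (6 * p) 6≤p) ⟩
          (p + 6 * p) * (n * x) ≡⟨ lemma₃ p (n * x) ⟩
          p * (7 * (n * x)) ∎)
          where
            lemma₁ : ∀ p e → p * (12 * e) ≡ 6 * (2 * (p * e))
            lemma₁ = solve-∀
            lemma₂ : ∀ n p x → 6 * (n * (suc p * x)) ≡ (6 + 6 * p) * (n * x)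
            lemma₂ = solve-∀
            lemma₃ : ∀ p y → (p + 6 * p) * y ≡ p * (7 * y)
            lemma₃ = solve-∀
        -- 13 = 6 + 7 joins the n of the ground level with the contribution of `12E≤`; the spare 2 n
        -- pays for the constant 3.
        13n≤ : 13 * n ≤ 3 * (p * p) + 15 * p + 9
        13n≤ = +-cancelʳ-≤ 3 _ _ (begin
          13 * n + 3 ≤⟨ +-monoʳ-≤ (13 * n) (≤-trans (s≤s (s≤s (s≤s z≤n))) (*-monoʳ-≤ 2 2≤n)) ⟩
          13 * n + 2 * n ≡⟨ lemma₁ n ⟩
          3 * (5 * n) ≤⟨ *-monoʳ-≤ 3 5n≤ ⟩
          3 * (q * (q + 3)) ≡⟨ trans (cong (λ z → 3 * (z * (z + 3))) q≡suc) (lemma₂ p) ⟩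
          3 * (p * p) + 15 * p + 9 + 3 ∎)
          where
            lemma₁ : ∀ n → 13 * n + 2 * n ≡ 3 * (5 * n)
            lemma₁ = solve-∀
            lemma₂ : ∀ p → 3 * (suc p * (suc p + 3)) ≡ 3 * (p * p) + 15 * p + 9 + 3
            lemma₂ = solve-∀
        12Z≤ : 12 * Z ≤ 9 * size
        12Z≤ = begin
          12 * Z ≡⟨ *-assoc 6 2 Z ⟩
          6 * (2 * Z) ≤⟨ *-monoʳ-≤ 6 (2sizes g length-lin≤) ⟩
          6 * (x * (n + g * (2 * q ∸ 1)) + 2 * E) ≡⟨ trans (cong (λ z → 6 * (x * (n + g * z) + 2 * E)) 2q-1) (lemma₁ x n g p E) ⟩
          x * (6 * n + 3 * (2 * g * (2 * p + 1))) + 12 * E ≤⟨ +-mono-≤ (*-monoʳ-≤ x (+-monoʳ-≤ (6 * n) (*-monoʳ-≤ 3 (*-monoˡ-≤ (2 * p + 1) (half-gcd n p (≤-trans (s≤s z≤n) 6≤p) q-1∤n))))) 12E≤ ⟩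
          x * (6 * n + 3 * (p * (2 * p + 1))) + 7 * (n * x) ≡⟨ lemma₂ x n p ⟩
          x * (13 * n + (6 * (p * p) + 3 * p)) ≤⟨ *-monoʳ-≤ x (+-monoˡ-≤ _ 13n≤) ⟩
          x * (3 * (p * p) + 15 * p + 9 + (6 * (p * p) + 3 * p)) ≡⟨ lemma₃ x p ⟩
          9 * (x * (suc p * suc p)) ≡⟨ cong (9 *_) (trans (cong (λ z → x * (z * z)) (sym q≡suc)) (sym size≡x)) ⟩
          9 * size ∎
          where
            lemma₁ : ∀ x n g p e → 6 * (x * (n + g * (2 * p + 1)) + 2 * e) ≡ x * (6 * n + 3 * (2 * g * (2 * p + 1))) + 12 * e
            lemma₁ = solve-∀
            lemma₂ : ∀ x n p → x * (6 * n + 3 * (p * (2 * p + 1))) + 7 * (n * x) ≡ x * (13 * n + (6 * (p * p) + 3 * p))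
            lemma₂ = solve-∀
            lemma₃ : ∀ x p → x * (3 * (p * p) + 15 * p + 9 + (6 * (p * p) + 3 * p)) ≡ 9 * (x * (suc p * suc p))
            lemma₃ = solve-∀
        hw : size + 4 * Z ≤ 4 * size
        hw = +-monoʳ-≤ size (*-cancelˡ-≤ 3 (≤-trans (≤-reflexive (sym (*-assoc 3 4 Z))) (≤-trans 12Z≤ (≤-reflexive (*-assoc 3 3 size)))))

    -- For n = q - 1 the linear sets may cover (q - 1)/q of K and the higher levels 1/(2q). The
    -- remaining 1/(2q) dictates w = 2 q, and the estimates leave no slack in `hw`.
    full-splitting-case : 32 ≤ q → q ∸ 1 ≡ n → ∃ Good
    full-splitting-case 32≤q p≡n = union-criterion′ (2 * q) (4≤N (≤-trans (≤ᵇ⇒≤ 7 32 tt) 32≤q)) hw lt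
      where
        open ≤-Reasoning
        Z = sizes allBadSets
        q≡n : q ≡ suc n
        q≡n = trans q≡suc (cong suc p≡n)
        instance
          n-nz : NonZero n
          n-nz = >-nonZero 0<n
        2E≤ : 2 * E ≤ q * x
        2E≤ = *-cancelˡ-≤ n (≤-trans (≤-reflexive (trans (lemma n E) (cong (λ z → 2 * (z * E)) (sym p≡n)))) extra-bound)
          where
            lemma : ∀ n e → n * (2 * e) ≡ 2 * (n * e)
            lemma = solve-∀
        2q-1 : 2 * q ∸ 1 ≡ 2 * n + 1
        2q-1 = trans (cong (λ z → 2 * z ∸ 1) q≡n) (cong (_∸ 1) (lemma n))
          where
            lemma : ∀ p → 2 * suc p ≡ suc (2 * p + 1)
            lemma = solve-∀
        hw : size + 2 * q * Z ≤ 2 * q * size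
        hw = begin
          size + 2 * q * Z ≡⟨ cong (size +_) (lemma₀ q Z) ⟩
          size + q * (2 * Z) ≤⟨ +-monoʳ-≤ size (*-monoʳ-≤ q (2sizes n (≤-trans length-lin≤ (∣⇒≤ (gcd[m,n]∣m n (q ∸ 1)))))) ⟩
          size + q * (x * (n + n * (2 * q ∸ 1)) + 2 * E) ≤⟨ +-monoʳ-≤ size (*-monoʳ-≤ q (+-monoʳ-≤ _ 2E≤)) ⟩
          size + q * (x * (n + n * (2 * q ∸ 1)) + q * x) ≡⟨ cong₂ _+_ size≡x (cong (λ z → q * (x * (n + n * z) + q * x)) 2q-1) ⟩
          x * (q * q) + q * (x * (n + n * (2 * n + 1)) + q * x) ≡⟨ cong (λ z → x * (z * z) + z * (x * (n + n * (2 * n + 1)) + z * x)) q≡n ⟩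
          x * (suc n * suc n) + suc n * (x * (n + n * (2 * n + 1)) + suc n * x) ≡⟨ lemma₁ x n ⟩
          2 * suc n * (x * (suc n * suc n)) ≡⟨ trans (cong (λ z → 2 * z * (x * (z * z))) (sym q≡n)) (cong (2 * q *_) (sym size≡x)) ⟩
          2 * q * size ∎
          where
            lemma₀ : ∀ q z → 2 * q * z ≡ q * (2 * z)
            lemma₀ = solve-∀
            lemma₁ : ∀ x n → x * (suc n * suc n) + suc n * (x * (n + n * (2 * n + 1)) + suc n * x) ≡ 2 * suc n * (x * (suc n * suc n))
            lemma₁ = solve-∀
        2ql≤ : 2 * q * l ≤ q * (q * q)
        2ql≤ = begin
          2 * q * l ≡⟨ lemma q l ⟩
          q * (2 * l) ≤⟨ *-monoʳ-≤ q 2l≤ ⟩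
          q * (n * n + n) ≤⟨ *-monoʳ-≤ q (≤-trans (≤-reflexive (trans (+-comm (n * n) n) refl)) (≤-trans (*-monoʳ-≤ (suc n) (n≤1+n n)) (≤-reflexive (cong (λ z → z * z) (sym q≡n))))) ⟩
          q * (q * q) ∎
          where
            lemma : ∀ q l → 2 * q * l ≡ q * (2 * l)
            lemma = solve-∀
        C₄≤ : 16 * C₄ ≤ q * (q * (q * (q * (q * 1))))
        C₄≤ = ≤-trans (subst (λ c → 16 * c ≤ 32 ^ 5) (sym C₄≡) (≤ᵇ⇒≤ (16 * 517576) (32 ^ 5) tt)) (^-monoˡ-≤ 5 32≤q)
        lt : 16 * C₄ * (2 * q * l) ^ 4 < q ^ suc n
        lt = begin-strict
          16 * C₄ * (2 * q * l) ^ 4 ≤⟨ *-mono-≤ C₄≤ (^-monoˡ-≤ 4 2ql≤) ⟩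
          q ^ 5 * (q * (q * q)) ^ 4 ≡⟨ lemma q ⟩
          q ^ 17 <⟨ ^-monoʳ-< q 1<q (≤-trans (≤ᵇ⇒≤ 18 32 tt) (≤-trans 32≤q (≤-reflexive q≡n))) ⟩
          q ^ suc n ∎
          where
            lemma : ∀ q → (q * (q * (q * (q * (q * 1))))) * ((q * (q * q)) * ((q * (q * q)) * ((q * (q * q)) * ((q * (q * q)) * 1)))) ≡ q * (q * (q * (q * (q * (q * (q * (q * (q * (q * (q * (q * (q * (q * (q * (q * (q * 1))))))))))))))))
            lemma = solve-∀

    private
      module Eig = Eigenspaces 1 n-1 1n≡n

    -- Oddness of n makes q - 1 odd and q even, so n is not 0 in K and `avoid-size` applies. The set
    -- A is invariant under an intersection of at most q - 1 hyperplanes only, which raises its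
    -- error from √Q to about q^((n+q)/2).
    multiple-splitting-case : 32 ≤ q → (q ∸ 1) ∣ n → 3 * (q ∸ 1) ≤ n → n ^ 3 < q ^ 4 → ¬ (2 ∣ n) → ∃ Good
    multiple-splitting-case 32≤q q-1∣n 3p≤n n³<q⁴ n-odd =
      large-criterion A badSets s s s 16 (suc l₀) (q ^ (2 * (n + q))) equi badSets-subgroups s²≥size normal hw (≤-reflexive (+-comm (l₀ * s) s)) s⁴≤ lt
      where
        open ≤-Reasoning
        p l₀ : ℕ
        p = q ∸ 1
        l₀ = length badSets
        zs : List 𝕂
        zs = listOf Ground.rootsOfUnity
        A U : 𝕂 → Bool
        A = Eig.avoid zs
        U = Eig.common zs

        n≡suc : suc n-1 ≡ n
        n≡suc = suc-pred n {{>-nonZero 0<n}}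

        p-odd : ¬ (2 ∣ p)
        p-odd d = n-odd (∣-trans d q-1∣n)

        2∣q : 2 ∣ q
        2∣q = let k , e = odd-form p p-odd in divides (suc k) (trans q≡suc (cong suc e))

        2⋆𝟙 : 2 ⋆ 𝟙 ≡ 𝟘
        2⋆𝟙 = let r , e , r-prime , _ , q≡ = q-pp in
          trans (cong (_⋆ 𝟙) (prime-∣-prime prime[2] r-prime (prime-∣-^ r e prime[2] (subst (2 ∣_) q≡ 2∣q)))) p⋆𝟙

        m⋆𝟙≢𝟘 : suc n-1 ⋆ 𝟙 ≢ 𝟘
        m⋆𝟙≢𝟘 e = let k , n≡ = odd-form n n-odd in 0≢1 (trans (sym e) (trans (cong (_⋆ 𝟙) (trans n≡suc n≡))
          (trans (cong (𝟙 ⊹_) (trans (×1-homo-* k 2) (trans (cong (k ⋆ 𝟙 ·_) 2⋆𝟙) (·-zeroʳ _)))) (⊹-idʳ 𝟙))))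

        zs-roots : All (T ∘ Ground.rootsOfUnity) zs
        zs-roots = All.tabulate ∈-listOf⁻

        length-zs : length zs ≤ p
        length-zs = ≤-trans (≤-reflexive (sym (Listₚ.length-map _ zs))) (≤-trans length-lin≤ (∣⇒≤ {{>-nonZero (m<n⇒0<n∸m 1<q)}} (gcd[m,n]∣n n p)))

        q^1 : q ^ 1 ≡ q
        q^1 = *-identityʳ q

        A-size : size ≤ 4 * # A
        A-size = *-cancelʳ-≤ size (4 * # A) (p ^ length zs) {{m^n≢0 p (length zs) {{>-nonZero (m<n⇒0<n∸m 1<q)}}}} (begin
          size * p ^ length zs ≤⟨ subst (λ z → size * (z ∸ 1) ^ length zs ≤ # A * z ^ length zs) q^1 (Eig.avoid-size m⋆𝟙≢𝟘 zs zs-roots (listOf-Unique Ground.rootsOfUnity)) ⟩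
          # A * q ^ length zs ≤⟨ *-monoʳ-≤ (# A) (subst (λ z → z ^ length zs ≤ 4 * p ^ length zs) (sym q≡suc) (quarter-power p (length zs) length-zs)) ⟩
          # A * (4 * p ^ length zs) ≡⟨ lemma (# A) (p ^ length zs) ⟩
          4 * # A * p ^ length zs ∎)
          where
            lemma : ∀ a b → a * (4 * b) ≡ 4 * a * b
            lemma = solve-∀

        h s : ℕ
        -- Rounded down: 2 h is n + q or n + q - 1, and n + (q - 1) is what the intersection of the
        -- hyperplanes demands of s².
        h = (n + q) / 2
        s = q ^ h

        2h≤ : h * 2 ≤ n + q
        2h≤ = m/n*n≤m (n + q) 2

        2h≥ : n + p ≤ h * 2
        2h≥ = ≤-pred (begin
          suc (n + p) ≡⟨ trans (sym (+-suc n p)) (cong (n +_) (sym q≡suc)) ⟩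
          n + q ≡⟨ m≡m%n+[m/n]*n (n + q) 2 ⟩
          (n + q) % 2 + h * 2 ≤⟨ +-monoˡ-≤ (h * 2) (≤-pred (m%n<n (n + q) 2)) ⟩
          suc (h * 2) ∎)

        s² : s * s ≡ q ^ (h * 2)
        s² = trans (sym (^-distribˡ-+-* q h h)) (cong (q ^_) (lemma h))
          where
            lemma : ∀ h → h + h ≡ h * 2
            lemma = solve-∀

        s²≥ : size * q ^ length zs ≤ s * s
        s²≥ = begin
          size * q ^ length zs ≤⟨ *-monoʳ-≤ size (^-monoʳ-≤ q length-zs) ⟩
          size * q ^ p ≡⟨ trans (cong (_* q ^ p) size≡) (sym (^-distribˡ-+-* q n p)) ⟩
          q ^ (n + p) ≤⟨ ^-monoʳ-≤ q 2h≥ ⟩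
          q ^ (h * 2) ≡⟨ sym s² ⟩
          s * s ∎

        s²≥size : size ≤ s * s
        s²≥size = ≤-trans (≤-trans (≤-reflexive (sym (*-identityʳ size))) (*-monoʳ-≤ size (m^n>0 q (length zs)))) s²≥

        s⁴≤ : s ^ 4 ≤ q ^ (2 * (n + q))
        s⁴≤ = begin
          s * (s * (s * (s * 1))) ≡⟨ lemma s ⟩
          s * s * (s * s) ≡⟨ cong₂ _*_ s² s² ⟩
          q ^ (h * 2) * q ^ (h * 2) ≤⟨ *-mono-≤ (^-monoʳ-≤ q 2h≤) (^-monoʳ-≤ q 2h≤) ⟩
          q ^ (n + q) * q ^ (n + q) ≡⟨ trans (sym (^-distribˡ-+-* q (n + q) (n + q))) (cong (λ z → q ^ (n + q + z)) (sym (+-identityʳ (n + q)))) ⟩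
          q ^ (2 * (n + q)) ∎
          where
            lemma : ∀ s → s * (s * (s * (s * 1))) ≡ s * s * (s * s)
            lemma = solve-∀

        equi : Equidistributed A s
        equi = invariant-equidistributed A U s (Eig.avoid-invariant zs) (has-𝟘 (Eig.common-isSubgroup zs)) (begin
          size * # A ≤⟨ *-monoʳ-≤ size (≤-trans (#-⊆ {A} {λ _ → true} (λ _ _ → tt)) (≤-reflexive #-all)) ⟩
          size * size ≤⟨ *-monoʳ-≤ size (subst (λ z → size ≤ # U * z ^ length zs) q^1 (Eig.common-size zs zs-roots)) ⟩
          size * (# U * q ^ length zs) ≡⟨ lemma size (# U) (q ^ length zs) ⟩
          size * q ^ length zs * # U ≤⟨ *-monoˡ-≤ (# U) s²≥ ⟩
          s * s * # U ∎)
          where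
            lemma : ∀ a b c → a * (b * c) ≡ a * c * b
            lemma = solve-∀

        normal : ∀ x → T (A x) → Outside badSets x → CompletelyNormal K q n x
        normal x a o = outside-badSets x (Eig.avoid⇒outside zs x a) o

        8n≤q² : 8 * n ≤ q * q
        8n≤q² = ≮⇒≥ λ lt → <-irrefl refl (begin-strict
          512 * (q * (q * (q * (q * 1)))) ≡⟨ lemma₁ 512 q ⟩
          q * q * (q * q) * 512 ≤⟨ *-monoʳ-≤ (q * q * (q * q)) (≤-trans (≤ᵇ⇒≤ 512 1024 tt) (*-mono-≤ 32≤q 32≤q)) ⟩
          q * q * (q * q) * (q * q) ≤⟨ *-mono-≤ (*-mono-≤ (<⇒≤ lt) (<⇒≤ lt)) (<⇒≤ lt) ⟩
          8 * n * (8 * n) * (8 * n) ≡⟨ lemma₂ 8 n ⟩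
          512 * (n * (n * (n * 1))) <⟨ *-monoʳ-< 512 n³<q⁴ ⟩
          512 * (q * (q * (q * (q * 1)))) ∎)
          where
            lemma₁ : ∀ c q → c * (q * (q * (q * (q * 1)))) ≡ q * q * (q * q) * c
            lemma₁ = solve-∀
            lemma₂ : ∀ c n → c * n * (c * n) * (c * n) ≡ c * c * c * (n * (n * (n * 1)))
            lemma₂ = solve-∀

        2E≤ : 2 * E ≤ 2 * (n * x)
        2E≤ = *-cancelˡ-≤ p {{>-nonZero (m<n⇒0<n∸m 1<q)}} (begin
          p * (2 * E) ≡⟨ lemma₁ p E ⟩
          2 * (p * E) ≤⟨ extra-bound ⟩
          n * (q * x) ≤⟨ *-monoʳ-≤ n (*-monoˡ-≤ x (≤-trans (≤-reflexive q≡suc) (+-mono-≤ {1} {p} (m<n⇒0<n∸m 1<q) (≤-reflexive (sym (+-identityʳ p)))))) ⟩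
          n * (2 * p * x) ≡⟨ lemma₂ n p x ⟩
          p * (2 * (n * x)) ∎)
          where
            lemma₁ : ∀ p e → p * (2 * e) ≡ 2 * (p * e)
            lemma₁ = solve-∀
            lemma₂ : ∀ n p x → n * (2 * p * x) ≡ p * (2 * (n * x))
            lemma₂ = solve-∀

        -- A holds at least a quarter of K and the remaining bad subgroups at most 3/16, so 1/16 is
        -- left.
        hw : size + 16 * sizes badSets ≤ 16 * # A
        hw = begin
          size + 16 * sizes badSets ≡⟨ cong (size +_) (*-assoc 8 2 (sizes badSets)) ⟩
          size + 8 * (2 * sizes badSets) ≤⟨ +-monoʳ-≤ size (*-monoʳ-≤ 8 (≤-trans 2sizes-bad (+-monoʳ-≤ (n * x) 2E≤))) ⟩
          size + 8 * (n * x + 2 * (n * x)) ≡⟨ cong (size +_) (lemma₁ n x) ⟩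
          size + 3 * (x * (8 * n)) ≤⟨ +-monoʳ-≤ size (*-monoʳ-≤ 3 (*-monoʳ-≤ x 8n≤q²)) ⟩
          size + 3 * (x * (q * q)) ≡⟨ cong (λ z → size + 3 * z) (sym size≡x) ⟩
          4 * size ≤⟨ *-monoʳ-≤ 4 A-size ⟩
          4 * (4 * # A) ≡⟨ sym (*-assoc 4 4 (# A)) ⟩
          16 * # A ∎
          where
            lemma₁ : ∀ n x → 8 * (n * x + 2 * (n * x)) ≡ 3 * (x * (8 * n))
            lemma₁ = solve-∀

        sl≤n² : suc l₀ ≤ n * n
        sl≤n² = *-cancelˡ-≤ 2 (begin
          2 * suc l₀ ≡⟨ *-suc 2 l₀ ⟩
          2 + 2 * l₀ ≤⟨ +-mono-≤ 2≤n (*-monoʳ-≤ 2 (≤-trans (m≤n+m l₀ (length Ground.linearSets)) (≤-reflexive (sym (Listₚ.length-++ Ground.linearSets))))) ⟩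
          n + 2 * length allBadSets ≤⟨ +-monoʳ-≤ n 2l≤ ⟩
          n + (n * n + n) ≡⟨ lemma₁ n ⟩
          n * n + n * 2 ≤⟨ +-monoʳ-≤ (n * n) (*-monoʳ-≤ n 2≤n) ⟩
          n * n + n * n ≡⟨ lemma₂ (n * n) ⟩
          2 * (n * n) ∎)
          where
            lemma₁ : ∀ n → n + (n * n + n) ≡ n * n + n * 2
            lemma₁ = solve-∀
            lemma₂ : ∀ n → n + n ≡ 2 * n
            lemma₂ = solve-∀

        n⁸≤ : (n * n) ^ 4 ≤ q ^ 12
        n⁸≤ = begin
          (n * n) ^ 4 ≡⟨ ^-*-assoc′ n ⟩
          n ^ 8 ≤⟨ ^-monoʳ-≤ n {{>-nonZero 0<n}} (n≤1+n 8) ⟩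
          n ^ 9 ≡⟨ sym (^-*-assoc n 3 3) ⟩
          (n ^ 3) ^ 3 ≤⟨ ^-monoˡ-≤ 3 (<⇒≤ n³<q⁴) ⟩
          (q ^ 4) ^ 3 ≡⟨ ^-*-assoc q 4 3 ⟩
          q ^ 12 ∎
          where
            ^-*-assoc′ : ∀ n → (n * n) ^ 4 ≡ n ^ 8
            ^-*-assoc′ n = trans (cong (λ z → (n * z) ^ 4) (sym (*-identityʳ n))) (^-*-assoc n 2 4)

        C₄≤ : 4 * 16 ^ 4 * C₄ ≤ q ^ 8
        C₄≤ = ≤-trans (subst (λ c → 4 * 16 ^ 4 * c ≤ 32 ^ 8) (sym C₄≡) (≤ᵇ⇒≤ (4 * 16 ^ 4 * 517576) (32 ^ 8) tt)) (^-monoˡ-≤ 8 32≤q)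

        -- The constants take q^8, the number of subgroups q^12 and s⁴ at most q^(2n+2q), against
        -- q^(3n+1). Here 3 (q - 1) ≤ n decides.
        exponents : 8 + 12 + 2 * (n + q) < n * 3 + 1
        exponents = begin-strict
          20 + 2 * (n + q) ≡⟨ trans (cong (λ z → 20 + 2 * (n + z)) q≡suc) (lemma₁ n p) ⟩
          n * 2 + (22 + 2 * p) ≤⟨ +-monoʳ-≤ (n * 2) (+-monoˡ-≤ (2 * p) (≤-trans (≤ᵇ⇒≤ 22 31 tt) (∸-monoˡ-≤ 1 32≤q))) ⟩
          n * 2 + 3 * p ≤⟨ +-monoʳ-≤ (n * 2) 3p≤n ⟩
          n * 2 + n ≡⟨ lemma₂ n ⟩
          n * 3 <⟨ ≤-reflexive (+-comm 1 (n * 3)) ⟩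
          n * 3 + 1 ∎
          where
            lemma₁ : ∀ n p → 20 + 2 * (n + suc p) ≡ n * 2 + (22 + 2 * p)
            lemma₁ = solve-∀
            lemma₂ : ∀ n → n * 2 + n ≡ n * 3
            lemma₂ = solve-∀

        lt : (16 * suc l₀) ^ 4 * q ^ (2 * (n + q)) * C₄ < N * N * N * (q ∸ 1)
        lt = *-cancelˡ-< 4 _ _ (begin-strict
          4 * ((16 * suc l₀) ^ 4 * X * C₄) ≡⟨ cong (λ z → 4 * (z * X * C₄)) (pow-*₄ 16 (suc l₀)) ⟩
          4 * (16 ^ 4 * suc l₀ ^ 4 * X * C₄) ≡⟨ lemma₁ 4 (16 ^ 4) (suc l₀ ^ 4) X C₄ ⟩
          4 * 16 ^ 4 * C₄ * suc l₀ ^ 4 * X ≤⟨ *-monoˡ-≤ X (*-mono-≤ C₄≤ (≤-trans (^-monoˡ-≤ 4 sl≤n²) n⁸≤)) ⟩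
          q ^ 8 * q ^ 12 * X ≡⟨ trans (cong (_* X) (sym (^-distribˡ-+-* q 8 12))) (sym (^-distribˡ-+-* q 20 (2 * (n + q)))) ⟩
          q ^ (20 + 2 * (n + q)) <⟨ ^-monoʳ-< q 1<q exponents ⟩
          q ^ (n * 3 + 1) ≡⟨ trans (^-distribˡ-+-* q (n * 3) 1) (cong₂ _*_ (trans (sym (^-*-assoc q n 3)) (trans (cong (_^ 3) (sym size≡)) (lemma₂ size))) q^1) ⟩
          size * size * size * q ≤⟨ quarter-size-cubed (4≤N (≤-trans (≤ᵇ⇒≤ 7 32 tt) 32≤q)) ⟩
          4 * (N * N * N * (q ∸ 1)) ∎)
          where
            X = q ^ (2 * (n + q))
            lemma₁ : ∀ f a b x c → f * (a * b * x * c) ≡ f * a * c * b * x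
            lemma₁ = solve-∀
            lemma₂ : ∀ s → s * (s * (s * 1)) ≡ s * s * s
            lemma₂ = solve-∀

    -- Distinction of cases

    module Assembly (3≤n : 3 ≤ n) (range : InRange q n) (exceptional-case : T (exceptional q n) → ∃ Good) where
      private
        cube-or-fourth : n ^ 3 < q ^ 4 ⊎ n ^ 4 < q ^ 5
        cube-or-fourth = Data.Sum.map proj₂ (proj₂ ∘ proj₂) range

        generic : 7 ≤ q → ¬ ((q ∸ 1) ∣ n) → threshold n < q ^ suc n → ∃ Good
        generic 7≤q q-1∤n = non-splitting-case 7≤q q-1∤n (linear-in-square q n 7≤q cube-or-fourth)

        q<2¹¹ : n < 22 → q < searchBound n → q < 2 ^ 11
        q<2¹¹ n<22 q<b = <-≤-trans q<b (≤ᵇ⇒≤ (searchBound n) (2 ^ 11) (allBelow-sound 22 (λ n → searchBound n ≤ᵇ 2 ^ 11) tt n n<22))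

        small-case : n < 22 → q < searchBound n → ∃ Good
        small-case n<22 q<b = decide (check-sound q n 3≤n n<22 q<b)
          where
            decide : T (notPrimePower q) ⊎ T (outOfRange q n) ⊎ T (exceptional q n) ⊎ T (sieveTest q n) → ∃ Good
            decide (inj₁ t) = contradiction q-pp (notPrimePower-sound q (q<2¹¹ n<22 q<b) t)
            decide (inj₂ (inj₁ t)) = contradiction range (outOfRange-sound q n t)
            decide (inj₂ (inj₂ (inj₁ t))) = exceptional-case t
            decide (inj₂ (inj₂ (inj₂ t))) = test-sound t

        medium-case : n < 22 → searchBound n ≤ q → ∃ Good
        medium-case n<22 b≤q = let (n+2≤b , 7≤b) , lt = bound-table n 3≤n n<22 in
          generic (≤-trans 7≤b b≤q) (λ d → <⇒≱ (∸-monoˡ-≤ 1 (≤-trans (≤-trans (≤-reflexive (+-comm 2 n)) n+2≤b) b≤q)) (∣⇒≤ {{>-nonZero 0<n}} d)) (<-≤-trans lt (^-monoˡ-≤ (suc n) b≤q))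

        7≤q : 22 ≤ n → 7 ≤ q
        7≤q 22≤n = ≰⇒> λ q≤6 → too-small q≤6 cube-or-fourth
          where
            too-small : q ≤ 6 → n ^ 3 < q ^ 4 ⊎ n ^ 4 < q ^ 5 → ⊥
            too-small q≤6 (inj₁ h) = <⇒≱ h (≤-trans (^-monoˡ-≤ 4 q≤6) (≤-trans (≤ᵇ⇒≤ (6 ^ 4) (22 ^ 3) tt) (^-monoˡ-≤ 3 22≤n)))
            too-small q≤6 (inj₂ h) = <⇒≱ h (≤-trans (^-monoˡ-≤ 5 q≤6) (≤-trans (≤ᵇ⇒≤ (6 ^ 5) (22 ^ 4) tt) (^-monoˡ-≤ 4 22≤n)))

        -- Only odd n can be a multiple c (q - 1) here. Oddness excludes c = 2, and c = 1 and c ≥ 3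
        -- have been treated separately.
        splitting-case : 22 ≤ n → (q ∸ 1) ∣ n → ∃ Good
        splitting-case 22≤n d@(divides c n≡) = go range c n≡
          where
            even-q : ¬ (2 ∣ n) → 2 ∣ q
            even-q odd = let k , e = odd-form (q ∸ 1) (λ h → odd (∣-trans h d)) in divides (suc k) (trans q≡suc (cong suc e))
            go : InRange q n → ∀ c → n ≡ c * (q ∸ 1) → ∃ Good
            go (inj₂ (_ , q-1∤n , _)) c e = contradiction d q-1∤n
            go (inj₁ _) zero e = contradiction (sym e) (<⇒≢ 0<n)
            go (inj₁ (odd , _)) 1 e = full-splitting-case (power-of-two-≥32 q q-pp (even-q odd) (≤-trans (s≤s 22≤n) (≤-reflexive (trans (cong suc (trans e (*-identityˡ (q ∸ 1)))) (sym q≡suc))))) (sym (trans e (*-identityˡ (q ∸ 1))))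
            go (inj₁ (odd , _)) 2 e = contradiction (divides (q ∸ 1) (trans e (*-comm 2 (q ∸ 1)))) odd
            go (inj₁ (odd , lt)) (suc (suc (suc c))) e = multiple-splitting-case (power-of-two-≥32 q q-pp (even-q odd) 23≤q) d 3p≤n lt odd
              where
                3p≤n : 3 * (q ∸ 1) ≤ n
                3p≤n = ≤-trans (*-monoˡ-≤ (q ∸ 1) {3} {suc (suc (suc c))} (s≤s (s≤s (s≤s z≤n)))) (≤-reflexive (sym e))
                23≤q : 23 ≤ q
                -- For 7 ≤ q < 23 already (3 (q - 1))³ ≥ q⁴, which puts n ≥ 3 (q - 1) out of range.
                -- An even prime power from 23 on is at least 32.
                23≤q = ≮⇒≥ λ q<23 → table q<23 (T-∨ {q <ᵇ 7} (allBelow-sound 23 (λ q → (q <ᵇ 7) ∨ (q ^ 4 ≤ᵇ (3 * (q ∸ 1)) ^ 3)) tt q q<23))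
                  where
                    table : q < 23 → T (q <ᵇ 7) ⊎ T (q ^ 4 ≤ᵇ (3 * (q ∸ 1)) ^ 3) → ⊥
                    table _ (inj₁ t) = <⇒≱ (<ᵇ⇒< q 7 t) (7≤q 22≤n)
                    table _ (inj₂ t) = <⇒≱ lt (≤-trans (≤ᵇ⇒≤ (q ^ 4) ((3 * (q ∸ 1)) ^ 3) t) (^-monoˡ-≤ 3 3p≤n))

        large-case : 22 ≤ n → ∃ Good
        large-case 22≤n = decide ((q ∸ 1) ∣? n)
          where
            decide : Dec ((q ∸ 1) ∣ n) → ∃ Good
            decide (yes d) = splitting-case 22≤n d
            decide (no q-1∤n) = generic (7≤q 22≤n) q-1∤n (<-≤-trans (threshold-large n 22≤n) (^-monoˡ-≤ (suc n) (7≤q 22≤n)))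

      conclusion : ∃ Good
      conclusion = decide (n <? 22) (q <? searchBound n)
        where
          decide : Dec (n < 22) → Dec (q < searchBound n) → ∃ Good
          decide (no h) _ = large-case (≮⇒≥ h)
          decide (yes n<22) (yes q<b) = small-case n<22 q<b
          decide (yes n<22) (no h) = medium-case n<22 (≮⇒≥ h)

-- Explicit elements for the three exceptional pairs

module Exceptions (K : FiniteField) where
  open Field K

  private
    primes-among : ∀ L R → T ⌊ All.all? prime? L ⌋ → T ⌊ All.all? (_∈? R) L ⌋ → ∀ {N′} → N′ ≡ product L → ∀ {r} → IsPrimeDivisor N′ r → r ∈ R
    primes-among L R t t′ refl (pr , r∣) = All.lookup (toWitness t′) (factorisationHasAllPrimeFactors pr r∣ (toWitness t))

    cancel-factor : ∀ {a b} → a ≢ 𝟘 → a · b ≡ 𝟘 → b ≡ 𝟘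
    cancel-factor {a} {b} h e with no-zero-div e
    ... | inj₁ z = contradiction z h
    ... | inj₂ z = z

    Free : 𝕂 → Set
    Free γ = ∀ {r} → IsPrimeDivisor N r → ¬ T (power r γ)

    not-one : ∀ {γ} → Free γ → ∀ r e N′ → N ≡ N′ → N′ ÷ r ≡ e → Prime r → r ∣ N′ → γ ^ᴷ e ≢ 𝟙
    not-one free r e N′ refl refl pr r∣ h = free (pr , r∣) (fromWitness h)

    power-one : ∀ {γ} → γ ≢ 𝟘 → ∀ N′ → N ≡ N′ → γ ^ᴷ N′ ≡ 𝟙
    power-one h N′ refl = fermat h

    -- The empty product is spelt 1 ⋆ 𝟙, the value of the solver's constant 1.
    pw : 𝕂 → ℕ → 𝕂
    pw t zero = 1 ⋆ 𝟙
    pw t (suc k) = t · pw t k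

    pow≡pw : ∀ t k → t ^ᴷ k ≡ pw t k
    pow≡pw t zero = sym (⊹-idʳ 𝟙)
    pow≡pw t (suc k) = cong (t ·_) (pow≡pw t k)

    𝟙′ : 𝟙 ≡ 1 ⋆ 𝟙
    𝟙′ = sym (⊹-idʳ 𝟙)

    _:^_ : ∀ {k} → 𝕊.Polynomial k → ℕ → 𝕊.Polynomial k
    t :^ zero = con (ℤ.+ 1)
    t :^ suc k = t :* (t :^ k)

    ≢𝟙⇒ : ∀ {x} → x ≢ 𝟙 → x ⊝ 1 ⋆ 𝟙 ≢ 𝟘
    ≢𝟙⇒ h e = h (trans (⊝-≡ e) (sym 𝟙′))

    ≡𝟙⇒ : ∀ {x} → x ≡ 𝟙 → x ⊝ 1 ⋆ 𝟙 ≡ 𝟘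
    ≡𝟙⇒ {x} h = trans (cong (_⊝ 1 ⋆ 𝟙) (trans h 𝟙′)) (⊖-invʳ _)

  -- θ = γ^7 is a primitive ninth root of unity, as 63 = 7 · 9. Dividing θ⁹ - 1 by θ³ - 1 gives θ⁶ +
  -- θ³ + 1 = 0, which modulo 2 is the relation `rel`.
  exception-4-3 : IsPrimePower 4 → size ≡ 64 → ∃ λ x → Primitive K x × CompletelyNormal K 4 3 x
  exception-4-3 q-pp size≡ = use generator
    where
      N≡ : N ≡ 63
      N≡ = cong (_∸ 1) size≡
      2⋆𝟙 : 2 ⋆ 𝟙 ≡ 𝟘
      2⋆𝟙 = Extension.characteristic K 4 3 q-pp z<s size≡ prime[2] (divides 2 refl)
      rel x : Vec ℕ 6
      rel = 1 ∷ 0 ∷ 0 ∷ 1 ∷ 0 ∷ 0 ∷ []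
      x = 1 ∷ 1 ∷ 1 ∷ 0 ∷ 0 ∷ 0 ∷ []
      y : ℕ → Vec ℕ 6
      y 1 = 1 ∷ 1 ∷ 1 ∷ 0 ∷ 1 ∷ 1 ∷ []
      y _ = 0 ∷ 0 ∷ 0 ∷ 1 ∷ 1 ∷ 0 ∷ []
      rs : List (ℕ × Vec ℕ 6)
      rs = (3 , 0 ∷ 0 ∷ 0 ∷ 1 ∷ 0 ∷ 0 ∷ []) ∷ (7 , 1 ∷ 0 ∷ 0 ∷ 0 ∷ 1 ∷ 1 ∷ []) ∷ []
      use : (∃ λ γ → Primitive K γ × Free γ) → ∃ λ x → Primitive K x × CompletelyNormal K 4 3 x
      use (γ , (γ≢0 , _) , γ-free) = Extension.certified K 4 3 q-pp z<s size≡ 2 rel 2⋆𝟙 θ θ-rel x y rs tt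
          (subst (λ z → T (Coordinates.orderTest 2 rel z x rs)) (sym N≡) tt) (primes-among (3 ∷ 3 ∷ 7 ∷ []) (3 ∷ 7 ∷ []) tt tt N≡) tt
        where
          θ = γ ^ᴷ 7
          θ³≢1 : θ ^ᴷ 3 ≢ 𝟙
          θ³≢1 e = not-one γ-free 3 21 63 N≡ refl (toWitness {a? = prime? 3} tt) (divides 21 refl) (trans (pow-* γ 7 3) e)
          Φ : 𝕂
          Φ = pw θ 6 ⊹ pw θ 3 ⊹ 1 ⋆ 𝟙
          Φ≡0 : Φ ≡ 𝟘
          Φ≡0 = cancel-factor (≢𝟙⇒ θ³≢1) (trans (cong (λ z → (z ⊝ 1 ⋆ 𝟙) · Φ) (pow≡pw θ 3))
            (trans (solveR 1 (λ t → (t :^ 3 :- con (ℤ.+ 1)) :* (t :^ 6 :+ t :^ 3 :+ con (ℤ.+ 1)) := t :^ 9 :- con (ℤ.+ 1)) refl θ)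
              (≡𝟙⇒ (trans (sym (pow≡pw θ 9)) (trans (sym (pow-* γ 7 9)) (power-one γ≢0 63 N≡))))))
          θ-rel : θ ^ᴷ 6 ≡ Evaluation.ev 2 rel θ rel
          θ-rel = trans (pow≡pw θ 6) (trans
            (solveR 2 (λ t z → t :^ 6 := (t :^ 6 :+ t :^ 3 :+ con (ℤ.+ 1)) :+ (con (ℤ.+ 1) :+ t :* (con (ℤ.+ 0) :+ t :* (con (ℤ.+ 0) :+ t :* (con (ℤ.+ 1) :+ t :* (con (ℤ.+ 0) :+ t :* (con (ℤ.+ 0) :+ t :* con (ℤ.+ 0))))))) :- con (ℤ.+ 2) :* (t :^ 3 :+ con (ℤ.+ 1))) refl θ 𝟘)
            (trans (cong₂ (λ a b → a ⊹ Evaluation.ev 2 rel θ rel ⊝ b · (pw θ 3 ⊹ 1 ⋆ 𝟙)) Φ≡0 2⋆𝟙)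
              (solveR 2 (λ e w → con (ℤ.+ 0) :+ e :- con (ℤ.+ 0) :* w := e) refl (Evaluation.ev 2 rel θ rel) (pw θ 3 ⊹ 1 ⋆ 𝟙))))

  -- θ = γ^2232 is a primitive seventh root of unity, as 15624 = 2232 · 7; `rel` is its cyclotomic
  -- equation with -1 written as 4.
  exception-5-6 : IsPrimePower 5 → size ≡ 15625 → ∃ λ x → Primitive K x × CompletelyNormal K 5 6 x
  exception-5-6 q-pp size≡ = use generator
    where
      N≡ : N ≡ 15624
      N≡ = cong (_∸ 1) size≡
      5⋆𝟙 : 5 ⋆ 𝟙 ≡ 𝟘
      5⋆𝟙 = Extension.characteristic K 5 6 q-pp z<s size≡ (toWitness {a? = prime? 5} tt) (divides 1 refl)
      rel x : Vec ℕ 6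
      rel = 4 ∷ 4 ∷ 4 ∷ 4 ∷ 4 ∷ 4 ∷ []
      x = 2 ∷ 1 ∷ 0 ∷ 0 ∷ 0 ∷ 0 ∷ []
      y : ℕ → Vec ℕ 6
      y 1 = 1 ∷ 2 ∷ 2 ∷ 2 ∷ 2 ∷ 2 ∷ []
      y 2 = 1 ∷ 0 ∷ 2 ∷ 4 ∷ 3 ∷ 4 ∷ []
      y 3 = 3 ∷ 1 ∷ 4 ∷ 4 ∷ 0 ∷ 1 ∷ []
      y _ = 2 ∷ 3 ∷ 0 ∷ 4 ∷ 2 ∷ 3 ∷ []
      rs : List (ℕ × Vec ℕ 6)
      rs = (2 , 2 ∷ 0 ∷ 0 ∷ 0 ∷ 0 ∷ 0 ∷ []) ∷ (3 , 0 ∷ 1 ∷ 1 ∷ 0 ∷ 1 ∷ 0 ∷ []) ∷ (7 , 2 ∷ 0 ∷ 2 ∷ 4 ∷ 1 ∷ 3 ∷ []) ∷ (31 , 4 ∷ 0 ∷ 2 ∷ 1 ∷ 1 ∷ 2 ∷ []) ∷ []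
      use : (∃ λ γ → Primitive K γ × Free γ) → ∃ λ x → Primitive K x × CompletelyNormal K 5 6 x
      use (γ , (γ≢0 , _) , γ-free) = Extension.certified K 5 6 q-pp z<s size≡ 5 rel 5⋆𝟙 θ θ-rel x y rs tt
          (subst (λ z → T (Coordinates.orderTest 5 rel z x rs)) (sym N≡) tt) (primes-among (2 ∷ 2 ∷ 2 ∷ 3 ∷ 3 ∷ 7 ∷ 31 ∷ []) (2 ∷ 3 ∷ 7 ∷ 31 ∷ []) tt tt N≡) tt
        where
          e = 2232
          θ = γ ^ᴷ e
          θ≢1 : θ ≢ 𝟙
          θ≢1 = not-one γ-free 7 e 15624 N≡ refl (toWitness {a? = prime? 7} tt) (divides 2232 refl)
          θ⁷≡1 : θ ^ᴷ 7 ≡ 𝟙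
          θ⁷≡1 = trans (sym (pow-* γ e 7)) (power-one γ≢0 15624 N≡)
          Φ low : 𝕂
          low = pw θ 5 ⊹ pw θ 4 ⊹ pw θ 3 ⊹ pw θ 2 ⊹ pw θ 1 ⊹ 1 ⋆ 𝟙
          Φ = pw θ 6 ⊹ low
          Φ≡0 : Φ ≡ 𝟘
          Φ≡0 = cancel-factor (≢𝟙⇒ θ≢1)
            (trans (solveR 1 (λ t → (t :- con (ℤ.+ 1)) :* (t :^ 6 :+ (t :^ 5 :+ t :^ 4 :+ t :^ 3 :+ t :^ 2 :+ t :^ 1 :+ con (ℤ.+ 1))) := t :^ 7 :- con (ℤ.+ 1)) refl θ)
              (≡𝟙⇒ (trans (sym (pow≡pw θ 7)) θ⁷≡1)))
          θ-rel : θ ^ᴷ 6 ≡ Evaluation.ev 5 rel θ rel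
          θ-rel = trans (pow≡pw θ 6) (trans
            (solveR 1 (λ t → let f = con (ℤ.+ 4) ; s = t :^ 5 :+ t :^ 4 :+ t :^ 3 :+ t :^ 2 :+ t :^ 1 :+ con (ℤ.+ 1) in
              t :^ 6 := (t :^ 6 :+ s) :+ (f :+ t :* (f :+ t :* (f :+ t :* (f :+ t :* (f :+ t :* (f :+ t :* con (ℤ.+ 0))))))) :- con (ℤ.+ 5) :* s) refl θ)
            (trans (cong₂ (λ a b → a ⊹ Evaluation.ev 5 rel θ rel ⊝ b · low) Φ≡0 5⋆𝟙)
              (solveR 2 (λ e w → con (ℤ.+ 0) :+ e :- con (ℤ.+ 0) :* w := e) refl (Evaluation.ev 5 rel θ rel) low)))

  -- t = γ^205 has order 32, so b = t⁴ satisfies b⁴ = -1. Modulo 3, b⁴ + 1 = (b² + b - 1)(b² - b -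
  -- 1), and which factor vanishes depends on γ. In the second case t⁵ replaces t: its fourth power
  -- b⁵ = -b is a root of the first factor.
  exception-9-4 : IsPrimePower 9 → size ≡ 6561 → ∃ λ x → Primitive K x × CompletelyNormal K 9 4 x
  exception-9-4 q-pp size≡ = use generator
    where
      N≡ : N ≡ 6560
      N≡ = cong (_∸ 1) size≡
      3⋆𝟙 : 3 ⋆ 𝟙 ≡ 𝟘
      3⋆𝟙 = Extension.characteristic K 9 4 q-pp z<s size≡ (toWitness {a? = prime? 3} tt) (divides 3 refl)
      rel x : Vec ℕ 8
      rel = 1 ∷ 0 ∷ 0 ∷ 0 ∷ 2 ∷ 0 ∷ 0 ∷ 0 ∷ []
      x = 2 ∷ 1 ∷ 1 ∷ 1 ∷ 0 ∷ 0 ∷ 0 ∷ 0 ∷ []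
      y : ℕ → Vec ℕ 8
      y 1 = 2 ∷ 1 ∷ 1 ∷ 1 ∷ 0 ∷ 1 ∷ 1 ∷ 1 ∷ []
      y 2 = 1 ∷ 1 ∷ 1 ∷ 0 ∷ 2 ∷ 2 ∷ 2 ∷ 2 ∷ []
      y _ = 0 ∷ 0 ∷ 2 ∷ 2 ∷ 0 ∷ 1 ∷ 1 ∷ 2 ∷ []
      rs : List (ℕ × Vec ℕ 8)
      rs = (2 , 1 ∷ 0 ∷ 0 ∷ 0 ∷ 0 ∷ 0 ∷ 0 ∷ 0 ∷ []) ∷ (5 , 1 ∷ 0 ∷ 2 ∷ 0 ∷ 0 ∷ 0 ∷ 1 ∷ 0 ∷ []) ∷ (41 , 1 ∷ 2 ∷ 0 ∷ 0 ∷ 0 ∷ 0 ∷ 0 ∷ 2 ∷ []) ∷ []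
      Root : 𝕂 → Set
      Root θ = pw (θ ^ᴷ 4) 2 ⊹ θ ^ᴷ 4 ⊝ 1 ⋆ 𝟙 ≡ 𝟘
      finish : ∀ θ → Root θ → ∃ λ x → Primitive K x × CompletelyNormal K 9 4 x
      finish θ root = Extension.certified K 9 4 q-pp z<s size≡ 3 rel 3⋆𝟙 θ θ-rel x y rs tt
          (subst (λ z → T (Coordinates.orderTest 3 rel z x rs)) (sym N≡) tt) (primes-among (2 ∷ 2 ∷ 2 ∷ 2 ∷ 2 ∷ 5 ∷ 41 ∷ []) (2 ∷ 5 ∷ 41 ∷ []) tt tt N≡) tt
        where
          θ-rel : θ ^ᴷ 8 ≡ Evaluation.ev 3 rel θ rel
          θ-rel = trans (trans (pow-* θ 4 2) (pow≡pw (θ ^ᴷ 4) 2)) (trans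
            (solveR 1 (λ b → b :^ 2 := (b :^ 2 :+ b :- con (ℤ.+ 1)) :+ (con (ℤ.+ 1) :+ con (ℤ.+ 2) :* b) :- con (ℤ.+ 3) :* b) refl (θ ^ᴷ 4))
            (trans (cong₂ (λ a c → a ⊹ (1 ⋆ 𝟙 ⊹ 2 ⋆ 𝟙 · θ ^ᴷ 4) ⊝ c · θ ^ᴷ 4) root 3⋆𝟙)
              (trans (solveR 2 (λ e w → con (ℤ.+ 0) :+ e :- con (ℤ.+ 0) :* w := e) refl (1 ⋆ 𝟙 ⊹ 2 ⋆ 𝟙 · θ ^ᴷ 4) (θ ^ᴷ 4))
                (trans (cong (λ b → 1 ⋆ 𝟙 ⊹ 2 ⋆ 𝟙 · b) (pow≡pw θ 4))
                  (solveR 1 (λ t → let z = con (ℤ.+ 0) in con (ℤ.+ 1) :+ con (ℤ.+ 2) :* (t :^ 4) :=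
                    con (ℤ.+ 1) :+ t :* (z :+ t :* (z :+ t :* (z :+ t :* (con (ℤ.+ 2) :+ t :* (z :+ t :* (z :+ t :* (z :+ t :* z)))))))) refl θ)))))
      use : (∃ λ γ → Primitive K γ × Free γ) → ∃ λ x → Primitive K x × CompletelyNormal K 9 4 x
      use (γ , (γ≢0 , _) , γ-free) = cases (no-zero-div both)
        where
          e = 205
          t = γ ^ᴷ e
          b = t ^ᴷ 4
          t¹⁶ : t ^ᴷ 16 ≡ pw b 4
          t¹⁶ = trans (pow-* t 4 4) (pow≡pw b 4)
          t¹⁶≢1 : t ^ᴷ 16 ≢ 𝟙
          t¹⁶≢1 h = not-one γ-free 2 3280 6560 N≡ refl prime[2] (divides 3280 refl) (trans (pow-* γ e 16) h)
          t³² : t ^ᴷ 32 ≡ 𝟙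
          t³² = trans (sym (pow-* γ e 32)) (power-one γ≢0 6560 N≡)
          b⁸ : pw b 8 ≡ 𝟙
          b⁸ = trans (sym (pow≡pw b 8)) (trans (sym (pow-* t 4 8)) t³²)
          s⁴ : (t ^ᴷ 5) ^ᴷ 4 ≡ pw b 5
          s⁴ = trans (sym (pow-* t 5 4)) (trans (pow-* t 4 5) (pow≡pw b 5))
          b⁴+1 : pw b 4 ⊹ 1 ⋆ 𝟙 ≡ 𝟘
          b⁴+1 = cancel-factor (subst (λ z → z ⊝ 1 ⋆ 𝟙 ≢ 𝟘) t¹⁶ (≢𝟙⇒ t¹⁶≢1))
            (trans (solveR 1 (λ b → (b :^ 4 :- con (ℤ.+ 1)) :* (b :^ 4 :+ con (ℤ.+ 1)) := b :^ 8 :- con (ℤ.+ 1)) refl b) (≡𝟙⇒ b⁸))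
          both : (pw b 2 ⊹ b ⊝ 1 ⋆ 𝟙) · (pw b 2 ⊝ b ⊝ 1 ⋆ 𝟙) ≡ 𝟘
          both = trans (solveR 1 (λ b → (b :^ 2 :+ b :- con (ℤ.+ 1)) :* (b :^ 2 :- b :- con (ℤ.+ 1)) := (b :^ 4 :+ con (ℤ.+ 1)) :- con (ℤ.+ 3) :* b :^ 2) refl b)
            (trans (cong₂ (λ u c → u ⊝ c · pw b 2) b⁴+1 3⋆𝟙) (solveR 1 (λ w → con (ℤ.+ 0) :- con (ℤ.+ 0) :* w := con (ℤ.+ 0)) refl (pw b 2)))
          cases : pw b 2 ⊹ b ⊝ 1 ⋆ 𝟙 ≡ 𝟘 ⊎ pw b 2 ⊝ b ⊝ 1 ⋆ 𝟙 ≡ 𝟘 → ∃ λ x → Primitive K x × CompletelyNormal K 9 4 x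
          cases (inj₁ h) = finish t h
          cases (inj₂ h) = finish (t ^ᴷ 5) (trans (cong (λ z → pw z 2 ⊹ z ⊝ 1 ⋆ 𝟙) s⁴)
            (trans (solveR 1 (λ b → (b :^ 5) :^ 2 :+ b :^ 5 :- con (ℤ.+ 1) := (b :^ 4 :+ con (ℤ.+ 1)) :* (b :^ 2 :* (b :^ 4 :- con (ℤ.+ 1)) :+ b) :+ (b :^ 2 :- b :- con (ℤ.+ 1))) refl b)
              (trans (cong₂ (λ u v → u · (pw b 2 · (pw b 4 ⊝ 1 ⋆ 𝟙) ⊹ b) ⊹ v) b⁴+1 h) (solveR 1 (λ w → con (ℤ.+ 0) :* w :+ con (ℤ.+ 0) := con (ℤ.+ 0)) refl (pw b 2 · (pw b 4 ⊝ 1 ⋆ 𝟙) ⊹ b)))))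

  exceptional-case : ∀ q n → IsPrimePower q → size ≡ q ^ n → T (exceptional q n) → ∃ λ x → Primitive K x × CompletelyNormal K q n x
  exceptional-case q n q-pp size≡ t = Data.Sum.[ case₁ , (λ h → Data.Sum.[ case₂ , case₃ ] (T-∨ {(q ≡ᵇ 5) ∧ (n ≡ᵇ 6)} h)) ] (T-∨ {(q ≡ᵇ 4) ∧ (n ≡ᵇ 3)} t)
    where
      G = ∃ λ x → Primitive K x × CompletelyNormal K q n x
      help₁ : q ≡ 4 → n ≡ 3 → G
      help₁ refl refl = exception-4-3 q-pp size≡
      help₂ : q ≡ 5 → n ≡ 6 → G
      help₂ refl refl = exception-5-6 q-pp size≡
      help₃ : q ≡ 9 → n ≡ 4 → G
      help₃ refl refl = exception-9-4 q-pp size≡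
      case₁ : T ((q ≡ᵇ 4) ∧ (n ≡ᵇ 3)) → G
      case₁ h = help₁ (≡ᵇ⇒≡ q 4 (T-∧₁ h)) (≡ᵇ⇒≡ n 3 (T-∧₂ {q ≡ᵇ 4} h))
      case₂ : T ((q ≡ᵇ 5) ∧ (n ≡ᵇ 6)) → G
      case₂ h = help₂ (≡ᵇ⇒≡ q 5 (T-∧₁ h)) (≡ᵇ⇒≡ n 6 (T-∧₂ {q ≡ᵇ 5} h))
      case₃ : T ((q ≡ᵇ 9) ∧ (n ≡ᵇ 4)) → G
      case₃ h = help₃ (≡ᵇ⇒≡ q 9 (T-∧₁ h)) (≡ᵇ⇒≡ n 4 (T-∧₂ {q ≡ᵇ 9} h))

theorem3 : (q n : ℕ) → IsPrimePower q → 1 ≤ n →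
    ((¬ (2 ∣ n) × n ^ 3 < q ^ 4) ⊎ (2 ∣ n × ¬ ((q ∸ 1) ∣ n) × n ^ 4 < q ^ 5)) →
    (K : FiniteField) → FiniteField.size K ≡ q ^ n →
    ∃ λ x → Primitive K x × CompletelyNormal K q n x
theorem3 q 1 q-pp 1≤n range K size≡ = Extension.degree-one K q 1 q-pp 1≤n size≡ refl
theorem3 q 2 q-pp 1≤n range K size≡ = Extension.degree-two K q 2 q-pp 1≤n size≡ refl
theorem3 q n@(suc (suc (suc _))) q-pp 1≤n range K size≡ =
  Extension.AtLeastTwo.Assembly.conclusion K q n q-pp 1≤n size≡ (s≤s (s≤s z≤n)) (s≤s (s≤s (s≤s z≤n))) range
    (Exceptions.exceptional-case K q n q-pp size≡)
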